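{- Let $g \geq 0$ be a constant integer, and let $m=m(n)$ be an integer-valued function satisfying $1 < \liminf \frac{m}{n} \leq \limsup \frac{m}{n} < 3$. Then there is a constant $c>0$ such that with probability tending to $1$ as $n\to\infty$, $F(S_{g}(n,m)) \ge c\ln n$.
   Context: A graph has genus at most $g$ if it can be embedded without crossing edges on an orientable surface of genus $g$. $\mathcal{S}^{g}(n,m)$ is the set of labelled simple graphs on $[n]$ with exactly $m$ edges and genus at most $g$; $S_{g}(n,m)$ is chosen uniformly at random from it. For a given embedding, the size of a face is the number of edges having a side in the face, counting an edge twice if both sides lie in the face; $F(G)$ is the largest face size of $G$ maximised over all embeddings of $G$ on orientable surfaces of genus at most $g$. -}

module Defs where

open import Data.Bool using (Bool; true; false; _∧_; not)
open import Data.Nat using (ℕ; zero; suc; _+_; _*_; _≤_; _<ᵇ_; _≤ᵇ_; _≡ᵇ_)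
open import Data.Fin using (Fin; toℕ)
open import Data.Vec using (Vec; lookup; tabulate; sum)
open import Data.List using (upTo; map)
open import Data.Bool.ListAction using (and)
open import Data.Product using (_×_; _,_; ∃; ∃₂; Σ)
open import Data.Sum using (_⊎_)
open import Relation.Binary.PropositionalEquality using (_≡_)
open import Relation.Binary.Construct.Closure.ReflexiveTransitive using (Star)
open import Data.Nat.Logarithm using (⌊log₂_⌋)

Graph : ℕ → Set
Graph n = Vec (Vec Bool n) n

adj : ∀ {n} → Graph n → Fin n → Fin n → Bool
adj G u v = lookup (lookup G u) v

IsSimple : ∀ {n} → Graph n → Set
IsSimple {n} G = (∀ (u v : Fin n) → adj G u v ≡ adj G v u) × (∀ (v : Fin n) → adj G v v ≡ false)

[_] : Bool → ℕ
[ true ] = 1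
[ false ] = 0

Σᶠ : ∀ {n} → (Fin n → ℕ) → ℕ
Σᶠ f = sum (tabulate f)

numEdges : ∀ {n} → Graph n → ℕ
numEdges G = Σᶠ λ u → Σᶠ λ v → [ (toℕ v <ᵇ toℕ u) ∧ adj G u v ]

isIsolated : ∀ {n} → Graph n → Fin n → Bool
isIsolated G v = (Σᶠ λ u → [ adj G v u ]) ≡ᵇ 0

numIsolated : ∀ {n} → Graph n → ℕ
numIsolated G = Σᶠ λ v → [ isIsolated G v ]

iter : ∀ {A : Set} → (A → A) → ℕ → A → A
iter f zero x = x
iter f (suc k) x = f (iter f k x)

-- rotation system: ρ v is the cyclic successor map on the neighbours of v
Rotation : ℕ → Set
Rotation n = Fin n → Fin n → Fin n

IsRotation : ∀ {n} → Graph n → Rotation n → Set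
IsRotation {n} G ρ =
  (∀ (v u : Fin n) → adj G v u ≡ true → adj G v (ρ v u) ≡ true) ×
  (∀ (v u w : Fin n) → adj G v u ≡ true → adj G v w ≡ true → ∃ λ k → iter (ρ v) k u ≡ w)

-- darts (u , v) with u adjacent to v; face-tracing permutation
Dart : ℕ → Set
Dart n = Fin n × Fin n

φ : ∀ {n} → Rotation n → Dart n → Dart n
φ ρ (u , v) = (v , ρ v u)

key : ∀ {n} → Dart n → ℕ
key {n} (u , v) = toℕ u * n + toℕ v

-- d has the smallest key in its φ-orbit (orbits have length ≤ n*n)
isOrbitMin : ∀ {n} → Rotation n → Dart n → Bool
isOrbitMin {n} ρ d = and (map (λ k → key d ≤ᵇ key (iter (φ ρ) k d)) (upTo (n * n)))

-- number of facial walks: φ-orbits of darts, plus one trivial walk per isolated vertex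
numWalks : ∀ {n} → Graph n → Rotation n → ℕ
numWalks G ρ = (Σᶠ λ u → Σᶠ λ v → [ adj G u v ∧ isOrbitMin ρ (u , v) ]) + numIsolated G

-- A (not necessarily cellular) embedding of G in a closed connected orientable
-- surface of genus at most g, described combinatorially: a rotation system
-- (determining the facial walks) and a grouping of the facial walks into f faces
-- (each face a sphere with holes).
record Embedding (g : ℕ) {n : ℕ} (G : Graph n) : Set where
  field
    f        : ℕ
    ρ        : Rotation n
    isRot    : IsRotation G ρ
    face     : Fin n → Fin n → Fin f
    isoFace  : Fin n → Fin f
    faceInv  : ∀ (u v : Fin n) → adj G u v ≡ true → face v (ρ v u) ≡ face u v
    faceSurj : ∀ (F : Fin f) →
               (∃₂ λ u v → adj G u v ≡ true × face u v ≡ F) ⊎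
               (∃ λ v → isIsolated G v ≡ true × isoFace v ≡ F)
  OnFace : Fin f → Fin n → Set
  OnFace F v = (∃ λ w → adj G v w ≡ true × face v w ≡ F) ⊎
               (isIsolated G v ≡ true × isoFace v ≡ F)
  Step : Fin n → Fin n → Set
  Step u v = adj G u v ≡ true ⊎ (∃ λ F → OnFace F u × OnFace F v)
  field
    connected : ∀ (u v : Fin n) → Star Step u v
    -- Euler: genus = (2 - n + |E| + #walks - 2f) / 2 ≤ g
    genusOK   : 2 + numEdges G + numWalks G ρ ≤ 2 * g + n + 2 * f

  faceSize : Fin f → ℕ
  faceSize F = Σᶠ λ u → Σᶠ λ v → [ adj G u v ∧ (toℕ (face u v) ≡ᵇ toℕ F) ]

InS : ℕ → (n m : ℕ) → Graph n → Set
InS g n m G = IsSimple G × numEdges G ≡ m × Embedding g G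

-- F(G) ≥ (p/q) · ⌊log₂ n⌋ : some embedding of genus ≤ g has such a face
LargeFace : ℕ → (p q : ℕ) → ∀ {n} → Graph n → Set
LargeFace g p q {n} G = Σ (Embedding g G) λ e → ∃ λ F → p * ⌊log₂ n ⌋ ≤ q * Embedding.faceSize e F

{-# OPTIONS --safe #-}
module Submission where

{-
All darts of a pendant path lie on one face of every embedding, so a graph without a large face has no
pendant path with k = ⌊log₂ n / Q⌋ edges; it remains to show that such graphs are rare. This is done by switching.

In a bad graph G, embedded inside an edge-maximal K, contract k vertices one after the other, each into a neighbour.
Euler's inequality provides linearly many vertices that have bounded degree in K and have either degree at most 2
or a neighbour of bounded degree in G; contracting such a vertex is undone from its identity and boundedly many bits,
so each step costs only a constant factor. String the k freed vertices into a pendant path hanging from any of the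
remaining vertices, and restore the number of edges with edges of K. Since m ≤ (3 - ε) n while K has at least
3 n - O(g) edges, there are linearly many to choose from at each step. The choice of the hanging point
gains a factor n, and the path is visible in the outcome: every pendant path with k edges of the outcome
meets one of the O(k) rows in which outcome and bad graph differ, so there are only polynomially (in k) many of them.
Hence #bad · n ≤ #all · poly(k) · Λᵏ for a constant Λ, and Q is chosen so that the right-hand factor is o(n).

The number of edges of K is bounded by linear algebra over F₂. In an edge-maximal embedding two vertices of
one face are adjacent, so four consecutive vertices a, b, c, d of a non-triangular face (a window) give a triangle abc
made of two consecutive darts of the face and a chord. Colour the vertices with four colours such that
a constant proportion of the windows is coloured in order. The triangles of these windows, the face boundaries and
the edges of a spanning tree satisfy essentially one relation, so n + #faces + #windows ≤ #edges + 2, and Euler's inequality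
bounds the number of windows, hence of excess darts, in terms of g alone.
-}
open import Defs
open import Data.Bool using (Bool; true; false; _∧_; _∨_; if_then_else_; T; _xor_)
open import Data.Bool.ListAction using (and)
open import Data.Bool.Properties using (∨-zeroʳ; xor-assoc; xor-comm; xor-same; xor-identityʳ; ∧-zeroʳ; ∧-identityʳ; ∧-comm) renaming (_≟_ to _≟ᵇ_)
open import Data.Empty using (⊥; ⊥-elim)
open import Data.Fin using (Fin; toℕ; fromℕ<; combine) renaming (zero to fzero; suc to fsuc)
open import Data.Fin.Properties using (_≟_; toℕ-combine; pigeonhole; combine-injective; toℕ-injective; toℕ<n; toℕ-fromℕ<; any?; all?)
open import Data.List using (List; []; _∷_; _++_; length; map; filter; concatMap; allFin; cartesianProduct; upTo; deduplicate) renaming (tabulate to ltabulate)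
open import Data.List.Properties using () renaming (≡-dec to List-≡-dec)
open import Data.List.Properties using (length-map; length-++; filter-accept; filter-reject; length-tabulate; length-filter; filter-++; map-∘; filter-none; filter-all; length-upTo)
open import Data.List.Membership.Propositional using (_∈_; _∉_; mapWith∈; find; lose)
open import Data.List.Membership.Propositional.Properties using (∈-∃++; ∈-filter⁺; ∈-filter⁻; ∈-map⁺; ∈-map⁻; ∈-++⁺ˡ; ∈-++⁺ʳ; ∈-++⁻; ∈-allFin; ∈-cartesianProduct⁺; ∈-cartesianProduct⁻; ∈-concat⁺′; ∈-concat⁻′; ∈-upTo⁺; ∈-upTo⁻; ∈-deduplicate⁺; ∈-deduplicate⁻; map-mapWith∈; mapWith∈≗map)
open import Data.List.Relation.Unary.All using ([]; _∷_) renaming (lookup to All-lookup; tabulate to All-tabulate)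
open import Data.List.Relation.Unary.Any using (here; there) renaming (any? to anyL?)
open import Data.List.Relation.Unary.AllPairs using ([]; _∷_)
open import Data.List.Relation.Unary.Unique.Propositional using (Unique)
open import Data.List.Relation.Unary.Unique.DecPropositional.Properties using (deduplicate-!)
open import Data.List.Relation.Unary.Unique.Propositional.Properties using (filter⁺; allFin⁺; cartesianProduct⁺; upTo⁺) renaming (map⁺ to Unique-map⁺; map⁻ to Unique-map⁻; ++⁺ to Unique-++⁺)
open import Data.Maybe using (Maybe; just; nothing)
open import Data.Nat using (ℕ; zero; suc; _+_; _*_; _∸_; _^_; _≤_; _<_; z≤n; s≤s; _⊔_; _≤?_; _<?_; _≡ᵇ_; _<ᵇ_; _≤ᵇ_; pred; ⌊_/2⌋; NonZero; >-nonZero)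
open import Data.Nat.DivMod using (_/_; _%_; m≡m%n+[m/n]*n; m%n<n)
open import Data.Nat.Logarithm using (⌊log₂_⌋; ⌊log₂⌋-mono-≤; ⌊log₂⌊n/2⌋⌋≡⌊log₂n⌋∸1; ⌊log₂[2^n]⌋≡n)
open import Data.Nat.Properties hiding (_≟_)
open import Data.Nat.Properties using () renaming (_≟_ to _≟ⁿ_)
open import Data.Nat.Tactic.RingSolver using (solve-∀)
open import Data.Product using (_×_; _,_; proj₁; proj₂; ∃; ∃₂; Σ)
open import Data.Product.Properties using () renaming (≡-dec to ×-≡-dec)
open import Data.Sum.Properties using () renaming (≡-dec to ⊎-≡-dec)
open import Data.Sum using (_⊎_; inj₁; inj₂; map₁)
open import Data.Vec using (Vec; lookup; tabulate) renaming (sum to vsum)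
open import Data.Vec.Properties using (lookup∘tabulate; tabulate∘lookup; tabulate-cong) renaming (≡-dec to Vec-≡-dec)
open import Function using (_∘_; id; case_of_)
open import Function.Bundles using (_⇔_; Equivalence)
open import Relation.Binary using (DecidableEquality; tri<; tri≈; tri>)
open import Relation.Binary.Construct.Closure.ReflexiveTransitive using (Star; ε; _◅_; _◅◅_)
open import Relation.Binary.PropositionalEquality using (_≡_; _≢_; refl; sym; trans; cong; cong₂; subst; subst₂; module ≡-Reasoning)
open import Relation.Nullary using (¬_; Dec; yes; no; does)
open import Relation.Nullary.Decidable using (dec-true; dec-false; _×-dec_; _⊎-dec_; ¬?) renaming (map′ to mapDec)

-- Why contraction: deleting a vertex of degree 3 would leave about n³ possible neighbourhoods to
-- restore. After a contraction the lost neighbours are neighbours of the target `u`, so a bounded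
-- degree of `u` leaves boundedly many bits, and for degree at most 2 a single dart at `u` suffices.
-- A vertex of degree at least 3 all of whose neighbours have large degree admits no such step;
-- Euler's inequality for bipartite graphs shows that these are few. Why a bound by linear algebra:
-- an edge-maximal simple graph on a surface need not be a triangulation, since the chord of a face
-- may already be an edge drawn elsewhere. Such faces cannot be removed by adding edges, so they
-- have to be counted. Why embeddings are not assumed cellular: deletions and contractions leave
-- isolated vertices and disconnected graphs. Faces may therefore have several boundary walks, and
-- the genus is carried along only as an inequality.

variable
  A B C : Set

Adj : ℕ → Set
Adj n = Fin n → Fin n → Bool

infix 4 _≟ᵈ_
_≟ᵈ_ : ∀ {n} → DecidableEquality (Dart n)
_≟ᵈ_ = ×-≡-dec _≟_ _≟_

false≢true : false ≢ true
false≢true ()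

≢true⇒false : ∀ {b} → b ≢ true → b ≡ false
≢true⇒false {true} h = ⊥-elim (h refl)
≢true⇒false {false} h = refl

-- Finite sets as duplicate-free lists

∉-head : ∀ {x : A} {xs} → Unique (x ∷ xs) → ∀ {y} → y ∈ xs → x ≢ y
∉-head (h ∷ _) y∈ = All-lookup h y∈

∈-remove : ∀ {x y : A} as {bs} → y ∈ as ++ x ∷ bs → y ≢ x → y ∈ as ++ bs
∈-remove [] (here e) ne = ⊥-elim (ne e)
∈-remove [] (there p) ne = p
∈-remove (a ∷ as) (here e) ne = here e
∈-remove (a ∷ as) (there p) ne = there (∈-remove as p ne)

length-remove : ∀ (as : List A) {x bs} → length (as ++ x ∷ bs) ≡ suc (length (as ++ bs))
length-remove [] = refl
length-remove (a ∷ as) = cong suc (length-remove as)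

-- An injection given by a relation: no witness has to be chosen canonically, which suits counts in
-- which a dart is only known to reach some representative of its walk.
rel-length : (Rel : A → B → Set) → ∀ {xs ys} → Unique xs →
  (∀ {x} → x ∈ xs → ∃ λ y → y ∈ ys × Rel x y) →
  (∀ {x x' y} → x ∈ xs → x' ∈ xs → Rel x y → Rel x' y → x ≡ x') → length xs ≤ length ys
rel-length Rel {[]} u m i = z≤n
rel-length Rel {x ∷ xs} (h ∷ u) m i with m (here refl)
... | y , y∈ , r with ∈-∃++ y∈
... | as , bs , refl = subst (suc (length xs) ≤_) (sym (length-remove as))
  (s≤s (rel-length Rel u
    (λ x∈ → let z , z∈ , s = m (there x∈) in
       z , ∈-remove as z∈ (λ e → All-lookup h x∈ (i (here refl) (there x∈) r (subst (Rel _) e s))) , s)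
    (λ p q → i (there p) (there q))))

inj-length : ∀ {xs : List A} {ys : List B} (f : A → B) → Unique xs →
  (∀ {x} → x ∈ xs → f x ∈ ys) →
  (∀ {x y} → x ∈ xs → y ∈ xs → f x ≡ f y → x ≡ y) → length xs ≤ length ys
inj-length f u m i = rel-length (λ x y → f x ≡ y) u (λ x∈ → f _ , m x∈ , refl) (λ p q e e' → i p q (trans e (sym e')))

⊆-length : ∀ {xs ys : List A} → Unique xs → (∀ {x} → x ∈ xs → x ∈ ys) → length xs ≤ length ys
⊆-length u m = inj-length id u m (λ _ _ e → e)

sel : (A → Bool) → List A → List A
sel p = filter (λ x → p x ≟ᵇ true)

∈-sel⁺ : ∀ (p : A → Bool) {x xs} → x ∈ xs → p x ≡ true → x ∈ sel p xs
∈-sel⁺ p = ∈-filter⁺ (λ x → p x ≟ᵇ true)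

∈-sel⁻ : ∀ (p : A → Bool) {x} xs → x ∈ sel p xs → x ∈ xs × p x ≡ true
∈-sel⁻ p xs = ∈-filter⁻ (λ x → p x ≟ᵇ true) {xs = xs}

sel! : ∀ (p : A → Bool) {xs} → Unique xs → Unique (sel p xs)
sel! p = filter⁺ (λ x → p x ≟ᵇ true)

allD : ∀ {n} → List (Dart n)
allD {n} = cartesianProduct (allFin n) (allFin n)

∈-allD : ∀ {n} (d : Dart n) → d ∈ allD
∈-allD (u , v) = ∈-cartesianProduct⁺ (∈-allFin u) (∈-allFin v)

allD! : ∀ {n} → Unique (allD {n})
allD! {n} = cartesianProduct⁺ (allFin⁺ n) (allFin⁺ n)

darts : ∀ {n} → Adj n → List (Dart n)
darts A = sel (λ d → A (proj₁ d) (proj₂ d)) allD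

∈-darts⁺ : ∀ {n} (A : Adj n) {u v} → A u v ≡ true → (u , v) ∈ darts A
∈-darts⁺ A e = ∈-sel⁺ (λ d → A (proj₁ d) (proj₂ d)) (∈-allD _) e

∈-darts⁻ : ∀ {n} (A : Adj n) {d} → d ∈ darts A → A (proj₁ d) (proj₂ d) ≡ true
∈-darts⁻ A m = proj₂ (∈-sel⁻ (λ d → A (proj₁ d) (proj₂ d)) allD m)

darts! : ∀ {n} (A : Adj n) → Unique (darts A)
darts! A = sel! _ allD!

#d : ∀ {n} → Adj n → ℕ
#d A = length (darts A)

nbrs : ∀ {n} → Adj n → Fin n → List (Fin n)
nbrs {n} A v = sel (A v) (allFin n)

deg : ∀ {n} → Adj n → Fin n → ℕ
deg A v = length (nbrs A v)

∈-nbrs⁺ : ∀ {n} (A : Adj n) {u v} → A u v ≡ true → v ∈ nbrs A u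
∈-nbrs⁺ A e = ∈-sel⁺ (A _) (∈-allFin _) e

∈-nbrs⁻ : ∀ {n} (A : Adj n) {u v} → v ∈ nbrs A u → A u v ≡ true
∈-nbrs⁻ A m = proj₂ (∈-sel⁻ (A _) (allFin _) m)

nbrs! : ∀ {n} (A : Adj n) v → Unique (nbrs A v)
nbrs! A v = sel! (A v) (allFin⁺ _)

-- Iteration and orbits

data Reach {A : Set} (f : A → A) : A → A → Set where
  here : ∀ {x} → Reach f x x
  step : ∀ {x y} → Reach f (f x) y → Reach f x y

reach-trans : ∀ {f : A → A} {x y z} → Reach f x y → Reach f y z → Reach f x z
reach-trans here q = q
reach-trans (step p) q = step (reach-trans p q)

reach-snoc : ∀ {f : A → A} {x y} → Reach f x y → Reach f x (f y)
reach-snoc p = reach-trans p (step here)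

iter-shift : ∀ (f : A → A) k x → iter f k (f x) ≡ iter f (suc k) x
iter-shift f zero x = refl
iter-shift f (suc k) x = cong f (iter-shift f k x)

iter-+ : ∀ (f : A → A) j k x → iter f (j + k) x ≡ iter f j (iter f k x)
iter-+ f zero k x = refl
iter-+ f (suc j) k x = cong f (iter-+ f j k x)

reach⇒iter : ∀ {f : A → A} {x y} → Reach f x y → ∃ λ k → iter f k x ≡ y
reach⇒iter here = 0 , refl
reach⇒iter {f = f} {x} (step p) with reach⇒iter p
... | k , e = suc k , trans (sym (iter-shift f k x)) e

iter⇒reach : ∀ (f : A → A) k x → Reach f x (iter f k x)
iter⇒reach f zero x = here
iter⇒reach f (suc k) x = reach-snoc (iter⇒reach f k x)

reach-inv : ∀ {f : A → A} (P : A → Set) → (∀ {x} → P x → P (f x)) → ∀ {x y} → Reach f x y → P x → P y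
reach-inv P cl here px = px
reach-inv P cl (step r) px = reach-inv P cl r (cl px)

reach-fix : ∀ {f : A → A} {x y} → f x ≡ x → Reach f x y → y ≡ x
reach-fix {f = f} {x} e r = reach-inv (_≡ x) (λ { refl → e }) r refl

lastStep : ∀ {f : A → A} {x y} → Reach f (f x) y → ∃ λ p → Reach f x p × f p ≡ y
lastStep {x = x} here = x , here , refl
lastStep (step r) with lastStep r
... | p , q , e = p , step q , e

record Finite (A : Set) : Set where
  field
    size : ℕ
    enc : A → Fin size
    enc-inj : ∀ {x y} → enc x ≡ enc y → x ≡ y

finFin : ∀ {n} → Finite (Fin n)
finFin {n} = record { size = n ; enc = id ; enc-inj = id }

finDart : ∀ {n} → Finite (Dart n)
finDart {n} = record { size = n * n ; enc = λ d → combine (proj₁ d) (proj₂ d)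
  ; enc-inj = λ {x} {y} e → let p , q = combine-injective (proj₁ x) (proj₂ x) (proj₁ y) (proj₂ y) e in cong₂ _,_ p q }

module _ (F : Finite A) where
  open Finite F

  collide : (s : ℕ → A) → ∃₂ λ i j → i < j × j ≤ size × s i ≡ s j
  collide s with pigeonhole (n<1+n size) (λ i → enc (s (toℕ i)))
  ... | i , j , lt , e = toℕ i , toℕ j , lt , ≤-pred (toℕ<n j) , enc-inj e

  -- A collision among the first iterates cuts a loop out of the path, and this is repeated until
  -- `k` is below `size`. It makes reachability decidable and matches the bounded search in
  -- `isOrbitMin`.
  iter-bound : ∀ (f : A → A) k x → ∃ λ k' → k' < size × iter f k' x ≡ iter f k x
  iter-bound f k x = go k k ≤-refl
    where
    go : ∀ fuel k → k ≤ fuel → ∃ λ k' → k' < size × iter f k' x ≡ iter f k x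
    go fuel k le with k <? size
    ... | yes lt = k , lt , refl
    ... | no nlt with collide (λ i → iter f i x)
    ... | i , j , i<j , j≤ , e = shorten fuel le
      where
      j≤k : j ≤ k
      j≤k = ≤-trans j≤ (≮⇒≥ nlt)
      same : iter f ((k ∸ j) + i) x ≡ iter f k x
      same = trans (iter-+ f (k ∸ j) i x) (trans (cong (iter f (k ∸ j)) e)
        (trans (sym (iter-+ f (k ∸ j) j x)) (cong (λ t → iter f t x) (m∸n+n≡m j≤k))))
      smaller : (k ∸ j) + i < k
      smaller = subst ((k ∸ j) + i <_) (m∸n+n≡m j≤k) (+-monoʳ-< (k ∸ j) i<j)
      shorten : ∀ fuel → k ≤ fuel → ∃ λ k' → k' < size × iter f k' x ≡ iter f k x
      shorten zero k≤ = ⊥-elim (n≮0 (<-≤-trans smaller k≤))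
      shorten (suc fl) k≤ = let k' , lt , eq = go fl ((k ∸ j) + i) (≤-pred (≤-trans smaller k≤)) in k' , lt , trans eq same

  reach-bound : ∀ {f : A → A} {x y} → Reach f x y → ∃ λ k → k < size × iter f k x ≡ y
  reach-bound {f} {x} r with reach⇒iter r
  ... | k , e with iter-bound f k x
  ... | k' , lt , e' = k' , lt , trans e' e

  reach? : DecidableEquality A → ∀ f x y → Dec (Reach f x y)
  reach? _≟ᴬ_ f x y = mapDec to from (any? (λ (i : Fin size) → iter f (toℕ i) x ≟ᴬ y))
    where
    to : (∃ λ (i : Fin size) → iter f (toℕ i) x ≡ y) → Reach f x y
    to (i , e) = subst (Reach f x) e (iter⇒reach f (toℕ i) x)
    from : Reach f x y → ∃ λ (i : Fin size) → iter f (toℕ i) x ≡ y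
    from r with reach-bound r
    ... | k , lt , e = fromℕ< lt , trans (cong (λ t → iter f t x) (toℕ-fromℕ< lt)) e

  -- `f` is only known to hit every element of `P` from within `P`. On a finite type this makes `f`
  -- a permutation there, even for undecidable `P`: an orbit of chosen preimages must repeat.
  module Perm (f : A → A) (P : A → Set) (pre : ∀ {x} → P x → ∃ λ p → P p × f p ≡ x) where
    private
      back : Σ A P → Σ A P
      back (x , px) = let p , pp , _ = pre px in p , pp

      back-spec : ∀ s → f (proj₁ (back s)) ≡ proj₁ s
      back-spec (x , px) = proj₂ (proj₂ (pre px))

      undo : ∀ k s → iter f k (proj₁ (iter back k s)) ≡ proj₁ s
      undo zero s = refl
      undo (suc k) s = trans (sym (iter-shift f k _)) (trans (cong (iter f k) (back-spec (iter back k s))) (undo k s))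

    period : ∀ {x} → P x → ∃ λ k → iter f (suc k) x ≡ x
    period {x} px with collide (λ i → proj₁ (iter back i (x , px)))
    ... | i , j , i<j , _ , e = j ∸ suc i , trans (cong (λ t → iter f t x) s≡) shift
      where
      s≡ : suc (j ∸ suc i) ≡ j ∸ i
      s≡ = sym (+-∸-assoc 1 i<j)
      y = proj₁ (iter back i (x , px))
      shift : iter f (j ∸ i) x ≡ x
      shift = trans (cong (iter f (j ∸ i)) (sym (undo i (x , px))))
        (trans (sym (iter-+ f (j ∸ i) i y)) (trans (cong (λ t → iter f t y) (m∸n+n≡m (<⇒≤ i<j)))
        (trans (cong (iter f j) e) (undo j (x , px)))))

    return : ∀ {x} → P x → Reach f (f x) x
    return {x} px with period px
    ... | k , e = subst (Reach f (f x)) (trans (iter-shift f k x) e) (iter⇒reach f k (f x))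

    private
      mult : ∀ {x} k → iter f k x ≡ x → ∀ m → iter f (m * k) x ≡ x
      mult k e zero = refl
      mult {x} k e (suc m) = trans (iter-+ f k (m * k) x) (trans (cong (iter f k) (mult k e m)) e)

    -- For a common multiple N of the two periods, `iter f N` fixes both points, while its value
    -- depends only on the common image under `f`.
    injective : ∀ {x y} → P x → P y → f x ≡ f y → x ≡ y
    injective {x} {y} px py e with period px | period py
    ... | i , ei | j , ej = trans (sym (mult (suc i) ei (suc j))) (trans agree
        (trans (cong (λ t → iter f t y) (*-comm (suc j) (suc i))) (mult (suc j) ej (suc i))))
      where
      agree : iter f (suc j * suc i) x ≡ iter f (suc j * suc i) y
      agree = trans (sym (iter-shift f (i + j * suc i) x)) (trans (cong (iter f (i + j * suc i)) e) (iter-shift f (i + j * suc i) y))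

    reach-sym : (∀ {x} → P x → P (f x)) → ∀ {x y} → P x → Reach f x y → Reach f y x
    reach-sym cl px here = here
    reach-sym cl px (step r) = reach-trans (reach-sym cl (cl px) r) (return px)

-- Cyclic orders on a neighbourhood

-- `fix` is a convention: the rotation at `s` also fixes the centre `s` itself. An isolated vertex v
-- then carries the walk consisting of the fixed point (v , v), and trivial walks are treated like
-- walks of darts.
record Cyc {n} (N : Fin n → Bool) (s : Fin n) (r : Fin n → Fin n) : Set where
  field
    fix : r s ≡ s
    cl : ∀ {u} → N u ≡ true → N (r u) ≡ true
    tr : ∀ {u w} → N u ≡ true → N w ≡ true → Reach r u w

  pre : ∀ {u} → N u ≡ true → ∃ λ p → N p ≡ true × r p ≡ u
  pre {u} nu with lastStep (tr (cl nu) nu)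
  ... | p , q , e = p , reach-inv (λ z → N z ≡ true) cl q nu , e

  inj : ∀ {u w} → N u ≡ true → N w ≡ true → r u ≡ r w → u ≡ w
  inj = Perm.injective finFin r (λ z → N z ≡ true) pre

abstract
  -- `z` is placed immediately before `t`. The value `t ≡ s` encodes an empty neighbourhood, in
  -- which case `z` becomes its own successor.
  insf : ∀ {n} (s z t : Fin n) (r : Fin n → Fin n) → Fin n → Fin n
  insf s z t r w = if does (w ≟ s) then s else
                   (if does (w ≟ z) then (if does (t ≟ s) then z else t) else
                   (if does (r w ≟ t) then z else r w))

  insf-self : ∀ {n} {s z t : Fin n} {r : Fin n → Fin n} → insf s z t r s ≡ s
  insf-self {s = s} {z} {t} {r} rewrite dec-true (s ≟ s) refl = refl

  insf-new : ∀ {n} {s z t : Fin n} {r : Fin n → Fin n} → z ≢ s → t ≢ s → insf s z t r z ≡ t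
  insf-new {s = s} {z} {t} {r} zs ts rewrite dec-false (z ≟ s) zs | dec-true (z ≟ z) refl | dec-false (t ≟ s) ts = refl

  insf-new₀ : ∀ {n} {s z t : Fin n} {r : Fin n → Fin n} → z ≢ s → t ≡ s → insf s z t r z ≡ z
  insf-new₀ {s = s} {z} {t} {r} zs ts rewrite dec-false (z ≟ s) zs | dec-true (z ≟ z) refl | dec-true (t ≟ s) ts = refl

  insf-hit : ∀ {n} {s z t : Fin n} {r : Fin n → Fin n} {w} → w ≢ s → w ≢ z → r w ≡ t → insf s z t r w ≡ z
  insf-hit {s = s} {z} {t} {r} {w = w} ws wz e rewrite dec-false (w ≟ s) ws | dec-false (w ≟ z) wz | dec-true (r w ≟ t) e = refl

  insf-miss : ∀ {n} {s z t : Fin n} {r : Fin n → Fin n} {w} → w ≢ s → w ≢ z → r w ≢ t → insf s z t r w ≡ r w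
  insf-miss {s = s} {z} {t} {r} {w = w} ws wz e rewrite dec-false (w ≟ s) ws | dec-false (w ≟ z) wz | dec-false (r w ≟ t) e = refl

  delf : ∀ {n} (s z : Fin n) (r : Fin n → Fin n) → Fin n → Fin n
  delf s z r w = if does (w ≟ s) then s else (if does (r w ≟ z) then r z else r w)

  delf-self : ∀ {n} {s z : Fin n} {r : Fin n → Fin n} → delf s z r s ≡ s
  delf-self {s = s} {z} {r} rewrite dec-true (s ≟ s) refl = refl

  delf-hit : ∀ {n} {s z : Fin n} {r : Fin n → Fin n} {w} → w ≢ s → r w ≡ z → delf s z r w ≡ r z
  delf-hit {s = s} {z} {r} {w = w} ws e rewrite dec-false (w ≟ s) ws | dec-true (r w ≟ z) e = refl

  delf-miss : ∀ {n} {s z : Fin n} {r : Fin n → Fin n} {w} → w ≢ s → r w ≢ z → delf s z r w ≡ r w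
  delf-miss {s = s} {z} {r} {w = w} ws e rewrite dec-false (w ≟ s) ws | dec-false (r w ≟ z) e = refl

≡subst : ∀ (N : A → Bool) {u w} → u ≡ w → N u ≡ true → N w ≡ true
≡subst N refl h = h

record Plus {n} (N N' : Fin n → Bool) (s z : Fin n) : Set where
  field
    z≢s : z ≢ s
    Ns : N s ≢ true
    N's : N' s ≢ true
    Nz : N z ≢ true
    N'z : N' z ≡ true
    up : ∀ {u} → N u ≡ true → N' u ≡ true
    dn : ∀ {u} → N' u ≡ true → N u ≡ true ⊎ u ≡ z

module _ {n} {N N' : Fin n → Bool} {s z : Fin n} {r : Fin n → Fin n} (P : Plus N N' s z) where
  open Plus P

  private
    ≢s : ∀ {u} → N u ≡ true → u ≢ s
    ≢s h refl = Ns h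
    ≢z : ∀ {u} → N u ≡ true → u ≢ z
    ≢z h refl = Nz h
    ≢s' : ∀ {u} → N' u ≡ true → u ≢ s
    ≢s' h refl = N's h

  insCyc : ∀ {t} → Cyc N s r → (N t ≡ true ⊎ (t ≡ s × (∀ w → N w ≢ true))) → Cyc N' s (insf s z t r)
  insCyc {t} C cor = record { fix = insf-self ; cl = cl' ; tr = tr' cor }
    where
    open Cyc C
    r' = insf s z t r
    cl' : ∀ {u} → N' u ≡ true → N' (r' u) ≡ true
    cl' {u} h with dn h
    cl' {u} h | inj₁ nu = case r u ≟ t of λ
      { (yes e) → ≡subst N' (sym (insf-hit (≢s nu) (≢z nu) e)) N'z
      ; (no ne) → ≡subst N' (sym (insf-miss (≢s nu) (≢z nu) ne)) (up (cl nu)) }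
    cl' {u} h | inj₂ refl = clz cor
      where
      clz : (N t ≡ true ⊎ (t ≡ s × (∀ w → N w ≢ true))) → N' (r' z) ≡ true
      clz (inj₁ nt) = ≡subst N' (sym (insf-new z≢s (≢s nt))) (up nt)
      clz (inj₂ (e , _)) = ≡subst N' (sym (insf-new₀ z≢s e)) N'z
    module _ (nt : N t ≡ true) where
      z→t : Reach r' z t
      z→t = step (subst (λ q → Reach r' q t) (sym (insf-new z≢s (≢s nt))) here)
      follow : ∀ {u w} → N u ≡ true → Reach r u w → Reach r' u w
      follow nu here = here
      follow {u} {w} nu (step q) = case r u ≟ t of λ
        { (yes e) → step (subst (λ y → Reach r' y w) (sym (insf-hit (≢s nu) (≢z nu) e))
                      (reach-trans z→t (subst (λ y → Reach r' y w) e ih)))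
        ; (no ne) → step (subst (λ y → Reach r' y w) (sym (insf-miss (≢s nu) (≢z nu) ne)) ih) }
        where
        ih : Reach r' (r u) w
        ih = follow (cl nu) q
      toz : ∀ {u} → N u ≡ true → Reach r' u z
      toz {u} nu with pre nt
      ... | p , np , e = subst (Reach r' u) (insf-hit (≢s np) (≢z np) e) (reach-snoc (follow nu (tr nu np)))
    tr' : (N t ≡ true ⊎ (t ≡ s × (∀ w → N w ≢ true))) → ∀ {u w} → N' u ≡ true → N' w ≡ true → Reach r' u w
    tr' (inj₁ nt) hu hw with dn hu | dn hw
    ... | inj₁ nu | inj₁ nw = follow nt nu (tr nu nw)
    ... | inj₁ nu | inj₂ refl = toz nt nu
    ... | inj₂ refl | inj₁ nw = reach-trans (z→t nt) (follow nt nt (tr nt nw))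
    ... | inj₂ refl | inj₂ refl = here
    tr' (inj₂ (_ , em)) hu hw with dn hu | dn hw
    ... | inj₁ nu | _ = ⊥-elim (em _ nu)
    ... | inj₂ _ | inj₁ nw = ⊥-elim (em _ nw)
    ... | inj₂ refl | inj₂ refl = here

  delCyc : Cyc N' s r → Cyc N s (delf s z r)
  delCyc C = record { fix = delf-self ; cl = cl' ; tr = λ nu nw → proj₁ (follow (tr (up nu) (up nw)) (up nu) nw) (≢z nu) }
    where
    open Cyc C
    r' = delf s z r
    down : ∀ {u} → N' u ≡ true → u ≢ z → N u ≡ true
    down h ne with dn h
    ... | inj₁ q = q
    ... | inj₂ e = ⊥-elim (ne e)
    cl' : ∀ {u} → N u ≡ true → N (r' u) ≡ true
    cl' {u} nu = case r u ≟ z of λ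
      { (yes e) → ≡subst N (sym (delf-hit (≢s nu) e))
                    (down (cl N'z) (λ f → ≢z nu (reach-fix f (tr N'z (up nu)))))
      ; (no ne) → ≡subst N (sym (delf-miss (≢s nu) ne)) (down (cl (up nu)) ne) }
    -- The second component starts at `r z`, the point where the bypass of `z` arrives.
    follow : ∀ {u w} → Reach r u w → N' u ≡ true → N w ≡ true →
             (u ≢ z → Reach r' u w) × (u ≡ z → Reach r' (r z) w)
    follow here nu nw = (λ _ → here) , (λ { refl → ⊥-elim (Nz nw) })
    follow {u} {w} (step q) nu nw with follow q (cl nu) nw
    ... | f , g = h₁ , h₂
      where
      h₁ : u ≢ z → Reach r' u w
      h₁ ne = case r u ≟ z of λ
        { (yes e) → step (subst (λ y → Reach r' y w) (sym (delf-hit (≢s' nu) e)) (g e))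
        ; (no ne') → step (subst (λ y → Reach r' y w) (sym (delf-miss (≢s' nu) ne')) (f ne')) }
      h₂ : u ≡ z → Reach r' (r z) w
      h₂ refl = case r u ≟ z of λ { (yes e) → g e ; (no ne') → f ne' }

-- Rotation systems and insertion/deletion of an edge

isD : ∀ {n} → Adj n → Dart n → Set
isD A d = A (proj₁ d) (proj₂ d) ≡ true

iso : ∀ {n} → Adj n → Fin n → Set
iso A u = ∀ w → A u w ≢ true

-- The objects carried by the walks: darts, and the pair (v , v) for an isolated vertex v.
Obj : ∀ {n} → Adj n → Dart n → Set
Obj A d = isD A d ⊎ (proj₁ d ≡ proj₂ d × iso A (proj₁ d))

record Rot {n} (A : Adj n) : Set where
  field
    ρ : Fin n → Fin n → Fin n
    symA : ∀ {u v} → A u v ≡ true → A v u ≡ true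
    irr : ∀ {v} → A v v ≢ true
    cyc : ∀ v → Cyc (A v) v (ρ v)

  nxt : Dart n → Dart n
  nxt = φ ρ

  nxt-cl : ∀ {d} → isD A d → isD A (nxt d)
  nxt-cl {u , v} h = Cyc.cl (cyc v) (symA h)

  nxt-pre : ∀ {d} → isD A d → ∃ λ p → isD A p × nxt p ≡ d
  nxt-pre {u , v} h with Cyc.pre (cyc u) h
  ... | p , np , e = (p , u) , symA np , cong (u ,_) e

  module N = Perm finDart nxt (isD A) nxt-pre

  nxt-sym : ∀ {d e} → isD A d → Reach nxt d e → Reach nxt e d
  nxt-sym = N.reach-sym nxt-cl

  nxt-D : ∀ {d e} → Reach nxt d e → isD A d → isD A e
  nxt-D = reach-inv (isD A) nxt-cl

  adj≢ : ∀ {u v} → A u v ≡ true → u ≢ v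
  adj≢ h refl = irr h

  iso-fix : ∀ {v} → nxt (v , v) ≡ (v , v)
  iso-fix {v} = cong (v ,_) (Cyc.fix (cyc v))

  iso-reach : ∀ {v e} → Reach nxt (v , v) e → e ≡ (v , v)
  iso-reach = reach-fix iso-fix

record Ext {n} (A A' : Adj n) (x y : Fin n) : Set where
  field
    x≢y : x ≢ y
    nxy : A x y ≢ true
    nyx : A y x ≢ true
    axy : A' x y ≡ true
    ayx : A' y x ≡ true
    up : ∀ {u v} → A u v ≡ true → A' u v ≡ true
    dn : ∀ {u v} → A' u v ≡ true → A u v ≡ true ⊎ (u ≡ x × v ≡ y) ⊎ (u ≡ y × v ≡ x)

-- One description of edge insertion and edge deletion, read in opposite directions: `R'` is `R`
-- with the edge xy put into the corners before (x , cx) and (y , cy). Old walks are diverted only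
-- at these corners (`nx`); the new darts lead to the opposite corner, or to each other at an end
-- that was isolated (`na`, `nb`).
record Surg {n} {A A' : Adj n} (R : Rot A) (R' : Rot A') (x y : Fin n) : Set where
  open Rot R
  open Rot R' using () renaming (nxt to nxt')
  field
    ext : Ext A A' x y
    cx cy : Fin n
    ox : Obj A (x , cx)
    oy : Obj A (y , cy)
    nx : ∀ {d} → isD A d → (nxt' d ≡ (x , y) × nxt d ≡ (x , cx)) ⊎
                           (nxt' d ≡ (y , x) × nxt d ≡ (y , cy)) ⊎ nxt' d ≡ nxt d
    na : (iso A y × nxt' (x , y) ≡ (y , x)) ⊎ (isD A (y , cy) × nxt' (x , y) ≡ (y , cy))
    nb : (iso A x × nxt' (y , x) ≡ (x , y)) ⊎ (isD A (x , cx) × nxt' (y , x) ≡ (x , cx))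

abstract
  upd : ∀ {n} → Fin n → B → (Fin n → B) → Fin n → B
  upd x b f v = if does (v ≟ x) then b else f v

  upd-same : ∀ {n} {x : Fin n} {b : B} {f} {v} → v ≡ x → upd x b f v ≡ b
  upd-same {x = x} {v = v} e rewrite dec-true (v ≟ x) e = refl

  upd-other : ∀ {n} {x : Fin n} {b : B} {f} {v} → v ≢ x → upd x b f v ≡ f v
  upd-other {x = x} {v = v} e rewrite dec-false (v ≟ x) e = refl

module _ {n} {A A' : Adj n} {x y : Fin n} (E : Ext A A' x y) where
  open Ext E

  dn-other : ∀ {v u} → v ≢ x → v ≢ y → A' v u ≡ true → A v u ≡ true
  dn-other vx vy h with dn h
  ... | inj₁ q = q
  ... | inj₂ (inj₁ (e , _)) = ⊥-elim (vx e)
  ... | inj₂ (inj₂ (e , _)) = ⊥-elim (vy e)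

  module _ (irrA : ∀ {v} → A v v ≢ true) where
    irrA' : ∀ {v} → A' v v ≢ true
    irrA' h with dn h
    ... | inj₁ q = irrA q
    ... | inj₂ (inj₁ (refl , e)) = x≢y e
    ... | inj₂ (inj₂ (refl , e)) = x≢y (sym e)

    plusx : Plus (A x) (A' x) x y
    plusx = record { z≢s = x≢y ∘ sym ; Ns = irrA ; N's = irrA' ; Nz = nxy ; N'z = axy ; up = up ; dn = d }
      where
      d : ∀ {u} → A' x u ≡ true → A x u ≡ true ⊎ u ≡ y
      d h with dn h
      ... | inj₁ q = inj₁ q
      ... | inj₂ (inj₁ (_ , e)) = inj₂ e
      ... | inj₂ (inj₂ (e , _)) = ⊥-elim (x≢y e)

    plusy : Plus (A y) (A' y) y x
    plusy = record { z≢s = x≢y ; Ns = irrA ; N's = irrA' ; Nz = nyx ; N'z = ayx ; up = up ; dn = d }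
      where
      d : ∀ {u} → A' y u ≡ true → A y u ≡ true ⊎ u ≡ x
      d h with dn h
      ... | inj₁ q = inj₁ q
      ... | inj₂ (inj₁ (e , _)) = ⊥-elim (x≢y (sym e))
      ... | inj₂ (inj₂ (_ , e)) = inj₂ e

cycOther : ∀ {n} {N N' : Fin n → Bool} {s r} → (∀ {u} → N u ≡ true → N' u ≡ true) → (∀ {u} → N' u ≡ true → N u ≡ true) →
  Cyc N s r → Cyc N' s r
cycOther up dn C = record { fix = fix ; cl = λ h → up (cl (dn h)) ; tr = λ h k → tr (dn h) (dn k) }
  where open Cyc C

module InsRot {n} {A A' : Adj n} {x y : Fin n} (R : Rot A) (E : Ext A A' x y)
  (cx cy : Fin n) (ox : Obj A (x , cx)) (oy : Obj A (y , cy)) where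
  open Ext E
  open Rot R
  fx = insf x y cx (ρ x)
  fy = insf y x cy (ρ y)
  ρ' : Fin n → Fin n → Fin n
  ρ' = upd x fx (upd y fy ρ)

  corner : ∀ {v c} → Obj A (v , c) → A v c ≡ true ⊎ (c ≡ v × (∀ w → A v w ≢ true))
  corner (inj₁ h) = inj₁ h
  corner (inj₂ (e , i)) = inj₂ (sym e , i)

  ρ'x : ∀ {v} → v ≡ x → ρ' v ≡ fx
  ρ'x e = upd-same e
  ρ'y : ∀ {v} → v ≡ y → ρ' v ≡ fy
  ρ'y refl = trans (upd-other (x≢y ∘ sym)) (upd-same refl)
  ρ'o : ∀ {v} → v ≢ x → v ≢ y → ρ' v ≡ ρ v
  ρ'o a b = trans (upd-other a) (upd-other b)

  cyc' : ∀ v → Cyc (A' v) v (ρ' v)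
  cyc' v = go (v ≟ x) (v ≟ y)
    where
    go : Dec (v ≡ x) → Dec (v ≡ y) → Cyc (A' v) v (ρ' v)
    go (yes refl) _ = subst (Cyc (A' v) v) (sym (ρ'x refl)) (insCyc (plusx E irr) (cyc x) (corner ox))
    go (no _) (yes refl) = subst (Cyc (A' v) v) (sym (ρ'y refl)) (insCyc (plusy E irr) (cyc y) (corner oy))
    go (no a) (no b) = subst (Cyc (A' v) v) (sym (ρ'o a b)) (cycOther up (dn-other E a b) (cyc v))

  symA' : ∀ {u v} → A' u v ≡ true → A' v u ≡ true
  symA' h with dn h
  ... | inj₁ q = up (symA q)
  ... | inj₂ (inj₁ (refl , refl)) = ayx
  ... | inj₂ (inj₂ (refl , refl)) = axy

  R' : Rot A'
  R' = record { ρ = ρ' ; symA = symA' ; irr = irrA' E irr ; cyc = cyc' }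

  surg : Surg R R' x y
  surg = record { ext = E ; cx = cx ; cy = cy ; ox = ox ; oy = oy ; nx = nx ; na = na' oy ; nb = nb' ox }
    where
    nx₁ : ∀ {u v} → A u v ≡ true → Dec (v ≡ x) → Dec (v ≡ y) → (φ ρ' (u , v) ≡ (x , y) × φ ρ (u , v) ≡ (x , cx)) ⊎ (φ ρ' (u , v) ≡ (y , x) × φ ρ (u , v) ≡ (y , cy)) ⊎ φ ρ' (u , v) ≡ φ ρ (u , v)
    nx : ∀ {d} → isD A d → (φ ρ' d ≡ (x , y) × φ ρ d ≡ (x , cx)) ⊎ (φ ρ' d ≡ (y , x) × φ ρ d ≡ (y , cy)) ⊎ φ ρ' d ≡ φ ρ d
    nx {u , v} h = nx₁ h (v ≟ x) (v ≟ y)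
    nx₁ {u} h (yes refl) _ = case ρ x u ≟ cx of λ
      { (yes e) → inj₁ (cong (x ,_) (trans (cong (λ f → f u) (ρ'x refl)) (insf-hit (adj≢ h) (λ { refl → nyx h }) e)) , cong (x ,_) e)
      ; (no ne) → inj₂ (inj₂ (cong (x ,_) (trans (cong (λ f → f u) (ρ'x refl)) (insf-miss (adj≢ h) (λ { refl → nyx h }) ne)))) }
    nx₁ {u} h (no _) (yes refl) = case ρ y u ≟ cy of λ
      { (yes e) → inj₂ (inj₁ (cong (y ,_) (trans (cong (λ f → f u) (ρ'y refl)) (insf-hit (adj≢ h) (λ { refl → nxy h }) e)) , cong (y ,_) e))
      ; (no ne) → inj₂ (inj₂ (cong (y ,_) (trans (cong (λ f → f u) (ρ'y refl)) (insf-miss (adj≢ h) (λ { refl → nxy h }) ne)))) }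
    nx₁ {u} {v} h (no a) (no b) = inj₂ (inj₂ (cong (v ,_) (cong (λ f → f u) (ρ'o a b))))
    na' : Obj A (y , cy) → (iso A y × φ ρ' (x , y) ≡ (y , x)) ⊎ (isD A (y , cy) × φ ρ' (x , y) ≡ (y , cy))
    na' (inj₁ h) = inj₂ (h , cong (y ,_) (trans (cong (λ f → f x) (ρ'y refl)) (insf-new x≢y (adj≢ h ∘ sym))))
    na' (inj₂ (e , i)) = inj₁ (i , cong (y ,_) (trans (cong (λ f → f x) (ρ'y refl)) (insf-new₀ x≢y (sym e))))
    nb' : Obj A (x , cx) → (iso A x × φ ρ' (y , x) ≡ (x , y)) ⊎ (isD A (x , cx) × φ ρ' (y , x) ≡ (x , cx))
    nb' (inj₁ h) = inj₂ (h , cong (x ,_) (trans (cong (λ f → f y) (ρ'x refl)) (insf-new (x≢y ∘ sym) (adj≢ h ∘ sym))))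
    nb' (inj₂ (e , i)) = inj₁ (i , cong (x ,_) (trans (cong (λ f → f y) (ρ'x refl)) (insf-new₀ (x≢y ∘ sym) (sym e))))

module DelRot {n} {A A' : Adj n} {x y : Fin n} (R' : Rot A') (E : Ext A A' x y) where
  open Ext E
  open Rot R' renaming (ρ to ρ'; symA to symA'; irr to irr'; cyc to cyc'; adj≢ to adj≢')
  fx = delf x y (ρ' x)
  fy = delf y x (ρ' y)
  ρ : Fin n → Fin n → Fin n
  ρ = upd x fx (upd y fy ρ')

  ρx : ∀ {v} → v ≡ x → ρ v ≡ fx
  ρx e = upd-same e
  ρy : ∀ {v} → v ≡ y → ρ v ≡ fy
  ρy refl = trans (upd-other (x≢y ∘ sym)) (upd-same refl)
  ρo : ∀ {v} → v ≢ x → v ≢ y → ρ v ≡ ρ' v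
  ρo a b = trans (upd-other a) (upd-other b)

  irrA : ∀ {v} → A v v ≢ true
  irrA h = irr' (up h)

  cyc : ∀ v → Cyc (A v) v (ρ v)
  cyc v = go (v ≟ x) (v ≟ y)
    where
    go : Dec (v ≡ x) → Dec (v ≡ y) → Cyc (A v) v (ρ v)
    go (yes refl) _ = subst (Cyc (A v) v) (sym (ρx refl)) (delCyc (plusx E irrA) (cyc' x))
    go (no _) (yes refl) = subst (Cyc (A v) v) (sym (ρy refl)) (delCyc (plusy E irrA) (cyc' y))
    go (no a) (no b) = subst (Cyc (A v) v) (sym (ρo a b)) (cycOther (dn-other E a b) up (cyc' v))

  symA : ∀ {u v} → A u v ≡ true → A v u ≡ true
  symA {u} {v} h with dn (symA' (up h))
  ... | inj₁ q = q
  ... | inj₂ (inj₁ (refl , refl)) = ⊥-elim (nyx h)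
  ... | inj₂ (inj₂ (refl , refl)) = ⊥-elim (nxy h)

  R : Rot A
  R = record { ρ = ρ ; symA = symA ; irr = irrA ; cyc = cyc }

  -- The corner left behind by the edge is the successor of `z`. If `z` is its own successor it is
  -- the only neighbour; then `s` becomes isolated and the corner is (s , s).
  cornerOf : ∀ {s z} → Plus (A s) (A' s) s z →
    ∃ λ c → Obj A (s , c) × ((iso A s × ρ' s z ≡ z) ⊎ (A s c ≡ true × ρ' s z ≡ c))
  cornerOf {s} {z} P with ρ' s z ≟ z
  ... | yes e = s , inj₂ (refl , em) , inj₁ (em , e)
    where
    em : iso A s
    em w h = Plus.Nz P (≡subst (A s) (reach-fix e (Cyc.tr (cyc' s) (Plus.N'z P) (Plus.up P h))) h)
  ... | no ne with Plus.dn P (Cyc.cl (cyc' s) (Plus.N'z P))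
  ... | inj₁ q = ρ' s z , inj₁ q , inj₂ (q , refl)
  ... | inj₂ e = ⊥-elim (ne e)

  px = plusx E irrA
  py = plusy E irrA
  cornx = cornerOf px
  corny = cornerOf py
  cx = proj₁ cornx
  cy = proj₁ corny

  hitc : ∀ {s z} (P : Plus (A s) (A' s) s z) {u} → A s u ≡ true → ρ' s u ≡ z → ρ' s z ≡ proj₁ (cornerOf P)
  hitc {s} {z} P {u} h e with proj₂ (proj₂ (cornerOf P))
  ... | inj₁ (i , _) = ⊥-elim (i _ h)
  ... | inj₂ (_ , q) = q

  surg : Surg R R' x y
  surg = record { ext = E ; cx = cx ; cy = cy ; ox = proj₁ (proj₂ cornx) ; oy = proj₁ (proj₂ corny) ; nx = nx
    ; na = go (proj₂ (proj₂ corny)) ; nb = go (proj₂ (proj₂ cornx)) }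
    where
    go : ∀ {s z c} → (iso A s × ρ' s z ≡ z) ⊎ (A s c ≡ true × ρ' s z ≡ c) →
      (iso A s × φ ρ' (z , s) ≡ (s , z)) ⊎ (isD A (s , c) × φ ρ' (z , s) ≡ (s , c))
    go (inj₁ (i , e)) = inj₁ (i , cong (_ ,_) e)
    go (inj₂ (i , e)) = inj₂ (i , cong (_ ,_) e)
    nx₁ : ∀ {u v} → A u v ≡ true → Dec (v ≡ x) → Dec (v ≡ y) → (φ ρ' (u , v) ≡ (x , y) × φ ρ (u , v) ≡ (x , cx)) ⊎ (φ ρ' (u , v) ≡ (y , x) × φ ρ (u , v) ≡ (y , cy)) ⊎ φ ρ' (u , v) ≡ φ ρ (u , v)
    nx : ∀ {d} → isD A d → (φ ρ' d ≡ (x , y) × φ ρ d ≡ (x , cx)) ⊎ (φ ρ' d ≡ (y , x) × φ ρ d ≡ (y , cy)) ⊎ φ ρ' d ≡ φ ρ d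
    nx {u , v} h = nx₁ h (v ≟ x) (v ≟ y)
    nx₁ {u} h (yes refl) _ = case ρ' x u ≟ y of λ
      { (yes e) → inj₁ (cong (x ,_) e , cong (x ,_) (trans (cong (λ f → f u) (ρx refl)) (trans (delf-hit (adj≢' (up h)) e) (hitc px (symA h) e))))
      ; (no ne) → inj₂ (inj₂ (cong (x ,_) (sym (trans (cong (λ f → f u) (ρx refl)) (delf-miss (adj≢' (up h)) ne))))) }
    nx₁ {u} h (no _) (yes refl) = case ρ' y u ≟ x of λ
      { (yes e) → inj₂ (inj₁ (cong (y ,_) e , cong (y ,_) (trans (cong (λ f → f u) (ρy refl)) (trans (delf-hit (adj≢' (up h)) e) (hitc py (symA h) e)))))
      ; (no ne) → inj₂ (inj₂ (cong (y ,_) (sym (trans (cong (λ f → f u) (ρy refl)) (delf-miss (adj≢' (up h)) ne))))) }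
    nx₁ {u} {v} h (no a) (no b) = inj₂ (inj₂ (cong (v ,_) (sym (cong (λ f → f u) (ρo a b)))))

-- Embeddings with walk representatives and face labels

On : ∀ {n} → Adj n → (Dart n → ℕ) → ℕ → Fin n → Set
On A lab ℓ u = ∃ λ w → Obj A (u , w) × lab (u , w) ≡ ℓ

Link : ∀ {n} → Adj n → (Dart n → ℕ) → Fin n → Fin n → Set
Link A lab u v = A u v ≡ true ⊎ (∃ λ ℓ → On A lab ℓ u × On A lab ℓ v)

-- lab names the face of an object, L lists the faces, and every walk meets the list R.
-- The Euler condition is doubled, so that edges are counted as darts.
record QE (g : ℕ) {n : ℕ} (A : Adj n) : Set where
  field
    rot : Rot A
  open Rot rot public
  field
    lab : Dart n → ℕ
    L : List ℕ
    L! : Unique L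
    lab∈ : ∀ d → lab d ∈ L
    labinv : ∀ {d} → isD A d → lab (nxt d) ≡ lab d
    surj : ∀ {ℓ} → ℓ ∈ L → ∃ λ d → Obj A d × lab d ≡ ℓ
    R : List (Dart n)
    cov : ∀ {d} → Obj A d → ∃ λ r → r ∈ R × Reach nxt d r
    conn : ∀ u v → Star (Link A lab) u v
    gen : 4 + #d A + 2 * length R ≤ 4 * g + 2 * n + 4 * length L

  objSym : ∀ {d e} → Obj A d → Reach nxt d e → Reach nxt e d
  objSym (inj₁ h) r = nxt-sym h r
  objSym (inj₂ (refl , _)) r = subst (λ q → Reach nxt q _) (sym (iso-reach r)) here

  lab-reach : ∀ {d e} → isD A d → Reach nxt d e → lab e ≡ lab d
  lab-reach {d} h r = proj₂ (reach-inv (λ e → isD A e × lab e ≡ lab d)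
    (λ { (p , q) → nxt-cl p , trans (labinv p) q }) r (h , refl))

stepEq : ∀ {f : A → A} {x y z} → f x ≡ y → Reach f y z → Reach f x z
stepEq refl r = step r

starBind : {P Q : A → A → Set} → (∀ {u v} → P u v → Star Q u v) → ∀ {u v} → Star P u v → Star Q u v
starBind f ε = ε
starBind f (s ◅ r) = f s ◅◅ starBind f r

fresh : List ℕ → ℕ
fresh [] = 0
fresh (x ∷ xs) = suc x ⊔ fresh xs

fresh> : ∀ {x xs} → x ∈ xs → x < fresh xs
fresh> {xs = y ∷ ys} (here refl) = m≤m⊔n (suc y) (fresh ys)
fresh> {xs = y ∷ ys} (there p) = ≤-trans (fresh> p) (m≤n⊔m (suc y) (fresh ys))

module _ {n} {A A' : Adj n} {x y : Fin n} (E : Ext A A' x y) where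
  open Ext E

  #d-ext : #d A' ≡ 2 + #d A
  #d-ext = ≤-antisym
    (⊆-length (darts! A') (λ m → sub (dn (∈-darts⁻ A' m))))
    (⊆-length u2 sup)
    where
    sub : ∀ {d} → A (proj₁ d) (proj₂ d) ≡ true ⊎ (proj₁ d ≡ x × proj₂ d ≡ y) ⊎ (proj₁ d ≡ y × proj₂ d ≡ x) →
      d ∈ (x , y) ∷ (y , x) ∷ darts A
    sub (inj₁ h) = there (there (∈-darts⁺ A h))
    sub (inj₂ (inj₁ (refl , refl))) = here refl
    sub (inj₂ (inj₂ (refl , refl))) = there (here refl)
    u2 : Unique ((x , y) ∷ (y , x) ∷ darts A)
    u2 = ((λ e → x≢y (cong proj₁ e)) ∷ All-tabulate (λ { m refl → nxy (∈-darts⁻ A m) })) ∷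
         (All-tabulate (λ { m refl → nyx (∈-darts⁻ A m) }) ∷ darts! A)
    sup : ∀ {d} → d ∈ (x , y) ∷ (y , x) ∷ darts A → d ∈ darts A'
    sup (here refl) = ∈-darts⁺ A' axy
    sup (there (here refl)) = ∈-darts⁺ A' ayx
    sup (there (there m)) = ∈-darts⁺ A' (up (∈-darts⁻ A m))

-- How walks change when an edge is inserted or deleted

module Follow {n} {A A' : Adj n} {x y : Fin n} {R : Rot A} {R' : Rot A'} (S : Surg R R' x y) where
  open Surg S
  open Rot R
  open Rot R' using () renaming (nxt to nxt'; module N to N')
  open Ext ext

  a b : Dart n
  a = x , y
  b = y , x

  -- In `R'` the dart (x , cx) is preceded by the new dart `b`. Since `nxt'` is injective, an old
  -- dart that keeps its successor cannot lead there.
  nx≢x : ∀ {d} → isD A d → nxt' d ≡ nxt d → nxt d ≢ (x , cx)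
  nx≢x {d} h e f with nb
  ... | inj₁ (i , _) = i cx (subst (isD A) f (nxt-cl h))
  ... | inj₂ (_ , q) = nyx (subst (isD A) (N'.injective (up h) ayx (trans e (trans f (sym q)))) h)

  nx≢y : ∀ {d} → isD A d → nxt' d ≡ nxt d → nxt d ≢ (y , cy)
  nx≢y {d} h e f with na
  ... | inj₁ (i , _) = i cy (subst (isD A) f (nxt-cl h))
  ... | inj₂ (_ , q) = nxy (subst (isD A) (N'.injective (up h) axy (trans e (trans f (sym q)))) h)

  Hit : Dart n → Set
  Hit d = (Reach nxt' d a × Reach nxt d (x , cx)) ⊎ (Reach nxt' d b × Reach nxt d (y , cy))

  hit-step : ∀ {d} → nxt' d ≡ nxt d → Hit (nxt d) → Hit d
  hit-step e (inj₁ (p , q)) = inj₁ (stepEq e p , step q)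
  hit-step e (inj₂ (p , q)) = inj₂ (stepEq e p , step q)

  follow : ∀ {d e} → isD A d → Reach nxt d e → Reach nxt' d e ⊎ Hit d
  follow h here = inj₁ here
  follow h (step r) with nx h
  ... | inj₁ (p , q) = inj₂ (inj₁ (stepEq p here , stepEq q here))
  ... | inj₂ (inj₁ (p , q)) = inj₂ (inj₂ (stepEq p here , stepEq q here))
  ... | inj₂ (inj₂ e) with follow (nxt-cl h) r
  ... | inj₁ p = inj₁ (stepEq e p)
  ... | inj₂ t = inj₂ (hit-step e t)

  hits : ∀ {d o} → isD A d → (o ≡ (x , cx) ⊎ o ≡ (y , cy)) → Reach nxt (nxt d) o → Hit d
  hits h w r with nx h
  ... | inj₁ (p , q) = inj₁ (stepEq p here , stepEq q here)
  ... | inj₂ (inj₁ (p , q)) = inj₂ (stepEq p here , stepEq q here)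
  hits h (inj₁ w) here | inj₂ (inj₂ e) = ⊥-elim (nx≢x h e w)
  hits h (inj₂ w) here | inj₂ (inj₂ e) = ⊥-elim (nx≢y h e w)
  hits h w (step r) | inj₂ (inj₂ e) = hit-step e (hits (nxt-cl h) w r)

  -- A walk through a corner that receives the edge is diverted somewhere. If `d` itself is the
  -- corner, one full turn of the old walk leads back to it.
  orb : ∀ {d o} → isD A d → (o ≡ (x , cx) ⊎ o ≡ (y , cy)) → Reach nxt d o → Hit d
  orb h w here = hits h w (N.return h)
  orb h w (step r) = hits h w r

  follow' : ∀ {d e} → isD A d → Reach nxt' d e → Reach nxt d e ⊎
    (Reach nxt d (x , cx) × Reach nxt' d a) ⊎ (Reach nxt d (y , cy) × Reach nxt' d b)
  follow' = go refl
    where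
    go : ∀ {d₀ d e} → d₀ ≡ d → isD A d → Reach nxt' d₀ e → Reach nxt d e ⊎
      (Reach nxt d (x , cx) × Reach nxt' d a) ⊎ (Reach nxt d (y , cy) × Reach nxt' d b)
    go refl h here = inj₁ here
    go refl h (step r) with nx h
    ... | inj₁ (p , q) = inj₂ (inj₁ (stepEq q here , stepEq p here))
    ... | inj₂ (inj₁ (p , q)) = inj₂ (inj₂ (stepEq q here , stepEq p here))
    ... | inj₂ (inj₂ e) with go e (nxt-cl h) r
    ... | inj₁ p = inj₁ (step p)
    ... | inj₂ (inj₁ (p , q)) = inj₂ (inj₁ (step p , stepEq e q))
    ... | inj₂ (inj₂ (p , q)) = inj₂ (inj₂ (step p , stepEq e q))

abstract
  labAt : ∀ {n} → (Dart n → Bool) → ℕ → (Dart n → ℕ) → Dart n → ℕ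
  labAt p ℓ f d = if p d then ℓ else f d

  labAt-yes : ∀ {n} (p : Dart n → Bool) {ℓ f d} → p d ≡ true → labAt p ℓ f d ≡ ℓ
  labAt-yes p e rewrite e = refl

  labAt-no : ∀ {n} (p : Dart n → Bool) {ℓ f d} → p d ≡ false → labAt p ℓ f d ≡ f d
  labAt-no p e rewrite e = refl

labAt-∈ : ∀ {n} (p : Dart n → Bool) {ℓ f d L} → ℓ ∈ L → f d ∈ L → labAt p ℓ f d ∈ L
labAt-∈ p {ℓ} {f} {d} h k = go (p d) refl
  where
  go : ∀ q → p d ≡ q → labAt p ℓ f d ∈ _
  go true e = subst (_∈ _) (sym (labAt-yes p e)) h
  go false e = subst (_∈ _) (sym (labAt-no p e)) k

-- Insertion of an edge between two corners of one face

module Ins {g n} {A A' : Adj n} {x y : Fin n} (Q : QE g A) (E : Ext A A' x y)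
  (cx cy : Fin n) (ox : Obj A (x , cx)) (oy : Obj A (y , cy)) (same : QE.lab Q (x , cx) ≡ QE.lab Q (y , cy)) where
  open QE Q
  open Ext E
  private module IR = InsRot rot E cx cy ox oy
  open Follow IR.surg
  open Rot IR.R' using () renaming (nxt to nxt'; nxt-cl to nxt'-cl; nxt-sym to nxt'-sym; symA to symA'; irr to irr'; module N to N')
  open Surg IR.surg using (nx; na; nb)

  F : ℕ
  F = lab (x , cx)

  isab : Dart n → Bool
  isab d = does (d ≟ᵈ a) ∨ does (d ≟ᵈ b)

  lab₁ : Dart n → ℕ
  lab₁ = labAt isab F lab

  lab₁a : lab₁ a ≡ F
  lab₁a = labAt-yes isab (cong (_∨ does (a ≟ᵈ b)) (dec-true (a ≟ᵈ a) refl))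

  lab₁b : lab₁ b ≡ F
  lab₁b = labAt-yes isab (trans (cong₂ _∨_ (dec-false (b ≟ᵈ a) (λ e → x≢y (sym (cong proj₁ e)))) (dec-true (b ≟ᵈ b) refl)) refl)

  obj≢a : ∀ {d} → Obj A d → d ≢ a
  obj≢a (inj₁ h) refl = nxy h
  obj≢a (inj₂ (e , _)) refl = x≢y e

  obj≢b : ∀ {d} → Obj A d → d ≢ b
  obj≢b (inj₁ h) refl = nyx h
  obj≢b (inj₂ (e , _)) refl = x≢y (sym e)

  lab₁o : ∀ {d} → Obj A d → lab₁ d ≡ lab d
  lab₁o {d} o = labAt-no isab (cong₂ _∨_ (dec-false (d ≟ᵈ a) (obj≢a o)) (dec-false (d ≟ᵈ b) (obj≢b o)))

  data View (d : Dart n) : Set where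
    isa : d ≡ a → View d
    isb : d ≡ b → View d
    old : isD A d → View d

  view : ∀ {d} → isD A' d → View d
  view h with dn h
  ... | inj₁ q = old q
  ... | inj₂ (inj₁ (refl , refl)) = isa refl
  ... | inj₂ (inj₂ (refl , refl)) = isb refl

  lab₁inv : ∀ {d} → isD A' d → lab₁ (nxt' d) ≡ lab₁ d
  lab₁inv h with view h
  lab₁inv h | isa refl with na
  ... | inj₁ (_ , e) = trans (cong lab₁ e) (trans lab₁b (sym lab₁a))
  ... | inj₂ (o , e) = trans (cong lab₁ e) (trans (lab₁o (inj₁ o)) (trans (sym same) (sym lab₁a)))
  lab₁inv h | isb refl with nb
  ... | inj₁ (_ , e) = trans (cong lab₁ e) (trans lab₁a (sym lab₁b))
  ... | inj₂ (o , e) = trans (cong lab₁ e) (trans (lab₁o (inj₁ o)) (sym lab₁b))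
  lab₁inv h | old q with nx q
  ... | inj₁ (p , s) = trans (cong lab₁ p) (trans lab₁a (trans (cong lab (sym s)) (trans (labinv q) (sym (lab₁o (inj₁ q))))))
  ... | inj₂ (inj₁ (p , s)) = trans (cong lab₁ p) (trans lab₁b (trans same (trans (cong lab (sym s)) (trans (labinv q) (sym (lab₁o (inj₁ q)))))))
  ... | inj₂ (inj₂ e) = trans (cong lab₁ e) (trans (lab₁o (inj₁ (nxt-cl q))) (trans (labinv q) (sym (lab₁o (inj₁ q)))))

  iso-corner : ∀ {v c} → Obj A (v , c) → iso A v → c ≡ v
  iso-corner (inj₁ h) i = ⊥-elim (i _ h)
  iso-corner (inj₂ (e , _)) i = sym e

  isoUp : ∀ {v} → v ≢ x → v ≢ y → iso A v → iso A' v
  isoUp vx vy i w h with dn h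
  ... | inj₁ q = i w q
  ... | inj₂ (inj₁ (e , _)) = vx e
  ... | inj₂ (inj₂ (e , _)) = vy e

  objUp : ∀ {d} → Obj A d → ∃ λ w → Obj A' (proj₁ d , w) × lab₁ (proj₁ d , w) ≡ lab d
  objUp {u , w} (inj₁ h) = w , inj₁ (up h) , lab₁o (inj₁ h)
  objUp {v , _} (inj₂ (refl , i)) with v ≟ x | v ≟ y
  ... | yes refl | _ = y , inj₁ axy , trans lab₁a (cong (λ c → lab (x , c)) (iso-corner ox i))
  ... | no _ | yes refl = x , inj₁ ayx , trans lab₁b (trans same (cong (λ c → lab (y , c)) (iso-corner oy i)))
  ... | no p | no q = v , inj₂ (refl , isoUp p q i) , lab₁o (inj₂ (refl , i))

  isoDn : ∀ {v} → iso A' v → iso A v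
  isoDn i w h = i w (up h)

  iso≢x : ∀ {v} → iso A' v → v ≢ x
  iso≢x i refl = i _ axy

  rx : Dart n
  rx = proj₁ (cov ox)
  rx∈ : rx ∈ R
  rx∈ = proj₁ (proj₂ (cov ox))
  ox→ : Reach nxt (x , cx) rx
  ox→ = proj₂ (proj₂ (cov ox))

  iso≢rx : ∀ {v} → iso A' v → (v , v) ≢ rx
  iso≢rx i e = iso≢x i (sym (cong proj₁ (iso-reach (subst (λ t → Reach nxt t (x , cx)) (sym e) (objSym ox ox→)))))

  linkUp : ∀ {lab'} → (∀ {u ℓ v} → On A' lab₁ ℓ u → On A' lab₁ ℓ v → Star (Link A' lab') u v) →
    ∀ {u v} → Link A lab u v → Star (Link A' lab') u v
  linkUp f (inj₁ h) = inj₁ (up h) ◅ ε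
  linkUp f (inj₂ (ℓ , (w , o , e) , (w' , o' , e'))) =
    let z , p , q = objUp o ; z' , p' , q' = objUp o' in f (z , p , trans q e) (z' , p' , trans q' e')

  -- The edge joins two boundary walks of the face: two darts more, one walk fewer and the same
  -- faces, so both sides of `gen` keep their values.
  module Merged (sep : ¬ Reach nxt (x , cx) (y , cy)) where
    ry : Dart n
    ry = proj₁ (cov oy)
    ry∈ : ry ∈ R
    ry∈ = proj₁ (proj₂ (cov oy))
    oy→ : Reach nxt (y , cy) ry
    oy→ = proj₂ (proj₂ (cov oy))

    ry≢rx : ry ≢ rx
    ry≢rx e = sep (reach-trans ox→ (subst (λ t → Reach nxt t _) e (objSym oy oy→)))

    iso≢ry : ∀ {v} → iso A' v → (v , v) ≢ ry
    iso≢ry i e = i _ (subst (λ t → A' t x ≡ true) (cong proj₁ (iso-reach (subst (λ t → Reach nxt t (y , cy)) (sym e) (objSym oy oy→)))) ayx)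

    a→b : Reach nxt' a b
    a→b with na
    ... | inj₁ (_ , e) = stepEq e here
    ... | inj₂ (h , e) with orb h (inj₂ refl) here
    ... | inj₁ (_ , q) = ⊥-elim (sep (objSym (inj₁ h) q))
    ... | inj₂ (p , _) = stepEq e p

    hit→b : ∀ {d} → Hit d → Reach nxt' d b
    hit→b (inj₁ (p , _)) = reach-trans p a→b
    hit→b (inj₂ (p , _)) = p

    cov' : ∀ {cs} → (∀ {r} → r ∈ R → r ≢ rx → r ≢ ry → r ∈ cs) → ∀ {d} → Obj A' d →
      ∃ λ r → r ∈ b ∷ cs × Reach nxt' d r
    cov' keep (inj₁ h) with view h
    ... | isa refl = b , here refl , a→b
    ... | isb refl = b , here refl , here
    ... | old q with cov (inj₁ q)
    ... | r , r∈ , d→r with r ≟ᵈ rx | r ≟ᵈ ry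
    ... | yes refl | _ = b , here refl , hit→b (orb q (inj₁ refl) (reach-trans d→r (objSym ox ox→)))
    ... | no _ | yes refl = b , here refl , hit→b (orb q (inj₂ refl) (reach-trans d→r (objSym oy oy→)))
    ... | no p | no p' with follow q d→r
    ... | inj₁ t = r , there (keep r∈ p p') , t
    ... | inj₂ t = b , here refl , hit→b t
    cov' keep (inj₂ (refl , i)) with cov (inj₂ (refl , isoDn i))
    ... | r , r∈ , d→r with iso-reach d→r
    ... | refl = r , there (keep r∈ (iso≢rx i) (iso≢ry i)) , here

    result : QE g A'
    result with ∈-∃++ rx∈
    ... | as , bs , eq with ∈-∃++ (∈-remove as (subst (ry ∈_) eq ry∈) ry≢rx)
    ... | cs , ds , eq' = record
      { rot = IR.R' ; lab = lab₁ ; L = L ; L! = L! ; lab∈ = λ d → labAt-∈ isab (lab∈ _) (lab∈ d) ; labinv = lab₁inv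
      ; surj = λ ℓ∈ → let d , o , e = surj ℓ∈ ; w , o' , e' = objUp o in (proj₁ d , w) , o' , trans e' e
      ; R = b ∷ cs ++ ds
      ; cov = cov' (λ r∈ p q → ∈-remove cs (subst (_ ∈_) eq' (∈-remove as (subst (_ ∈_) eq r∈) p)) q)
      ; conn = λ u v → starBind (linkUp (λ p q → inj₂ (_ , p , q) ◅ ε)) (conn u v)
      ; gen = subst (_≤ 4 * g + 2 * n + 4 * length L) size gen }
      where
      size : 4 + #d A + 2 * length R ≡ 4 + #d A' + 2 * length (b ∷ cs ++ ds)
      size rewrite #d-ext E | eq | length-remove as {rx} {bs} | eq' | length-remove cs {ry} {ds} = arith (#d A) (length (cs ++ ds))
        where
        arith : ∀ D k → 4 + D + 2 * (2 + k) ≡ 4 + (2 + D) + 2 * (1 + k)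
        arith = solve-∀

  -- The edge cuts one boundary walk in two and the face with it; the walk of `b` receives a new
  -- label, and all other walks of the face stay with `a`. With two darts, one walk and one face
  -- more, both sides of `gen` grow by 4.
  module Split (tog : Reach nxt (x , cx) (y , cy)) where
    oxD : isD A (x , cx)
    oxD = go ox tog
      where
      go : ∀ {c} → Obj A (x , c) → Reach nxt (x , c) (y , cy) → isD A (x , c)
      go (inj₁ h) _ = h
      go (inj₂ (refl , i)) r = ⊥-elim (x≢y (sym (cong proj₁ (iso-reach r))))

    nb' : nxt' b ≡ (x , cx)
    nb' with nb
    ... | inj₁ (i , _) = ⊥-elim (i _ oxD)
    ... | inj₂ (_ , e) = e

    -- The old walk from `d` comes back to (x , cx) before it meets (y , cy).
    data Clean (d : Dart n) : Set where
      done : nxt d ≡ (x , cx) → Clean d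
      more : nxt d ≢ (y , cy) → Clean (nxt d) → Clean d

    build : ∀ k {d} → isD A d → iter nxt' k d ≡ a → Clean (x , cx) ⊎ Clean d
    build zero h refl = ⊥-elim (nxy h)
    build (suc k) {d} h e with nx h
    ... | inj₁ (_ , q) = inj₂ (done q)
    build (suc zero) {d} h e | inj₂ (inj₁ (p , _)) = ⊥-elim (x≢y (cong proj₁ (trans (sym e) p)))
    -- Two steps of `nxt'` are used up here, to `b` and on to (x , cx), where the argument restarts.
    build (suc (suc k)) {d} h e | inj₂ (inj₁ (p , _)) with build k oxD
      (trans (cong (iter nxt' k) (sym (trans (cong nxt' p) nb'))) (trans (iter-shift nxt' k (nxt' d)) (trans (iter-shift nxt' (suc k) d) e)))
    ... | inj₁ c = inj₁ c
    ... | inj₂ c = inj₁ c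
    build (suc k) {d} h e | inj₂ (inj₂ q) with build k (nxt-cl h)
      (trans (cong (iter nxt' k) (sym q)) (trans (iter-shift nxt' k d) e))
    ... | inj₁ c = inj₁ c
    ... | inj₂ c = inj₂ (more (nx≢y h q) c)

    -- If the new walk of `b` passed through `a`, the old walk of (x , cx) would close up without
    -- meeting (y , cy), contrary to `tog`.
    apart : ¬ Reach nxt' b a
    apart here = x≢y refl
    apart (step r) = case c of λ { (inj₁ c) → no-clean c ; (inj₂ c) → no-clean c }
      where
      r' : Reach nxt' (x , cx) a
      r' = subst (λ t → Reach nxt' t a) nb' r
      c : Clean (x , cx) ⊎ Clean (x , cx)
      c = build (proj₁ (reach⇒iter r')) oxD (proj₂ (reach⇒iter r'))
      no-clean : ¬ Clean (x , cx)
      no-clean c₀ = proj₂ (reach-inv (λ e → Clean e × e ≢ (y , cy)) cl tog (c₀ , λ e → x≢y (cong proj₁ e))) refl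
        where
        cl : ∀ {e} → Clean e × e ≢ (y , cy) → Clean (nxt e) × nxt e ≢ (y , cy)
        cl (done q , _) = subst Clean (sym q) c₀ , λ e → x≢y (cong proj₁ (trans (sym q) e))
        cl (more ne c , _) = c , ne

    b? : Dart n → Bool
    b? d = does (reach? finDart _≟ᵈ_ nxt' b d)

    new : ℕ
    new = fresh L

    lab' : Dart n → ℕ
    lab' = labAt b? new lab₁

    labM : ∀ {d} → Reach nxt' b d → lab' d ≡ new
    labM {d} r = labAt-yes b? (dec-true (reach? finDart _≟ᵈ_ nxt' b d) r)

    labN : ∀ {d} → ¬ Reach nxt' b d → lab' d ≡ lab₁ d
    labN {d} r = labAt-no b? (dec-false (reach? finDart _≟ᵈ_ nxt' b d) r)

    MF : ∀ {d} → Reach nxt' b d → lab₁ d ≡ F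
    MF r = proj₂ (reach-inv (λ e → isD A' e × lab₁ e ≡ F) (λ { (p , q) → nxt'-cl p , trans (lab₁inv p) q }) r (ayx , lab₁b))

    labinv' : ∀ {d} → isD A' d → lab' (nxt' d) ≡ lab' d
    labinv' {d} h with reach? finDart _≟ᵈ_ nxt' b d
    ... | yes r = trans (labM (reach-snoc r)) (sym (labM r))
    ... | no r = trans (labN (λ s → r (reach-trans s (N'.return h)))) (trans (lab₁inv h) (sym (labN r)))

    lift : ∀ {u ℓ} → On A' lab₁ ℓ u → On A' lab' ℓ u ⊎ (On A' lab' new u × ℓ ≡ F)
    lift {u} (w , o , e) with reach? finDart _≟ᵈ_ nxt' b (u , w)
    ... | yes r = inj₂ ((w , o , labM r) , trans (sym e) (MF r))
    ... | no r = inj₁ (w , o , trans (labN r) e)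

    xF : On A' lab' F x
    xF = y , inj₁ axy , trans (labN apart) lab₁a

    xnew : On A' lab' new x
    xnew = cx , inj₁ (up oxD) , labM (stepEq nb' here)

    -- Two vertices of the old face may end up on different parts of it. Both parts contain `x`,
    -- which links them.
    share : ∀ {u ℓ v} → On A' lab₁ ℓ u → On A' lab₁ ℓ v → Star (Link A' lab') u v
    share p q with lift p | lift q
    ... | inj₁ s | inj₁ t = inj₂ (_ , s , t) ◅ ε
    ... | inj₂ (s , _) | inj₂ (t , _) = inj₂ (_ , s , t) ◅ ε
    ... | inj₂ (s , refl) | inj₁ t = inj₂ (_ , s , xnew) ◅ inj₂ (_ , xF , t) ◅ ε
    ... | inj₁ s | inj₂ (t , refl) = inj₂ (_ , s , xF) ◅ inj₂ (_ , xnew , t) ◅ ε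

    surj' : ∀ {ℓ} → ℓ ∈ new ∷ L → ∃ λ d → Obj A' d × lab' d ≡ ℓ
    surj' (here refl) = b , inj₁ ayx , labM here
    surj' (there ℓ∈) with surj ℓ∈
    ... | d , o , e with objUp o
    ... | w , o' , e' with lift (w , o' , trans e' e)
    ... | inj₁ (w' , o″ , q) = (proj₁ d , w') , o″ , q
    ... | inj₂ (_ , refl) = a , inj₁ axy , trans (labN apart) lab₁a

    cov' : ∀ {cs} → (∀ {r} → r ∈ R → r ≢ rx → r ∈ cs) → ∀ {d} → Obj A' d → ∃ λ r → r ∈ a ∷ b ∷ cs × Reach nxt' d r
    cov' {cs} keep = go
      where
      hit : ∀ {d} → Hit d → ∃ λ r → r ∈ a ∷ b ∷ cs × Reach nxt' d r
      hit (inj₁ (p , _)) = a , here refl , p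
      hit (inj₂ (p , _)) = b , there (here refl) , p
      go : ∀ {d} → Obj A' d → ∃ λ r → r ∈ a ∷ b ∷ cs × Reach nxt' d r
      go (inj₁ h) with view h
      ... | isa refl = a , here refl , here
      ... | isb refl = b , there (here refl) , here
      ... | old q with cov (inj₁ q)
      ... | r , r∈ , d→r with r ≟ᵈ rx
      ... | yes refl = hit (orb q (inj₁ refl) (reach-trans d→r (objSym ox ox→)))
      ... | no p with follow q d→r
      ... | inj₁ t = r , there (there (keep r∈ p)) , t
      ... | inj₂ t = hit t
      go (inj₂ (refl , i)) with cov (inj₂ (refl , isoDn i))
      ... | r , r∈ , d→r with iso-reach d→r
      ... | refl = r , there (there (keep r∈ (iso≢rx i))) , here

    result : QE g A'
    result with ∈-∃++ rx∈
    ... | as , bs , eq = record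
      { rot = IR.R' ; lab = lab' ; L = new ∷ L
      ; L! = All-tabulate (λ { m refl → <-irrefl refl (fresh> m) }) ∷ L!
      ; lab∈ = λ d → labAt-∈ b? (here refl) (there (labAt-∈ isab (lab∈ _) (lab∈ d))) ; labinv = labinv'
      ; surj = surj'
      ; R = a ∷ b ∷ as ++ bs
      ; cov = cov' (λ r∈ p → ∈-remove as (subst (_ ∈_) eq r∈) p)
      ; conn = λ u v → starBind (linkUp share) (conn u v)
      ; gen = subst₂ _≤_ size (arith₂ (4 * g + 2 * n) (length L)) (+-monoʳ-≤ 4 gen) }
      where
      arith₂ : ∀ c l → 4 + (c + 4 * l) ≡ c + 4 * (1 + l)
      arith₂ = solve-∀
      size : 4 + (4 + #d A + 2 * length R) ≡ 4 + #d A' + 2 * length (a ∷ b ∷ as ++ bs)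
      size rewrite #d-ext E | eq | length-remove as {rx} {bs} = arith (#d A) (length (as ++ bs))
        where
        arith : ∀ D k → 4 + (4 + D + 2 * (1 + k)) ≡ 4 + (2 + D) + 2 * (2 + k)
        arith = solve-∀

  result : QE g A'
  result with reach? finDart _≟ᵈ_ nxt (x , cx) (y , cy)
  ... | yes t = Split.result t
  ... | no s = Merged.result s

-- Deletion of an edge

module Del {g n} {A A' : Adj n} {x y : Fin n} (Q : QE g A') (E : Ext A A' x y) where
  open QE Q using (lab; L; L!; lab∈; surj; R; cov; conn; gen) renaming (rot to rot'; labinv to labinv';
    nxt to nxt'; nxt-sym to nxt'-sym; iso-reach to iso-reach'; objSym to objSym'; module N to N'; nxt-D to nxt'-D; irr to irr'; lab-reach to lab-reach')
  open Ext E
  private module DR = DelRot rot' E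
  open Follow DR.surg
  open Rot DR.R using (nxt; nxt-cl; nxt-sym; nxt-D; irr; iso-reach)
  open Surg DR.surg using (nx; na; nb; cx; cy; ox; oy)

  la lb : ℕ
  la = lab a
  lb = lab b

  abstract
    merge : ℕ → ℕ
    merge ℓ = if does (ℓ ≟ⁿ lb) then la else ℓ

    merge-hit : ∀ {ℓ} → ℓ ≡ lb → merge ℓ ≡ la
    merge-hit {ℓ} e rewrite dec-true (ℓ ≟ⁿ lb) e = refl

    merge-miss : ∀ {ℓ} → ℓ ≢ lb → merge ℓ ≡ ℓ
    merge-miss {ℓ} e rewrite dec-false (ℓ ≟ⁿ lb) e = refl

  merge-la : ∀ {ℓ} → ℓ ≡ la → merge ℓ ≡ la
  merge-la {ℓ} e with ℓ ≟ⁿ lb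
  ... | yes p = merge-hit p
  ... | no p = trans (merge-miss p) e

  isxy : Dart n → Bool
  isxy d = does (d ≟ᵈ (x , x)) ∨ does (d ≟ᵈ (y , y))

  -- An end of the deleted edge may become isolated; its trivial walk then lies in the face in which
  -- the edge was drawn.
  labD : Dart n → ℕ
  labD = labAt isxy la (merge ∘ lab)

  labx : labD (x , x) ≡ la
  labx = labAt-yes isxy (cong (_∨ does ((x , x) ≟ᵈ (y , y))) (dec-true ((x , x) ≟ᵈ (x , x)) refl))

  laby : labD (y , y) ≡ la
  laby = labAt-yes isxy (trans (cong (does ((y , y) ≟ᵈ (x , x)) ∨_) (dec-true ((y , y) ≟ᵈ (y , y)) refl)) (∨-zeroʳ _))

  labo : ∀ {d} → d ≢ (x , x) → d ≢ (y , y) → labD d ≡ merge (lab d)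
  labo {d} p q = labAt-no isxy (cong₂ _∨_ (dec-false (d ≟ᵈ (x , x)) p) (dec-false (d ≟ᵈ (y , y)) q))

  labd : ∀ {d} → isD A d → labD d ≡ merge (lab d)
  labd h = labo (λ { refl → irr h }) (λ { refl → irr h })

  labox : labD (x , cx) ≡ la
  labox = go ox nb
    where
    go : ∀ {c} → Obj A (x , c) → (iso A x × nxt' b ≡ a) ⊎ (isD A (x , c) × nxt' b ≡ (x , c)) → labD (x , c) ≡ la
    go (inj₂ (refl , i)) _ = labx
    go (inj₁ h) (inj₁ (i , _)) = ⊥-elim (i _ h)
    go (inj₁ h) (inj₂ (_ , e)) = trans (labd h) (merge-hit (trans (cong lab (sym e)) (labinv' ayx)))

  laboy : labD (y , cy) ≡ la
  laboy = go oy na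
    where
    go : ∀ {c} → Obj A (y , c) → (iso A y × nxt' a ≡ b) ⊎ (isD A (y , c) × nxt' a ≡ (y , c)) → labD (y , c) ≡ la
    go (inj₂ (refl , i)) _ = laby
    go (inj₁ h) (inj₁ (i , _)) = ⊥-elim (i _ h)
    go (inj₁ h) (inj₂ (_ , e)) = trans (labd h) (merge-la (trans (cong lab (sym e)) (labinv' axy)))

  labinv : ∀ {d} → isD A d → labD (nxt d) ≡ labD d
  labinv {d} h with nx h
  ... | inj₁ (p , q) = trans (cong labD q) (trans labox (sym (trans (labd h) (merge-la (trans (sym (labinv' (up h))) (cong lab p))))))
  ... | inj₂ (inj₁ (p , q)) = trans (cong labD q) (trans laboy (sym (trans (labd h) (merge-hit (trans (sym (labinv' (up h))) (cong lab p))))))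
  ... | inj₂ (inj₂ e) = trans (labd (nxt-cl h)) (trans (cong merge (trans (cong lab (sym e)) (labinv' (up h)))) (sym (labd h)))

  data View' (d : Dart n) : Set where
    isa : d ≡ a → View' d
    isb : d ≡ b → View' d
    old : isD A d → View' d

  view' : ∀ {d} → isD A' d → View' d
  view' h with dn h
  ... | inj₁ q = old q
  ... | inj₂ (inj₁ (refl , refl)) = isa refl
  ... | inj₂ (inj₂ (refl , refl)) = isb refl

  isoDn : ∀ {v} → iso A' v → iso A v
  isoDn i w h = i w (up h)

  isoUp : ∀ {v} → v ≢ x → v ≢ y → iso A v → iso A' v
  isoUp vx vy i w h with dn h
  ... | inj₁ q = i w q
  ... | inj₂ (inj₁ (e , _)) = vx e
  ... | inj₂ (inj₂ (e , _)) = vy e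

  objDown : ∀ {d} → Obj A' d → ∃ λ w → Obj A (proj₁ d , w) × labD (proj₁ d , w) ≡ merge (lab d)
  objDown (inj₁ h) with view' h
  ... | isa refl = cx , ox , trans labox (sym (merge-la refl))
  ... | isb refl = cy , oy , trans laboy (sym (merge-hit refl))
  ... | old q = _ , inj₁ q , labd q
  objDown {v , _} (inj₂ (refl , i)) = v , inj₂ (refl , isoDn i) ,
    labo (λ e → i y (subst (λ t → A' t y ≡ true) (sym (cong proj₁ e)) axy)) (λ e → i x (subst (λ t → A' t x ≡ true) (sym (cong proj₁ e)) ayx))

  link : ∀ {u v} → Link A' lab u v → Link A labD u v
  link (inj₁ h) with dn h
  ... | inj₁ q = inj₁ q
  ... | inj₂ (inj₁ (refl , refl)) = inj₂ (la , (cx , ox , labox) , (cy , oy , laboy))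
  ... | inj₂ (inj₂ (refl , refl)) = inj₂ (la , (cy , oy , laboy) , (cx , ox , labox))
  link (inj₂ (ℓ , (w , o , e) , (w' , o' , e'))) = let z , p , q = objDown o ; z' , p' , q' = objDown o' in
    inj₂ (merge ℓ , (z , p , trans q (cong merge e)) , (z' , p' , trans q' (cong merge e')))

  conn' : ∀ u v → Star (Link A labD) u v
  conn' u v = starBind (λ l → link l ◅ ε) (conn u v)

  surj' : ∀ {ℓ} → ℓ ∈ L → ∃ λ d → Obj A d × labD d ≡ merge ℓ
  surj' ℓ∈ with surj ℓ∈
  ... | d , o , refl with objDown o
  ... | w , p , q = (proj₁ d , w) , p , q

  ra : Dart n
  ra = proj₁ (cov (inj₁ axy))
  ra∈ : ra ∈ R
  ra∈ = proj₁ (proj₂ (cov (inj₁ axy)))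
  a→ : Reach nxt' a ra
  a→ = proj₂ (proj₂ (cov (inj₁ axy)))

  D≢iso : ∀ {d v} → isD A' d → (v , v) ≢ d
  D≢iso h refl = irr' h

  isoObj : ∀ {v} → iso A v → (v , v) ≡ (x , cx) ⊎ (v , v) ≡ (y , cy) ⊎ iso A' v
  isoObj {v} i with v ≟ x | v ≟ y
  ... | yes refl | _ = inj₁ (cong (x ,_) (sym (c≡ ox)))
    where
    c≡ : ∀ {c} → Obj A (x , c) → c ≡ x
    c≡ (inj₁ h) = ⊥-elim (i _ h)
    c≡ (inj₂ (e , _)) = sym e
  ... | no _ | yes refl = inj₂ (inj₁ (cong (y ,_) (sym (c≡ oy))))
    where
    c≡ : ∀ {c} → Obj A (y , c) → c ≡ y
    c≡ (inj₁ h) = ⊥-elim (i _ h)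
    c≡ (inj₂ (e , _)) = sym e
  ... | no p | no q = inj₂ (inj₂ (isoUp p q i))

  -- The two sides of the edge may lie on one walk, which splits, or on two walks of the face, which
  -- merge. No distinction is made: `R` only has to meet every walk, so both corners may be listed,
  -- and with two darts fewer and one representative more `gen` stays balanced.
  module Equal (eq : la ≡ lb) where
    merge-id : ∀ ℓ → merge ℓ ≡ ℓ
    merge-id ℓ with ℓ ≟ⁿ lb
    ... | yes p = trans (merge-hit p) (trans eq (sym p))
    ... | no p = merge-miss p

    cov' : ∀ {cs} → (∀ {r} → r ∈ R → r ≢ ra → r ∈ cs) → ∀ {d} → Obj A d → ∃ λ r → r ∈ (x , cx) ∷ (y , cy) ∷ cs × Reach nxt d r
    cov' {cs} keep = go
      where
      hit : ∀ {d} → (Reach nxt d (x , cx) × Reach nxt' d a) ⊎ (Reach nxt d (y , cy) × Reach nxt' d b) →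
        ∃ λ r → r ∈ (x , cx) ∷ (y , cy) ∷ cs × Reach nxt d r
      hit (inj₁ (p , _)) = _ , here refl , p
      hit (inj₂ (p , _)) = _ , there (here refl) , p
      go : ∀ {d} → Obj A d → ∃ λ r → r ∈ (x , cx) ∷ (y , cy) ∷ cs × Reach nxt d r
      go (inj₁ h) with cov (inj₁ (up h))
      ... | r , r∈ , d→r with r ≟ᵈ ra
      go (inj₁ h) | r , r∈ , d→r | yes refl with follow' h (reach-trans d→r (nxt'-sym axy a→))
      ... | inj₁ t = ⊥-elim (nxy (nxt-D t h))
      ... | inj₂ t = hit t
      go (inj₁ h) | r , r∈ , d→r | no p with follow' h d→r
      ... | inj₁ t = r , there (there (keep r∈ p)) , t
      ... | inj₂ t = hit t
      go {v , _} (inj₂ (refl , i)) with isoObj i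
      ... | inj₁ e = _ , here refl , subst (Reach nxt _) e here
      ... | inj₂ (inj₁ e) = _ , there (here refl) , subst (Reach nxt _) e here
      ... | inj₂ (inj₂ i') with cov (inj₂ (refl , i'))
      ... | r , r∈ , d→r with iso-reach' d→r
      ... | refl = r , there (there (keep r∈ (D≢iso (nxt'-D a→ axy)))) , here

    result : QE g A
    result with ∈-∃++ ra∈
    ... | as , bs , eqR = record
      { rot = DR.R ; lab = labD ; L = L ; L! = L!
      ; lab∈ = λ d → labAt-∈ isxy (lab∈ _) (subst (_∈ L) (sym (merge-id _)) (lab∈ d)) ; labinv = labinv
      ; surj = λ ℓ∈ → let d , o , e = surj' ℓ∈ in d , o , trans e (merge-id _)
      ; R = (x , cx) ∷ (y , cy) ∷ as ++ bs
      ; cov = cov' (λ r∈ p → ∈-remove as (subst (_ ∈_) eqR r∈) p)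
      ; conn = conn' ; gen = subst (_≤ 4 * g + 2 * n + 4 * length L) size gen }
      where
      size : 4 + #d A' + 2 * length R ≡ 4 + #d A + 2 * length ((x , cx) ∷ (y , cy) ∷ as ++ bs)
      size rewrite #d-ext E | eqR | length-remove as {ra} {bs} = arith (#d A) (length (as ++ bs))
        where
        arith : ∀ D k → 4 + (2 + D) + 2 * (1 + k) ≡ 4 + D + 2 * (2 + k)
        arith = solve-∀

  -- Two faces become one and so do the walks on the two sides of the edge. Both sides of `gen` drop
  -- by 4.
  module Differ (ne : la ≢ lb) where
    rb : Dart n
    rb = proj₁ (cov (inj₁ ayx))
    rb∈ : rb ∈ R
    rb∈ = proj₁ (proj₂ (cov (inj₁ ayx)))
    b→ : Reach nxt' b rb
    b→ = proj₂ (proj₂ (cov (inj₁ ayx)))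

    rb≢ra : rb ≢ ra
    rb≢ra e = ne (trans (sym (lab-reach' axy a→)) (trans (cong lab (sym e)) (lab-reach' ayx b→)))

    oxD : isD A (x , cx) × nxt' b ≡ (x , cx)
    oxD with nb
    ... | inj₁ (_ , e) = ⊥-elim (ne (trans (cong lab (sym e)) (labinv' ayx)))
    ... | inj₂ q = q

    oyD : isD A (y , cy)
    oyD with na
    ... | inj₁ (_ , e) = ⊥-elim (ne (sym (trans (cong lab (sym e)) (labinv' axy))))
    ... | inj₂ (q , _) = q

    ox→oy : Reach nxt (x , cx) (y , cy)
    ox→oy with follow' (proj₁ oxD) (subst (λ t → Reach nxt' t b) (proj₂ oxD) (N'.return ayx))
    ... | inj₁ t = ⊥-elim (nyx (nxt-D t (proj₁ oxD)))
    ... | inj₂ (inj₁ (_ , t)) = ⊥-elim (ne (trans (lab-reach' (up (proj₁ oxD)) t) (trans (cong lab (sym (proj₂ oxD))) (labinv' ayx))))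
    ... | inj₂ (inj₂ (t , _)) = t

    cov' : ∀ {cs} → (∀ {r} → r ∈ R → r ≢ ra → r ≢ rb → r ∈ cs) → ∀ {d} → Obj A d → ∃ λ r → r ∈ (y , cy) ∷ cs × Reach nxt d r
    cov' {cs} keep = go
      where
      hit : ∀ {d} → (Reach nxt d (x , cx) × Reach nxt' d a) ⊎ (Reach nxt d (y , cy) × Reach nxt' d b) →
        ∃ λ r → r ∈ (y , cy) ∷ cs × Reach nxt d r
      hit (inj₁ (p , _)) = _ , here refl , reach-trans p ox→oy
      hit (inj₂ (p , _)) = _ , here refl , p
      hita : ∀ {d} → isD A d → Reach nxt' d a → ∃ λ r → r ∈ (y , cy) ∷ cs × Reach nxt d r
      hita h t with follow' h t
      ... | inj₁ s = ⊥-elim (nxy (nxt-D s h))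
      ... | inj₂ s = hit s
      hitb : ∀ {d} → isD A d → Reach nxt' d b → ∃ λ r → r ∈ (y , cy) ∷ cs × Reach nxt d r
      hitb h t with follow' h t
      ... | inj₁ s = ⊥-elim (nyx (nxt-D s h))
      ... | inj₂ s = hit s
      go : ∀ {d} → Obj A d → ∃ λ r → r ∈ (y , cy) ∷ cs × Reach nxt d r
      go (inj₁ h) with cov (inj₁ (up h))
      ... | r , r∈ , d→r with r ≟ᵈ ra | r ≟ᵈ rb
      ... | yes refl | _ = hita h (reach-trans d→r (nxt'-sym axy a→))
      ... | no _ | yes refl = hitb h (reach-trans d→r (nxt'-sym ayx b→))
      ... | no p | no p' with follow' h d→r
      ... | inj₁ t = r , there (keep r∈ p p') , t
      ... | inj₂ t = hit t
      go {v , _} (inj₂ (refl , i)) with isoObj i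
      ... | inj₁ e = ⊥-elim (i _ (subst (λ t → A t cx ≡ true) (sym (cong proj₁ e)) (proj₁ oxD)))
      ... | inj₂ (inj₁ e) = ⊥-elim (i _ (subst (λ t → A t cy ≡ true) (sym (cong proj₁ e)) oyD))
      ... | inj₂ (inj₂ i') with cov (inj₂ (refl , i'))
      ... | r , r∈ , d→r with iso-reach' d→r
      ... | refl = r , there (keep r∈ (D≢iso (nxt'-D a→ axy)) (D≢iso (nxt'-D b→ ayx))) , here

    result : QE g A
    result with ∈-∃++ ra∈ | ∈-∃++ (lab∈ b)
    ... | as , bs , eqR | ls , ms , eqL with ∈-∃++ (∈-remove as (subst (rb ∈_) eqR rb∈) rb≢ra)
    ... | cs , ds , eqR' = record
      { rot = DR.R ; lab = labD ; L = ls ++ ms ; L! = proj₂ uniq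
      ; lab∈ = λ d → labAt-∈ isxy la∈ (merge∈ d) ; labinv = labinv
      ; surj = λ ℓ∈ → let d , o , e = surj' (subst (_ ∈_) (sym eqL) (inL ℓ∈)) in d , o , trans e (merge-miss (λ { refl → proj₁ uniq ℓ∈ }))
      ; R = (y , cy) ∷ cs ++ ds
      ; cov = cov' (λ r∈ p q → ∈-remove cs (subst (_ ∈_) eqR' (∈-remove as (subst (_ ∈_) eqR r∈) p)) q)
      ; conn = conn' ; gen = +-cancelˡ-≤ 4 _ _ (subst₂ _≤_ size sizeL gen) }
      where
      inL : ∀ {ℓ} → ℓ ∈ ls ++ ms → ℓ ∈ ls ++ lb ∷ ms
      inL m with ∈-++⁻ ls m
      ... | inj₁ p = ∈-++⁺ˡ p
      ... | inj₂ p = ∈-++⁺ʳ ls (there p)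
      split! : ∀ {ls : List ℕ} {z ms} → Unique (ls ++ z ∷ ms) → z ∉ (ls ++ ms) × Unique (ls ++ ms)
      split! {[]} (h ∷ u) = (λ m → All-lookup h m refl) , u
      split! {l ∷ ls} {z} {ms} (h ∷ u) with split! {ls} u
      ... | p , q = (λ { (here refl) → All-lookup h (∈-++⁺ʳ ls (here refl)) refl ; (there m) → p m }) ,
        All-tabulate (λ m → All-lookup h (grow m)) ∷ q
        where
        grow : ∀ {t} → t ∈ ls ++ ms → t ∈ ls ++ z ∷ ms
        grow m with ∈-++⁻ ls m
        ... | inj₁ p = ∈-++⁺ˡ p
        ... | inj₂ p = ∈-++⁺ʳ ls (there p)
      uniq : lb ∉ (ls ++ ms) × Unique (ls ++ ms)
      uniq = split! (subst Unique eqL L!)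
      la∈ : la ∈ ls ++ ms
      la∈ = ∈-remove ls (subst (la ∈_) eqL (lab∈ a)) ne
      merge∈ : ∀ d → merge (lab d) ∈ ls ++ ms
      merge∈ d with lab d ≟ⁿ lb
      ... | yes p = subst (_∈ _) (sym (merge-hit p)) la∈
      ... | no p = subst (_∈ _) (sym (merge-miss p)) (∈-remove ls (subst (lab d ∈_) eqL (lab∈ d)) p)
      size : 4 + #d A' + 2 * length R ≡ 4 + (4 + #d A + 2 * length ((y , cy) ∷ cs ++ ds))
      size rewrite #d-ext E | eqR | length-remove as {ra} {bs} | eqR' | length-remove cs {rb} {ds} = arith (#d A) (length (cs ++ ds))
        where
        arith : ∀ D k → 4 + (2 + D) + 2 * (2 + k) ≡ 4 + (4 + D + 2 * (1 + k))
        arith = solve-∀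
      sizeL : 4 * g + 2 * n + 4 * length L ≡ 4 + (4 * g + 2 * n + 4 * length (ls ++ ms))
      sizeL rewrite eqL | length-remove ls {lb} {ms} = arith (4 * g + 2 * n) (length (ls ++ ms))
        where
        arith : ∀ c l → c + 4 * (1 + l) ≡ 4 + (c + 4 * l)
        arith = solve-∀

  result : QE g A
  result with la ≟ⁿ lb
  ... | yes e = Equal.result e
  ... | no e = Differ.result e

-- Isolated vertices change their face and become leaves

module _ {n} {A : Adj n} {lab : Dart n → ℕ} where
  iso-shares : ∀ {v} → iso A v → ∀ {u} → Star (Link A lab) v u → u ≢ v → ∃ λ w → w ≢ v × On A lab (lab (v , v)) w
  iso-shares i ε ne = ⊥-elim (ne refl)
  iso-shares i (inj₁ h ◅ r) ne = ⊥-elim (i _ h)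
  iso-shares i (inj₂ (ℓ , (w , inj₁ h , _) , _) ◅ r) ne = ⊥-elim (i _ h)
  iso-shares {v} i (_◅_ {j = j} (inj₂ (ℓ , (w , inj₂ (refl , _) , refl) , o)) r) ne with j ≟ v
  ... | yes refl = iso-shares i r ne
  ... | no p = j , p , o

-- Only the label of (v , v) changes. By connectedness the old face of `v` contains another vertex
-- `z`, so no face is lost, and links through `v` are rerouted by putting `z` in its place.
module MoveIso {g n} {A : Adj n} (Q : QE g A) {v : Fin n} (i : iso A v)
  {o : Dart n} (oO : Obj A o) (o≢ : proj₁ o ≢ v) where
  open QE Q
  private
    q : Fin n
    q = proj₁ o

  isv : Dart n → Bool
  isv d = does (d ≟ᵈ (v , v))

  lab' : Dart n → ℕ
  lab' = labAt isv (lab o) lab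

  lab'v : lab' (v , v) ≡ lab o
  lab'v = labAt-yes isv (dec-true ((v , v) ≟ᵈ (v , v)) refl)

  lab'o : ∀ {d} → proj₁ d ≢ v → lab' d ≡ lab d
  lab'o {d} ne = labAt-no isv (dec-false (d ≟ᵈ (v , v)) (λ e → ne (cong proj₁ e)))

  other : ∃ λ w → w ≢ v × On A lab (lab (v , v)) w
  other = iso-shares i (conn v q) o≢

  z : Fin n
  z = proj₁ other

  keep : ∀ {u ℓ} → u ≢ v → On A lab ℓ u → On A lab' ℓ u
  keep ne (w , o , e) = w , o , trans (lab'o ne) e

  atv : ∀ {ℓ} → On A lab ℓ v → ℓ ≡ lab (v , v)
  atv (w , inj₁ h , e) = ⊥-elim (i w h)
  atv (w , inj₂ (refl , _) , e) = sym e

  D≢v : ∀ {d} → isD A d → proj₁ d ≢ v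
  D≢v h refl = i _ h

  rep : Fin n → Fin n
  rep u = if does (u ≟ v) then z else u

  rep-o : ∀ {u} → u ≢ v → rep u ≡ u
  rep-o {u} ne rewrite dec-false (u ≟ v) ne = refl

  zOn : On A lab' (lab (v , v)) z
  zOn = keep (proj₁ (proj₂ other)) (proj₂ (proj₂ other))

  onRep : ∀ {u ℓ} → On A lab ℓ u → On A lab' ℓ (rep u)
  onRep {u} p with u ≟ v
  ... | yes refl = subst (λ ℓ → On A lab' ℓ z) (sym (atv p)) zOn
  ... | no ne = keep ne p

  link : ∀ {u w} → Link A lab u w → Link A lab' (rep u) (rep w)
  link {u} {w} (inj₁ h) = inj₁ (subst₂ (λ s t → A s t ≡ true) (sym (rep-o (D≢v h))) (sym (rep-o (D≢v (symA h)))) h)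
  link (inj₂ (ℓ , p , p')) = inj₂ (ℓ , onRep p , onRep p')

  links : ∀ {u w} → Star (Link A lab) u w → Star (Link A lab') (rep u) (rep w)
  links ε = ε
  links (s ◅ r) = link s ◅ links r

  vOn : On A lab' (lab o) v
  vOn = v , inj₂ (refl , i) , lab'v

  qOn : On A lab' (lab o) q
  qOn = proj₂ o , oO , lab'o o≢

  conn' : ∀ u w → Star (Link A lab') u w
  conn' u w with u ≟ v | w ≟ v
  ... | yes refl | yes refl = ε
  ... | yes refl | no ne = inj₂ (_ , vOn , qOn) ◅ subst₂ (Star _) (rep-o o≢) (rep-o ne) (links (conn q w))
  ... | no ne | yes refl = subst₂ (Star _) (rep-o ne) (rep-o o≢) (links (conn u q)) ◅◅ (inj₂ (_ , qOn , vOn) ◅ ε)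
  ... | no ne | no ne' = subst₂ (Star _) (rep-o ne) (rep-o ne') (links (conn u w))

  surj' : ∀ {ℓ} → ℓ ∈ L → ∃ λ d → Obj A d × lab' d ≡ ℓ
  surj' ℓ∈ with surj ℓ∈
  ... | d , od , e with onRep (proj₂ d , od , e)
  ... | w , o' , e' = (rep (proj₁ d) , w) , o' , e'

  result : QE g A
  result = record { rot = rot ; lab = lab' ; L = L ; L! = L! ; lab∈ = λ d → labAt-∈ isv (lab∈ o) (lab∈ d)
    ; labinv = λ h → trans (lab'o (D≢v (nxt-cl h))) (trans (labinv h) (sym (lab'o (D≢v h))))
    ; surj = surj' ; R = R ; cov = cov ; conn = conn' ; gen = gen }

obj-at : ∀ {n} (A : Adj n) v → ∃ λ w → Obj A (v , w)
obj-at A v with any? (λ w → A v w ≟ᵇ true)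
... | yes (w , h) = w , inj₁ h
... | no ne = v , inj₂ (refl , λ w h → ne (w , h))

-- The isolated vertex is first moved into a face at `x`, so that the new edge joins two objects of
-- one face.
attach : ∀ {g n} {A A' : Adj n} {v x} → QE g A → iso A v → Ext A A' v x → QE g A'
attach {A = A} {v = v} {x} Q i E with obj-at A x
... | w , o = Ins.result (MoveIso.result Q i o ne) E v w (inj₂ (refl , i)) o
    (trans (MoveIso.lab'v Q i o ne) (sym (MoveIso.lab'o Q i o ne ne)))
  where
  ne : x ≢ v
  ne e = Ext.x≢y E (sym e)

-- Graphs defined by decidable relations

does⁻ : ∀ {P : Set} (p? : Dec P) → does p? ≡ true → P
does⁻ (yes p) _ = p

bool-ext : ∀ {b c} → (b ≡ true → c ≡ true) → (c ≡ true → b ≡ true) → b ≡ c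
bool-ext {true} f g = sym (f refl)
bool-ext {false} {true} f g = g refl
bool-ext {false} {false} f g = refl

abstract
  adjOf : ∀ {n} {P : Fin n → Fin n → Set} → (∀ x y → Dec (P x y)) → Adj n
  adjOf P? x y = does (P? x y)

  adjOf⁺ : ∀ {n} {P : Fin n → Fin n → Set} (P? : ∀ x y → Dec (P x y)) {x y} → P x y → adjOf P? x y ≡ true
  adjOf⁺ P? {x} {y} = dec-true (P? x y)

  adjOf⁻ : ∀ {n} {P : Fin n → Fin n → Set} (P? : ∀ x y → Dec (P x y)) {x y} → adjOf P? x y ≡ true → P x y
  adjOf⁻ P? {x} {y} = does⁻ (P? x y)

Edge : ∀ {n} (x y u v : Fin n) → Set
Edge x y u v = (u ≡ x × v ≡ y) ⊎ (u ≡ y × v ≡ x)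

edge? : ∀ {n} (x y u v : Fin n) → Dec (Edge x y u v)
edge? x y u v = ((u ≟ x) ×-dec (v ≟ y)) ⊎-dec ((u ≟ y) ×-dec (v ≟ x))

edge-sym : ∀ {n} {x y u v : Fin n} → Edge x y u v → Edge x y v u
edge-sym (inj₁ (p , q)) = inj₂ (q , p)
edge-sym (inj₂ (p , q)) = inj₁ (q , p)

add? : ∀ {n} (A : Adj n) (x y u v : Fin n) → Dec (A u v ≡ true ⊎ Edge x y u v)
add? A x y u v = (A u v ≟ᵇ true) ⊎-dec edge? x y u v

add : ∀ {n} → Adj n → Fin n → Fin n → Adj n
add A x y = adjOf (add? A x y)

rem? : ∀ {n} (A : Adj n) (x y u v : Fin n) → Dec (A u v ≡ true × ¬ Edge x y u v)
rem? A x y u v = (A u v ≟ᵇ true) ×-dec ¬? (edge? x y u v)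

rem : ∀ {n} → Adj n → Fin n → Fin n → Adj n
rem A x y = adjOf (rem? A x y)

add-ext : ∀ {n} (A : Adj n) {x y} → x ≢ y → A x y ≢ true → A y x ≢ true → Ext A (add A x y) x y
add-ext A {x} {y} ne p q = record { x≢y = ne ; nxy = p ; nyx = q
  ; axy = adjOf⁺ (add? A x y) (inj₂ (inj₁ (refl , refl))) ; ayx = adjOf⁺ (add? A x y) (inj₂ (inj₂ (refl , refl)))
  ; up = λ h → adjOf⁺ (add? A x y) (inj₁ h) ; dn = adjOf⁻ (add? A x y) }

rem-ext : ∀ {n} (A : Adj n) {x y} → x ≢ y → A x y ≡ true → A y x ≡ true → Ext (rem A x y) A x y
rem-ext A {x} {y} ne p q = record { x≢y = ne
  ; nxy = λ h → proj₂ (adjOf⁻ (rem? A x y) h) (inj₁ (refl , refl)) ; nyx = λ h → proj₂ (adjOf⁻ (rem? A x y) h) (inj₂ (refl , refl))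
  ; axy = p ; ayx = q ; up = λ h → proj₁ (adjOf⁻ (rem? A x y) h) ; dn = d }
  where
  d : ∀ {u v} → A u v ≡ true → rem A x y u v ≡ true ⊎ Edge x y u v
  d {u} {v} h with edge? x y u v
  ... | yes e = inj₂ e
  ... | no e = inj₁ (adjOf⁺ (rem? A x y) (h , e))

infix 4 _⊑_
_⊑_ : ∀ {n} → Adj n → Adj n → Set
A ⊑ A' = ∀ {u v} → A u v ≡ true → A' u v ≡ true

#d-mono : ∀ {n} {A A' : Adj n} → A ⊑ A' → #d A ≤ #d A'
#d-mono {A = A} {A'} s = ⊆-length (darts! A) (λ m → ∈-darts⁺ A' (s (∈-darts⁻ A m)))

module _ {g n} {A A' : Adj n} (Q : QE g A) (f : A ⊑ A') (b : A' ⊑ A) where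
  open QE Q
  private
    obj : ∀ {d} → Obj A d → Obj A' d
    obj (inj₁ h) = inj₁ (f h)
    obj (inj₂ (e , i)) = inj₂ (e , λ w h → i w (b h))
    obj' : ∀ {d} → Obj A' d → Obj A d
    obj' (inj₁ h) = inj₁ (b h)
    obj' (inj₂ (e , i)) = inj₂ (e , λ w h → i w (f h))
    on : ∀ {ℓ u} → On A lab ℓ u → On A' lab ℓ u
    on (w , o , e) = w , obj o , e
    link : ∀ {u v} → Link A lab u v → Star (Link A' lab) u v
    link (inj₁ h) = inj₁ (f h) ◅ ε
    link (inj₂ (ℓ , p , q)) = inj₂ (ℓ , on p , on q) ◅ ε

  QE-resp : QE g A'
  QE-resp = record { rot = record { ρ = ρ ; symA = λ h → f (symA (b h)) ; irr = λ h → irr (b h) ; cyc = λ v → cycOther f b (cyc v) }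
    ; lab = lab ; L = L ; L! = L! ; lab∈ = lab∈ ; labinv = λ h → labinv (b h)
    ; surj = λ m → let d , o , e = surj m in d , obj o , e ; R = R ; cov = λ o → cov (obj' o)
    ; conn = λ u v → starBind link (conn u v)
    ; gen = subst (λ t → 4 + t + 2 * length R ≤ 4 * g + 2 * n + 4 * length L) (≤-antisym (#d-mono {A = A} {A'} (λ h → f h)) (#d-mono {A = A'} {A} (λ h → b h))) gen }

decD : ∀ {n} {P : Dart n → Set} → (∀ d → Dec (P d)) → Dec (∃ P)
decD p? = mapDec (λ { (u , v , p) → (u , v) , p }) (λ { ((u , v) , p) → u , v , p }) (any? (λ u → any? (λ v → p? (u , v))))

subQE : ∀ {g n} {J K : Adj n} → QE g K → J ⊑ K → (∀ {u v} → J u v ≡ true → J v u ≡ true) → QE g J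
subQE {g} {n} {J} {K} Q s symJ = go (#d K) K Q s ≤-refl
  where
  go : ∀ fuel K → QE g K → J ⊑ K → #d K ≤ fuel → QE g J
  go fuel K Q s le with decD (λ d → (K (proj₁ d) (proj₂ d) ≟ᵇ true) ×-dec ¬? (J (proj₁ d) (proj₂ d) ≟ᵇ true))
  ... | no none = QE-resp Q back s
    where
    back : K ⊑ J
    back {u} {v} h with J u v ≟ᵇ true
    ... | yes p = p
    ... | no p = ⊥-elim (none ((u , v) , h , p))
  ... | yes ((x , y) , h , nj) = next fuel le
    where
    E = rem-ext K (QE.adj≢ Q h) h (QE.symA Q h)
    s' : J ⊑ rem K x y
    s' {u} {v} j = adjOf⁺ (rem? K x y) (s j , λ { (inj₁ (refl , refl)) → nj j ; (inj₂ (refl , refl)) → nj (symJ j) })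
    next : ∀ fuel → #d K ≤ fuel → QE g J
    next zero le = ⊥-elim (n≮0 (≤-trans (s≤s z≤n) (subst (_≤ 0) (#d-ext E) le)))
    next (suc fl) le = go fl (rem K x y) (Del.result Q E) s' (≤-pred (≤-trans (n≤1+n _) (subst (_≤ suc fl) (#d-ext E) le)))

-- Contraction of v into its neighbour u; v is left isolated.
CP : ∀ {n} → Adj n → (v u x y : Fin n) → Set
CP A v u x y = x ≢ v × y ≢ v × (A x y ≡ true ⊎ (x ≡ u × y ≢ u × A v y ≡ true) ⊎ (y ≡ u × x ≢ u × A v x ≡ true))

contr? : ∀ {n} (A : Adj n) (v u x y : Fin n) → Dec (CP A v u x y)
contr? A v u x y = ¬? (x ≟ v) ×-dec ¬? (y ≟ v) ×-dec
  ((A x y ≟ᵇ true) ⊎-dec ((x ≟ u) ×-dec ¬? (y ≟ u) ×-dec (A v y ≟ᵇ true)) ⊎-dec ((y ≟ u) ×-dec ¬? (x ≟ u) ×-dec (A v x ≟ᵇ true)))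

contr : ∀ {n} → Adj n → Fin n → Fin n → Adj n
contr A v u = adjOf (contr? A v u)

contr-mono : ∀ {n} {A A' : Adj n} {v u} → A ⊑ A' → contr A v u ⊑ contr A' v u
contr-mono {A = A} {A'} {v} {u} s h with adjOf⁻ (contr? A v u) h
... | p , q , inj₁ e = adjOf⁺ (contr? A' v u) (p , q , inj₁ (s e))
... | p , q , inj₂ (inj₁ (a , b , e)) = adjOf⁺ (contr? A' v u) (p , q , inj₂ (inj₁ (a , b , s e)))
... | p , q , inj₂ (inj₂ (a , b , e)) = adjOf⁺ (contr? A' v u) (p , q , inj₂ (inj₂ (a , b , s e)))

contr-iso : ∀ {n} (A : Adj n) v u → iso (contr A v u) v
contr-iso A v u w h = proj₁ (adjOf⁻ (contr? A v u) h) refl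

contr-sym : ∀ {n} (A : Adj n) {v u} → (∀ {x y} → A x y ≡ true → A y x ≡ true) → ∀ {x y} → contr A v u x y ≡ true → contr A v u y x ≡ true
contr-sym A {v} {u} sy h with adjOf⁻ (contr? A v u) h
... | p , q , inj₁ e = adjOf⁺ (contr? A v u) (q , p , inj₁ (sy e))
... | p , q , inj₂ (inj₁ t) = adjOf⁺ (contr? A v u) (q , p , inj₂ (inj₂ t))
... | p , q , inj₂ (inj₂ t) = adjOf⁺ (contr? A v u) (q , p , inj₂ (inj₁ t))

-- Contraction is carried out by insertions and deletions of edges. If `w` follows `u` in the
-- rotation at `v`, then (u , v) and (v , w) are consecutive on a face, so the edge uw can be drawn
-- along them (unless it exists) and vw deleted. This does not change the result of the contraction
-- and lowers the degree of `v`; when `u` is the only neighbour left, vu is deleted.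
contrQE : ∀ {g n} {A : Adj n} {v u} → QE g A → A v u ≡ true → QE g (contr A v u)
contrQE {g} {n} {A} {v} {u} Q₀ h₀ = go (deg A v) A Q₀ h₀ id id ≤-refl
  where
  go : ∀ fuel B → QE g B → B v u ≡ true → contr B v u ⊑ contr A v u → contr A v u ⊑ contr B v u → deg B v ≤ fuel → QE g (contr A v u)
  go fuel B Q h f b le with QE.ρ Q v u ≟ u
  ... | yes e = QE-resp (Del.result Q E) (f ∘ f₁) (b₁ ∘ b)
    where
    E = rem-ext B (QE.adj≢ Q h) h (QE.symA Q h)
    only : ∀ {y} → B v y ≡ true → y ≡ u
    only k = reach-fix e (Cyc.tr (QE.cyc Q v) h k)
    f₁ : rem B v u ⊑ contr B v u
    f₁ {x} {y} k with adjOf⁻ (rem? B v u) k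
    ... | p , q = adjOf⁺ (contr? B v u) ((λ { refl → q (inj₁ (refl , only p)) }) , (λ { refl → q (inj₂ (only (QE.symA Q p) , refl)) }) , inj₁ p)
    b₁ : contr B v u ⊑ rem B v u
    b₁ {x} {y} k with adjOf⁻ (contr? B v u) k
    ... | p , q , inj₁ t = adjOf⁺ (rem? B v u) (t , λ { (inj₁ (r , _)) → p r ; (inj₂ (_ , r)) → q r })
    ... | p , q , inj₂ (inj₁ (_ , r , t)) = ⊥-elim (r (only t))
    ... | p , q , inj₂ (inj₂ (_ , r , t)) = ⊥-elim (r (only t))
  ... | no ne = next fuel le
    where
    module Q = QE Q
    w : Fin n
    w = Q.ρ v u
    vw : B v w ≡ true
    vw = Cyc.cl (Q.cyc v) h
    wv : B w v ≡ true
    wv = Q.symA vw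
    w≢v : w ≢ v
    w≢v = Q.adj≢ wv
    u≢v : u ≢ v
    u≢v e = Q.adj≢ h (sym e)
    record Joined : Set where
      field
        B₁ : Adj n
        Q₁ : QE g B₁
        inc : B ⊑ B₁
        uw : B₁ u w ≡ true
        dec : ∀ {x y} → B₁ x y ≡ true → B x y ≡ true ⊎ Edge u w x y
    joined : Joined
    joined with B u w ≟ᵇ true
    ... | yes e = record { B₁ = B ; Q₁ = Q ; inc = id ; uw = e ; dec = inj₁ }
    ... | no e = record { B₁ = add B u w ; Q₁ = Ins.result Q E₁ v (Q.ρ w v) (inj₁ (Q.symA h)) (inj₁ (Cyc.cl (Q.cyc w) wv))
          (sym (trans (Q.labinv vw) (Q.labinv (Q.symA h))))
        ; inc = Ext.up E₁ ; uw = Ext.axy E₁ ; dec = Ext.dn E₁ }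
      where
      E₁ = add-ext B (ne ∘ sym) e (λ k → e (Q.symA k))
    open Joined joined
    E₂ : Ext (rem B₁ v w) B₁ v w
    E₂ = rem-ext B₁ (w≢v ∘ sym) (inc vw) (inc wv)
    vu₂ : rem B₁ v w v u ≡ true
    vu₂ = adjOf⁺ (rem? B₁ v w) (inc h , λ { (inj₁ (_ , e)) → ne (sym e) ; (inj₂ (e , _)) → w≢v (sym e) })
    row : ∀ {y} → B₁ v y ≡ true → B v y ≡ true
    row k with dec k
    ... | inj₁ t = t
    ... | inj₂ (inj₁ (e , _)) = ⊥-elim (u≢v (sym e))
    ... | inj₂ (inj₂ (e , _)) = ⊥-elim (w≢v (sym e))
    f₂ : contr (rem B₁ v w) v u ⊑ contr B v u
    f₂ {x} {y} k with adjOf⁻ (contr? (rem B₁ v w) v u) k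
    f₂ {x} {y} k | p , q , inj₂ (inj₁ (e , r , t)) = adjOf⁺ (contr? B v u) (p , q , inj₂ (inj₁ (e , r , row (proj₁ (adjOf⁻ (rem? B₁ v w) t)))))
    f₂ {x} {y} k | p , q , inj₂ (inj₂ (e , r , t)) = adjOf⁺ (contr? B v u) (p , q , inj₂ (inj₂ (e , r , row (proj₁ (adjOf⁻ (rem? B₁ v w) t)))))
    f₂ {x} {y} k | p , q , inj₁ t with dec (proj₁ (adjOf⁻ (rem? B₁ v w) t))
    ... | inj₁ s = adjOf⁺ (contr? B v u) (p , q , inj₁ s)
    ... | inj₂ (inj₁ (refl , refl)) = adjOf⁺ (contr? B v u) (p , q , inj₂ (inj₁ (refl , ne , vw)))
    ... | inj₂ (inj₂ (refl , refl)) = adjOf⁺ (contr? B v u) (p , q , inj₂ (inj₂ (refl , ne , vw)))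
    b₂ : contr B v u ⊑ contr (rem B₁ v w) v u
    b₂ {x} {y} k with adjOf⁻ (contr? B v u) k
    b₂ {x} {y} k | p , q , inj₁ t = adjOf⁺ (contr? (rem B₁ v w) v u) (p , q , inj₁ (adjOf⁺ (rem? B₁ v w)
      (inc t , λ { (inj₁ (e , _)) → p e ; (inj₂ (_ , e)) → q e })))
    b₂ {x} {y} k | p , q , inj₂ (inj₁ (e , r , t)) with y ≟ w
    ... | yes refl = adjOf⁺ (contr? (rem B₁ v w) v u) (p , q , inj₁ (adjOf⁺ (rem? B₁ v w)
      (subst (λ z → B₁ z w ≡ true) (sym e) uw , λ { (inj₁ (e' , _)) → p e' ; (inj₂ (_ , e')) → q e' })))
    ... | no nw = adjOf⁺ (contr? (rem B₁ v w) v u) (p , q , inj₂ (inj₁ (e , r , adjOf⁺ (rem? B₁ v w)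
      (inc t , λ { (inj₁ (_ , e')) → nw e' ; (inj₂ (_ , e')) → q e' }))))
    b₂ {x} {y} k | p , q , inj₂ (inj₂ (e , r , t)) with x ≟ w
    ... | yes refl = adjOf⁺ (contr? (rem B₁ v w) v u) (p , q , inj₁ (adjOf⁺ (rem? B₁ v w)
      (subst (λ z → B₁ w z ≡ true) (sym e) (QE.symA Q₁ uw) , λ { (inj₁ (e' , _)) → p e' ; (inj₂ (_ , e')) → q e' })))
    ... | no nw = adjOf⁺ (contr? (rem B₁ v w) v u) (p , q , inj₂ (inj₂ (e , r , adjOf⁺ (rem? B₁ v w)
      (inc t , λ { (inj₁ (_ , e')) → nw e' ; (inj₂ (_ , e')) → p e' }))))
    fewer : suc (deg (rem B₁ v w) v) ≤ deg B v
    fewer = ⊆-length {xs = w ∷ nbrs (rem B₁ v w) v}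
      (All-tabulate (λ { m refl → Ext.nxy E₂ (∈-nbrs⁻ (rem B₁ v w) m) }) ∷ nbrs! (rem B₁ v w) v)
      (λ { (here refl) → ∈-nbrs⁺ B vw ; (there m) → ∈-nbrs⁺ B (row (Ext.up E₂ (∈-nbrs⁻ (rem B₁ v w) m))) })
    next : ∀ fuel → deg B v ≤ fuel → QE g (contr A v u)
    next zero le = ⊥-elim (n≮0 (≤-trans fewer le))
    next (suc fl) le = go fl (rem B₁ v w) (Del.result Q₁ E₂) vu₂ (λ k → f (f₂ k)) (λ k → b₂ (b k)) (≤-pred (≤-trans fewer le))

-- Edge-maximal embeddings

Sat : ∀ {g n} {A : Adj n} → QE g A → Set
Sat {A = A} Q = ∀ {d e} → Obj A d → Obj A e → QE.lab Q d ≡ QE.lab Q e → proj₁ d ≡ proj₁ e ⊎ A (proj₁ d) (proj₁ e) ≡ true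

obj? : ∀ {n} (A : Adj n) d → Dec (Obj A d)
obj? A (u , v) = (A u v ≟ᵇ true) ⊎-dec ((u ≟ v) ×-dec all? (λ w → ¬? (A u w ≟ᵇ true)))

#d≤ : ∀ {n} (A : Adj n) → #d A ≤ n * n
#d≤ {n} A = subst (#d A ≤_) size (length-filter (λ d → A (proj₁ d) (proj₂ d) ≟ᵇ true) allD)
  where
  len : ∀ (xs : List (Fin n)) → length (cartesianProduct xs (allFin n)) ≡ length xs * n
  len [] = refl
  len (x ∷ xs) = trans (length-++ (map (x ,_) (allFin n))) (cong₂ _+_ (trans (length-map (x ,_) (allFin n)) (length-tabulate {n = n} id)) (len xs))
  size : length (allD {n}) ≡ n * n
  size = trans (len (allFin n)) (cong (_* n) {length (allFin n)} {n} (length-tabulate {n = n} id))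

record Saturated (g : ℕ) {n} (A : Adj n) : Set where
  field
    K : Adj n
    Q : QE g K
    inc : A ⊑ K
    sat : Sat Q

saturate : ∀ {g n} {A : Adj n} → QE g A → Saturated g A
saturate {g} {n} {A} Q = go (n * n) A Q id (m≤m+n (n * n) _)
  where
  go : ∀ fuel K → QE g K → A ⊑ K → n * n ≤ fuel + #d K → Saturated g A
  go fuel K Q s le with decD (λ d → decD (λ e → obj? K d ×-dec obj? K e ×-dec (QE.lab Q d ≟ⁿ QE.lab Q e)
                          ×-dec ¬? (proj₁ d ≟ proj₁ e) ×-dec ¬? (K (proj₁ d) (proj₁ e) ≟ᵇ true)))
  ... | no none = record { K = K ; Q = Q ; inc = s ; sat = σ }
    where
    σ : Sat Q
    σ {d} {e} od oe l with proj₁ d ≟ proj₁ e | K (proj₁ d) (proj₁ e) ≟ᵇ true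
    ... | yes p | _ = inj₁ p
    ... | no _ | yes p = inj₂ p
    ... | no p | no q = ⊥-elim (none (d , e , od , oe , l , p , q))
  ... | yes ((x , cx) , (y , cy) , od , oe , l , ne , nk) = next fuel le
    where
    E = add-ext K ne nk (λ k → nk (QE.symA Q k))
    bigger : #d (add K x y) ≡ 2 + #d K
    bigger = #d-ext E
    next : ∀ fuel → n * n ≤ fuel + #d K → Saturated g A
    next zero le = ⊥-elim (<-irrefl refl (≤-trans (≤-trans (s≤s le) (≤-trans (n≤1+n _) (≤-reflexive (sym bigger)))) (#d≤ (add K x y))))
    next (suc fl) le = go fl (add K x y) (Ins.result Q E cx cy od oe l) (λ h → Ext.up E (s h))
      (≤-trans le (≤-trans (≤-reflexive (sym (+-suc fl (#d K)))) (+-monoʳ-≤ fl (≤-trans (n≤1+n _) (≤-reflexive (sym bigger))))))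

-- Counting with sums over Fin

sel-map : ∀ {A B : Set} (P : B → Bool) (f : A → B) ys → length (sel P (map f ys)) ≡ length (sel (P ∘ f) ys)
sel-map P f [] = refl
sel-map P f (y ∷ ys) with P (f y) ≟ᵇ true
... | yes _ = cong suc (sel-map P f ys)
... | no _ = sel-map P f ys

cnt₁ : ∀ {n m} (h : Fin n → Fin m) (p : Fin m → Bool) → vsum (tabulate (λ i → [ p (h i) ])) ≡ length (sel p (ltabulate h))
cnt₁ {zero} h p = refl
cnt₁ {suc n} h p with p (h fzero)
... | true = cong suc (cnt₁ (h ∘ fsuc) p)
... | false = cnt₁ (h ∘ fsuc) p

Σ-sel : ∀ {n} (p : Fin n → Bool) → Σᶠ (λ v → [ p v ]) ≡ length (sel p (allFin n))
Σ-sel = cnt₁ id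

cnt₂ : ∀ {n m} (h : Fin n → Fin m) (P : Dart m → Bool) →
  vsum (tabulate (λ i → Σᶠ (λ v → [ P (h i , v) ]))) ≡ length (sel P (cartesianProduct (ltabulate h) (allFin m)))
cnt₂ {zero} h P = refl
cnt₂ {suc n} {m} h P = begin
  Σᶠ (λ v → [ P (h fzero , v) ]) + vsum (tabulate (λ i → Σᶠ (λ v → [ P (h (fsuc i) , v) ])))
    ≡⟨ cong₂ _+_ (trans (Σ-sel (λ v → P (h fzero , v))) (sym (sel-map P (h fzero ,_) (allFin m)))) (cnt₂ (h ∘ fsuc) P) ⟩
  length (sel P (map (h fzero ,_) (allFin m))) + length (sel P rest)
    ≡⟨ length-++ (sel P (map (h fzero ,_) (allFin m))) ⟨
  length (sel P (map (h fzero ,_) (allFin m)) ++ sel P rest)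
    ≡⟨ cong length (filter-++ (λ x → P x ≟ᵇ true) (map (h fzero ,_) (allFin m)) rest) ⟨
  length (sel P (map (h fzero ,_) (allFin m) ++ rest)) ∎
  where
  open ≡-Reasoning
  rest = cartesianProduct (ltabulate (h ∘ fsuc)) (allFin m)

ΣΣ-sel : ∀ {n} (P : Dart n → Bool) → Σᶠ (λ u → Σᶠ (λ v → [ P (u , v) ])) ≡ length (sel P allD)
ΣΣ-sel = cnt₂ id

true⇒T : ∀ {b} → b ≡ true → T b
true⇒T refl = _

T⇒true : ∀ {b} → T b → b ≡ true
T⇒true {true} _ = refl

∧-true : ∀ {b c} → b ∧ c ≡ true → b ≡ true × c ≡ true
∧-true {true} {true} _ = refl , refl

∧-intro : ∀ {b c} → b ≡ true → c ≡ true → b ∧ c ≡ true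
∧-intro refl refl = refl

and-all : ∀ (p : A → Bool) xs → and (map p xs) ≡ true → ∀ {x} → x ∈ xs → p x ≡ true
and-all p (y ∷ ys) h (here refl) = proj₁ (∧-true h)
and-all p (y ∷ ys) h (there m) = and-all p ys (proj₂ (∧-true {p y} h)) m

and-false : ∀ (p : A → Bool) xs → and (map p xs) ≢ true → ∃ λ x → x ∈ xs × p x ≢ true
and-false p [] h = ⊥-elim (h refl)
and-false p (y ∷ ys) h with p y ≟ᵇ true
... | no ne = y , here refl , ne
... | yes e = let x , m , q = and-false p ys (λ k → h (∧-intro e k)) in x , there m , q

∈-upTo : ∀ {k n} → k < n → k ∈ upTo n
∈-upTo = ∈-upTo⁺

key-inj : ∀ {n} {d e : Dart n} → key d ≡ key e → d ≡ e
key-inj {n} {u , v} {u' , v'} h = cong₂ _,_ (proj₁ same) (proj₂ same)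
  where
  same : u ≡ u' × v ≡ v'
  same = combine-injective u v u' v' (toℕ-injective
    (trans (toℕ-combine u v) (trans (cong (_+ toℕ v) (*-comm n (toℕ u)))
    (trans h (trans (cong (_+ toℕ v') (sym (*-comm n (toℕ u')))) (sym (toℕ-combine u' v')))))))

isolated⁺ : ∀ {n} (G : Graph n) {v} → iso (adj G) v → isIsolated G v ≡ true
isolated⁺ {n} G {v} i = T⇒true (≡⇒≡ᵇ _ 0 (trans (Σ-sel (adj G v)) (n≤0⇒n≡0 (⊆-length {ys = []} (nbrs! (adj G) v) (λ m → ⊥-elim (i _ (∈-nbrs⁻ (adj G) m)))))))

isolated⁻ : ∀ {n} (G : Graph n) {v} → isIsolated G v ≡ true → iso (adj G) v
isolated⁻ {n} G {v} h w e = none (trans (sym (Σ-sel (adj G v))) (≡ᵇ⇒≡ _ 0 (true⇒T h))) (∈-nbrs⁺ (adj G) e)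
  where
  none : ∀ {xs : List (Fin n)} → length xs ≡ 0 → w ∉ xs
  none {[]} _ ()

halfP : ∀ {n} → Adj n → Dart n → Bool
halfP A d = (toℕ (proj₂ d) <ᵇ toℕ (proj₁ d)) ∧ A (proj₁ d) (proj₂ d)

half : ∀ {n} → Adj n → List (Dart n)
half A = sel (halfP A) allD

module _ {n} (H : Adj n) (sy : ∀ {u v} → H u v ≡ true → H v u ≡ true) (ir : ∀ {v} → H v v ≢ true) where
  private
    P' : Dart n → Bool
    P' (u , v) = (toℕ u <ᵇ toℕ v) ∧ H u v
    swap : Dart n → Dart n
    swap (u , v) = v , u
    swap-inj : ∀ {d e : Dart n} → swap d ≡ swap e → d ≡ e
    swap-inj refl = refl
    to : ∀ {d} → halfP H d ≡ true → P' (swap d) ≡ true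
    to {u , v} h = ∧-intro (proj₁ (∧-true h)) (sy (proj₂ (∧-true {toℕ v <ᵇ toℕ u} h)))
    from : ∀ {d} → P' d ≡ true → halfP H (swap d) ≡ true
    from {u , v} h = ∧-intro (proj₁ (∧-true h)) (sy (proj₂ (∧-true {toℕ u <ᵇ toℕ v} h)))

  half-cover : ∀ {u v} → H u v ≡ true → (u , v) ∈ half H ⊎ (v , u) ∈ half H
  half-cover {u} {v} h with <-cmp (toℕ u) (toℕ v)
  ... | tri< lt _ _ = inj₂ (∈-sel⁺ (halfP H) (∈-allD _) (∧-intro (T⇒true (<⇒<ᵇ lt)) (sy h)))
  ... | tri> _ _ lt = inj₁ (∈-sel⁺ (halfP H) (∈-allD _) (∧-intro (T⇒true (<⇒<ᵇ lt)) h))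
  ... | tri≈ _ e _ = ⊥-elim (ir (subst (λ z → H z v ≡ true) (toℕ-injective e) h))

  #d-half : #d H ≡ length (half H) + length (half H)
  #d-half = trans (≤-antisym le ge) (trans (length-++ (half H)) (cong (length (half H) +_) e'))
    where
    e' : length (sel P' allD) ≡ length (half H)
    e' = ≤-antisym
        (inj-length swap (sel! P' allD!) (λ m → ∈-sel⁺ (halfP H) (∈-allD _) (from (proj₂ (∈-sel⁻ P' allD m)))) (λ _ _ → swap-inj))
        (inj-length swap (sel! (halfP H) allD!) (λ m → ∈-sel⁺ P' (∈-allD _) (to (proj₂ (∈-sel⁻ (halfP H) allD m)))) (λ _ _ → swap-inj))
    le : #d H ≤ length (half H ++ sel P' allD)
    le = ⊆-length (darts! H) (λ {d} m → go d (∈-darts⁻ H m))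
      where
      go : ∀ d → H (proj₁ d) (proj₂ d) ≡ true → d ∈ half H ++ sel P' allD
      go (u , v) h with half-cover h
      ... | inj₁ p = ∈-++⁺ˡ p
      ... | inj₂ p = ∈-++⁺ʳ (half H) (∈-sel⁺ P' (∈-allD _) (to (proj₂ (∈-sel⁻ (halfP H) allD p))))
    ge : length (half H ++ sel P' allD) ≤ #d H
    ge = ⊆-length (Unique-++⁺ (sel! (halfP H) allD!) (sel! P' allD!) disj) sub
      where
      disj : ∀ {d} → ¬ (d ∈ half H × d ∈ sel P' allD)
      disj {u , v} (p , q) = <-asym (<ᵇ⇒< (toℕ v) (toℕ u) (true⇒T (proj₁ (∧-true (proj₂ (∈-sel⁻ (halfP H) allD p))))))
        (<ᵇ⇒< (toℕ u) (toℕ v) (true⇒T (proj₁ (∧-true (proj₂ (∈-sel⁻ P' allD q))))))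
      sub : ∀ {d} → d ∈ half H ++ sel P' allD → d ∈ darts H
      sub {u , v} m with ∈-++⁻ (half H) m
      ... | inj₁ p = ∈-darts⁺ H (proj₂ (∧-true {toℕ v <ᵇ toℕ u} (proj₂ (∈-sel⁻ (halfP H) allD p))))
      ... | inj₂ p = ∈-darts⁺ H (proj₂ (∧-true {toℕ u <ᵇ toℕ v} (proj₂ (∈-sel⁻ P' allD p))))

#d-edges : ∀ {n} (G : Graph n) → IsSimple G → #d (adj G) ≡ numEdges G + numEdges G
#d-edges G (sy , ir) = trans (#d-half (adj G) (λ {u} {v} h → trans (sy v u) h) (λ {v} h → false≢true (trans (sym (ir v)) h)))
  (cong₂ _+_ (sym (ΣΣ-sel (halfP (adj G)))) (sym (ΣΣ-sel (halfP (adj G)))))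

-- From the combinatorial embeddings of the statement to QE and back

reach-cong : ∀ {f h : A → A} (P : A → Set) → (∀ {x} → P x → P (f x)) → (∀ {x} → P x → f x ≡ h x) →
  ∀ {x y} → P x → Reach f x y → Reach h x y
reach-cong P cl e px here = here
reach-cong P cl e px (step r) = step (subst (λ t → Reach _ t _) (e px) (reach-cong P cl e (cl px) r))

module FromEmb {g n} (G : Graph n) (S : IsSimple G) (e : Embedding g G) where
  open Embedding e renaming (ρ to ρe)
  H = adj G

  irrA : ∀ {v} → H v v ≢ true
  irrA {v} h = false≢true (trans (sym (proj₂ S v)) h)

  symA : ∀ {u v} → H u v ≡ true → H v u ≡ true
  symA {u} {v} h = trans (proj₁ S v u) h

  -- `IsRotation` leaves the rotation at v arbitrary outside the neighbours; the value at v itself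
  -- is adjusted to the convention of `Cyc`.
  ρ' : Fin n → Fin n → Fin n
  ρ' v = upd v v (ρe v)

  ρ'≡ : ∀ {v u} → H v u ≡ true → ρe v u ≡ ρ' v u
  ρ'≡ h = sym (upd-other (λ { refl → irrA h }))

  cyc : ∀ v → Cyc (H v) v (ρ' v)
  cyc v = record { fix = upd-same refl ; cl = λ h → ≡subst (H v) (ρ'≡ h) (proj₁ isRot v _ h)
    ; tr = λ {u} {w} h k → reach-cong (λ z → H v z ≡ true) (λ q → proj₁ isRot v _ q) ρ'≡ h
        (let j , q = proj₂ isRot v u w h k in subst (Reach (ρe v) u) q (iter⇒reach (ρe v) j u)) }

  rot : Rot H
  rot = record { ρ = ρ' ; symA = symA ; irr = irrA ; cyc = cyc }
  open Rot rot using (nxt; nxt-cl)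

  nxt≡ : ∀ {d} → isD H d → φ ρe d ≡ nxt d
  nxt≡ {u , v} h = cong (v ,_) (ρ'≡ (symA h))

  φ-cl : ∀ {d} → isD H d → isD H (φ ρe d)
  φ-cl h = subst (isD H) (sym (nxt≡ h)) (nxt-cl h)

  lab : Dart n → ℕ
  lab (u , v) = toℕ (if does (u ≟ v) then isoFace u else face u v)

  lab-d : ∀ {u v} → H u v ≡ true → lab (u , v) ≡ toℕ (face u v)
  lab-d {u} {v} h = cong toℕ (cong (λ b → if b then isoFace u else face u v) (dec-false (u ≟ v) (λ { refl → irrA h })))

  lab-i : ∀ v → lab (v , v) ≡ toℕ (isoFace v)
  lab-i v = cong toℕ (cong (λ b → if b then isoFace v else face v v) (dec-true (v ≟ v) refl))

  minP : Dart n → Bool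
  minP d = adj G (proj₁ d) (proj₂ d) ∧ isOrbitMin ρe d

  R : List (Dart n)
  R = sel minP allD ++ map (λ v → v , v) (sel (isIsolated G) (allFin n))

  R-length : length R ≡ numWalks G ρe
  R-length = trans (length-++ (sel minP allD)) (cong₂ _+_ (sym (ΣΣ-sel minP))
    (trans (length-map (λ v → v , v) (sel (isIsolated G) (allFin n))) (sym (Σ-sel (isIsolated G)))))

  -- Descent on `key`: a dart that fails `isOrbitMin` has an iterate with a smaller key.
  find-min : ∀ fuel d → key d < fuel → isD H d → ∃ λ r → r ∈ R × Reach nxt d r
  find-min zero d () h
  find-min (suc fuel) d lt h with isOrbitMin ρe d ≟ᵇ true
  ... | yes p = d , ∈-++⁺ˡ (∈-sel⁺ minP (∈-allD d) (∧-intro h p)) , here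
  ... | no p with and-false (λ k → key d ≤ᵇ key (iter (φ ρe) k d)) (upTo (n * n)) p
  ... | k , _ , nle = let r , r∈ , q = find-min fuel d' (≤-trans smaller (≤-pred lt)) (reach-inv (isD H) φ-cl path h) in
      r , r∈ , reach-trans (reach-cong (isD H) φ-cl nxt≡ h path) q
    where
    d' = iter (φ ρe) k d
    path : Reach (φ ρe) d d'
    path = iter⇒reach (φ ρe) k d
    smaller : key d' < key d
    smaller = ≰⇒> (λ le → nle (T⇒true (≤⇒≤ᵇ le)))

  cov : ∀ {d} → Obj H d → ∃ λ r → r ∈ R × Reach nxt d r
  cov {d} (inj₁ h) = find-min (suc (key d)) d ≤-refl h
  cov {v , _} (inj₂ (refl , i)) = (v , v) , ∈-++⁺ʳ (sel minP allD) (∈-map⁺ (λ v → v , v) (∈-sel⁺ (isIsolated G) (∈-allFin v) (isolated⁺ G i))) , here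

  surj : ∀ {ℓ} → ℓ ∈ upTo f → ∃ λ d → Obj H d × lab d ≡ ℓ
  surj {ℓ} m = go (faceSurj F)
    where
    lt : ℓ < f
    lt = ∈-upTo⁻ m
    F = fromℕ< lt
    go : (∃₂ λ u v → adj G u v ≡ true × face u v ≡ F) ⊎ (∃ λ v → isIsolated G v ≡ true × isoFace v ≡ F) → ∃ λ d → Obj H d × lab d ≡ ℓ
    go (inj₁ (u , v , h , q)) = (u , v) , inj₁ h , trans (lab-d h) (trans (cong toℕ q) (toℕ-fromℕ< lt))
    go (inj₂ (v , h , q)) = (v , v) , inj₂ (refl , isolated⁻ G h) , trans (lab-i v) (trans (cong toℕ q) (toℕ-fromℕ< lt))

  on : ∀ {F v} → OnFace F v → On H lab (toℕ F) v
  on (inj₁ (w , h , refl)) = w , inj₁ h , lab-d h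
  on {v = v} (inj₂ (h , refl)) = v , inj₂ (refl , isolated⁻ G h) , lab-i v

  link : ∀ {u v} → Step u v → Star (Link H lab) u v
  link (inj₁ h) = inj₁ h ◅ ε
  link (inj₂ (F , p , q)) = inj₂ (toℕ F , on p , on q) ◅ ε

  qe : QE g H
  qe = record { rot = rot ; lab = lab ; L = upTo f ; L! = upTo⁺ f ; lab∈ = λ { (u , v) → ∈-upTo (toℕ<n _) }
    ; labinv = λ { {u , v} h → trans (lab-d (nxt-cl h)) (trans (cong (λ z → toℕ (face v z)) (sym (ρ'≡ (symA h)))) (trans (cong toℕ (faceInv u v h)) (sym (lab-d h)))) }
    ; surj = surj ; R = R ; cov = cov ; conn = λ u v → starBind link (connected u v)
    ; gen = gen }
    where
    E = numEdges G
    W = numWalks G ρe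
    gen : 4 + #d H + 2 * length R ≤ 4 * g + 2 * n + 4 * length (upTo f)
    gen rewrite #d-edges G S | R-length | length-upTo f =
      subst₂ _≤_ (a₁ E W) (a₂ g n f) (*-monoʳ-≤ 2 genusOK)
      where
      a₁ : ∀ E W → 2 * (2 + E + W) ≡ 4 + (E + E) + 2 * W
      a₁ = solve-∀
      a₂ : ∀ g n f → 2 * (2 * g + n + 2 * f) ≡ 4 * g + 2 * n + 4 * f
      a₂ = solve-∀

pos : ∀ {L : List ℕ} {ℓ} → ℓ ∈ L → Fin (length L)
pos (here _) = fzero
pos (there m) = fsuc (pos m)

pos-cong : ∀ {L : List ℕ} → Unique L → ∀ {ℓ ℓ'} (p : ℓ ∈ L) (q : ℓ' ∈ L) → ℓ ≡ ℓ' → pos p ≡ pos q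
pos-cong u (here refl) (here e) refl = refl
pos-cong (h ∷ u) (here refl) (there m) refl = ⊥-elim (All-lookup h m refl)
pos-cong (h ∷ u) (there m) (here refl) refl = ⊥-elim (All-lookup h m refl)
pos-cong (h ∷ u) (there p) (there q) e = cong fsuc (pos-cong u p q e)

pos-surj : ∀ {L : List ℕ} (i : Fin (length L)) → ∃ λ ℓ → Σ (ℓ ∈ L) λ p → pos p ≡ i
pos-surj {x ∷ L} fzero = x , here refl , refl
pos-surj {x ∷ L} (fsuc i) = let ℓ , p , e = pos-surj i in ℓ , there p , cong fsuc e

module ToEmb {g n} (G : Graph n) (Q : QE g (adj G)) where
  open QE Q
  H = adj G

  simple : IsSimple G
  simple = (λ u v → bool-ext symA symA) , (λ v → ≢true⇒false irr)

  face : Fin n → Fin n → Fin (length L)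
  face u v = pos (lab∈ (u , v))

  isoFace : Fin n → Fin (length L)
  isoFace v = pos (lab∈ (v , v))

  minP : Dart n → Bool
  minP d = adj G (proj₁ d) (proj₂ d) ∧ isOrbitMin ρ d

  W : List (Dart n)
  W = sel minP allD ++ map (λ v → v , v) (sel (isIsolated G) (allFin n))

  W-length : length W ≡ numWalks G ρ
  W-length = trans (length-++ (sel minP allD)) (cong₂ _+_ (sym (ΣΣ-sel minP))
    (trans (length-map (λ v → v , v) (sel (isIsolated G) (allFin n))) (sym (Σ-sel (isIsolated G)))))

  view : ∀ {d} → d ∈ W → (isD H d × isOrbitMin ρ d ≡ true) ⊎ (∃ λ v → d ≡ (v , v) × iso H v)
  view {d} m with ∈-++⁻ (sel minP allD) m
  ... | inj₁ p = inj₁ (∧-true (proj₂ (∈-sel⁻ minP allD p)))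
  ... | inj₂ p with ∈-map⁻ (λ v → v , v) p
  ... | v , q , e = inj₂ (v , e , isolated⁻ G (proj₂ (∈-sel⁻ (isIsolated G) (allFin n) q)))

  obj : ∀ {d} → d ∈ W → Obj H d
  obj m with view m
  ... | inj₁ (h , _) = inj₁ h
  ... | inj₂ (v , refl , i) = inj₂ (refl , i)

  min≤ : ∀ {d e} → isOrbitMin ρ d ≡ true → Reach nxt d e → key d ≤ key e
  min≤ {d} h r with reach-bound finDart r
  ... | k , lt , refl = ≤ᵇ⇒≤ _ _ (true⇒T (and-all (λ k → key d ≤ᵇ key (iter nxt k d)) (upTo (n * n)) h (∈-upTo lt)))

  W! : Unique W
  W! = Unique-++⁺ (sel! minP allD!) (Unique-map⁺ (cong proj₁) (sel! (isIsolated G) (allFin⁺ n))) disj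
    where
    disj : ∀ {d} → ¬ (d ∈ sel minP allD × d ∈ map (λ v → v , v) (sel (isIsolated G) (allFin n)))
    disj (p , q) with ∈-map⁻ (λ v → v , v) q
    ... | v , _ , refl = irr (proj₁ (∧-true (proj₂ (∈-sel⁻ minP allD p))))

  sep : ∀ {d e r} → d ∈ W → e ∈ W → Reach nxt d r → Reach nxt e r → d ≡ e
  sep {d} {e} md me p q with view md | view me
  ... | inj₁ (hd , nd) | inj₁ (he , ne) = key-inj (≤-antisym (min≤ nd (reach-trans p (nxt-sym he q))) (min≤ ne (reach-trans q (nxt-sym hd p))))
  ... | inj₁ (hd , _) | inj₂ (v , refl , i) = ⊥-elim (irr (subst (isD H) (iso-reach q) (nxt-D p hd)))
  ... | inj₂ (v , refl , i) | inj₁ (he , _) = ⊥-elim (irr (subst (isD H) (iso-reach p) (nxt-D q he)))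
  ... | inj₂ (v , refl , i) | inj₂ (w , refl , j) = trans (sym (iso-reach p)) (iso-reach q)

  -- `R` may meet a walk more than once, so `gen` is at least as strong as the inequality for
  -- `numWalks`. The orbit minima are related to `R` by reachability, and two minima that reach the
  -- same representative coincide.
  walks≤ : numWalks G ρ ≤ length R
  walks≤ = subst (_≤ length R) W-length (rel-length (Reach nxt) W! (λ m → cov (obj m)) sep)

  embedding : Embedding g G
  embedding = record { f = length L ; ρ = ρ ; isRot = (λ v u h → Cyc.cl (cyc v) h) , (λ v u w h k → reach⇒iter (Cyc.tr (cyc v) h k))
    ; face = face ; isoFace = isoFace
    ; faceInv = λ u v h → pos-cong L! _ _ (labinv h)
    ; faceSurj = fs
    ; connected = λ u v → starBind link (conn u v)
    ; genusOK = genus }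
    where
    fs : ∀ F → (∃₂ λ u v → adj G u v ≡ true × face u v ≡ F) ⊎ (∃ λ v → isIsolated G v ≡ true × isoFace v ≡ F)
    fs F with pos-surj {L} F
    ... | ℓ , p , refl with surj p
    ... | (u , v) , inj₁ h , e = inj₁ (u , v , h , pos-cong L! _ _ e)
    ... | (v , _) , inj₂ (refl , i) , e = inj₂ (v , isolated⁺ G i , pos-cong L! _ _ e)
    OnF : Fin (length L) → Fin n → Set
    OnF F v = (∃ λ w → adj G v w ≡ true × face v w ≡ F) ⊎ (isIsolated G v ≡ true × isoFace v ≡ F)
    onf : ∀ {ℓ v} → On H lab ℓ v → (p : ℓ ∈ L) → OnF (pos p) v
    onf (w , inj₁ h , e) p = inj₁ (w , h , pos-cong L! _ _ e)
    onf (w , inj₂ (refl , i) , e) p = inj₂ (isolated⁺ G i , pos-cong L! _ _ e)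
    link : ∀ {u v} → Link H lab u v → Star (λ u v → adj G u v ≡ true ⊎ (∃ λ F → OnF F u × OnF F v)) u v
    link (inj₁ h) = inj₁ h ◅ ε
    link (inj₂ (ℓ , (w , o , refl) , q)) = inj₂ (pos (lab∈ _) , onf (w , o , refl) (lab∈ _) , onf q (lab∈ _)) ◅ ε
    genus : 2 + numEdges G + numWalks G ρ ≤ 2 * g + n + 2 * length L
    genus = ≤-trans (+-monoʳ-≤ (2 + numEdges G) walks≤) (*-cancelˡ-≤ 2 (subst₂ _≤_ (trans (cong (λ t → 4 + t + 2 * length R) (#d-edges G simple)) (a₁ (numEdges G) (length R))) (a₂ g n (length L)) gen))
      where
      a₁ : ∀ E W → 4 + (E + E) + 2 * W ≡ 2 * (2 + E + W)
      a₁ = solve-∀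
      a₂ : ∀ g n f → 4 * g + 2 * n + 4 * f ≡ 2 * (2 * g + n + 2 * f)
      a₂ = solve-∀

-- Euler inequalities

len-cart : ∀ {A B : Set} (xs : List A) (ys : List B) → length (cartesianProduct xs ys) ≡ length xs * length ys
len-cart [] ys = refl
len-cart (x ∷ xs) ys = trans (length-++ (map (x ,_) ys)) (cong₂ _+_ (length-map (x ,_) ys) (len-cart xs ys))

length-split : ∀ {A : Set} {P : A → Set} (P? : ∀ x → Dec (P x)) xs → length (filter P? xs) + length (filter (λ x → ¬? (P? x)) xs) ≡ length xs
length-split P? [] = refl
length-split P? (x ∷ xs) with P? x
... | yes _ = cong suc (length-split P? xs)
... | no _ = trans (+-suc _ _) (cong suc (length-split P? xs))

fan : ∀ {n} → Adj n → List (Fin n) → List (Dart n)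
fan A [] = []
fan A (x ∷ xs) = map (x ,_) (nbrs A x) ++ fan A xs

∈-fan : ∀ {n} (A : Adj n) xs {u v} → (u , v) ∈ fan A xs → u ∈ xs × A u v ≡ true
∈-fan A (x ∷ xs) m with ∈-++⁻ (map (x ,_) (nbrs A x)) m
... | inj₂ q = let a , b = ∈-fan A xs q in there a , b
... | inj₁ q with ∈-map⁻ (x ,_) q
... | v , r , refl = here refl , ∈-nbrs⁻ A r

fan! : ∀ {n} (A : Adj n) {xs} → Unique xs → Unique (fan A xs)
fan! A {[]} u = []
fan! A {x ∷ xs} (h ∷ u) = Unique-++⁺ (Unique-map⁺ (cong proj₂) (nbrs! A x)) (fan! A u) disj
  where
  disj : ∀ {d} → ¬ (d ∈ map (x ,_) (nbrs A x) × d ∈ fan A xs)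
  disj {u , v} (p , q) with ∈-map⁻ (x ,_) p
  ... | _ , _ , refl = All-lookup h (proj₁ (∈-fan A xs q)) refl

fan-length : ∀ {n} (A : Adj n) xs {c} → (∀ {x} → x ∈ xs → c ≤ deg A x) → length xs * c ≤ length (fan A xs)
fan-length A [] h = z≤n
fan-length A (x ∷ xs) {c} h = subst (c + length xs * c ≤_) (sym (length-++ (map (x ,_) (nbrs A x))))
  (+-mono-≤ (subst (c ≤_) (sym (length-map (x ,_) (nbrs A x))) (h (here refl))) (fan-length A xs (h ∘ there)))

fan-bound : ∀ {n} (A : Adj n) {xs c} → Unique xs → (∀ {x} → x ∈ xs → c ≤ deg A x) → length xs * c ≤ #d A
fan-bound A {xs} u h = ≤-trans (fan-length A xs h) (⊆-length (fan! A u) (λ { {p , q} m → ∈-darts⁺ A (proj₂ (∈-fan A xs m)) }))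

iso? : ∀ {n} (A : Adj n) v → Dec (iso A v)
iso? A v = all? (λ w → ¬? (A v w ≟ᵇ true))

isos nonisos : ∀ {n} → Adj n → List (Fin n)
isos {n} A = filter (iso? A) (allFin n)
nonisos {n} A = filter (λ v → ¬? (iso? A v)) (allFin n)

iso-count : ∀ {n} (A : Adj n) → length (isos A) + length (nonisos A) ≡ n
iso-count {n} A = trans (length-split (iso? A) (allFin n)) (length-tabulate {n = n} id)

∈-nonisos : ∀ {n} (A : Adj n) {u v} → A u v ≡ true → u ∈ nonisos A
∈-nonisos A {u} {v} h = ∈-filter⁺ (λ v → ¬? (iso? A v)) (∈-allFin u) (λ i → i v h)

nonisos⁻ : ∀ {n} (A : Adj n) {u} → u ∈ nonisos A → ∃ λ v → A u v ≡ true
nonisos⁻ {n} A {u} m with any? (λ v → A u v ≟ᵇ true)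
... | yes p = p
... | no p = ⊥-elim (proj₂ (∈-filter⁻ (λ v → ¬? (iso? A v)) {xs = allFin n} m) (λ w h → p (w , h)))

pick : {P : A → Set} → (∀ x → Dec (P x)) → A → List A → A
pick P? x₀ [] = x₀
pick P? x₀ (x ∷ xs) = if does (P? x) then x else pick P? x₀ xs

pick-ok : {P : A → Set} (P? : ∀ x → Dec (P x)) (x₀ : A) {xs : List A} {x : A} → x ∈ xs → P x → P (pick P? x₀ xs)
pick-ok P? x₀ {y ∷ ys} m p with P? y
pick-ok P? x₀ {y ∷ ys} m p | yes q = q
pick-ok P? x₀ {y ∷ ys} (here refl) p | no q = ⊥-elim (q p)
pick-ok P? x₀ {y ∷ ys} (there m) p | no q = pick-ok P? x₀ m p

module Euler {g n} {A : Adj n} (Q : QE g A) {d₀ : Dart n} (h₀ : isD A d₀) where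
  open QE Q

  -- Follow a chain of links from the isolated vertex to a vertex with a neighbour. As long as it
  -- meets isolated vertices only, the face stays the same, because such a vertex lies on a single
  -- face. Hence every face contains a dart.
  iso-face : ∀ {v} → iso A v → ∀ {u} → Star (Link A lab) v u → (∃ λ w → A u w ≡ true) → ∃ λ d → isD A d × lab d ≡ lab (v , v)
  iso-face i ε (w , h) = ⊥-elim (i w h)
  iso-face i (inj₁ h ◅ r) k = ⊥-elim (i _ h)
  iso-face i (inj₂ (ℓ , (w , inj₁ h , e) , q) ◅ r) k = ⊥-elim (i _ h)
  iso-face i (inj₂ (ℓ , (w , inj₂ (refl , _) , refl) , (w' , inj₁ h , e')) ◅ r) k = _ , h , e'
  iso-face i (inj₂ (ℓ , (w , inj₂ (refl , _) , refl) , (w' , inj₂ (refl , i') , e')) ◅ r) k =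
    let d , h , e = iso-face i' r k in d , h , trans e e'

  faceDart : ∀ {ℓ} → ℓ ∈ L → ∃ λ d → isD A d × lab d ≡ ℓ
  faceDart m with surj m
  ... | d , inj₁ h , e = d , h , e
  ... | (v , _) , inj₂ (refl , i) , refl = iso-face i (conn v (proj₁ d₀)) (proj₂ d₀ , h₀)

  -- Each face has a walk made of darts, and these come on top of the trivial walks of the isolated
  -- vertices.
  L+iso≤R : length L + length (isos A) ≤ length R
  L+iso≤R = subst (_≤ length R) size (rel-length Rel uniq ex inj)
    where
    src : List (ℕ ⊎ Fin n)
    src = map inj₁ L ++ map inj₂ (isos A)
    size : length src ≡ length L + length (isos A)
    size = trans (length-++ (map inj₁ L)) (cong₂ _+_ (length-map inj₁ L) (length-map inj₂ (isos A)))
    Rel : ℕ ⊎ Fin n → Dart n → Set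
    Rel (inj₁ ℓ) r = isD A r × lab r ≡ ℓ
    Rel (inj₂ v) r = r ≡ (v , v)
    uniq : Unique src
    uniq = Unique-++⁺ (Unique-map⁺ (λ { refl → refl }) L!) (Unique-map⁺ (λ { refl → refl }) (filter⁺ (iso? A) (allFin⁺ n))) disj
      where
      disj : ∀ {z} → ¬ (z ∈ map inj₁ L × z ∈ map inj₂ (isos A))
      disj (p , q) with ∈-map⁻ inj₁ p | ∈-map⁻ inj₂ q
      ... | _ , _ , refl | _ , _ , ()
    ex : ∀ {z} → z ∈ src → ∃ λ r → r ∈ R × Rel z r
    ex m with ∈-++⁻ (map inj₁ L) m
    ... | inj₁ p with ∈-map⁻ inj₁ p
    ... | ℓ , q , refl with faceDart q
    ... | d , h , e with cov (inj₁ h)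
    ... | r , r∈ , t = r , r∈ , nxt-D t h , trans (lab-reach h t) e
    ex m | inj₂ p with ∈-map⁻ inj₂ p
    ... | v , q , refl with cov (inj₂ (refl , proj₂ (∈-filter⁻ (iso? A) {xs = allFin n} q)))
    ... | r , r∈ , t = r , r∈ , iso-reach t
    inj : ∀ {z z' r} → z ∈ src → z' ∈ src → Rel z r → Rel z' r → z ≡ z'
    inj {inj₁ _} {inj₁ _} _ _ (_ , refl) (_ , refl) = refl
    inj {inj₁ _} {inj₂ _} _ _ (h , _) refl = ⊥-elim (irr h)
    inj {inj₂ _} {inj₁ _} _ _ refl (h , _) = ⊥-elim (irr h)
    inj {inj₂ _} {inj₂ _} _ _ refl refl = refl

  euler : 4 + #d A + 2 * length (isos A) ≤ 4 * g + 2 * n + 2 * length L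
  euler = +-cancelʳ-≤ (2 * length L) _ _ (≤-trans (≤-reflexive (a₁ (#d A) (length (isos A)) (length L)))
    (≤-trans (+-monoʳ-≤ (4 + #d A) (*-monoʳ-≤ 2 L+iso≤R)) (≤-trans gen (≤-reflexive (a₂ (4 * g + 2 * n) (length L))))))
    where
    a₁ : ∀ D i l → 4 + D + 2 * i + 2 * l ≡ 4 + D + 2 * (l + i)
    a₁ = solve-∀
    a₂ : ∀ c l → c + 4 * l ≡ c + 2 * l + 2 * l
    a₂ = solve-∀

  dl : ℕ → Dart n
  dl ℓ = pick (λ d → (A (proj₁ d) (proj₂ d) ≟ᵇ true) ×-dec (lab d ≟ⁿ ℓ)) d₀ allD

  dl-ok : ∀ {ℓ} → ℓ ∈ L → isD A (dl ℓ) × lab (dl ℓ) ≡ ℓ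
  dl-ok {ℓ} m = let d , h , e = faceDart m in pick-ok (λ d → (A (proj₁ d) (proj₂ d) ≟ᵇ true) ×-dec (lab d ≟ⁿ ℓ)) d₀ (∈-allD d) (h , e)

  iter-D : ∀ k {d} → isD A d → isD A (iter nxt k d)
  iter-D k {d} h = nxt-D (iter⇒reach nxt k d) h

  iter-lab : ∀ k {d} → isD A d → lab (iter nxt k d) ≡ lab d
  iter-lab k {d} h = lab-reach h (iter⇒reach nxt k d)

  faces : ∀ k → (∀ {d i j} → isD A d → i < j → j < k → iter nxt i d ≢ iter nxt j d) → length L * k ≤ #d A
  faces k dist = subst (_≤ #d A) (trans (len-cart L (upTo k)) (cong (length L *_) (length-upTo k)))
    (inj-length f (cartesianProduct⁺ L! (upTo⁺ k)) into inj)
    where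
    f : ℕ × ℕ → Dart n
    f (ℓ , i) = iter nxt i (dl ℓ)
    into : ∀ {z} → z ∈ cartesianProduct L (upTo k) → f z ∈ darts A
    into {ℓ , i} m = ∈-darts⁺ A (iter-D i (proj₁ (dl-ok (proj₁ (∈-cartesianProduct⁻ L (upTo k) m)))))
    inj : ∀ {z z'} → z ∈ cartesianProduct L (upTo k) → z' ∈ cartesianProduct L (upTo k) → f z ≡ f z' → z ≡ z'
    inj {ℓ , i} {ℓ' , i'} m m' e with ∈-cartesianProduct⁻ L (upTo k) m | ∈-cartesianProduct⁻ L (upTo k) m'
    ... | p , q | p' , q' with dl-ok p | dl-ok p'
    ... | h , l | h' , l' with trans (sym l) (trans (sym (iter-lab i h)) (trans (cong lab e) (trans (iter-lab i' h') l')))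
    ... | refl with <-cmp i i'
    ... | tri< lt _ _ = ⊥-elim (dist h lt (∈-upTo⁻ q') e)
    ... | tri≈ _ refl _ = refl
    ... | tri> _ _ lt = ⊥-elim (dist h lt (∈-upTo⁻ q) (sym e))

  nxt≢ : ∀ {d} → isD A d → d ≢ nxt d
  nxt≢ h e = irr (subst (λ t → A t _ ≡ true) (cong proj₁ e) h)

  -- The walk of an isolated edge is charged to one of its end vertices.
  faces₃ : length L * 3 ≤ #d A + length (nonisos A)
  faces₃ = subst₂ _≤_ (len-cart L (upTo 3)) (trans (length-++ (darts A)) (cong (#d A +_) (length-map _ (nonisos A))))
    (inj-length f (cartesianProduct⁺ L! (upTo⁺ 3)) into inj)
    where
    ys : List (Dart n)
    ys = darts A ++ map (λ v → v , v) (nonisos A)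
    third : Dart n → Dart n
    third d = if does (nxt (nxt d) ≟ᵈ d) then (proj₁ d , proj₁ d) else nxt (nxt d)
    f : ℕ × ℕ → Dart n
    f (ℓ , 0) = dl ℓ
    f (ℓ , 1) = nxt (dl ℓ)
    f (ℓ , suc (suc _)) = third (dl ℓ)
    Good : ℕ → ℕ → Dart n → Set
    Good ℓ i e = (e ≡ iter nxt i (dl ℓ) × (i ≡ 2 → nxt (nxt (dl ℓ)) ≢ dl ℓ)) ⊎
                 (i ≡ 2 × e ≡ (proj₁ (dl ℓ) , proj₁ (dl ℓ)) × nxt (nxt (dl ℓ)) ≡ dl ℓ)
    good : ∀ ℓ {i} → i < 3 → Good ℓ i (f (ℓ , i))
    good ℓ {0} _ = inj₁ (refl , λ ())
    good ℓ {1} _ = inj₁ (refl , λ ())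
    good ℓ {2} _ with nxt (nxt (dl ℓ)) ≟ᵈ dl ℓ
    ... | yes e = inj₂ (refl , refl , e)
    ... | no ne = inj₁ (refl , λ _ → ne)
    good ℓ {suc (suc (suc _))} (s≤s (s≤s (s≤s ())))
    into : ∀ {z} → z ∈ cartesianProduct L (upTo 3) → f z ∈ ys
    into {ℓ , i} m with ∈-cartesianProduct⁻ L (upTo 3) m
    ... | p , q with dl-ok p | good ℓ (∈-upTo⁻ q)
    ... | h , _ | inj₁ (e , _) = subst (_∈ ys) (sym e) (∈-++⁺ˡ (∈-darts⁺ A (iter-D i h)))
    ... | h , _ | inj₂ (_ , e , _) = subst (_∈ ys) (sym e) (∈-++⁺ʳ (darts A) (∈-map⁺ (λ v → v , v) (∈-nonisos A h)))
    order : ∀ {ℓ i j} → isD A (dl ℓ) → i < j → j < 3 → (j ≡ 2 → nxt (nxt (dl ℓ)) ≢ dl ℓ) → iter nxt i (dl ℓ) ≢ iter nxt j (dl ℓ)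
    order {ℓ} {0} {1} h _ _ _ e = nxt≢ h e
    order {ℓ} {0} {2} h _ _ k e = k refl (sym e)
    order {ℓ} {1} {2} h _ _ _ e = nxt≢ (nxt-cl h) e
    order {ℓ} {1} {1} h (s≤s ()) _ _ e
    order {ℓ} {suc (suc _)} {1} h (s≤s ()) _ _ e
    order {ℓ} {suc (suc _)} {2} h (s≤s (s≤s ())) _ _ e
    order {ℓ} {_} {suc (suc (suc _))} h _ (s≤s (s≤s (s≤s ()))) _ e
    inj : ∀ {z z'} → z ∈ cartesianProduct L (upTo 3) → z' ∈ cartesianProduct L (upTo 3) → f z ≡ f z' → z ≡ z'
    inj {ℓ , i} {ℓ' , i'} m m' e with ∈-cartesianProduct⁻ L (upTo 3) m | ∈-cartesianProduct⁻ L (upTo 3) m'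
    ... | p , q | p' , q' with dl-ok p | dl-ok p' | good ℓ (∈-upTo⁻ q) | good ℓ' (∈-upTo⁻ q')
    ... | h , l | h' , l' | inj₁ (c , k) | inj₂ (_ , c' , _) = ⊥-elim (irr (subst (isD A) (trans (sym c) (trans e c')) (iter-D i h)))
    ... | h , l | h' , l' | inj₂ (_ , c , _) | inj₁ (c' , k') = ⊥-elim (irr (subst (isD A) (trans (sym c') (trans (sym e) c)) (iter-D i' h')))
    ... | h , l | h' , l' | inj₂ (refl , c , t) | inj₂ (refl , c' , t') = cong (_, 2) (trans (sym l) (trans (cong lab same) l'))
      where
      fst≡ : proj₁ (dl ℓ) ≡ proj₁ (dl ℓ')
      fst≡ = cong proj₁ (trans (sym c) (trans e c'))
      snd≡ : proj₂ (dl ℓ) ≡ proj₂ (dl ℓ')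
      snd≡ = sym (reach-fix ρfix (Cyc.tr (cyc (proj₁ (dl ℓ))) h (subst (λ t → A t (proj₂ (dl ℓ')) ≡ true) (sym fst≡) h')))
        where
        ρfix : ρ (proj₁ (dl ℓ)) (proj₂ (dl ℓ)) ≡ proj₂ (dl ℓ)
        ρfix = trans (cong (λ t → ρ t (proj₂ (dl ℓ))) (sym (cong proj₁ t))) (cong proj₂ t)
      same : dl ℓ ≡ dl ℓ'
      same = cong₂ _,_ fst≡ snd≡
    ... | h , l | h' , l' | inj₁ (c , k) | inj₁ (c' , k') with trans (sym l) (trans (sym (iter-lab i h)) (trans (cong lab (trans (sym c) (trans e c'))) (trans (iter-lab i' h') l')))
    ... | refl with <-cmp i i'
    ... | tri< lt _ _ = ⊥-elim (order h lt (∈-upTo⁻ q') k' (trans (sym c) (trans e c')))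
    ... | tri≈ _ refl _ = refl
    ... | tri> _ _ lt = ⊥-elim (order h lt (∈-upTo⁻ q) k (trans (sym c') (trans (sym e) c)))

  -- Three times `euler`, with the faces eliminated by `faces₃`. Isolated vertices cancel; therefore
  -- the inequality can also be read as a lower bound on the number of non-isolated vertices.
  sparse : #d A ≤ 12 * g + 8 * length (nonisos A)
  sparse = +-cancelʳ-≤ (2 * #d A + 6 * i) _ _ (≤-trans (≤-trans (≤-reflexive (a₁ (#d A) i)) (≤-trans (m≤n+m _ 12) (≤-trans (≤-reflexive (a₂ (#d A) i)) (*-monoʳ-≤ 3 euler))))
     (≤-trans (≤-reflexive (trans (cong (λ t → 3 * (4 * g + 2 * t + 2 * length L)) (sym (iso-count A))) (a₃ g i k (length L))))
     (≤-trans (+-monoʳ-≤ (12 * g + (6 * i + 6 * k)) (*-monoʳ-≤ 2 faces₃)) (≤-reflexive (a₄ g i k (#d A))))))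
    where
    i = length (isos A)
    k = length (nonisos A)
    a₁ : ∀ D i → D + (2 * D + 6 * i) ≡ 3 * D + 6 * i
    a₁ = solve-∀
    a₂ : ∀ D i → 12 + (3 * D + 6 * i) ≡ 3 * (4 + D + 2 * i)
    a₂ = solve-∀
    a₃ : ∀ g i k l → 3 * (4 * g + 2 * (i + k) + 2 * l) ≡ 12 * g + (6 * i + 6 * k) + 2 * (l * 3)
    a₃ = solve-∀
    a₄ : ∀ g i k D → 12 * g + (6 * i + 6 * k) + 2 * (D + k) ≡ (12 * g + 8 * k) + (2 * D + 6 * i)
    a₄ = solve-∀

-- Walks alternate between the two sides and no edge is isolated, so every face has size at least 4.
module Bipartite {g n} {J : Adj n} (Q : QE g J) (Xs Ys : List (Fin n)) (X! : Unique Xs)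
  (disjoint : ∀ {v} → v ∈ Xs → v ∉ Ys)
  (bip : ∀ {u v} → J u v ≡ true → (u ∈ Xs × v ∈ Ys) ⊎ (u ∈ Ys × v ∈ Xs))
  (deg3 : ∀ {v} → v ∈ Xs → 3 ≤ deg J v) where
  open QE Q

  twice : length Xs * 3 + length Xs * 3 ≤ #d J
  twice = ≤-trans (+-mono-≤ (fan-length J Xs deg3) (≤-trans (fan-length J Xs deg3) (≤-reflexive (sym (length-map swap (fan J Xs))))))
    (≤-trans (≤-reflexive (sym (length-++ (fan J Xs)))) (⊆-length (Unique-++⁺ (fan! J X!) (Unique-map⁺ (λ { refl → refl }) (fan! J X!)) disj) sub))
    where
    swap : Dart n → Dart n
    swap (u , v) = v , u
    disj : ∀ {d} → ¬ (d ∈ fan J Xs × d ∈ map swap (fan J Xs))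
    disj (p , q) with ∈-map⁻ swap q
    disj (p , q) | (u , v) , r , refl with ∈-fan J Xs p | ∈-fan J Xs r
    ... | a , h | b , k with bip k
    ... | inj₁ (_ , y) = disjoint a y
    ... | inj₂ (y , _) = disjoint b y
    sub : ∀ {d} → d ∈ fan J Xs ++ map swap (fan J Xs) → d ∈ darts J
    sub {d} m with ∈-++⁻ (fan J Xs) m
    ... | inj₁ p = ∈-darts⁺ J (proj₂ (∈-fan J Xs p))
    ... | inj₂ p with ∈-map⁻ swap p
    ... | (u , v) , r , refl = ∈-darts⁺ J (symA (proj₂ (∈-fan J Xs r)))

  swapped : ∀ {u v} → J u v ≡ true → (u ∈ Xs → v ∈ Xs → ⊥) × (u ∈ Ys → v ∈ Ys → ⊥)
  swapped h with bip h
  ... | inj₁ (x , y) = (λ _ x' → disjoint x' y) , (λ y' _ → disjoint x y')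
  ... | inj₂ (y , x) = (λ x' _ → disjoint x' y) , (λ _ y' → disjoint x y')

  noturn : ∀ {x y} → x ∈ Xs → J x y ≡ true → ρ x y ≢ y
  noturn {x} {y} m h e = <-irrefl refl (≤-trans (s≤s (s≤s z≤n)) (≤-trans (deg3 m) (⊆-length {ys = y ∷ []} (nbrs! J x)
    (λ k → here (reach-fix e (Cyc.tr (cyc x) h (∈-nbrs⁻ J k)))))))

  -- A walk returns after two steps only if it turns back at both ends of an edge. One end lies in
  -- `Xs`, where three neighbours exclude this (`noturn`). A return after three steps contradicts
  -- the alternation of sides.
  dist : ∀ {d i j} → isD J d → i < j → j < 4 → iter nxt i d ≢ iter nxt j d
  dist {d} {i} {j} h lt l4 e = go i j lt l4 e
    where
    side : ∀ {d} → isD J d → proj₁ d ≢ proj₁ (nxt d)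
    side h refl = irr h
    two : ∀ {d} → isD J d → d ≢ nxt (nxt d)
    two {x , y} h e with bip h
    ... | inj₁ (mx , my) = noturn mx h (trans (cong (λ t → ρ t y) (cong proj₁ e)) (sym (cong proj₂ e)))
    ... | inj₂ (my , mx) = noturn mx (symA h) (sym (cong proj₁ e))
    three : ∀ {d} → isD J d → d ≢ nxt (nxt (nxt d))
    three {x , y} h e with bip h | bip (nxt-cl (nxt-cl h)) | cong proj₁ e
    ... | inj₁ (mx , my) | inj₁ (mx' , my') | q = disjoint mx (subst (_∈ Ys) (sym q) my')
    ... | inj₂ (my , mx) | inj₂ (my' , mx') | q = disjoint mx' (subst (_∈ Ys) q my)
    ... | inj₁ (mx , my) | inj₂ (my' , mx') | q = proj₂ (swapped (nxt-cl h)) my my'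
    ... | inj₂ (my , mx) | inj₁ (mx' , my') | q = proj₁ (swapped (nxt-cl h)) mx mx'
    go : ∀ i j → i < j → j < 4 → iter nxt i d ≢ iter nxt j d
    go 0 1 _ _ e = side h (cong proj₁ e)
    go 0 2 _ _ e = two h e
    go 0 3 _ _ e = three h e
    go 1 2 _ _ e = side (nxt-cl h) (cong proj₁ e)
    go 1 3 _ _ e = two (nxt-cl h) e
    go 2 3 _ _ e = side (nxt-cl (nxt-cl h)) (cong proj₁ e)
    go (suc _) 1 (s≤s ()) _ e
    go (suc (suc _)) 2 (s≤s (s≤s ())) _ e
    go (suc (suc (suc _))) 3 (s≤s (s≤s (s≤s ()))) _ e
    go _ (suc (suc (suc (suc _)))) _ (s≤s (s≤s (s≤s (s≤s ())))) e

  none⇒[] : (∀ d → J (proj₁ d) (proj₂ d) ≢ true) → ∀ {zs c} → (∀ {v} → v ∈ zs → 3 ≤ deg J v) → length zs ≤ c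
  none⇒[] none {[]} d = z≤n
  none⇒[] none {z ∷ zs} d with nbrs J z | (λ {y} → ∈-nbrs⁻ J {z} {y}) | d (here refl)
  ... | y ∷ ys | mem | _ = ⊥-elim (none (z , y) (mem (here refl)))

  -- With x and y the sizes of the sides, faces of size at least 4 give at most 8 g + 4 (x + y)
  -- darts, and degrees at least 3 in `Xs` give at least 6 x.
  bound : length Xs ≤ 4 * g + 2 * length Ys
  bound with decD (λ d → J (proj₁ d) (proj₂ d) ≟ᵇ true)
  ... | no none = none⇒[] (λ d h → none (d , h)) deg3
  ... | yes (d₀ , h₀) = main
    where
    open Euler Q h₀
    x = length Xs
    y = length Ys
    i = length (isos J)
    k = length (nonisos J)
    k≤ : k ≤ x + y
    k≤ = ≤-trans (⊆-length (filter⁺ (λ v → ¬? (iso? J v)) (allFin⁺ n)) sub) (≤-reflexive (length-++ Xs))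
      where
      sub : ∀ {v} → v ∈ nonisos J → v ∈ Xs ++ Ys
      sub m with bip (proj₂ (nonisos⁻ J m))
      ... | inj₁ (p , _) = ∈-++⁺ˡ p
      ... | inj₂ (p , _) = ∈-++⁺ʳ Xs p
    ineq : #d J ≤ 8 * g + 4 * k
    ineq = +-cancelʳ-≤ (#d J + 4 * i) _ _ (≤-trans (≤-trans (≤-reflexive (a₁ (#d J) i)) (≤-trans (m≤n+m _ 8) (≤-trans (≤-reflexive (a₂ (#d J) i)) (*-monoʳ-≤ 2 euler))))
      (≤-trans (≤-reflexive (trans (cong (λ t → 2 * (4 * g + 2 * t + 2 * length L)) (sym (iso-count J))) (a₃ g i k (length L))))
      (≤-trans (+-monoʳ-≤ (8 * g + (4 * i + 4 * k)) (faces 4 dist)) (≤-reflexive (a₄ g i k (#d J))))))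
      where
      a₁ : ∀ D i → D + (D + 4 * i) ≡ 2 * D + 4 * i
      a₁ = solve-∀
      a₂ : ∀ D i → 8 + (2 * D + 4 * i) ≡ 2 * (4 + D + 2 * i)
      a₂ = solve-∀
      a₃ : ∀ g i k l → 2 * (4 * g + 2 * (i + k) + 2 * l) ≡ 8 * g + (4 * i + 4 * k) + l * 4
      a₃ = solve-∀
      a₄ : ∀ g i k D → 8 * g + (4 * i + 4 * k) + D ≡ (8 * g + 4 * k) + (D + 4 * i)
      a₄ = solve-∀
    main : x ≤ 4 * g + 2 * y
    main = *-cancelˡ-≤ 2 (+-cancelʳ-≤ (4 * x) _ _ (≤-trans (≤-reflexive (b₁ x)) (≤-trans twice (≤-trans ineq
      (≤-trans (+-monoʳ-≤ (8 * g) (*-monoʳ-≤ 4 k≤)) (≤-reflexive (b₂ g x y)))))))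
      where
      b₁ : ∀ x → 2 * x + 4 * x ≡ x * 3 + x * 3
      b₁ = solve-∀
      b₂ : ∀ g x y → 8 * g + 4 * (x + y) ≡ 2 * (4 * g + 2 * y) + 4 * x
      b₂ = solve-∀

-- Linear algebra over the field with two elements

⊕ : (A → Bool) → List A → Bool
⊕ f [] = false
⊕ f (x ∷ xs) = f x xor ⊕ f xs

xor-cancel : ∀ {a b} → a xor b ≡ false → a ≡ b
xor-cancel {true} {true} _ = refl
xor-cancel {false} {false} _ = refl

xor-mid : ∀ a b c d → (a xor b) xor (c xor d) ≡ (a xor c) xor (b xor d)
xor-mid true true true d = refl
xor-mid true true false true = refl
xor-mid true true false false = refl
xor-mid true false true true = refl
xor-mid true false true false = refl
xor-mid true false false d = refl
xor-mid false true true true = refl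
xor-mid false true true false = refl
xor-mid false true false d = refl
xor-mid false false c d = refl

⊕-cong : ∀ {f h : A → Bool} xs → (∀ {x} → x ∈ xs → f x ≡ h x) → ⊕ f xs ≡ ⊕ h xs
⊕-cong [] e = refl
⊕-cong (x ∷ xs) e = cong₂ _xor_ (e (here refl)) (⊕-cong xs (e ∘ there))

⊕-none : ∀ {f : A → Bool} xs → (∀ {x} → x ∈ xs → f x ≡ false) → ⊕ f xs ≡ false
⊕-none [] e = refl
⊕-none (x ∷ xs) e = cong₂ _xor_ (e (here refl)) (⊕-none xs (e ∘ there))

⊕-xor : ∀ (f h : A → Bool) xs → ⊕ (λ x → f x xor h x) xs ≡ ⊕ f xs xor ⊕ h xs
⊕-xor f h [] = refl
⊕-xor f h (x ∷ xs) = trans (cong ((f x xor h x) xor_) (⊕-xor f h xs)) (xor-mid (f x) (h x) (⊕ f xs) (⊕ h xs))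

⊕-++ : ∀ (f : A → Bool) xs {ys} → ⊕ f (xs ++ ys) ≡ ⊕ f xs xor ⊕ f ys
⊕-++ f [] = refl
⊕-++ f (x ∷ xs) {ys} = trans (cong (f x xor_) (⊕-++ f xs)) (sym (xor-assoc (f x) (⊕ f xs) (⊕ f ys)))

⊕-map : ∀ {A B : Set} (f : B → Bool) (h : A → B) xs → ⊕ f (map h xs) ≡ ⊕ (f ∘ h) xs
⊕-map f h [] = refl
⊕-map f h (x ∷ xs) = cong (f (h x) xor_) (⊕-map f h xs)

⊕-swap : ∀ {A B : Set} (f : A → B → Bool) xs ys → ⊕ (λ x → ⊕ (f x) ys) xs ≡ ⊕ (λ y → ⊕ (λ x → f x y) xs) ys
⊕-swap f [] ys = sym (⊕-none ys (λ _ → refl))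
⊕-swap f (x ∷ xs) ys = trans (cong (⊕ (f x) ys xor_) (⊕-swap f xs ys)) (sym (⊕-xor (f x) (λ y → ⊕ (λ x → f x y) xs) ys))

⊕-∧ : ∀ b (f : A → Bool) xs → ⊕ (λ x → b ∧ f x) xs ≡ b ∧ ⊕ f xs
⊕-∧ true f xs = refl
⊕-∧ false f xs = ⊕-none xs (λ _ → refl)

⊕-insert : ∀ (f : A → Bool) as {x bs} → ⊕ f (as ++ x ∷ bs) ≡ f x xor ⊕ f (as ++ bs)
⊕-insert f [] = refl
⊕-insert f (a ∷ as) {x} {bs} = trans (cong (f a xor_) (⊕-insert f as))
  (trans (sym (xor-assoc (f a) (f x) _)) (trans (cong (_xor ⊕ f (as ++ bs)) (xor-comm (f a) (f x))) (xor-assoc (f x) (f a) _)))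

Unique-remove : ∀ (as : List A) {x bs} → Unique (as ++ x ∷ bs) → x ∉ as ++ bs × Unique (as ++ bs)
Unique-remove [] (h ∷ u) = (λ m → All-lookup h m refl) , u
Unique-remove (a ∷ as) {x} {bs} (h ∷ u) with Unique-remove as u
... | p , q = (λ { (here refl) → All-lookup h (∈-++⁺ʳ as (here refl)) refl ; (there m) → p m }) , All-tabulate (λ m → All-lookup h (grow m)) ∷ q
  where
  grow : ∀ {t} → t ∈ as ++ bs → t ∈ as ++ x ∷ bs
  grow m with ∈-++⁻ as m
  ... | inj₁ p = ∈-++⁺ˡ p
  ... | inj₂ p = ∈-++⁺ʳ as (there p)

∈-grow : ∀ (as : List A) {x bs t} → t ∈ as ++ bs → t ∈ as ++ x ∷ bs
∈-grow as m with ∈-++⁻ as m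
... | inj₁ p = ∈-++⁺ˡ p
... | inj₂ p = ∈-++⁺ʳ as (there p)

⊕-set : ∀ (f : A → Bool) {xs ys} → Unique xs → Unique ys → (∀ {x} → x ∈ xs → x ∈ ys) → (∀ {x} → x ∈ ys → x ∈ xs) → ⊕ f xs ≡ ⊕ f ys
⊕-set f {[]} {[]} _ _ _ _ = refl
⊕-set f {[]} {y ∷ ys} _ _ _ b with b (here refl)
... | ()
⊕-set f {x ∷ xs} {ys} (h ∷ u) v s b with ∈-∃++ (s (here refl))
... | as , bs , refl = trans (cong (f x xor_) (⊕-set f u (proj₂ (Unique-remove as v))
    (λ m → ∈-remove as (s (there m)) (λ e → All-lookup h m (sym e))) back)) (sym (⊕-insert f as))
  where
  back : ∀ {z} → z ∈ as ++ bs → z ∈ xs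
  back m with b (∈-grow as m)
  ... | here refl = ⊥-elim (proj₁ (Unique-remove as v) m)
  ... | there q = q

⊕-one : ∀ {f : A → Bool} {xs x₀} → Unique xs → x₀ ∈ xs → (∀ {x} → x ∈ xs → x ≢ x₀ → f x ≡ false) → ⊕ f xs ≡ f x₀
⊕-one {f = f} {x₀ = x₀} u m z with ∈-∃++ m
... | as , bs , refl = trans (⊕-insert f as) (trans (cong (f x₀ xor_) (⊕-none (as ++ bs)
    (λ q → z (∈-grow as q) (λ { refl → proj₁ (Unique-remove as u) q })))) (xor-identityʳ (f x₀)))

-- Gaussian elimination: an equation containing the unknown `j` is solved for it and substituted
-- into the others. The number of equations is a separate argument for the sake of termination, as
-- the reduced system is not a subterm.
solveₖ : (_≟ᴬ_ : DecidableEquality A) (k : ℕ) (es : List (A → Bool)) → length es ≡ k → {vs : List A} → Unique vs → length es < length vs →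
  ∃ λ (x : A → Bool) → (∀ {e : A → Bool} → e ∈ es → ⊕ (λ j → e j ∧ x j) vs ≡ false) × (∃ λ (j : A) → j ∈ vs × x j ≡ true)
solveₖ _≟ᴬ_ k [] _ {v ∷ vs} u lt = (λ _ → true) , (λ ()) , v , here refl , refl
solveₖ {A} _≟ᴬ_ (suc k) (e ∷ es) ek {vs} u lt with anyL? (λ j → e j ≟ᵇ true) vs
... | no none with solveₖ _≟ᴬ_ k es (suc-injective ek) u (<-trans (n<1+n _) lt)
... | x , sol , nz = x , (λ { (here refl) → ⊕-none vs (λ m → cong (_∧ x _) (≢true⇒false (λ h → none (lose m h)))) ; (there m) → sol m }) , nz
solveₖ {A} _≟ᴬ_ (suc k) (e ∷ es) ek {vs} u lt | yes p with find p
... | j , j∈ , ej with ∈-∃++ j∈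
... | as , bs , refl = x , sol' , j₀ , ∈-grow as j₀∈ , trans (x-other j₀∈) xj₀
  where
  red : (A → Bool) → A → Bool
  red e' i = e' i xor (e' j ∧ e i)
  u' = Unique-remove as u
  rec = solveₖ _≟ᴬ_ k (map red es) (trans (length-map red es) (suc-injective ek)) {as ++ bs} (proj₂ u')
    (≤-pred (subst₂ _<_ (cong suc (sym (length-map red es))) (length-remove as) lt))
  x' : A → Bool
  x' = proj₁ rec
  sol = proj₁ (proj₂ rec)
  j₀ = proj₁ (proj₂ (proj₂ rec))
  j₀∈ = proj₁ (proj₂ (proj₂ (proj₂ rec)))
  xj₀ = proj₂ (proj₂ (proj₂ (proj₂ rec)))
  s : Bool
  s = ⊕ (λ i → e i ∧ x' i) (as ++ bs)
  x : A → Bool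
  x i = if does (i ≟ᴬ j) then s else x' i
  x-j : x j ≡ s
  x-j rewrite dec-true (j ≟ᴬ j) refl = refl
  x-other : ∀ {i} → i ∈ as ++ bs → x i ≡ x' i
  x-other {i} m rewrite dec-false (i ≟ᴬ j) (λ { refl → proj₁ u' m }) = refl
  expand : ∀ e' → ⊕ (λ i → e' i ∧ x i) (as ++ j ∷ bs) ≡ (e' j ∧ s) xor ⊕ (λ i → e' i ∧ x' i) (as ++ bs)
  expand e' = trans (⊕-insert _ as) (cong₂ _xor_ (cong (e' j ∧_) x-j) (⊕-cong (as ++ bs) (λ m → cong (e' _ ∧_) (x-other m))))
  dist : ∀ a b c d → (a xor (b ∧ c)) ∧ d ≡ (a ∧ d) xor (b ∧ (c ∧ d))
  dist a true true true = trans (∧-identityʳ _) (cong (_xor true) (sym (∧-identityʳ a)))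
  dist a true true false = trans (∧-zeroʳ _) (sym (trans (cong (_xor false) (∧-zeroʳ a)) refl))
  dist a true false d = trans (cong (_∧ d) (xor-identityʳ a)) (sym (xor-identityʳ _))
  dist a false c d = trans (cong (_∧ d) (xor-identityʳ a)) (sym (xor-identityʳ _))
  sol' : ∀ {e'} → e' ∈ e ∷ es → ⊕ (λ i → e' i ∧ x i) (as ++ j ∷ bs) ≡ false
  sol' (here refl) = trans (expand e) (trans (cong (λ t → (t ∧ s) xor s) ej) (xor-same s))
  sol' {e'} (there m) = trans (expand e') (trans (xor-comm (e' j ∧ s) _) (trans (sym reduced) (sol (∈-map⁺ red m))))
    where
    reduced : ⊕ (λ i → red e' i ∧ x' i) (as ++ bs) ≡ ⊕ (λ i → e' i ∧ x' i) (as ++ bs) xor (e' j ∧ s)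
    reduced = trans (⊕-cong (as ++ bs) (λ {i} _ → dist (e' i) (e' j) (e i) (x' i)))
      (trans (⊕-xor _ _ (as ++ bs)) (cong (⊕ (λ i → e' i ∧ x' i) (as ++ bs) xor_) (⊕-∧ (e' j) (λ i → e i ∧ x' i) (as ++ bs))))

solve : (_≟ᴬ_ : DecidableEquality A) (es : List (A → Bool)) {vs : List A} → Unique vs → length es < length vs →
  ∃ λ (x : A → Bool) → (∀ {e : A → Bool} → e ∈ es → ⊕ (λ j → e j ∧ x j) vs ≡ false) × (∃ λ (j : A) → j ∈ vs × x j ≡ true)
solve _≟ᴬ_ es u lt = solveₖ _≟ᴬ_ (length es) es refl u lt

-- Colourings of vertices

Role : ℕ → Set → Set
Role n A = A → Fin n → Maybe (Fin 4)

-- Four times an indicator, or 1 where no colour is prescribed; either way the mean over the four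
-- colours is 1. The product over all vertices is a power of 4 times the indicator that the
-- prescription is met, and it again has mean 1.
wt : Maybe (Fin 4) → Fin 4 → ℕ
wt nothing c = 1
wt (just c₀) c = if does (c₀ ≟ c) then 4 else 0

wt-sum : ∀ r → wt r fzero + (wt r (fsuc fzero) + (wt r (fsuc (fsuc fzero)) + wt r (fsuc (fsuc (fsuc fzero))))) ≡ 4
wt-sum nothing = refl
wt-sum (just fzero) = refl
wt-sum (just (fsuc fzero)) = refl
wt-sum (just (fsuc (fsuc fzero))) = refl
wt-sum (just (fsuc (fsuc (fsuc fzero)))) = refl

weight : ∀ {n} → (Fin n → Maybe (Fin 4)) → (Fin n → Fin 4) → List (Fin n) → ℕ
weight role χ [] = 1
weight role χ (v ∷ vs) = wt (role v) (χ v) * weight role χ vs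

total : ∀ {n} → Role n A → (Fin n → Fin 4) → List (Fin n) → List A → ℕ
total role χ vs [] = 0
total role χ vs (q ∷ qs) = weight (role q) χ vs + total role χ vs qs

pigeon₄ : ∀ {a b c d y} → 4 * y ≤ a + (b + (c + d)) → y ≤ a ⊎ y ≤ b ⊎ y ≤ c ⊎ y ≤ d
pigeon₄ {a} {b} {c} {d} {y} h with y ≤? a | y ≤? b | y ≤? c | y ≤? d
... | yes p | _ | _ | _ = inj₁ p
... | no _ | yes p | _ | _ = inj₂ (inj₁ p)
... | no _ | no _ | yes p | _ = inj₂ (inj₂ (inj₁ p))
... | no _ | no _ | no _ | yes p = inj₂ (inj₂ (inj₂ p))
... | no p | no q | no r | no s = ⊥-elim (<-irrefl refl (<-≤-trans (+-mono-< (≰⇒> p) (+-mono-< (≰⇒> q) (+-mono-< (≰⇒> r) (≰⇒> s)))) (≤-trans (≤-reflexive (e y)) h)))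
  where
  e : ∀ y → y + (y + (y + y)) ≡ 4 * y
  e = solve-∀

module _ {n} {A : Set} (role : Role n A) where
  weight-upd : ∀ {χ v c} q vs → v ∉ vs → weight (role q) (upd v c χ) vs ≡ weight (role q) χ vs
  weight-upd q [] nv = refl
  weight-upd q (w ∷ vs) nv = cong₂ _*_ (cong (wt (role q w)) (upd-other (λ { refl → nv (here refl) }))) (weight-upd q vs (nv ∘ there))

  total-split : ∀ χ v vs → v ∉ vs → ∀ qs → let t = λ c → total role (upd v c χ) (v ∷ vs) qs in
    4 * total role χ vs qs ≡ t fzero + (t (fsuc fzero) + (t (fsuc (fsuc fzero)) + t (fsuc (fsuc (fsuc fzero)))))
  total-split χ v vs nv [] = refl
  total-split χ v vs nv (q ∷ qs) = trans (*-distribˡ-+ 4 (weight (role q) χ vs) (total role χ vs qs))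
    (trans (cong₂ _+_ one (total-split χ v vs nv qs)) (mix (Tc fzero) (Tc (fsuc fzero)) (Tc (fsuc (fsuc fzero))) (Tc (fsuc (fsuc (fsuc fzero)))) (tq fzero) (tq (fsuc fzero)) (tq (fsuc (fsuc fzero))) (tq (fsuc (fsuc (fsuc fzero))))))
    where
    W = weight (role q) χ vs
    tq : Fin 4 → ℕ
    tq c = total role (upd v c χ) (v ∷ vs) qs
    r = role q v
    Tc : Fin 4 → ℕ
    Tc c = weight (role q) (upd v c χ) (v ∷ vs)
    T≡ : ∀ c → Tc c ≡ wt (role q v) c * W
    T≡ c = cong₂ _*_ (cong (wt (role q v)) (upd-same refl)) (weight-upd q vs nv)
    factor : ∀ a b c d W → (a + (b + (c + d))) * W ≡ a * W + (b * W + (c * W + d * W))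
    factor = solve-∀
    one : 4 * W ≡ Tc fzero + (Tc (fsuc fzero) + (Tc (fsuc (fsuc fzero)) + Tc (fsuc (fsuc (fsuc fzero)))))
    one = trans (cong (_* W) (sym (wt-sum (role q v)))) (trans (factor (wt r fzero) (wt r (fsuc fzero)) (wt r (fsuc (fsuc fzero))) (wt r (fsuc (fsuc (fsuc fzero)))) W)
      (cong₂ _+_ (sym (T≡ _)) (cong₂ _+_ (sym (T≡ _)) (cong₂ _+_ (sym (T≡ _)) (sym (T≡ _))))))
    mix : ∀ a b c d e f g h → (a + (b + (c + d))) + (e + (f + (g + h))) ≡ (a + e) + ((b + f) + ((c + g) + (d + h)))
    mix = solve-∀

  -- The method of conditional expectations: the vertices are coloured one at a time, and some
  -- colour keeps the total at least at its mean. A vertex not yet coloured counts with its mean 1.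
  colour : ∀ qs {vs} → Unique vs → ∃ λ χ → length qs ≤ total role χ vs qs
  colour qs {[]} u = (λ _ → fzero) , ≤-reflexive (e qs)
    where
    e : ∀ qs → length qs ≡ total role (λ _ → fzero) [] qs
    e [] = refl
    e (q ∷ qs) = cong suc (e qs)
  colour qs {v ∷ vs} (h ∷ u) with colour qs u
  ... | χ , le with pigeon₄ (≤-reflexive (total-split χ v vs (λ m → All-lookup h m refl) qs))
  ... | inj₁ p = _ , ≤-trans le p
  ... | inj₂ (inj₁ p) = _ , ≤-trans le p
  ... | inj₂ (inj₂ (inj₁ p)) = _ , ≤-trans le p
  ... | inj₂ (inj₂ (inj₂ p)) = _ , ≤-trans le p

just? : (r : Maybe (Fin 4)) → Dec (r ≢ nothing)
just? nothing = no (λ h → h refl)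
just? (just x) = yes (λ ())

weight≤ : ∀ {n} (role : Fin n → Maybe (Fin 4)) χ vs → weight role χ vs ≤ 4 ^ length (filter (λ v → just? (role v)) vs)
weight≤ role χ [] = ≤-refl
weight≤ role χ (v ∷ vs) with role v
... | nothing = subst (_≤ _) (sym (+-identityʳ _)) (weight≤ role χ vs)
... | just c₀ = *-mono-≤ (bound (does (c₀ ≟ χ v))) (weight≤ role χ vs)
  where
  bound : ∀ b → (if b then 4 else 0) ≤ 4
  bound true = ≤-refl
  bound false = z≤n

weight-zero : ∀ {n} (role : Fin n → Maybe (Fin 4)) χ {vs v c} → v ∈ vs → role v ≡ just c → c ≢ χ v → weight role χ vs ≡ 0
weight-zero role χ {w ∷ vs} (here refl) e ne rewrite e | dec-false (_ ≟ χ w) ne = refl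
weight-zero role χ {w ∷ vs} (there m) e ne = trans (cong (wt (role w) (χ w) *_) (weight-zero role χ m e ne)) (*-zeroʳ (wt (role w) (χ w)))

-- Edge-maximal embeddings are almost triangulations

∧-xorʳ : ∀ a b c → (a xor b) ∧ c ≡ (a ∧ c) xor (b ∧ c)
∧-xorʳ a b true = trans (∧-identityʳ _) (sym (cong₂ _xor_ (∧-identityʳ a) (∧-identityʳ b)))
∧-xorʳ a b false = trans (∧-zeroʳ _) (sym (cong₂ _xor_ (∧-zeroʳ a) (∧-zeroʳ b)))

xor-tele : ∀ a b c → (a xor b) xor (b xor c) ≡ a xor c
xor-tele a b c = trans (xor-assoc a b (b xor c)) (cong (a xor_) (trans (sym (xor-assoc b b c)) (cong (_xor c) (xor-same b))))

Unique-map-on : ∀ {A B : Set} (f : A → B) {xs} → (∀ {x y} → x ∈ xs → y ∈ xs → f x ≡ f y → x ≡ y) → Unique xs → Unique (map f xs)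
Unique-map-on f i [] = []
Unique-map-on f {x ∷ xs} i (h ∷ u) = All-tabulate (λ m e → let y , p , q = ∈-map⁻ f m in All-lookup h p (i (here refl) (there p) (trans e q)))
  ∷ Unique-map-on f (λ p q → i (there p) (there q)) u

does-cong : ∀ {P R : Set} (p? : Dec P) (r? : Dec R) → (P → R) → (R → P) → does p? ≡ does r?
does-cong p? r? f b = bool-ext (λ h → dec-true r? (f (does⁻ p? h))) (λ h → dec-true p? (b (does⁻ r? h)))

swp : ∀ {n} → Dart n → Dart n
swp (u , v) = v , u

star-inv : ∀ {P : A → A → Set} (S : A → Set) → (∀ {u v} → S u → P u v → S v) → ∀ {u v} → Star P u v → S u → S v
star-inv S cl ε s = s
star-inv S cl (p ◅ r) s = star-inv S cl r (cl s p)

-- A tree grown from the root r, listed with each vertex before its ancestors; a pair is (vertex , parent).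
data Tree {n} (K : Adj n) (r : Fin n) : List (Dart n) → Set where
  root : Tree K r []
  grow : ∀ {T v p} → v ∉ r ∷ map proj₁ T → p ∈ r ∷ map proj₁ T → K v p ≡ true → Tree K r T → Tree K r ((v , p) ∷ T)

tree! : ∀ {n} {K : Adj n} {r T} → Tree K r T → Unique (r ∷ map proj₁ T)
tree! root = [] ∷ []
tree! {r = r} (grow nv _ _ t) with tree! t
... | h ∷ u = ((λ e → nv (here (sym e))) ∷ h) ∷ (All-tabulate (λ { m refl → nv (there m) }) ∷ u)

∈-insert₂ : ∀ {r x y : A} {xs} → x ∈ r ∷ xs → x ∈ r ∷ y ∷ xs
∈-insert₂ (here e) = here e
∈-insert₂ (there m) = there (there m)

tree-ends : ∀ {n} {K : Adj n} {r T} → Tree K r T → ∀ {t} → t ∈ T → proj₁ t ∈ r ∷ map proj₁ T × proj₂ t ∈ r ∷ map proj₁ T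
tree-ends (grow nv p∈ _ t) (here refl) = there (here refl) , ∈-insert₂ p∈
tree-ends (grow nv p∈ _ t) (there m) = let a , b = tree-ends t m in ∈-insert₂ a , ∈-insert₂ b

infix 4 _∈?_
_∈?_ : ∀ {n} (v : Fin n) xs → Dec (v ∈ xs)
v ∈? xs = anyL? (v ≟_) xs

spanning : ∀ {n} (K : Adj n) → (∀ {u v} → K u v ≡ true → K v u ≡ true) → (∀ u v → Star (λ a b → K a b ≡ true) u v) →
  ∀ (r : Fin n) → ∃ λ T → Tree K r T × n ≤ suc (length T)
spanning {n} K symK path r = go n [] root (m≤m+n n 0)
  where
  cross : ∀ {S : List (Fin n)} {u z} → Star (λ a b → K a b ≡ true) u z → u ∈ S → z ∉ S → ∃ λ p → ∃ λ v → p ∈ S × v ∉ S × K v p ≡ true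
  cross ε u∈ nz = ⊥-elim (nz u∈)
  cross {S} {u} (_◅_ {j = w} h q) u∈ nz with w ∈? S
  ... | yes w∈ = cross q w∈ nz
  ... | no nw = u , w , u∈ , nw , symK h
  go : ∀ fuel T → Tree K r T → n ≤ fuel + length T → ∃ λ T → Tree K r T × n ≤ suc (length T)
  go fuel T t le with any? (λ z → ¬? (z ∈? (r ∷ map proj₁ T)))
  ... | no none = T , t , subst₂ _≤_ (length-tabulate {n = n} id) (cong suc (length-map proj₁ T)) (⊆-length (allFin⁺ n) all)
    where
    all : ∀ {z} → z ∈ allFin n → z ∈ r ∷ map proj₁ T
    all {z} _ with z ∈? (r ∷ map proj₁ T)
    ... | yes p = p
    ... | no p = ⊥-elim (none (z , p))
  go zero T t le | yes (z , nz) = T , t , ≤-trans le (n≤1+n _)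
  go (suc fuel) T t le | yes (z , nz) with cross (path r z) (here refl) nz
  ... | p , v , p∈ , nv , h = go fuel ((v , p) ∷ T) (grow nv p∈ h t) (subst (n ≤_) (sym (+-suc fuel (length T))) le)

-- Independence of face boundaries, windows and tree edges over F₂

module SatCount {g n} {K : Adj n} (Q : QE g K) (sat : Sat Q) (n≥3 : 3 ≤ n) where
  open QE Q

  path : ∀ u v → Star (λ a b → K a b ≡ true) u v
  path u v = starBind f (conn u v)
    where
    f : ∀ {u v} → Link K lab u v → Star (λ a b → K a b ≡ true) u v
    f (inj₁ h) = h ◅ ε
    f (inj₂ (ℓ , (w , o , e) , (w' , o' , e'))) with sat o o' (trans e (sym e'))
    ... | inj₁ refl = ε
    ... | inj₂ h = h ◅ ε

  third : ∀ a b → ∃ λ z → z ≢ a × z ≢ b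
  third a b with any? (λ z → ¬? (z ≟ a) ×-dec ¬? (z ≟ b))
  ... | yes p = p
  ... | no none = ⊥-elim (<-irrefl refl (≤-trans n≥3 (subst (_≤ 2) (length-tabulate {n = n} id) (⊆-length (allFin⁺ n) all))))
    where
    all : ∀ {z} → z ∈ allFin n → z ∈ a ∷ b ∷ []
    all {z} _ with z ≟ a | z ≟ b
    ... | yes p | _ = here p
    ... | no _ | yes q = there (here q)
    ... | no p | no q = ⊥-elim (none (z , p , q))

  nbr : ∀ v → ∃ λ w → K v w ≡ true
  nbr v = let z , p , _ = third v v in go (path v z) p
    where
    go : ∀ {z} → Star (λ a b → K a b ≡ true) v z → z ≢ v → ∃ λ w → K v w ≡ true
    go ε p = ⊥-elim (p refl)
    go (h ◅ _) p = _ , h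

  only : ∀ {v u w} → K v u ≡ true → ρ v u ≡ u → K v w ≡ true → w ≡ u
  only h e k = reach-fix e (Cyc.tr (cyc _) h k)

  -- If `a` were the only neighbour of `b`, then `b` and the neighbour of `a` after `b` would share
  -- a face. If they are distinct, saturation makes them adjacent, which is impossible; if they
  -- coincide, a and b alone form a component, contrary to n ≥ 3. So vertices two steps apart on a
  -- walk are distinct.
  noleaf : ∀ {a b} → K a b ≡ true → ρ b a ≢ a
  noleaf {a} {b} h e with ρ a b ≟ b
  ... | yes e' = let z , p , q = third a b in bad p q (star-inv (λ z → z ≡ a ⊎ z ≡ b) cl (path a z) (inj₁ refl))
    where
    cl : ∀ {u v} → u ≡ a ⊎ u ≡ b → K u v ≡ true → v ≡ a ⊎ v ≡ b
    cl (inj₁ refl) k = inj₂ (only h e' k)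
    cl (inj₂ refl) k = inj₁ (only (symA h) e k)
    bad : ∀ {z} → z ≢ a → z ≢ b → z ≡ a ⊎ z ≡ b → ⊥
    bad p q (inj₁ r) = p r
    bad p q (inj₂ r) = q r
  ... | no ne with sat (inj₁ (symA h)) (inj₁ (nxt-cl (nxt-cl (symA h)))) (sym (trans (labinv (nxt-cl (symA h))) (labinv (symA h))))
  ... | inj₁ b≡e = ne (sym b≡e)
  ... | inj₂ k = irr (subst (λ z → K a z ≡ true) (only (symA h) e k) (nxt-cl (symA h)))

  wv : ℕ → Dart n → Fin n
  wv i δ = proj₁ (iter nxt i δ)

  iterD : ∀ i {δ} → isD K δ → isD K (iter nxt i δ)
  iterD i h = nxt-D (iter⇒reach nxt i _) h

  iterlab : ∀ i {δ} → isD K δ → lab (iter nxt i δ) ≡ lab δ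
  iterlab i h = lab-reach h (iter⇒reach nxt i _)

  face-adj : ∀ i j {δ} → isD K δ → wv i δ ≢ wv j δ → K (wv i δ) (wv j δ) ≡ true
  face-adj i j h ne with sat (inj₁ (iterD i h)) (inj₁ (iterD j h)) (trans (iterlab i h) (sym (iterlab j h)))
  ... | inj₁ e = ⊥-elim (ne e)
  ... | inj₂ k = k

  wv-suc : ∀ i {δ} → isD K δ → wv i δ ≢ wv (suc i) δ
  wv-suc i {δ} h e = irr (subst (λ z → K z (proj₂ (iter nxt i δ)) ≡ true) e (iterD i h))

  wv-two : ∀ i {δ} → isD K δ → wv i δ ≢ wv (suc (suc i)) δ
  wv-two i h e = noleaf (iterD i h) (sym e)

  -- Windows coloured 0, 1, 2, 3 by χ; distinct ones overlap neither in arcs nor in chord ends.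
  Win : (Fin n → Fin 4) → Dart n → Set
  Win χ δ = isD K δ × χ (wv 0 δ) ≡ fzero × χ (wv 1 δ) ≡ fsuc fzero × χ (wv 2 δ) ≡ fsuc (fsuc fzero) × χ (wv 3 δ) ≡ fsuc (fsuc (fsuc fzero))

  -- The unknowns are coefficients of face boundaries, of the triangles on the first three vertices
  -- of the windows, and of tree edges. `eqv d` says that the combination vanishes at the edge `d`.
  -- The sum of all face boundaries is zero because an edge has two sides; `e₀` excludes this
  -- relation by fixing one coefficient. Only the zero solution remains, so there are at most as
  -- many unknowns as equations.
  module LA (χ : Fin n → Fin 4) (Ws : List (Dart n)) (Ws! : Unique Ws) (win : ∀ {δ} → δ ∈ Ws → Win χ δ) where
    r₀ : Fin n
    r₀ = fromℕ< (≤-trans (s≤s z≤n) n≥3)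

    d₀ : Dart n
    d₀ = r₀ , proj₁ (nbr r₀)

    h₀ : isD K d₀
    h₀ = proj₂ (nbr r₀)

    span : ∃ λ T → Tree K r₀ T × n ≤ suc (length T)
    span = spanning K symA path r₀

    Tr : List (Dart n)
    Tr = proj₁ span
    tree : Tree K r₀ Tr
    tree = proj₁ (proj₂ span)

    J : Set
    J = ℕ ⊎ (Dart n ⊎ Dart n)

    vs : List J
    vs = map inj₁ L ++ map (inj₂ ∘ inj₁) Ws ++ map (inj₂ ∘ inj₂) Tr

    arc chord tre : Dart n → Dart n → Bool
    arc δ d = does (δ ≟ᵈ d) xor does (nxt δ ≟ᵈ d)
    chord δ d = does (edge? (wv 0 δ) (wv 2 δ) (proj₁ d) (proj₂ d))
    tre t d = does (edge? (proj₁ t) (proj₂ t) (proj₁ d) (proj₂ d))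

    eqv : Dart n → J → Bool
    eqv d (inj₁ ℓ) = does (lab d ≟ⁿ ℓ) xor does (lab (swp d) ≟ⁿ ℓ)
    eqv d (inj₂ (inj₁ δ)) = (arc δ d xor arc δ (swp d)) xor chord δ d
    eqv d (inj₂ (inj₂ t)) = tre t d

    e₀ : J → Bool
    e₀ (inj₁ ℓ) = does (lab d₀ ≟ⁿ ℓ)
    e₀ (inj₂ _) = false

    eqs : List (J → Bool)
    eqs = e₀ ∷ map eqv (half K)

    vs! : Unique vs
    vs! = Unique-++⁺ (Unique-map⁺ (λ { refl → refl }) L!)
      (Unique-++⁺ (Unique-map⁺ (λ { refl → refl }) Ws!) (Unique-map⁺ (λ { refl → refl }) T!) disj₂) disj₁
      where
      T! : Unique Tr
      T! with tree! tree
      ... | _ ∷ u = Unique-map⁻ u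
      disj₂ : ∀ {j} → ¬ (j ∈ map (inj₂ ∘ inj₁) Ws × j ∈ map (inj₂ ∘ inj₂) Tr)
      disj₂ (p , q) with ∈-map⁻ (inj₂ ∘ inj₁) p | ∈-map⁻ (inj₂ ∘ inj₂) q
      ... | _ , _ , refl | _ , _ , ()
      disj₁ : ∀ {j} → ¬ (j ∈ map inj₁ L × j ∈ map (inj₂ ∘ inj₁) Ws ++ map (inj₂ ∘ inj₂) Tr)
      disj₁ (p , q) with ∈-map⁻ inj₁ p | ∈-++⁻ (map (inj₂ ∘ inj₁) Ws) q
      ... | _ , _ , refl | inj₁ q' with ∈-map⁻ (inj₂ ∘ inj₁) q'
      ... | _ , _ , ()
      disj₁ (p , q) | _ , _ , refl | inj₂ q' with ∈-map⁻ (inj₂ ∘ inj₂) q'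
      ... | _ , _ , ()

    module Sol (x : J → Bool) (sol : ∀ {e : J → Bool} → e ∈ eqs → ⊕ (λ j → e j ∧ x j) vs ≡ false)
      (nz : ∃ λ (j : J) → j ∈ vs × x j ≡ true) where
      Tx : ℕ → Bool
      Tx ℓ = x (inj₁ ℓ)
      Sx Yx : Dart n → Bool
      Sx δ = x (inj₂ (inj₁ δ))
      Yx t = x (inj₂ (inj₂ t))

      -- `colour'` is the coefficient on one side of an edge: that of the face there plus those of
      -- the window arcs running along it. `X` adds the two sides and the chords, so it is the edge
      -- set of a sum of closed walks, whereas `Y` consists of tree edges.
      ca colour' ch Y X : Dart n → Bool
      ca d = ⊕ (λ δ → arc δ d ∧ Sx δ) Ws
      colour' d = Tx (lab d) xor ca d
      ch d = ⊕ (λ δ → chord δ d ∧ Sx δ) Ws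
      Y d = ⊕ (λ t → tre t d ∧ Yx t) Tr
      X d = (colour' d xor colour' (swp d)) xor ch d

      dot-split : ∀ (e : J → Bool) → ⊕ (λ j → e j ∧ x j) vs ≡ ⊕ (λ ℓ → e (inj₁ ℓ) ∧ Tx ℓ) L xor
        (⊕ (λ δ → e (inj₂ (inj₁ δ)) ∧ Sx δ) Ws xor ⊕ (λ t → e (inj₂ (inj₂ t)) ∧ Yx t) Tr)
      dot-split e = trans (⊕-++ f (map inj₁ L)) (cong₂ _xor_ (⊕-map f inj₁ L)
        (trans (⊕-++ f (map (inj₂ ∘ inj₁) Ws)) (cong₂ _xor_ (⊕-map f (inj₂ ∘ inj₁) Ws) (⊕-map f (inj₂ ∘ inj₂) Tr))))
        where
        f : J → Bool
        f j = e j ∧ x j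

      atLab : ∀ d → ⊕ (λ ℓ → does (lab d ≟ⁿ ℓ) ∧ Tx ℓ) L ≡ Tx (lab d)
      atLab d = trans (⊕-one L! (lab∈ d) (λ {ℓ} _ ne → cong (_∧ Tx ℓ) (dec-false (lab d ≟ⁿ ℓ) (ne ∘ sym))))
        (cong (_∧ Tx (lab d)) (dec-true (lab d ≟ⁿ lab d) refl))

      eval : ∀ d → ⊕ (λ j → eqv d j ∧ x j) vs ≡ X d xor Y d
      eval d = begin
        ⊕ (λ j → eqv d j ∧ x j) vs ≡⟨ dot-split (eqv d) ⟩
        ⊕ (λ ℓ → eqv d (inj₁ ℓ) ∧ Tx ℓ) L xor (⊕ (λ δ → eqv d (inj₂ (inj₁ δ)) ∧ Sx δ) Ws xor Y d)
          ≡⟨ cong₂ _xor_ p₁ (cong (_xor Y d) p₂) ⟩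
        (Tx (lab d) xor Tx (lab (swp d))) xor (((ca d xor ca (swp d)) xor ch d) xor Y d)
          ≡⟨ xor-assoc (Tx (lab d) xor Tx (lab (swp d))) ((ca d xor ca (swp d)) xor ch d) (Y d) ⟨
        ((Tx (lab d) xor Tx (lab (swp d))) xor ((ca d xor ca (swp d)) xor ch d)) xor Y d
          ≡⟨ cong (_xor Y d) (xor-assoc (Tx (lab d) xor Tx (lab (swp d))) (ca d xor ca (swp d)) (ch d)) ⟨
        (((Tx (lab d) xor Tx (lab (swp d))) xor (ca d xor ca (swp d))) xor ch d) xor Y d
          ≡⟨ cong (λ t → (t xor ch d) xor Y d) (xor-mid (Tx (lab d)) (Tx (lab (swp d))) (ca d) (ca (swp d))) ⟩
        X d xor Y d ∎
        where
        open ≡-Reasoning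
        p₁ : ⊕ (λ ℓ → eqv d (inj₁ ℓ) ∧ Tx ℓ) L ≡ Tx (lab d) xor Tx (lab (swp d))
        p₁ = trans (⊕-cong L (λ {ℓ} _ → ∧-xorʳ (does (lab d ≟ⁿ ℓ)) (does (lab (swp d) ≟ⁿ ℓ)) (Tx ℓ)))
          (trans (⊕-xor _ _ L) (cong₂ _xor_ (atLab d) (atLab (swp d))))
        p₂ : ⊕ (λ δ → eqv d (inj₂ (inj₁ δ)) ∧ Sx δ) Ws ≡ (ca d xor ca (swp d)) xor ch d
        p₂ = trans (⊕-cong Ws (λ {δ} _ → trans (∧-xorʳ (arc δ d xor arc δ (swp d)) (chord δ d) (Sx δ))
               (cong (_xor (chord δ d ∧ Sx δ)) (∧-xorʳ (arc δ d) (arc δ (swp d)) (Sx δ)))))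
          (trans (⊕-xor _ _ Ws) (cong (_xor ch d) (⊕-xor _ _ Ws)))

      X≡Y : ∀ {d} → isD K d → X d ≡ Y d
      X≡Y {u , v} h with half-cover K symA irr h
      ... | inj₁ m = xor-cancel (trans (sym (eval (u , v))) (sol (there (∈-map⁺ eqv m))))
      ... | inj₂ m = trans X-swap (trans (xor-cancel (trans (sym (eval (v , u))) (sol (there (∈-map⁺ eqv m))))) Y-swap)
        where
        X-swap : X (u , v) ≡ X (v , u)
        X-swap = cong₂ _xor_ (xor-comm (colour' (u , v)) (colour' (v , u)))
          (⊕-cong Ws (λ {δ} _ → cong (_∧ Sx δ) (does-cong (edge? (wv 0 δ) (wv 2 δ) u v) (edge? (wv 0 δ) (wv 2 δ) v u) edge-sym edge-sym)))
        Y-swap : Y (v , u) ≡ Y (u , v)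
        Y-swap = ⊕-cong Tr (λ {t} _ → cong (_∧ Yx t) (does-cong (edge? (proj₁ t) (proj₂ t) v u) (edge? (proj₁ t) (proj₂ t) u v) edge-sym edge-sym))

      turn : Dart n → Dart n → Bool
      turn δ d = does (δ ≟ᵈ nxt d) xor does (nxt δ ≟ᵈ d)

      -- At the middle vertex of a window its two arcs cancel. Only the start and the end of the
      -- path of two darts are noticed when a corner is passed.
      arc-turn : ∀ {δ d} → isD K δ → isD K d → arc δ (nxt d) xor arc δ d ≡ turn δ d
      arc-turn {δ} {d} hδ h = trans (cong (λ t → (does (δ ≟ᵈ nxt d) xor t) xor arc δ d)
          (does-cong (nxt δ ≟ᵈ nxt d) (δ ≟ᵈ d) (N.injective hδ h) (cong nxt)))
        (xor-tele (does (δ ≟ᵈ nxt d)) (does (δ ≟ᵈ d)) (does (nxt δ ≟ᵈ d)))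

      colour-turn : ∀ {d} → isD K d → colour' (nxt d) xor colour' d ≡ ⊕ (λ δ → turn δ d ∧ Sx δ) Ws
      colour-turn {d} h = trans (xor-mid (Tx (lab (nxt d))) (ca (nxt d)) (Tx (lab d)) (ca d))
        (trans (cong (_xor (ca (nxt d) xor ca d)) (trans (cong (λ t → Tx t xor Tx (lab d)) (labinv h)) (xor-same (Tx (lab d)))))
        (trans (sym (⊕-xor _ _ Ws)) (⊕-cong Ws (λ {δ} m → trans (sym (∧-xorʳ (arc δ (nxt d)) (arc δ d) (Sx δ)))
          (cong (_∧ Sx δ) (arc-turn (proj₁ (win m)) h))))))

      module Even (w : Fin n) where
        N' : List (Fin n)
        N' = nbrs K w

        z : Dart n → Fin n → Bool
        z δ u = turn δ (u , w) xor chord δ (w , u)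

        module _ {δ} (hδ : isD K δ) where
          a c : Fin n
          a = wv 0 δ
          c = wv 2 δ
          a≢c : a ≢ c
          a≢c = wv-two 0 hδ

          p-sum : (q : Dec (a ≡ w)) → ⊕ (λ u → does (δ ≟ᵈ nxt (u , w))) N' ≡ does q
          p-sum (no ne) = ⊕-none N' (λ {u} _ → dec-false (δ ≟ᵈ nxt (u , w)) (λ e → ne (cong proj₁ e)))
          p-sum (yes refl) = let u₀ , hu , e = Cyc.pre (cyc a) hδ in
            trans (⊕-one (nbrs! K a) (∈-nbrs⁺ K hu) (λ {u} m ne → dec-false (δ ≟ᵈ nxt (u , a))
                  (λ q → ne (Cyc.inj (cyc a) (∈-nbrs⁻ K m) hu (trans (sym (cong proj₂ q)) (sym e))))))
                (dec-true (δ ≟ᵈ nxt (u₀ , a)) (cong (a ,_) (sym e)))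

          q-sum : (q : Dec (c ≡ w)) → ⊕ (λ u → does (nxt δ ≟ᵈ (u , w))) N' ≡ does q
          q-sum (no ne) = ⊕-none N' (λ {u} _ → dec-false (nxt δ ≟ᵈ (u , w)) (λ e → ne (cong proj₂ e)))
          q-sum (yes refl) = trans (⊕-one {x₀ = proj₁ (nxt δ)} (nbrs! K c) (∈-nbrs⁺ K (symA (nxt-cl hδ)))
                  (λ {u} m ne → dec-false (nxt δ ≟ᵈ (u , c)) (λ q → ne (sym (cong proj₁ q)))))
                (dec-true (nxt δ ≟ᵈ (proj₁ (nxt δ) , c)) refl)

          r-sum : (p : Dec (a ≡ w)) (q : Dec (c ≡ w)) → ⊕ (λ u → chord δ (w , u)) N' ≡ does p xor does q
          r-sum (yes p) (yes q) = ⊥-elim (a≢c (trans p (sym q)))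
          r-sum (yes refl) (no nc) = trans (⊕-one {x₀ = c} (nbrs! K a) (∈-nbrs⁺ K (face-adj 0 2 hδ a≢c))
                  (λ {u} m ne → dec-false (edge? a c a u) (λ { (inj₁ (_ , e)) → ne e ; (inj₂ (e , _)) → a≢c e })))
                (dec-true (edge? a c a c) (inj₁ (refl , refl)))
          r-sum (no na) (yes refl) = trans (⊕-one {x₀ = a} (nbrs! K c) (∈-nbrs⁺ K (symA (face-adj 0 2 hδ a≢c)))
                  (λ {u} m ne → dec-false (edge? a c c u) (λ { (inj₁ (e , _)) → a≢c (sym e) ; (inj₂ (_ , e)) → ne e })))
                (dec-true (edge? a c c a) (inj₂ (refl , refl)))
          r-sum (no na) (no nc) = ⊕-none N' (λ {u} _ → dec-false (edge? a c w u) (λ { (inj₁ (e , _)) → na (sym e) ; (inj₂ (e , _)) → nc (sym e) }))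

          z-sum : ⊕ (z δ) N' ≡ false
          z-sum = trans (⊕-xor _ _ N') (trans (cong₂ _xor_ (trans (⊕-xor _ _ N') (cong₂ _xor_ (p-sum (a ≟ w)) (q-sum (c ≟ w)))) (r-sum (a ≟ w) (c ≟ w)))
            (xor-same (does (a ≟ w) xor does (c ≟ w))))

        rotate : ⊕ (λ u → colour' (w , u)) N' ≡ ⊕ (λ u → colour' (nxt (u , w))) N'
        rotate = trans (⊕-set (λ u → colour' (w , u)) (nbrs! K w)
            (Unique-map-on (ρ w) (λ p q → Cyc.inj (cyc w) (∈-nbrs⁻ K p) (∈-nbrs⁻ K q)) (nbrs! K w)) to from)
          (⊕-map (λ u → colour' (w , u)) (ρ w) N')
          where
          to : ∀ {u} → u ∈ N' → u ∈ map (ρ w) N'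
          to m = let p , hp , e = Cyc.pre (cyc w) (∈-nbrs⁻ K m) in subst (_∈ map (ρ w) N') e (∈-map⁺ (ρ w) (∈-nbrs⁺ K hp))
          from : ∀ {u} → u ∈ map (ρ w) N' → u ∈ N'
          from m with ∈-map⁻ (ρ w) m
          ... | p , q , refl = ∈-nbrs⁺ K (Cyc.cl (cyc w) (∈-nbrs⁻ K q))

        -- A sum of closed walks has even degree at every vertex. The coefficients on the outgoing
        -- darts are shifted by the rotation at `w` and compared with those on the incoming ones,
        -- corner by corner: faces cancel, and a window contributes its turn at `w` and its chord at
        -- `w`, which cancel each other.
        even : ⊕ (λ u → X (w , u)) N' ≡ false
        even = begin
          ⊕ (λ u → X (w , u)) N'
            ≡⟨ ⊕-xor _ _ N' ⟩
          ⊕ (λ u → colour' (w , u) xor colour' (u , w)) N' xor ⊕ (λ u → ch (w , u)) N'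
            ≡⟨ cong (_xor ⊕ (λ u → ch (w , u)) N') (trans (⊕-xor _ _ N') (trans (cong (_xor ⊕ (λ u → colour' (u , w)) N') rotate) (sym (⊕-xor _ _ N')))) ⟩
          ⊕ (λ u → colour' (nxt (u , w)) xor colour' (u , w)) N' xor ⊕ (λ u → ch (w , u)) N'
            ≡⟨ cong (_xor ⊕ (λ u → ch (w , u)) N') (⊕-cong N' (λ m → colour-turn (symA (∈-nbrs⁻ K m)))) ⟩
          ⊕ (λ u → ⊕ (λ δ → turn δ (u , w) ∧ Sx δ) Ws) N' xor ⊕ (λ u → ch (w , u)) N'
            ≡⟨ ⊕-xor _ _ N' ⟨
          ⊕ (λ u → ⊕ (λ δ → turn δ (u , w) ∧ Sx δ) Ws xor ch (w , u)) N'
            ≡⟨ ⊕-cong N' (λ {u} _ → trans (sym (⊕-xor _ _ Ws)) (⊕-cong Ws (λ {δ} _ → sym (∧-xorʳ (turn δ (u , w)) (chord δ (w , u)) (Sx δ))))) ⟩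
          ⊕ (λ u → ⊕ (λ δ → z δ u ∧ Sx δ) Ws) N'
            ≡⟨ ⊕-swap (λ u δ → z δ u ∧ Sx δ) N' Ws ⟩
          ⊕ (λ δ → ⊕ (λ u → z δ u ∧ Sx δ) N') Ws
            ≡⟨ ⊕-none Ws (λ {δ} m → trans (⊕-cong N' (λ {u} _ → ∧-comm (z δ u) (Sx δ))) (trans (⊕-∧ (Sx δ) (z δ) N') (trans (cong (Sx δ ∧_) (z-sum (proj₁ (win m)))) (∧-zeroʳ (Sx δ))))) ⟩
          false ∎
          where open ≡-Reasoning

      Y-even : ∀ w → ⊕ (λ u → Y (w , u)) (nbrs K w) ≡ false
      Y-even w = trans (⊕-cong (nbrs K w) (λ m → sym (X≡Y (∈-nbrs⁻ K m)))) (Even.even w)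

      -- The newest vertex of the tree lies on a single tree edge.
      prune : ∀ {T'} → Tree K r₀ T' → (∀ w → ⊕ (λ u → ⊕ (λ t → tre t (w , u) ∧ Yx t) T') (nbrs K w) ≡ false) → ∀ {t} → t ∈ T' → Yx t ≡ false
      prune {(v , p) ∷ T'} (grow nv p∈ h tr) ev = λ { (here refl) → y₀ ; (there m) → prune tr ev' m }
        where
        rest : Fin n → Fin n → Bool
        rest w u = ⊕ (λ t → tre t (w , u) ∧ Yx t) T'
        rest-v : ∀ u → rest v u ≡ false
        rest-v u = ⊕-none T' (λ {t} m → cong (_∧ Yx t) (dec-false (edge? (proj₁ t) (proj₂ t) v u)
          (λ { (inj₁ (refl , _)) → nv (proj₁ (tree-ends tr m)) ; (inj₂ (refl , _)) → nv (proj₂ (tree-ends tr m)) })))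
        v≢p : v ≢ p
        v≢p refl = nv p∈
        y₀ : Yx (v , p) ≡ false
        y₀ = trans (sym (trans (⊕-cong (nbrs K v) (λ {u} _ → trans (cong (tre (v , p) (v , u) ∧ Yx (v , p) xor_) (rest-v u)) (xor-identityʳ _)))
          (trans (⊕-one {x₀ = p} (nbrs! K v) (∈-nbrs⁺ K h) (λ {u} m ne → cong (_∧ Yx (v , p)) (dec-false (edge? v p v u)
              (λ { (inj₁ (_ , e)) → ne e ; (inj₂ (e , _)) → v≢p e }))))
            (cong (_∧ Yx (v , p)) (dec-true (edge? v p v p) (inj₁ (refl , refl))))))) (ev v)
        ev' : ∀ w → ⊕ (rest w) (nbrs K w) ≡ false
        ev' w = trans (⊕-cong (nbrs K w) (λ {u} _ → sym (cong (_xor rest w u) (trans (cong (tre (v , p) (w , u) ∧_) y₀) (∧-zeroʳ _))))) (ev w)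

      -- A set of tree edges with even degree everywhere is empty. Hence `X` and `Y`, which agree on
      -- every edge, both vanish.
      Y-null : ∀ {t} → t ∈ Tr → Yx t ≡ false
      Y-null = prune tree Y-even

      X-null : ∀ {d} → isD K d → X d ≡ false
      X-null {d} h = trans (X≡Y h) (⊕-none Tr (λ {t} m → trans (cong (tre t d ∧_) (Y-null m)) (∧-zeroʳ _)))

      -- Chords and turns of the selected windows occur only at their vertices `wv 0` and `wv 2`. At
      -- any other vertex the side coefficient `colour'` is the same across each edge (`flip`) and
      -- across each corner (`around`), hence constant around the vertex.
      NoEnd : Fin n → Set
      NoEnd v = ∀ {δ} → δ ∈ Ws → Sx δ ≡ true → wv 0 δ ≢ v × wv 2 δ ≢ v

      off : ∀ {b s} → (s ≡ true → b ≡ false) → b ∧ s ≡ false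
      off {b} {true} f = trans (∧-identityʳ b) (f refl)
      off {b} {false} f = ∧-zeroʳ b

      flip : ∀ {v u} → NoEnd v → K v u ≡ true → colour' (u , v) ≡ colour' (v , u)
      flip {v} {u} ne h = xor-cancel (trans (sym (xor-identityʳ _)) (trans (cong ((colour' (u , v) xor colour' (v , u)) xor_) (sym ch0)) (X-null (symA h))))
        where
        ch0 : ch (u , v) ≡ false
        ch0 = ⊕-none Ws (λ {δ} m → off {chord δ (u , v)} (λ s → dec-false (edge? (wv 0 δ) (wv 2 δ) u v)
          (λ { (inj₁ (_ , e)) → proj₂ (ne m s) (sym e) ; (inj₂ (_ , e)) → proj₁ (ne m s) (sym e) })))

      around : ∀ {v u} → NoEnd v → K v u ≡ true → colour' (v , ρ v u) ≡ colour' (u , v)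
      around {v} {u} ne h = xor-cancel (trans (colour-turn (symA h)) (⊕-none Ws (λ {δ} m → off {turn δ (u , v)} (λ s →
        cong₂ _xor_ (dec-false (δ ≟ᵈ nxt (u , v)) (λ e → proj₁ (ne m s) (cong proj₁ e)))
          (dec-false (nxt δ ≟ᵈ (u , v)) (λ e → proj₂ (ne m s) (cong proj₂ e)))))))

      constant : ∀ {v u w} → NoEnd v → K v u ≡ true → K v w ≡ true → colour' (v , w) ≡ colour' (v , u)
      constant {v} {u} ne h k = proj₂ (reach-inv (λ z → K v z ≡ true × colour' (v , z) ≡ colour' (v , u))
        (λ { (p , q) → Cyc.cl (cyc v) p , trans (around ne p) (trans (flip ne p) q) }) (Cyc.tr (cyc v) h k) (h , refl))

      colours≢ : ∀ {v} {i j : Fin 4} → χ v ≡ i → i ≢ j → ∀ {w} → χ w ≡ j → w ≢ v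
      colours≢ p ne q refl = ne (trans (sym p) q)

      -- The vertices b and d of the window have colours 1 and 3, so no chord ends there and
      -- `colour'` is constant around each. Around b it is the value on the first arc, the face
      -- coefficient plus 1; around d it is the value on the dart after the two arcs, the face
      -- coefficient alone. Saturation supplies the edge bd, whose two sides would have to agree.
      impossible : ∀ {δ} → δ ∈ Ws → Sx δ ≡ true → ⊥
      impossible {δ} m s with win m
      ... | h , c₀ , c₁ , c₂ , c₃ = xor-neq (Tx (lab δ)) (trans (sym col-b) (trans bd col-d))
        where
        xor-neq : ∀ t → t xor true ≢ t
        xor-neq true ()
        xor-neq false ()
        b d : Fin n
        b = wv 1 δ
        d = wv 3 δ
        ne-b : NoEnd b
        ne-b m' _ = let _ , p₀ , _ , p₂ , _ = win m' in colours≢ c₁ (λ ()) p₀ , colours≢ c₁ (λ ()) p₂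
        ne-d : NoEnd d
        ne-d m' _ = let _ , p₀ , _ , p₂ , _ = win m' in colours≢ c₃ (λ ()) p₀ , colours≢ c₃ (λ ()) p₂
        own : arc δ δ ≡ true
        own = cong₂ _xor_ (dec-true (δ ≟ᵈ δ) refl) (dec-false (nxt δ ≟ᵈ δ) (λ e → wv-suc 0 h (sym (cong proj₁ e))))
        -- Another window could cover `δ` only by its second arc, which starts at colour 1, while
        -- `δ` starts at colour 0.
        col-δ : colour' δ ≡ Tx (lab δ) xor true
        col-δ = cong (Tx (lab δ) xor_) (trans (⊕-one Ws! m (λ {δ'} m' ne → cong (_∧ Sx δ') (cong₂ _xor_
            (dec-false (δ' ≟ᵈ δ) ne)
            (dec-false (nxt δ' ≟ᵈ δ) (λ e → colours≢ c₀ (λ ()) (proj₁ (proj₂ (proj₂ (win m')))) (cong proj₁ e))))))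
          (cong₂ _∧_ own s))
        col-c : colour' (iter nxt 2 δ) ≡ Tx (lab δ)
        col-c = trans (cong₂ _xor_ (cong Tx (iterlab 2 h)) (⊕-none Ws (λ {δ'} m' → cong (_∧ Sx δ') (cong₂ _xor_
            (dec-false (δ' ≟ᵈ iter nxt 2 δ) (λ e → colours≢ c₂ (λ ()) (proj₁ (proj₂ (win m'))) (cong proj₁ e)))
            (dec-false (nxt δ' ≟ᵈ iter nxt 2 δ) (λ e → colours≢ c₂ (λ ()) (proj₁ (proj₂ (proj₂ (win m')))) (cong proj₁ e)))))))
          (xor-identityʳ _)
        kbd : K b d ≡ true
        kbd = face-adj 1 3 h (wv-two 1 h)
        col-b : colour' (b , d) ≡ Tx (lab δ) xor true
        col-b = trans (constant ne-b (symA h) kbd) (trans (sym (flip ne-b (symA h))) col-δ)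
        col-d : colour' (d , b) ≡ Tx (lab δ)
        col-d = trans (constant ne-d (symA (iterD 2 h)) (symA kbd)) (trans (sym (flip ne-d (symA (iterD 2 h)))) col-c)
        bd : colour' (b , d) ≡ colour' (d , b)
        bd = sym (flip ne-b kbd)

      S-null : ∀ {δ} → δ ∈ Ws → Sx δ ≡ false
      S-null m = ≢true⇒false (impossible m)

      colour-lab : ∀ d → colour' d ≡ Tx (lab d)
      colour-lab d = trans (cong (Tx (lab d) xor_) (⊕-none Ws (λ {δ} m → trans (cong (arc δ d ∧_) (S-null m)) (∧-zeroʳ _)))) (xor-identityʳ _)

      all-free : ∀ {v} → NoEnd v
      all-free m s = ⊥-elim (false≢true (trans (sym (S-null m)) s))

      T-d₀ : Tx (lab d₀) ≡ false
      T-d₀ = trans (sym (trans (dot-split e₀) (trans (cong₂ _xor_ (atLab d₀) (cong₂ _xor_ (⊕-none Ws (λ _ → refl)) (⊕-none Tr (λ _ → refl)))) (xor-identityʳ _)))) (sol (here refl))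

      -- Without windows the face coefficients are constant around every vertex and across every
      -- edge, so connectedness spreads the value 0 fixed by `e₀`.
      T-null : ∀ {d} → isD K d → colour' d ≡ false
      T-null {u , v} h = star-inv (λ v → ∀ {w} → K v w ≡ true → colour' (v , w) ≡ false) cl (path r₀ u)
        (λ k → trans (constant all-free h₀ k) (trans (colour-lab d₀) T-d₀)) h
        where
        cl : ∀ {u v} → (∀ {w} → K u w ≡ true → colour' (u , w) ≡ false) → K u v ≡ true → ∀ {w} → K v w ≡ true → colour' (v , w) ≡ false
        cl f k k' = trans (constant all-free (symA k) k') (trans (sym (flip all-free (symA k))) (f k))

      data Where : J → Set where
        inL : ∀ {ℓ} → ℓ ∈ L → Where (inj₁ ℓ)
        inW : ∀ {δ} → δ ∈ Ws → Where (inj₂ (inj₁ δ))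
        inT : ∀ {t} → t ∈ Tr → Where (inj₂ (inj₂ t))

      locate : ∀ {j} → j ∈ vs → Where j
      locate m with ∈-++⁻ (map inj₁ L) m
      ... | inj₁ p with ∈-map⁻ inj₁ p
      ... | _ , q , refl = inL q
      locate m | inj₂ p with ∈-++⁻ (map (inj₂ ∘ inj₁) Ws) p
      ... | inj₁ q with ∈-map⁻ (inj₂ ∘ inj₁) q
      ... | _ , r , refl = inW r
      locate m | inj₂ p | inj₂ q with ∈-map⁻ (inj₂ ∘ inj₂) q
      ... | _ , r , refl = inT r

      zero' : ∀ {ℓ} → ℓ ∈ L → Tx ℓ ≡ false
      zero' m with surj m
      ... | d , inj₁ h , e = trans (cong Tx (sym e)) (trans (sym (colour-lab d)) (T-null h))
      ... | d , inj₂ (_ , i) , e = ⊥-elim (i _ (proj₂ (nbr (proj₁ d))))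

      absurd : ⊥
      absurd = go (locate (proj₁ (proj₂ nz))) (proj₂ (proj₂ nz))
        where
        go : ∀ {j} → Where j → x j ≡ true → ⊥
        go (inL m) t = false≢true (trans (sym (zero' m)) t)
        go (inW m) t = false≢true (trans (sym (S-null m)) t)
        go (inT m) t = false≢true (trans (sym (Y-null m)) t)

    rank : length vs ≤ length eqs
    rank with length eqs <? length vs
    ... | no h = ≮⇒≥ h
    ... | yes lt with solve (⊎-≡-dec _≟ⁿ_ (⊎-≡-dec _≟ᵈ_ _≟ᵈ_)) eqs vs! lt
    ... | x , sol , nz = ⊥-elim (Sol.absurd x sol nz)

    count : length L + length Ws + n ≤ 2 + length (half K)
    count = ≤-trans (+-monoʳ-≤ (length L + length Ws) (proj₂ (proj₂ span))) (≤-trans (≤-reflexive (arith (length L) (length Ws) (length Tr)))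
      (s≤s (subst₂ _≤_ vsl (cong suc (length-map eqv (half K))) rank)))
      where
      arith : ∀ l s t → l + s + suc t ≡ suc (l + (s + t))
      arith = solve-∀
      vsl : length vs ≡ length L + (length Ws + length Tr)
      vsl = trans (length-++ (map inj₁ L)) (cong₂ _+_ (length-map inj₁ L) (trans (length-++ (map (inj₂ ∘ inj₁) Ws))
        (cong₂ _+_ (length-map (inj₂ ∘ inj₁) Ws) (length-map (inj₂ ∘ inj₂) Tr))))

-- Counting the windows and the edges of an edge-maximal embedding

module SatBound {g n} {K : Adj n} (Q : QE g K) (sat : Sat Q) (n≥3 : 3 ≤ n) where
  open QE Q
  open SatCount Q sat n≥3

  win? : ∀ δ → Dec (isD K δ × wv 3 δ ≢ wv 0 δ)
  win? δ = (K (proj₁ δ) (proj₂ δ) ≟ᵇ true) ×-dec ¬? (wv 3 δ ≟ wv 0 δ)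

  wins : List (Dart n)
  wins = filter win? allD

  win⁻ : ∀ {δ} → δ ∈ wins → isD K δ × wv 3 δ ≢ wv 0 δ
  win⁻ m = proj₂ (∈-filter⁻ win? {xs = allD} m)

  role : Role n (Dart n)
  role δ v = if does (v ≟ wv 0 δ) then just fzero else
            (if does (v ≟ wv 1 δ) then just (fsuc fzero) else
            (if does (v ≟ wv 2 δ) then just (fsuc (fsuc fzero)) else
            (if does (v ≟ wv 3 δ) then just (fsuc (fsuc (fsuc fzero))) else nothing)))

  module _ {δ} (m : δ ∈ wins) where
    private
      h = proj₁ (win⁻ m)

    role₀ : role δ (wv 0 δ) ≡ just fzero
    role₀ rewrite dec-true (wv 0 δ ≟ wv 0 δ) refl = refl

    role₁ : role δ (wv 1 δ) ≡ just (fsuc fzero)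
    role₁ rewrite dec-false (wv 1 δ ≟ wv 0 δ) (wv-suc 0 h ∘ sym) | dec-true (wv 1 δ ≟ wv 1 δ) refl = refl

    role₂ : role δ (wv 2 δ) ≡ just (fsuc (fsuc fzero))
    role₂ rewrite dec-false (wv 2 δ ≟ wv 0 δ) (wv-two 0 h ∘ sym) | dec-false (wv 2 δ ≟ wv 1 δ) (wv-suc 1 h ∘ sym)
      | dec-true (wv 2 δ ≟ wv 2 δ) refl = refl

    role₃ : role δ (wv 3 δ) ≡ just (fsuc (fsuc (fsuc fzero)))
    role₃ rewrite dec-false (wv 3 δ ≟ wv 0 δ) (proj₂ (win⁻ m)) | dec-false (wv 3 δ ≟ wv 1 δ) (wv-two 1 h ∘ sym)
      | dec-false (wv 3 δ ≟ wv 2 δ) (wv-suc 2 h ∘ sym) | dec-true (wv 3 δ ≟ wv 3 δ) refl = refl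

  hits : ∀ δ → length (filter (λ v → just? (role δ v)) (allFin n)) ≤ 4
  hits δ = ⊆-length {ys = wv 0 δ ∷ wv 1 δ ∷ wv 2 δ ∷ wv 3 δ ∷ []} (filter⁺ (λ v → just? (role δ v)) (allFin⁺ n))
    (λ {v} m → in4 v (proj₂ (∈-filter⁻ (λ v → just? (role δ v)) {xs = allFin n} m)))
    where
    in4 : ∀ v → role δ v ≢ nothing → v ∈ wv 0 δ ∷ wv 1 δ ∷ wv 2 δ ∷ wv 3 δ ∷ []
    in4 v ne with v ≟ wv 0 δ
    ... | yes p = here p
    ... | no _ with v ≟ wv 1 δ
    ... | yes p = there (here p)
    ... | no _ with v ≟ wv 2 δ
    ... | yes p = there (there (here p))
    ... | no _ with v ≟ wv 3 δ
    ... | yes p = there (there (there (here p)))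
    ... | no _ = ⊥-elim (ne refl)

  Cols : (Fin n → Fin 4) → Dart n → Set
  Cols χ δ = χ (wv 0 δ) ≡ fzero × χ (wv 1 δ) ≡ fsuc fzero × χ (wv 2 δ) ≡ fsuc (fsuc fzero) × χ (wv 3 δ) ≡ fsuc (fsuc (fsuc fzero))

  cols? : ∀ χ δ → Dec (Cols χ δ)
  cols? χ δ = (χ (wv 0 δ) ≟ fzero) ×-dec (χ (wv 1 δ) ≟ fsuc fzero) ×-dec (χ (wv 2 δ) ≟ fsuc (fsuc fzero)) ×-dec (χ (wv 3 δ) ≟ fsuc (fsuc (fsuc fzero)))

  weight-bad : ∀ χ {δ} → δ ∈ wins → ¬ Cols χ δ → weight (role δ) χ (allFin n) ≡ 0
  weight-bad χ {δ} m nc with χ (wv 0 δ) ≟ fzero | χ (wv 1 δ) ≟ fsuc fzero | χ (wv 2 δ) ≟ fsuc (fsuc fzero) | χ (wv 3 δ) ≟ fsuc (fsuc (fsuc fzero))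
  ... | no p | _ | _ | _ = weight-zero (role δ) χ (∈-allFin _) (role₀ m) (p ∘ sym)
  ... | yes _ | no p | _ | _ = weight-zero (role δ) χ (∈-allFin _) (role₁ m) (p ∘ sym)
  ... | yes _ | yes _ | no p | _ = weight-zero (role δ) χ (∈-allFin _) (role₂ m) (p ∘ sym)
  ... | yes _ | yes _ | yes _ | no p = weight-zero (role δ) χ (∈-allFin _) (role₃ m) (p ∘ sym)
  ... | yes a | yes b | yes c | yes d = ⊥-elim (nc (a , b , c , d))

  total≤ : ∀ χ qs → (∀ {δ} → δ ∈ qs → δ ∈ wins) → total role χ (allFin n) qs ≤ length (filter (cols? χ) qs) * 256
  total≤ χ [] s = z≤n
  total≤ χ (q ∷ qs) s = go (cols? χ q)
    where
    rest : total role χ (allFin n) qs ≤ length (filter (cols? χ) qs) * 256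
    rest = total≤ χ qs (s ∘ there)
    -- This is 4 ^ 4: a window prescribes the colours of at most four vertices.
    ≤256 : weight (role q) χ (allFin n) ≤ 256
    ≤256 = ≤-trans (weight≤ (role q) χ (allFin n)) (^-monoʳ-≤ 4 (hits q))
    go : Dec (Cols χ q) → total role χ (allFin n) (q ∷ qs) ≤ length (filter (cols? χ) (q ∷ qs)) * 256
    go (yes c) = subst (λ t → total role χ (allFin n) (q ∷ qs) ≤ length t * 256) (sym (filter-accept (cols? χ) {q} {qs} c)) (+-mono-≤ ≤256 rest)
    go (no c) = subst₂ _≤_ (sym (cong (_+ total role χ (allFin n) qs) (weight-bad χ (s (here refl)) c)))
      (cong (λ t → length t * 256) (sym (filter-reject (cols? χ) {q} {qs} c))) rest

  chi : ∃ λ χ → length wins ≤ total role χ (allFin n) wins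
  chi = colour role wins (allFin⁺ n)

  χ : Fin n → Fin 4
  χ = proj₁ chi

  Ws : List (Dart n)
  Ws = filter (cols? χ) wins

  Ws-count : length wins ≤ length Ws * 256
  Ws-count = ≤-trans (proj₂ chi) (total≤ χ wins id)

  Ws-win : ∀ {δ} → δ ∈ Ws → Win χ δ
  Ws-win m = let p , q = ∈-filter⁻ (cols? χ) {xs = wins} m in proj₁ (win⁻ p) , q

  Ws! : Unique Ws
  Ws! = filter⁺ (cols? χ) (filter⁺ win? allD!)

  module M = LA χ Ws Ws! Ws-win

  module Eu = Euler Q M.h₀

  iter-inj : ∀ i {d e} → isD K d → isD K e → iter nxt i d ≡ iter nxt i e → d ≡ e
  iter-inj zero hd he q = q
  iter-inj (suc i) hd he q = iter-inj i hd he (N.injective (iterD i hd) (iterD i he) q)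

  tri? : ∀ δ → Dec (iter nxt 3 δ ≡ δ)
  tri? δ = iter nxt 3 δ ≟ᵈ δ

  -- Every dart of a triangular walk is within two steps of the representative of its walk.
  tri-bound : length (filter tri? (darts K)) ≤ length R * 3
  tri-bound = subst (length (filter tri? (darts K)) ≤_) (len-cart R (upTo 3))
    (rel-length Rel (filter⁺ tri? (darts! K)) ex (λ {_} {_} {y} p q → inj {p = y} (hd p) (hd q)))
    where
    Rel : Dart n → Dart n × ℕ → Set
    Rel d (r , i) = iter nxt i d ≡ r
    hd : ∀ {d} → d ∈ filter tri? (darts K) → isD K d
    hd m = ∈-darts⁻ K (proj₁ (∈-filter⁻ tri? {xs = darts K} m))
    inj : ∀ {d e p} → isD K d → isD K e → Rel d p → Rel e p → d ≡ e
    inj {p = r , i} hd he a b = iter-inj i hd he (trans a (sym b))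
    ex : ∀ {d} → d ∈ filter tri? (darts K) → ∃ λ p → p ∈ cartesianProduct R (upTo 3) × Rel d p
    ex {d} m with cov (inj₁ (hd m))
    ... | r , r∈ , t with reach-inv (λ e → ∃ λ i → i < 3 × iter nxt i d ≡ e) next t (0 , s≤s z≤n , refl)
      where
      next : ∀ {e} → (∃ λ i → i < 3 × iter nxt i d ≡ e) → ∃ λ i → i < 3 × iter nxt i d ≡ nxt e
      next (0 , _ , refl) = 1 , s≤s (s≤s z≤n) , refl
      next (1 , _ , refl) = 2 , s≤s (s≤s (s≤s z≤n)) , refl
      next (2 , _ , refl) = 0 , s≤s z≤n , sym (proj₂ (∈-filter⁻ tri? {xs = darts K} m))
      next (suc (suc (suc _)) , s≤s (s≤s (s≤s ())) , _)
    ... | i , lt , e = (r , i) , ∈-cartesianProduct⁺ r∈ (∈-upTo⁺ lt) , e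

  -- If the walk is back at the vertex `wv 0` after three steps but continues along another dart,
  -- then `wv 4` differs from `wv 1`, and the next dart starts a window.
  nontri : ∀ {δ} → isD K δ → iter nxt 3 δ ≢ δ → δ ∈ wins ⊎ nxt δ ∈ wins
  nontri {δ} h ne with wv 3 δ ≟ wv 0 δ
  ... | no p = inj₁ (∈-filter⁺ win? (∈-allD δ) (h , p))
  ... | yes p = inj₂ (∈-filter⁺ win? (∈-allD (nxt δ)) (nxt-cl h , λ e → ne (cong₂ _,_ p e)))

  nontri-bound : length (filter (λ δ → ¬? (tri? δ)) (darts K)) ≤ length wins * 2
  nontri-bound = subst (length (filter (λ δ → ¬? (tri? δ)) (darts K)) ≤_) (len-cart wins (upTo 2))
    (rel-length Rel (filter⁺ (λ δ → ¬? (tri? δ)) (darts! K)) ex (λ {_} {_} {y} p q → inj {p = y} (proj₁ (fl p)) (proj₁ (fl q))))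
    where
    Rel : Dart n → Dart n × ℕ → Set
    Rel d (r , i) = iter nxt i d ≡ r
    fl : ∀ {d} → d ∈ filter (λ δ → ¬? (tri? δ)) (darts K) → isD K d × iter nxt 3 d ≢ d
    fl m = let a , b = ∈-filter⁻ (λ δ → ¬? (tri? δ)) {xs = darts K} m in ∈-darts⁻ K a , b
    inj : ∀ {d e p} → isD K d → isD K e → Rel d p → Rel e p → d ≡ e
    inj {p = r , i} hd he a b = iter-inj i hd he (trans a (sym b))
    ex : ∀ {d} → d ∈ filter (λ δ → ¬? (tri? δ)) (darts K) → ∃ λ p → p ∈ cartesianProduct wins (upTo 2) × Rel d p
    ex {d} m with nontri (proj₁ (fl m)) (proj₂ (fl m))
    ... | inj₁ w = (d , 0) , ∈-cartesianProduct⁺ w (∈-upTo⁺ (s≤s z≤n)) , refl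
    ... | inj₂ w = (nxt d , 1) , ∈-cartesianProduct⁺ w (∈-upTo⁺ (s≤s (s≤s z≤n))) , refl

  dart-bound : #d K ≤ length R * 3 + length wins * 2
  dart-bound = subst (_≤ length R * 3 + length wins * 2) (length-split tri? (darts K)) (+-mono-≤ tri-bound nontri-bound)

  -- Independence bounds the number of darts from below, `gen` bounds it from above; together they
  -- give s + |R| ≤ 2 g + |L| for the number s of coloured windows. As |R| ≥ |L|, s is at most 2 g
  -- and there are at most 512 g windows in all. Inserting this into `dart-bound` yields 2060 = 6 ·
  -- 2 + 4 · 512.
  many-edges : 6 * n ≤ #d K + 12 + 2060 * g
  many-edges = +-cancelʳ-≤ (2 * D + 6 * l) _ _ (≤-trans (≤-reflexive (c₁ n D l)) (≤-trans (+-monoʳ-≤ (2 * D) (*-monoʳ-≤ 3 ii))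
    (≤-trans (≤-reflexive (c₂ D)) (≤-trans (+-monoʳ-≤ (12 + 3 * D) (*-monoʳ-≤ 2 dart-bound))
    (≤-trans (≤-reflexive (c₃ D (length R) (length wins))) (≤-trans (+-monoʳ-≤ (12 + 3 * D) (+-mono-≤ (*-monoʳ-≤ 6 R≤) (*-monoʳ-≤ 4 wins≤))) (≤-reflexive (c₄ D g l))))))))
    where
    D = #d K
    l = length L
    s = length Ws
    base : l + s + n ≤ 2 + length (half K)
    base = M.count
    dbl : 2 * (l + s + n) ≤ 4 + D
    dbl = ≤-trans (*-monoʳ-≤ 2 base) (≤-reflexive (trans (e (length (half K))) (cong (4 +_) (sym (#d-half K symA irr)))))
      where
      e : ∀ h → 2 * (2 + h) ≡ 4 + (h + h)
      e = solve-∀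
    ii : 2 * l + 2 * n ≤ 4 + D
    ii = ≤-trans (≤-reflexive (e l n)) (≤-trans (*-monoʳ-≤ 2 (+-monoˡ-≤ n (m≤m+n l s))) dbl)
      where
      e : ∀ l n → 2 * l + 2 * n ≡ 2 * (l + n)
      e = solve-∀
    i' : s + length R ≤ 2 * g + l
    i' = *-cancelˡ-≤ 2 (+-cancelʳ-≤ (4 + D + (2 * l + 2 * n)) _ _ (≤-trans (≤-reflexive (e₁ s (length R) D l n))
      (≤-trans (+-mono-≤ dbl gen) (≤-reflexive (e₂ g l D n)))))
      where
      e₁ : ∀ s r D l n → 2 * (s + r) + (4 + D + (2 * l + 2 * n)) ≡ 2 * (l + s + n) + (4 + D + 2 * r)
      e₁ = solve-∀
      e₂ : ∀ g l D n → 4 + D + (4 * g + 2 * n + 4 * l) ≡ 2 * (2 * g + l) + (4 + D + (2 * l + 2 * n))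
      e₂ = solve-∀
    R≤ : length R ≤ 2 * g + l
    R≤ = ≤-trans (m≤n+m (length R) s) i'
    s≤ : s ≤ 2 * g
    s≤ = +-cancelʳ-≤ l _ _ (≤-trans (+-monoʳ-≤ s (≤-trans (m≤m+n l _) Eu.L+iso≤R)) i')
    wins≤ : length wins ≤ 2 * g * 256
    wins≤ = ≤-trans Ws-count (*-monoˡ-≤ 256 s≤)
    c₁ : ∀ n D l → 6 * n + (2 * D + 6 * l) ≡ 2 * D + 3 * (2 * l + 2 * n)
    c₁ = solve-∀
    c₂ : ∀ D → 2 * D + 3 * (4 + D) ≡ 12 + 3 * D + 2 * D
    c₂ = solve-∀
    c₃ : ∀ D r w → 12 + 3 * D + 2 * (r * 3 + w * 2) ≡ 12 + 3 * D + (6 * r + 4 * w)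
    c₃ = solve-∀
    c₄ : ∀ D g l → 12 + 3 * D + (6 * (2 * g + l) + 4 * (2 * g * 256)) ≡ D + 12 + 2060 * g + (2 * D + 6 * l)
    c₄ = solve-∀

-- Graphs from adjacency functions

graphOf : ∀ {n} → Adj n → Graph n
graphOf A = tabulate (λ u → tabulate (A u))

adj-graphOf : ∀ {n} (A : Adj n) u v → adj (graphOf A) u v ≡ A u v
adj-graphOf A u v = trans (cong (λ r → lookup r v) (lookup∘tabulate (λ u → tabulate (A u)) u)) (lookup∘tabulate (A u) v)

gr⁺ : ∀ {n} (A : Adj n) → A ⊑ adj (graphOf A)
gr⁺ A {u} {v} h = trans (adj-graphOf A u v) h

gr⁻ : ∀ {n} (A : Adj n) → adj (graphOf A) ⊑ A
gr⁻ A {u} {v} h = trans (sym (adj-graphOf A u v)) h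

vec-ext : ∀ {A : Set} {n} (xs ys : Vec A n) → (∀ i → lookup xs i ≡ lookup ys i) → xs ≡ ys
vec-ext xs ys e = trans (sym (tabulate∘lookup xs)) (trans (tabulate-cong e) (tabulate∘lookup ys))

graph-ext : ∀ {n} {G H : Graph n} → adj G ⊑ adj H → adj H ⊑ adj G → G ≡ H
graph-ext {G = G} {H} f b = vec-ext G H (λ u → vec-ext (lookup G u) (lookup H u) (λ v → bool-ext (λ h → f h) (λ h → b h)))

infix 4 _≟ᵍ_
_≟ᵍ_ : ∀ {n} → DecidableEquality (Graph n)
_≟ᵍ_ = Vec-≡-dec (Vec-≡-dec _≟ᵇ_)

-- Pendant paths

-- p , x , xs is a path; x and the vertices of xs have no neighbours off the path, and its last vertex is a leaf.
PT : ∀ {n} → Adj n → Fin n → Fin n → List (Fin n) → Set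
PT A p x [] = A x p ≡ true × (∀ {z} → A x z ≡ true → z ≡ p)
PT A p x (y ∷ ys) = A x p ≡ true × A x y ≡ true × p ≢ y × (∀ {z} → A x z ≡ true → z ≡ p ⊎ z ≡ y) × PT A x y ys

PT-row : ∀ {n} {A A' : Adj n} {p x} xs → (∀ {v w} → v ∈ x ∷ xs → A v w ≡ true → A' v w ≡ true) →
  (∀ {v w} → v ∈ x ∷ xs → A' v w ≡ true → A v w ≡ true) → PT A p x xs → PT A' p x xs
PT-row [] f b (h , o) = f (here refl) h , λ k → o (b (here refl) k)
PT-row (y ∷ ys) f b (h , h' , ne , o , r) = f (here refl) h , f (here refl) h' , ne , (λ k → o (b (here refl) k)) , PT-row ys (f ∘ there) (b ∘ there) r

PP : ∀ {n} → Adj n → List (Fin n) → Set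
PP A (p ∷ x ∷ xs) = PT A p x xs
PP A _ = ⊥

PT-forward : ∀ {n} {A : Adj n} {p x} xs ys → length xs ≡ length ys → PT A p x xs → PT A p x ys → xs ≡ ys
PT-forward [] [] e a b = refl
PT-forward (y ∷ ys) (z ∷ zs) e (_ , hy , py , o , r) (_ , hz , pz , o' , r') with o' hy
... | inj₁ q = ⊥-elim (py (sym q))
... | inj₂ refl = cong (y ∷_) (PT-forward ys zs (suc-injective e) r r')

data At {n} : List (Fin n) → ℕ → Fin n → Fin n → Set where
  at0 : ∀ {w z xs} → At (w ∷ z ∷ xs) 0 w z
  ats : ∀ {x xs i w z} → At xs i w z → At (x ∷ xs) (suc i) w z

-- Behind the hanging point all degrees are at most 2, so one directed edge and its position
-- determine the path in both directions. Counting pendant paths is thereby reduced to counting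
-- edges.
PP-unique : ∀ {n} {A : Adj n} P P' {i w z} → length P ≡ length P' → PP A P → PP A P' → At P i w z → At P' i w z → P ≡ P'
PP-unique (w ∷ z ∷ xs) (_ ∷ _ ∷ ys) e a b at0 at0 = cong (λ t → w ∷ z ∷ t) (PT-forward xs ys (suc-injective (suc-injective e)) a b)
PP-unique (p ∷ x ∷ []) (p' ∷ x' ∷ []) e a b (ats (ats ())) _
PP-unique (p ∷ x ∷ []) (p' ∷ x' ∷ _ ∷ _) () a b _ _
PP-unique (p ∷ x ∷ _ ∷ _) (p' ∷ x' ∷ []) () a b _ _
PP-unique (p ∷ x ∷ y ∷ ys) (p' ∷ x' ∷ y' ∷ ys') e (h , _ , py , o , r) (h' , _ , py' , o' , r') (ats i) (ats j)
  with PP-unique (x ∷ y ∷ ys) (x' ∷ y' ∷ ys') (suc-injective e) r r' i j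
... | refl with o' h
... | inj₁ refl = refl
... | inj₂ q = ⊥-elim (py q)

PT-at : ∀ {n} {A : Adj n} {p x} xs → PT A p x xs → ∀ {z} → z ∈ x ∷ xs →
  ∃ λ i → ∃ λ w → i < suc (length xs) × At (p ∷ x ∷ xs) i w z × A z w ≡ true × deg A z ≤ 2
PT-at {A = A} {p} {x} [] (h , o) (here refl) = 0 , p , s≤s z≤n , at0 , h ,
  ≤-trans (⊆-length {ys = p ∷ []} (nbrs! A x) (λ m → here (o (∈-nbrs⁻ A m)))) (s≤s z≤n)
PT-at {A = A} {p} {x} (y ∷ ys) (h , _ , _ , o , r) (here refl) = 0 , p , s≤s z≤n , at0 , h ,
  ⊆-length {ys = p ∷ y ∷ []} (nbrs! A x) (λ m → two (o (∈-nbrs⁻ A m)))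
  where
  two : ∀ {z} → z ≡ p ⊎ z ≡ y → z ∈ p ∷ y ∷ []
  two (inj₁ e) = here e
  two (inj₂ e) = there (here e)
PT-at (y ∷ ys) (_ , _ , _ , _ , r) (there m) with PT-at ys r m
... | i , w , lt , a , h , d = suc i , w , s≤s lt , ats a , h , d

-- A pendant path lies on one face

module LargePath {g n} (G : Graph n) (e : Embedding g G) where
  open Embedding e

  -- A cyclic order of two elements exchanges them, whatever the embedding.
  turn-back : ∀ {p x y} → adj G x p ≡ true → adj G x y ≡ true → p ≢ y → (∀ {z} → adj G x z ≡ true → z ≡ p ⊎ z ≡ y) → ρ x y ≡ p
  turn-back {p} {x} {y} hp hy ne o with o (proj₁ isRot x y hy)
  ... | inj₁ q = q
  ... | inj₂ q = let k , r = proj₂ isRot x y p hy hp in ⊥-elim (ne (reach-fix q (subst (Reach (ρ x) y) r (iter⇒reach (ρ x) k y))))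

  -- Only the darts directed towards the hanging point are followed; they already give a face of the
  -- size required.
  pathDarts : Fin n → List (Fin n) → List (Dart n)
  pathDarts p [] = []
  pathDarts p (x ∷ xs) = (x , p) ∷ pathDarts x xs

  pathDarts-fst : ∀ p xs → map proj₁ (pathDarts p xs) ≡ xs
  pathDarts-fst p [] = refl
  pathDarts-fst p (x ∷ xs) = cong (x ∷_) (pathDarts-fst x xs)

  onFace : ∀ {p x} xs → (∀ {u v} → adj G u v ≡ true → adj G v u ≡ true) → PT (adj G) p x xs →
    ∀ {d} → d ∈ pathDarts p (x ∷ xs) → isD (adj G) d × face (proj₁ d) (proj₂ d) ≡ face x p
  onFace [] sy (h , _) (here refl) = h , refl
  onFace (y ∷ ys) sy (h , _) (here refl) = h , refl
  onFace {p} {x} (y ∷ ys) sy (h , h' , ne , o , r) (there m) with onFace ys sy r m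
  ... | hd , q = hd , trans q (trans (sym (faceInv y x (sy h'))) (cong (face x) (turn-back h h' ne o)))

  large : ∀ {p x} xs → (∀ {u v} → adj G u v ≡ true → adj G v u ≡ true) → PT (adj G) p x xs → Unique (x ∷ xs) →
    suc (length xs) ≤ faceSize (face x p)
  large {p} {x} xs sy t u = subst₂ _≤_ (trans (sym (length-map proj₁ (pathDarts p (x ∷ xs)))) (cong length (pathDarts-fst p (x ∷ xs))))
    (sym (ΣΣ-sel P)) (⊆-length (Unique-map⁻ (subst Unique (sym (pathDarts-fst p (x ∷ xs))) u))
      (λ {d} m → ∈-sel⁺ P (∈-allD d) (∧-intro (proj₁ (onFace xs sy t m)) (T⇒true (≡⇒≡ᵇ _ _ (cong toℕ (proj₂ (onFace xs sy t m))))))))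
    where
    P : Dart n → Bool
    P d = adj G (proj₁ d) (proj₂ d) ∧ (toℕ (face (proj₁ d) (proj₂ d)) ≡ᵇ toℕ (face x p))

-- Multiplicities in lists

collect : ∀ {A : Set} {P : A → Set} → (∀ x → Dec (P x)) → List A → List (Σ A P)
collect P? [] = []
collect P? (x ∷ xs) with P? x
... | yes p = (x , p) ∷ collect P? xs
... | no _ = collect P? xs

collect-fst : ∀ {A : Set} {P : A → Set} (P? : ∀ x → Dec (P x)) xs → map proj₁ (collect P? xs) ≡ filter P? xs
collect-fst P? [] = refl
collect-fst P? (x ∷ xs) with P? x
... | yes p = cong (x ∷_) (collect-fst P? xs)
... | no _ = collect-fst P? xs

collect-length : ∀ {A : Set} {P : A → Set} (P? : ∀ x → Dec (P x)) xs → length (collect P? xs) ≡ length (filter P? xs)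
collect-length P? xs = trans (sym (length-map proj₁ (collect P? xs))) (cong length (collect-fst P? xs))

module Mult {B : Set} (_≟ᴮ_ : DecidableEquality B) where
  infix 4 _∈ᴮ?_
  _∈ᴮ?_ : ∀ z zs → Dec (z ∈ zs)
  z ∈ᴮ? zs = anyL? (z ≟ᴮ_) zs

  -- States contain embeddings and proofs, and are compared only through a code `π` with decidable
  -- equality. Multiplicity means the number of states with the same code.
  occ : ∀ {S : Set} → (S → B) → List S → B → ℕ
  occ π X z = length (filter (λ x → π x ≟ᴮ z) X)

  occ-++ : ∀ {S : Set} (π : S → B) X Y z → occ π (X ++ Y) z ≡ occ π X z + occ π Y z
  occ-++ π X Y z = trans (cong length (filter-++ (λ x → π x ≟ᴮ z) X Y)) (length-++ (filter (λ x → π x ≟ᴮ z) X))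

  occ-unique : ∀ {S : Set} (π : S → B) {X} → Unique (map π X) → ∀ z → occ π X z ≤ 1
  occ-unique π {[]} u z = z≤n
  occ-unique π {x ∷ X} (h ∷ u) z with π x ≟ᴮ z
  ... | no _ = occ-unique π u z
  ... | yes refl = s≤s (≤-reflexive (cong length (filter-none (λ y → π y ≟ᴮ π x) (All-tabulate (λ m e → All-lookup h (∈-map⁺ π m) (sym e))))))

  cover : ∀ {S : Set} (π : S → B) {μ} X → (∀ z → occ π X z ≤ μ) → ∀ zs → length (filter (λ x → π x ∈ᴮ? zs) X) ≤ length zs * μ
  cover π X h [] = ≤-reflexive (cong length (filter-none (λ x → π x ∈ᴮ? []) {X} (All-tabulate (λ _ ()))))
  cover π {μ} X h (z ∷ zs) = ≤-trans (go X) (+-mono-≤ (h z) (cover π X h zs))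
    where
    go : ∀ X → length (filter (λ x → π x ∈ᴮ? (z ∷ zs)) X) ≤ occ π X z + length (filter (λ x → π x ∈ᴮ? zs) X)
    go [] = z≤n
    go (x ∷ X) = go' (π x ≟ᴮ z) (π x ∈ᴮ? zs)
      where
      a = filter (λ x → π x ∈ᴮ? (z ∷ zs))
      go' : Dec (π x ≡ z) → Dec (π x ∈ zs) → length (a (x ∷ X)) ≤ occ π (x ∷ X) z + length (filter (λ x → π x ∈ᴮ? zs) (x ∷ X))
      go' (yes p) q = ≤-trans (≤-reflexive (cong length (filter-accept (λ x → π x ∈ᴮ? (z ∷ zs)) {x} {X} (here p))))
        (≤-trans (s≤s (go X)) (+-mono-≤ (≤-reflexive (sym (cong length (filter-accept (λ x → π x ≟ᴮ z) {x} {X} p)))) (keep q)))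
        where
        keep : Dec (π x ∈ zs) → length (filter (λ x → π x ∈ᴮ? zs) X) ≤ length (filter (λ x → π x ∈ᴮ? zs) (x ∷ X))
        keep (yes r) = ≤-trans (n≤1+n _) (≤-reflexive (sym (cong length (filter-accept (λ x → π x ∈ᴮ? zs) {x} {X} r))))
        keep (no r) = ≤-reflexive (sym (cong length (filter-reject (λ x → π x ∈ᴮ? zs) {x} {X} r)))
      go' (no p) (yes q) = ≤-trans (≤-reflexive (cong length (filter-accept (λ x → π x ∈ᴮ? (z ∷ zs)) {x} {X} (there q))))
        (≤-trans (s≤s (go X)) (≤-trans (≤-reflexive (sym (+-suc (occ π X z) _)))
          (+-mono-≤ (≤-reflexive (sym (cong length (filter-reject (λ x → π x ≟ᴮ z) {x} {X} p)))) (≤-reflexive (sym (cong length (filter-accept (λ x → π x ∈ᴮ? zs) {x} {X} q)))))))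
      go' (no p) (no q) = ≤-trans (≤-reflexive (cong length (filter-reject (λ x → π x ∈ᴮ? (z ∷ zs)) {x} {X} (λ { (here e) → p e ; (there m) → q m }))))
        (≤-trans (go X) (+-mono-≤ (≤-reflexive (sym (cong length (filter-reject (λ x → π x ≟ᴮ z) {x} {X} p)))) (≤-reflexive (sym (cong length (filter-reject (λ x → π x ∈ᴮ? zs) {x} {X} q))))))

  fibre : ∀ {S : Set} (π : S → B) {μ} X zs → (∀ {x} → x ∈ X → π x ∈ zs) → (∀ z → occ π X z ≤ μ) → length X ≤ length zs * μ
  fibre π X zs m h = subst (_≤ _) (cong length (filter-all (λ x → π x ∈ᴮ? zs) (All-tabulate m))) (cover π X h zs)

module MultStep {B B' : Set} (_≟ᴮ_ : DecidableEquality B) (_≟′_ : DecidableEquality B')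
  {S S' : Set} (π : S → B) (π' : S' → B') (next : S → List S') (c : B' → List B) where
  open Mult _≟ᴮ_
  open Mult _≟′_ using () renaming (occ to occ'; occ-++ to occ-++'; occ-unique to occ-unique')

  occ-concat : ∀ X → (∀ {x y} → x ∈ X → y ∈ next x → π x ∈ c (π' y)) → (∀ {x} → x ∈ X → Unique (map π' (next x))) → ∀ z →
    occ' π' (concatMap next X) z ≤ length (filter (λ x → π x ∈ᴮ? c z) X)
  occ-concat [] d u z = z≤n
  occ-concat (x ∷ X) d u z = subst (_≤ length (filter (λ x → π x ∈ᴮ? c z) (x ∷ X))) (sym (occ-++' π' (next x) (concatMap next X) z)) (go (π x ∈ᴮ? c z))
    where
    rest = occ-concat X (d ∘ there) (u ∘ there) z
    go : Dec (π x ∈ c z) → occ' π' (next x) z + occ' π' (concatMap next X) z ≤ length (filter (λ x → π x ∈ᴮ? c z) (x ∷ X))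
    go (yes p) = ≤-trans (+-mono-≤ (occ-unique' π' (u (here refl)) z) rest) (≤-reflexive (sym (cong length (filter-accept (λ x → π x ∈ᴮ? c z) {x} {X} p))))
    go (no p) = ≤-trans (≤-reflexive (cong (_+ occ' π' (concatMap next X) z) (cong length (filter-none (λ y → π' y ≟′ z) {next x}
        (All-tabulate (λ m e → p (subst (λ t → π x ∈ c t) e (d (here refl) m)))))))) (≤-trans rest
      (≤-reflexive (sym (cong length (filter-reject (λ x → π x ∈ᴮ? c z) {x} {X} p)))))

  -- Double counting. A code `z` arises only from states whose codes lie in `c z`, which are at most
  -- β codes of multiplicity at most μ, and a single state produces `z` at most once.
  mult-step : ∀ {μ β} X → (∀ {x y} → x ∈ X → y ∈ next x → π x ∈ c (π' y)) → (∀ {x} → x ∈ X → Unique (map π' (next x))) →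
    (∀ {x y} → x ∈ X → y ∈ next x → length (c (π' y)) ≤ β) → (∀ z → occ π X z ≤ μ) → ∀ z → occ' π' (concatMap next X) z ≤ β * μ
  mult-step {μ} {β} X d u l h z with anyL? (λ y → π' y ≟′ z) (concatMap next X)
  ... | no none = subst (_≤ β * μ) (sym (cong length (filter-none (λ y → π' y ≟′ z) {concatMap next X} (All-tabulate (λ m e → none (lose m e)))))) z≤n
  ... | yes p with find p
  ... | y , y∈ , refl with ∈-concat⁻′ (map next X) y∈
  ... | ys , y∈ys , ys∈ with ∈-map⁻ next ys∈
  ... | x , x∈ , refl = ≤-trans (occ-concat X d u z) (≤-trans (cover π X h (c z)) (*-monoˡ-≤ μ (l x∈ y∈ys)))

concatMap-≥ : ∀ {S S' : Set} (next : S → List S') {c N} X → (∀ {x} → x ∈ X → N ≤ c * length (next x)) → length X * N ≤ c * length (concatMap next X)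
concatMap-≥ next {c} [] h = z≤n
concatMap-≥ next {c} {N} (x ∷ X) h = ≤-trans (+-mono-≤ (h (here refl)) (concatMap-≥ next {c} X (h ∘ there)))
  (≤-reflexive (trans (sym (*-distribˡ-+ c (length (next x)) _)) (cong (c *_) (sym (length-++ (next x))))))

tuples : ∀ {A : Set} → ℕ → List A → List (List A)
tuples zero xs = [] ∷ []
tuples (suc t) xs = map (λ p → proj₁ p ∷ proj₂ p) (cartesianProduct xs (tuples t xs))

tuples-length : ∀ {A : Set} t (xs : List A) → length (tuples t xs) ≡ length xs ^ t
tuples-length zero xs = refl
tuples-length (suc t) xs = trans (length-map _ (cartesianProduct xs (tuples t xs))) (trans (len-cart xs (tuples t xs)) (cong (length xs *_) (tuples-length t xs)))

∈-tuples : ∀ {A : Set} {xs : List A} es → (∀ {e} → e ∈ es → e ∈ xs) → es ∈ tuples (length es) xs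
∈-tuples [] h = here refl
∈-tuples (e ∷ es) h = ∈-map⁺ (λ p → proj₁ p ∷ proj₂ p) (∈-cartesianProduct⁺ (h (here refl)) (∈-tuples es (h ∘ there)))

subs : ∀ {A : Set} → List A → List (List A)
subs [] = [] ∷ []
subs (x ∷ xs) = subs xs ++ map (x ∷_) (subs xs)

subs-length : ∀ {A : Set} (xs : List A) → length (subs xs) ≡ 2 ^ length xs
subs-length [] = refl
subs-length (x ∷ xs) = trans (length-++ (subs xs)) (trans (cong₂ _+_ (subs-length xs) (trans (length-map (x ∷_) (subs xs)) (subs-length xs)))
  (cong (2 ^ length xs +_) (sym (+-identityʳ _))))

sel∈subs : ∀ {A : Set} (p : A → Bool) xs → sel p xs ∈ subs xs
sel∈subs p [] = here refl
sel∈subs p (x ∷ xs) with p x ≟ᵇ true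
... | yes _ = ∈-++⁺ʳ (subs xs) (∈-map⁺ (x ∷_) (sel∈subs p xs))
... | no _ = ∈-++⁺ˡ (sel∈subs p xs)

-- Counting and undoing contractions

module ContrCount {n} (A : Adj n) (sy : ∀ {u v} → A u v ≡ true → A v u ≡ true) (ir : ∀ {v} → A v v ≢ true)
  {v u : Fin n} (h : A v u ≡ true) where
  H : Adj n
  H = contr A v u

  u≢v : u ≢ v
  u≢v refl = ir h

  contr⁻ : ∀ {x y} → H x y ≡ true → CP A v u x y
  contr⁻ = adjOf⁻ (contr? A v u)

  contr⁺ : ∀ {x y} → CP A v u x y → H x y ≡ true
  contr⁺ = adjOf⁺ (contr? A v u)

  -- Each dart of the contraction stems from a dart of `A` on an edge other than vu, and no two from
  -- the same one; `Rel` states from which.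
  #d-dec : #d H + 2 ≤ #d A
  #d-dec = subst (#d H + 2 ≤_) (trans (+-comm (#d (rem A v u)) 2) (sym (#d-ext E))) (+-monoˡ-≤ 2
    (rel-length Rel (darts! H) (λ {d} m → ex d (∈-darts⁻ H m)) (λ {d} {e} p q → inj d e (contr⁻ (∈-darts⁻ H p)) (contr⁻ (∈-darts⁻ H q)))))
    where
    E : Ext (rem A v u) A v u
    E = rem-ext A (u≢v ∘ sym) h (sy h)
    Rel : Dart n → Dart n → Set
    Rel (x , y) e = e ≡ (x , y) ⊎ (x ≡ u × e ≡ (v , y)) ⊎ (y ≡ u × e ≡ (x , v))
    ex : ∀ d → H (proj₁ d) (proj₂ d) ≡ true → ∃ λ e → e ∈ darts (rem A v u) × Rel d e
    ex (x , y) b with contr⁻ b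
    ... | p , q , inj₁ k = (x , y) , ∈-darts⁺ (rem A v u) (adjOf⁺ (rem? A v u) (k , λ { (inj₁ (e , _)) → p e ; (inj₂ (_ , e)) → q e })) , inj₁ refl
    ... | p , q , inj₂ (inj₁ (e , r , k)) = (v , y) , ∈-darts⁺ (rem A v u) (adjOf⁺ (rem? A v u) (k , λ { (inj₁ (_ , e')) → r e' ; (inj₂ (_ , e')) → q e' })) , inj₂ (inj₁ (e , refl))
    ... | p , q , inj₂ (inj₂ (e , r , k)) = (x , v) , ∈-darts⁺ (rem A v u) (adjOf⁺ (rem? A v u) (sy k , λ { (inj₁ (e' , _)) → p e' ; (inj₂ (e' , _)) → r e' })) , inj₂ (inj₂ (e , refl))
    inj : ∀ d d' {e} → CP A v u (proj₁ d) (proj₂ d) → CP A v u (proj₁ d') (proj₂ d') → Rel d e → Rel d' e → d ≡ d'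
    inj _ _ _ _ (inj₁ refl) (inj₁ refl) = refl
    inj _ _ (p , _) _ (inj₁ refl) (inj₂ (inj₁ (_ , e))) = ⊥-elim (p (cong proj₁ e))
    inj _ _ (_ , q , _) _ (inj₁ refl) (inj₂ (inj₂ (_ , e))) = ⊥-elim (q (cong proj₂ e))
    inj _ _ _ (p , _) (inj₂ (inj₁ (_ , e))) (inj₁ refl) = ⊥-elim (p (cong proj₁ e))
    inj _ _ _ (_ , q , _) (inj₂ (inj₂ (_ , e))) (inj₁ refl) = ⊥-elim (q (cong proj₂ e))
    inj _ _ _ _ (inj₂ (inj₁ (refl , refl))) (inj₂ (inj₁ (refl , refl))) = refl
    inj _ _ _ _ (inj₂ (inj₂ (refl , refl))) (inj₂ (inj₂ (refl , refl))) = refl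
    inj _ _ (_ , q , _) _ (inj₂ (inj₁ (_ , refl))) (inj₂ (inj₂ (_ , e))) = ⊥-elim (q (cong proj₂ e))
    inj _ _ (p , _) _ (inj₂ (inj₂ (_ , refl))) (inj₂ (inj₁ (_ , e))) = ⊥-elim (p (cong proj₁ e))

  #d-inc : #d A ≤ #d H + 2 * deg A v
  #d-inc = ≤-trans (⊆-length {ys = darts H ++ map (v ,_) (nbrs A v) ++ map (_, v) (nbrs A v)} (darts! A) (λ {d} m → sub d (∈-darts⁻ A m)))
    (≤-reflexive (trans (length-++ (darts H)) (cong (#d H +_) (trans (length-++ (map (v ,_) (nbrs A v)))
      (trans (cong₂ _+_ (length-map (v ,_) (nbrs A v)) (length-map (_, v) (nbrs A v))) (cong (deg A v +_) (sym (+-identityʳ _))))))))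
    where
    sub : ∀ d → A (proj₁ d) (proj₂ d) ≡ true → d ∈ darts H ++ map (v ,_) (nbrs A v) ++ map (_, v) (nbrs A v)
    sub (x , y) k with x ≟ v | y ≟ v
    ... | yes refl | _ = ∈-++⁺ʳ (darts H) (∈-++⁺ˡ (∈-map⁺ (v ,_) (∈-nbrs⁺ A k)))
    ... | no _ | yes refl = ∈-++⁺ʳ (darts H) (∈-++⁺ʳ (map (v ,_) (nbrs A v)) (∈-map⁺ (_, v) (∈-nbrs⁺ A (sy k))))
    ... | no p | no q = ∈-++⁺ˡ (∈-darts⁺ H (contr⁺ (p , q , inj₁ k)))

  rows : ∀ {x} → x ∉ v ∷ u ∷ nbrs A v → ∀ y → A x y ≡ H x y
  rows {x} nx y = bool-ext (λ k → contr⁺ ((λ e → nx (here e)) , (λ { refl → nx (there (there (∈-nbrs⁺ A (sy k)))) }) , inj₁ k)) back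
    where
    back : H x y ≡ true → A x y ≡ true
    back b with contr⁻ b
    ... | _ , _ , inj₁ k = k
    ... | _ , _ , inj₂ (inj₁ (e , _)) = ⊥-elim (nx (there (here e)))
    ... | _ , _ , inj₂ (inj₂ (_ , _ , k)) = ⊥-elim (nx (there (there (∈-nbrs⁺ A k))))

  iso-keep : ∀ {w} → iso A w → iso H w
  iso-keep i y b with contr⁻ b
  ... | _ , _ , inj₁ k = i y k
  ... | _ , _ , inj₂ (inj₁ (refl , _)) = i v (sy h)
  ... | _ , _ , inj₂ (inj₂ (_ , _ , k)) = i v (sy k)

-- The graph with neighbours S₁ and u at v, and neighbours S₂ and v at u, that agrees with A elsewhere.
RB : ∀ {n} → Adj n → (v u : Fin n) (S₁ S₂ : List (Fin n)) (x y : Fin n) → Set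
RB A v u S₁ S₂ x y = (x ≡ v × (y ≡ u ⊎ y ∈ S₁)) ⊎ (y ≡ v × (x ≡ u ⊎ x ∈ S₁)) ⊎
  (x ≢ v × y ≢ v × ((x ≡ u × y ∈ S₂) ⊎ (y ≡ u × x ∈ S₂) ⊎ (x ≢ u × y ≢ u × A x y ≡ true)))

rb? : ∀ {n} (A : Adj n) v u S₁ S₂ x y → Dec (RB A v u S₁ S₂ x y)
rb? A v u S₁ S₂ x y = ((x ≟ v) ×-dec ((y ≟ u) ⊎-dec (y ∈? S₁))) ⊎-dec ((y ≟ v) ×-dec ((x ≟ u) ⊎-dec (x ∈? S₁))) ⊎-dec
  (¬? (x ≟ v) ×-dec ¬? (y ≟ v) ×-dec (((x ≟ u) ×-dec (y ∈? S₂)) ⊎-dec ((y ≟ u) ×-dec (x ∈? S₂)) ⊎-dec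
    (¬? (x ≟ u) ×-dec ¬? (y ≟ u) ×-dec (A x y ≟ᵇ true))))

rebuild : ∀ {n} → Graph n → (v u : Fin n) (S₁ S₂ : List (Fin n)) → Graph n
rebuild G v u S₁ S₂ = graphOf (adjOf (rb? (adj G) v u S₁ S₂))

guard : ∀ {A P : Set} → Dec P → List A → List A
guard (yes _) xs = xs
guard (no _) xs = []

guard-length : ∀ {A P : Set} (p? : Dec P) {xs : List A} {c} → (P → length xs ≤ c) → length (guard p? xs) ≤ c
guard-length (yes p) f = f p
guard-length (no _) f = z≤n

∈-guard : ∀ {A P : Set} (p? : Dec P) {xs : List A} {x} → P → x ∈ xs → x ∈ guard p? xs
∈-guard (yes _) p m = m
∈-guard (no np) p m = ⊥-elim (np p)

module Decode {n : ℕ} (Δ : ℕ) where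
  -- The guard makes the bound on the number of pairs of subsets valid for every `u`. The true
  -- target passes it, since its neighbours after the contraction were neighbours of `u` or of `v`.
  low : Graph n → (v u : Fin n) → List (Graph n)
  low G v u = guard (deg (adj G) u ≤? Δ + Δ) (map (λ p → rebuild G v u (proj₁ p) (proj₂ p))
    (cartesianProduct (subs (nbrs (adj G) u)) (subs (nbrs (adj G) u))))

  -- The possible graphs before the contraction of `v`. If the target had bounded degree, both old
  -- neighbourhoods are read off subsets of its present one. If `v` was a leaf, `u` alone suffices.
  -- If `v` had a second neighbour w only, then uw is now an edge, either present before or created
  -- by the contraction, which accounts for the last two lists. For a graph with O(n) edges there
  -- are O(n) candidates in all.
  cand : Graph n → Fin n → List (Graph n)
  cand G v = (concatMap (low G v) (allFin n) ++ map (λ u → rebuild G v u [] (nbrs (adj G) u)) (allFin n)) ++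
    (map (λ d → rebuild G v (proj₁ d) (proj₂ d ∷ []) (nbrs (adj G) (proj₁ d))) (darts (adj G)) ++
     map (λ d → rebuild G v (proj₁ d) (proj₂ d ∷ []) (filter (λ y → ¬? (y ≟ proj₂ d)) (nbrs (adj G) (proj₁ d)))) (darts (adj G)))

  c₀ : ℕ
  c₀ = 2 ^ (Δ + Δ) * 2 ^ (Δ + Δ)

  cand-length : ∀ G v → length (cand G v) ≤ n * (c₀ + 1) + 2 * #d (adj G)
  cand-length G v = ≤-trans (≤-reflexive (trans (length-++ (concatMap (low G v) (allFin n) ++ map (λ u → rebuild G v u [] (nbrs (adj G) u)) (allFin n)))
      (cong₂ _+_ (trans (length-++ (concatMap (low G v) (allFin n))) (cong (length (concatMap (low G v) (allFin n)) +_)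
        (trans (length-map (λ u → rebuild G v u [] (nbrs (adj G) u)) (allFin n)) (length-tabulate {n = n} id))))
      (trans (length-++ (map _ (darts (adj G)))) (cong₂ _+_ (length-map _ (darts (adj G))) (length-map _ (darts (adj G))))))))
    (≤-trans (+-monoˡ-≤ _ (+-monoˡ-≤ n (≤-trans (lows (allFin n)) (≤-reflexive (cong (_* c₀) (length-tabulate {n = n} id))))))
      (≤-reflexive (arith n c₀ (#d (adj G)))))
    where
    arith : ∀ n c D → n * c + n + (D + D) ≡ n * (c + 1) + 2 * D
    arith = solve-∀
    one : ∀ u → length (low G v u) ≤ c₀
    one u = guard-length (deg (adj G) u ≤? Δ + Δ) (λ le → ≤-trans (≤-reflexive (trans (length-map _ (cartesianProduct (subs N) (subs N))) (len-cart (subs N) (subs N))))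
        (*-mono-≤ (sub≤ le) (sub≤ le)))
      where
      N = nbrs (adj G) u
      sub≤ : deg (adj G) u ≤ Δ + Δ → length (subs N) ≤ 2 ^ (Δ + Δ)
      sub≤ le = ≤-trans (≤-reflexive (subs-length N)) (^-monoʳ-≤ 2 le)
    lows : ∀ xs → length (concatMap (low G v) xs) ≤ length xs * c₀
    lows [] = z≤n
    lows (x ∷ xs) = ≤-trans (≤-reflexive (length-++ (low G v x))) (+-mono-≤ (one x) (lows xs))

  module _ (G : Graph n) (sy : ∀ {u v} → adj G u v ≡ true → adj G v u ≡ true) (ir : ∀ {v} → adj G v v ≢ true)
    {v u : Fin n} (h : adj G v u ≡ true) where
    open ContrCount (adj G) sy ir h

    G' : Graph n
    G' = graphOf H

    N : List (Fin n)
    N = nbrs (adj G') u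

    record Spec (S₁ S₂ : List (Fin n)) : Set where
      field
        s₁ : ∀ {y} → y ∈ S₁ → adj G v y ≡ true
        s₁' : ∀ {y} → adj G v y ≡ true → y ≢ u → y ∈ S₁
        s₂ : ∀ {y} → y ∈ S₂ → adj G u y ≡ true
        s₂' : ∀ {y} → adj G u y ≡ true → y ≢ v → y ∈ S₂

    rebuild-eq : ∀ {S₁ S₂} → Spec S₁ S₂ → rebuild G' v u S₁ S₂ ≡ G
    rebuild-eq {S₁} {S₂} S = graph-ext to from
      where
      open Spec S
      R? = rb? (adj G') v u S₁ S₂
      to : adj (rebuild G' v u S₁ S₂) ⊑ adj G
      to {x} {y} k with adjOf⁻ R? (gr⁻ (adjOf R?) k)
      ... | inj₁ (refl , inj₁ refl) = h
      ... | inj₁ (refl , inj₂ m) = s₁ m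
      ... | inj₂ (inj₁ (refl , inj₁ refl)) = sy h
      ... | inj₂ (inj₁ (refl , inj₂ m)) = sy (s₁ m)
      ... | inj₂ (inj₂ (_ , _ , inj₁ (refl , m))) = s₂ m
      ... | inj₂ (inj₂ (_ , _ , inj₂ (inj₁ (refl , m)))) = sy (s₂ m)
      ... | inj₂ (inj₂ (p , q , inj₂ (inj₂ (p' , q' , a)))) with contr⁻ (gr⁻ H a)
      ... | _ , _ , inj₁ k' = k'
      ... | _ , _ , inj₂ (inj₁ (e , _)) = ⊥-elim (p' e)
      ... | _ , _ , inj₂ (inj₂ (e , _)) = ⊥-elim (q' e)
      rel : ∀ {x y} → adj G x y ≡ true → RB (adj G') v u S₁ S₂ x y
      rel {x} {y} k with x ≟ v | y ≟ v
      rel {x} {y} k | yes refl | _ with y ≟ u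
      ... | yes e = inj₁ (refl , inj₁ e)
      ... | no ne = inj₁ (refl , inj₂ (s₁' k ne))
      rel {x} {y} k | no _ | yes refl with x ≟ u
      ... | yes e = inj₂ (inj₁ (refl , inj₁ e))
      ... | no ne = inj₂ (inj₁ (refl , inj₂ (s₁' (sy k) ne)))
      rel {x} {y} k | no p | no q with x ≟ u | y ≟ u
      ... | yes refl | _ = inj₂ (inj₂ (p , q , inj₁ (refl , s₂' k q)))
      ... | no _ | yes refl = inj₂ (inj₂ (p , q , inj₂ (inj₁ (refl , s₂' (sy k) p))))
      ... | no p' | no q' = inj₂ (inj₂ (p , q , inj₂ (inj₂ (p' , q' , gr⁺ H (contr⁺ (p , q , inj₁ k))))))
      from : adj G ⊑ adj (rebuild G' v u S₁ S₂)
      from k = gr⁺ (adjOf R?) (adjOf⁺ R? (rel k))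

    N⁺ : ∀ {y} → CP (adj G) v u u y → y ∈ N
    N⁺ c = ∈-nbrs⁺ (adj G') (gr⁺ H (contr⁺ c))

    N⁻ : ∀ {y} → y ∈ N → y ≢ v × (adj G u y ≡ true ⊎ (y ≢ u × adj G v y ≡ true))
    N⁻ m with contr⁻ (gr⁻ H (∈-nbrs⁻ (adj G') m))
    ... | _ , q , inj₁ k = q , inj₁ k
    ... | _ , q , inj₂ (inj₁ (_ , r , k)) = q , inj₂ (r , k)
    ... | p , q , inj₂ (inj₂ (_ , r , _)) = ⊥-elim (r refl)

    in-cand : deg (adj G) v ≤ Δ → deg (adj G) v ≤ 2 ⊎ deg (adj G) u ≤ Δ → G ∈ cand G' v
    in-cand dv (inj₂ du) = subst (_∈ cand G' v) (rebuild-eq spec) (∈-++⁺ˡ (∈-++⁺ˡ (∈-concat⁺′ {xss = map (low G' v) (allFin n)} in-low (∈-map⁺ (low G' v) (∈-allFin u)))))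
      where
      S₁ = sel (adj G v) N
      S₂ = sel (adj G u) N
      spec : Spec S₁ S₂
      spec = record { s₁ = λ m → proj₂ (∈-sel⁻ (adj G v) N m) ; s₁' = λ {y} k ne → ∈-sel⁺ (adj G v) (N⁺ (u≢v , (λ { refl → ir k }) , inj₂ (inj₁ (refl , ne , k)))) k
        ; s₂ = λ m → proj₂ (∈-sel⁻ (adj G u) N m) ; s₂' = λ k ne → ∈-sel⁺ (adj G u) (N⁺ (u≢v , ne , inj₁ k)) k }
      small : deg (adj G') u ≤ Δ + Δ
      small = ≤-trans (⊆-length {ys = nbrs (adj G) u ++ nbrs (adj G) v} (nbrs! (adj G') u) sub) (≤-trans (≤-reflexive (length-++ (nbrs (adj G) u))) (+-mono-≤ du dv))
        where
        sub : ∀ {y} → y ∈ N → y ∈ nbrs (adj G) u ++ nbrs (adj G) v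
        sub m with proj₂ (N⁻ m)
        ... | inj₁ k = ∈-++⁺ˡ (∈-nbrs⁺ (adj G) k)
        ... | inj₂ (_ , k) = ∈-++⁺ʳ (nbrs (adj G) u) (∈-nbrs⁺ (adj G) k)
      in-low : rebuild G' v u S₁ S₂ ∈ low G' v u
      in-low = ∈-guard (deg (adj G') u ≤? Δ + Δ) small
        (∈-map⁺ (λ p → rebuild G' v u (proj₁ p) (proj₂ p)) (∈-cartesianProduct⁺ (sel∈subs (adj G v) N) (sel∈subs (adj G u) N)))
    in-cand dv (inj₁ d2) with any? (λ w → (adj G v w ≟ᵇ true) ×-dec ¬? (w ≟ u))
    ... | no none = subst (_∈ cand G' v) (rebuild-eq spec) (∈-++⁺ˡ (∈-++⁺ʳ (concatMap (low G' v) (allFin n)) (∈-map⁺ (λ u → rebuild G' v u [] (nbrs (adj G') u)) (∈-allFin u))))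
      where
      spec : Spec [] N
      spec = record { s₁ = λ () ; s₁' = λ k ne → ⊥-elim (none (_ , k , ne)) ; s₂ = s2 ; s₂' = λ k ne → N⁺ (u≢v , ne , inj₁ k) }
        where
        s2 : ∀ {y} → y ∈ N → adj G u y ≡ true
        s2 m with N⁻ m
        ... | _ , inj₁ k = k
        ... | _ , inj₂ (ne , k) = ⊥-elim (none (_ , k , ne))
    ... | yes (w , kw , w≢u) = go (adj G u w ≟ᵇ true)
      where
      onlyw : ∀ {y} → adj G v y ≡ true → y ≢ u → y ≡ w
      onlyw {y} k ne with y ≟ w
      ... | yes e = e
      ... | no nw = ⊥-elim (<-irrefl refl (≤-trans (⊆-length {xs = u ∷ w ∷ y ∷ []} ((w≢u ∘ sym ∷ ne ∘ sym ∷ []) ∷ (nw ∘ sym ∷ []) ∷ [] ∷ [])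
          (λ { (here refl) → ∈-nbrs⁺ (adj G) h ; (there (here refl)) → ∈-nbrs⁺ (adj G) kw ; (there (there (here refl))) → ∈-nbrs⁺ (adj G) k })) d2))
      dart∈ : (u , w) ∈ darts (adj G')
      dart∈ = ∈-darts⁺ (adj G') (gr⁺ H (contr⁺ (u≢v , (λ { refl → ir kw }) , inj₂ (inj₁ (refl , w≢u , kw)))))
      f₃ f₄ : Dart n → Graph n
      f₃ d = rebuild G' v (proj₁ d) (proj₂ d ∷ []) (nbrs (adj G') (proj₁ d))
      f₄ d = rebuild G' v (proj₁ d) (proj₂ d ∷ []) (filter (λ y → ¬? (y ≟ proj₂ d)) (nbrs (adj G') (proj₁ d)))
      pre : List (Graph n)
      pre = concatMap (low G' v) (allFin n) ++ map (λ u → rebuild G' v u [] (nbrs (adj G') u)) (allFin n)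
      go : Dec (adj G u w ≡ true) → G ∈ cand G' v
      go (yes e) = subst (_∈ cand G' v) (rebuild-eq spec) (∈-++⁺ʳ pre (∈-++⁺ˡ (∈-map⁺ f₃ dart∈)))
        where
        spec : Spec (w ∷ []) N
        spec = record { s₁ = λ { (here refl) → kw } ; s₁' = λ k ne → here (onlyw k ne) ; s₂ = s2 ; s₂' = λ k ne → N⁺ (u≢v , ne , inj₁ k) }
          where
          s2 : ∀ {y} → y ∈ N → adj G u y ≡ true
          s2 m with N⁻ m
          ... | _ , inj₁ k = k
          ... | _ , inj₂ (ne , k) = subst (λ z → adj G u z ≡ true) (sym (onlyw k ne)) e
      go (no e) = subst (_∈ cand G' v) (rebuild-eq spec) (∈-++⁺ʳ pre (∈-++⁺ʳ (map f₃ (darts (adj G'))) (∈-map⁺ f₄ dart∈)))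
        where
        S₂ = filter (λ y → ¬? (y ≟ w)) N
        spec : Spec (w ∷ []) S₂
        spec = record { s₁ = λ { (here refl) → kw } ; s₁' = λ k ne → here (onlyw k ne) ; s₂ = s2
          ; s₂' = λ k ne → ∈-filter⁺ (λ y → ¬? (y ≟ w)) (N⁺ (u≢v , ne , inj₁ k)) (λ { refl → e k }) }
          where
          s2 : ∀ {y} → y ∈ S₂ → adj G u y ≡ true
          s2 m with ∈-filter⁻ (λ y → ¬? (y ≟ w)) {xs = N} m
          ... | m' , nw with N⁻ m'
          ... | _ , inj₁ k = k
          ... | _ , inj₂ (ne , k) = ⊥-elim (nw (onlyw k ne))

#d-gr : ∀ {n} (A : Adj n) → #d (adj (graphOf A)) ≡ #d A
#d-gr A = ≤-antisym (#d-mono {A = adj (graphOf A)} {A} (λ {u} {v} → gr⁻ A {u} {v})) (#d-mono {A = A} {adj (graphOf A)} (λ {u} {v} → gr⁺ A {u} {v}))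

nbrs-mono : ∀ {n} {A A' : Adj n} → A ⊑ A' → ∀ v → deg A v ≤ deg A' v
nbrs-mono {A = A} {A'} s v = ⊆-length (nbrs! A v) (λ m → ∈-nbrs⁺ A' (s (∈-nbrs⁻ A m)))

-- Choosing vertices to contract

module Avail {n} (g m Δ i : ℕ) (Δ≥ : 199 ≤ Δ) (G : Graph n) (K : Adj n) (Q : QE g K) (inc : adj G ⊑ K)
  (sy : ∀ {u v} → adj G u v ≡ true → adj G v u ≡ true)
  (hi : #d (adj G) ≤ 2 * m) (lo : 2 * m ≤ #d (adj G) + 2 * (Δ * i)) (n≤m : n ≤ m) (m≤3n : m ≤ 3 * n)
  (n>0 : 0 < n) (big : 112 * g + 5 * (Δ * i) ≤ n) where

  -- The degree of `v` is bounded in K and not only in G, so that the contraction costs K at most Δ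
  -- edges. For the target a bound in G is enough, because only G has to be recovered.
  Choice : Fin n → Set
  Choice v = deg K v ≤ Δ × (∃ λ u → adj G v u ≡ true × (deg (adj G) v ≤ 2 ⊎ deg (adj G) u ≤ Δ))

  choice? : ∀ v → Dec (Choice v)
  choice? v = (deg K v ≤? Δ) ×-dec any? (λ u → (adj G v u ≟ᵇ true) ×-dec ((deg (adj G) v ≤? 2) ⊎-dec (deg (adj G) u ≤? Δ)))

  avail high hubs spiders : List (Fin n)
  avail = filter choice? (allFin n)
  high = filter (λ v → Δ <? deg K v) (allFin n)
  hubs = filter (λ v → Δ <? deg (adj G) v) (allFin n)

  -- The vertices of small degree that cannot be contracted. All their neighbours are hubs and there
  -- are at least three of them, so the bipartite bound applies to the edges between the two kinds.
  Spider : Fin n → Set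
  Spider v = deg K v ≤ Δ × 2 < deg (adj G) v × (∀ u → ¬ (adj G v u ≡ true × deg (adj G) u ≤ Δ))

  spider? : ∀ v → Dec (Spider v)
  spider? v = (deg K v ≤? Δ) ×-dec (2 <? deg (adj G) v) ×-dec all? (λ u → ¬? ((adj G v u ≟ᵇ true) ×-dec (deg (adj G) u ≤? Δ)))

  spiders = filter spider? (allFin n)

  spider⁻ : ∀ {v} → v ∈ spiders → Spider v
  spider⁻ m = proj₂ (∈-filter⁻ spider? {xs = allFin n} m)

  hub⁺ : ∀ {v} → ¬ (deg (adj G) v ≤ Δ) → v ∈ hubs
  hub⁺ {v} h = ∈-filter⁺ (λ v → Δ <? deg (adj G) v) (∈-allFin v) (≰⇒> h)

  covered : length (nonisos (adj G)) ≤ length avail + (length high + length spiders)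
  covered = ≤-trans (⊆-length {ys = avail ++ high ++ spiders} (filter⁺ (λ v → ¬? (iso? (adj G) v)) (allFin⁺ n)) sub)
    (≤-reflexive (trans (length-++ avail) (cong (length avail +_) (length-++ high))))
    where
    sub : ∀ {v} → v ∈ nonisos (adj G) → v ∈ avail ++ high ++ spiders
    sub {v} m with choice? v | deg K v ≤? Δ
    ... | yes c | _ = ∈-++⁺ˡ (∈-filter⁺ choice? (∈-allFin v) c)
    ... | no _ | no p = ∈-++⁺ʳ avail (∈-++⁺ˡ (∈-filter⁺ (λ v → Δ <? deg K v) (∈-allFin v) (≰⇒> p)))
    ... | no nc | yes p with nonisos⁻ (adj G) m
    ... | u , h = ∈-++⁺ʳ avail (∈-++⁺ʳ high (∈-filter⁺ spider? (∈-allFin v)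
          (p , ≰⇒> (λ d → nc (p , u , h , inj₁ d)) , λ u (k , d) → nc (p , u , k , inj₂ d))))

  high≤ : length high * suc Δ ≤ #d K
  high≤ = fan-bound K (filter⁺ (λ v → Δ <? deg K v) (allFin⁺ n)) (λ m → proj₂ (∈-filter⁻ (λ v → Δ <? deg K v) {xs = allFin n} m))

  hubs≤ : length hubs * suc Δ ≤ #d (adj G)
  hubs≤ = fan-bound (adj G) (filter⁺ (λ v → Δ <? deg (adj G) v) (allFin⁺ n)) (λ m → proj₂ (∈-filter⁻ (λ v → Δ <? deg (adj G) v) {xs = allFin n} m))

  JP : Fin n → Fin n → Set
  JP x y = adj G x y ≡ true × ((x ∈ spiders × y ∈ hubs) ⊎ (x ∈ hubs × y ∈ spiders))

  j? : ∀ x y → Dec (JP x y)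
  j? x y = (adj G x y ≟ᵇ true) ×-dec (((x ∈? spiders) ×-dec (y ∈? hubs)) ⊎-dec ((x ∈? hubs) ×-dec (y ∈? spiders)))

  spiders≤ : length spiders ≤ 4 * g + 2 * length hubs
  spiders≤ = Bipartite.bound (subQE Q (λ h → inc (proj₁ (adjOf⁻ j? h))) symJ) spiders hubs (filter⁺ spider? (allFin⁺ n)) disj
    (λ h → proj₂ (adjOf⁻ j? h)) deg3
    where
    symJ : ∀ {x y} → adjOf j? x y ≡ true → adjOf j? y x ≡ true
    symJ h with adjOf⁻ j? h
    ... | k , inj₁ (a , b) = adjOf⁺ j? (sy k , inj₂ (b , a))
    ... | k , inj₂ (a , b) = adjOf⁺ j? (sy k , inj₁ (b , a))
    disj : ∀ {v} → v ∈ spiders → v ∉ hubs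
    disj {v} a b = <-irrefl refl (≤-trans (proj₂ (∈-filter⁻ (λ v → Δ <? deg (adj G) v) {xs = allFin n} b))
      (≤-trans (nbrs-mono {A = adj G} {K} (λ h → inc h) v) (proj₁ (spider⁻ a))))
    deg3 : ∀ {v} → v ∈ spiders → 3 ≤ deg (adjOf j?) v
    deg3 {v} m = ≤-trans (proj₁ (proj₂ (spider⁻ m))) (⊆-length (nbrs! (adj G) v)
      (λ {u} k → ∈-nbrs⁺ (adjOf j?) (adjOf⁺ j? (∈-nbrs⁻ (adj G) k , inj₁ (m , hub⁺ (λ d → proj₂ (proj₂ (spider⁻ m)) u (∈-nbrs⁻ (adj G) k , d)))))))

  hasDart : ∃ λ d → isD (adj G) d
  hasDart with decD (λ d → adj G (proj₁ d) (proj₂ d) ≟ᵇ true)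
  ... | yes p = p
  ... | no none = ⊥-elim (<-irrefl refl (<-≤-trans (≤-trans step₁ step₂) big'))
    where
    empty : #d (adj G) ≡ 0
    empty = n≤0⇒n≡0 (⊆-length {ys = []} (darts! (adj G)) (λ {d} k → ⊥-elim (none (d , ∈-darts⁻ (adj G) k))))
    big' : 5 * (Δ * i) ≤ n
    big' = ≤-trans (m≤n+m _ (112 * g)) big
    step₁ : suc n ≤ 2 * n
    step₁ = ≤-trans (+-monoˡ-≤ n n>0) (≤-reflexive (cong (n +_) (sym (+-identityʳ n))))
    step₂ : 2 * n ≤ 5 * (Δ * i)
    step₂ = ≤-trans (*-monoʳ-≤ 2 n≤m) (≤-trans lo (≤-trans (≤-reflexive (cong (_+ 2 * (Δ * i)) empty)) (*-monoˡ-≤ (Δ * i) {2} {5} (s≤s (s≤s z≤n)))))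

  QG : QE g (adj G)
  QG = subQE Q inc sy

  K-sparse : #d K ≤ 12 * g + 8 * n
  K-sparse = ≤-trans (Euler.sparse Q (inc (proj₂ hasDart))) (+-monoʳ-≤ (12 * g) (*-monoʳ-≤ 8 (≤-trans (m≤n+m _ (length (isos K))) (≤-reflexive (iso-count K)))))

  G-sparse : #d (adj G) ≤ 12 * g + 8 * length (nonisos (adj G))
  G-sparse = Euler.sparse QG (proj₂ hasDart)

  -- In units of n and up to terms O(g + Δ i): at least 1/4 of the vertices are not isolated, at
  -- most 8/200 have high degree in K, and at most 12/200 are spiders. This leaves 3/20, of which
  -- the lower-order terms take at most 1/20 by `big`.
  many : n ≤ 10 * length avail
  many = *-cancelˡ-≤ 160 (+-cancelʳ-≤ (160 * n + 80 * n) (160 * n) (160 * (10 * av)) main)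
    where
    x = Δ * i
    ni = length (nonisos (adj G))
    av = length avail
    hk = length high
    td = length spiders
    hb = length hubs
    8896≤ : 8896 ≤ 8960
    8896≤ = m≤m+n 8896 64
    200≤ : 200 ≤ suc Δ
    200≤ = s≤s Δ≥
    hk≤ : hk * 200 ≤ 12 * g + 8 * n
    hk≤ = ≤-trans (*-monoʳ-≤ hk 200≤) (≤-trans high≤ K-sparse)
    hb≤ : hb * 200 ≤ 6 * n
    hb≤ = ≤-trans (*-monoʳ-≤ hb 200≤) (≤-trans hubs≤ (≤-trans hi (≤-trans (*-monoʳ-≤ 2 m≤3n) (≤-reflexive (e n)))))
      where
      e : ∀ n → 2 * (3 * n) ≡ 6 * n
      e = solve-∀
    td≤ : 1600 * td ≤ 6400 * g + 96 * n
    td≤ = ≤-trans (*-monoʳ-≤ 1600 spiders≤) (≤-trans (≤-reflexive (e₁ g hb)) (≤-trans (+-monoʳ-≤ (6400 * g) (*-monoʳ-≤ 16 hb≤)) (≤-reflexive (e₂ g n))))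
      where
      e₁ : ∀ g h → 1600 * (4 * g + 2 * h) ≡ 6400 * g + 16 * (h * 200)
      e₁ = solve-∀
      e₂ : ∀ g n → 6400 * g + 16 * (6 * n) ≡ 6400 * g + 96 * n
      e₂ = solve-∀
    2n≤ : 2 * n ≤ 12 * g + 8 * ni + 2 * (Δ * i)
    2n≤ = ≤-trans (*-monoʳ-≤ 2 n≤m) (≤-trans lo (+-monoˡ-≤ (2 * (Δ * i)) G-sparse))
    a₁ : ∀ n → 160 * n + (160 * n + 80 * n) ≡ 200 * (2 * n)
    a₁ = solve-∀
    a₂ : ∀ g ni x → 200 * (12 * g + 8 * ni + 2 * x) ≡ 2400 * g + 400 * x + 1600 * ni
    a₂ = solve-∀
    a₃ : ∀ g av hk td x → 2400 * g + 400 * x + 1600 * (av + (hk + td)) ≡ 2400 * g + 400 * x + 1600 * av + (8 * (hk * 200) + 1600 * td)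
    a₃ = solve-∀
    a₄ : ∀ g av n x → 2400 * g + 400 * x + 1600 * av + (8 * (12 * g + 8 * n) + (6400 * g + 96 * n)) ≡ 1600 * av + 160 * n + (8896 * g + 400 * x)
    a₄ = solve-∀
    a₅ : ∀ g x → 8960 * g + 400 * x ≡ 80 * (112 * g + 5 * x)
    a₅ = solve-∀
    a₆ : ∀ av n → 1600 * av + 160 * n + 80 * n ≡ 160 * (10 * av) + (160 * n + 80 * n)
    a₆ = solve-∀
    open ≤-Reasoning
    main : 160 * n + (160 * n + 80 * n) ≤ 160 * (10 * av) + (160 * n + 80 * n)
    main = begin
      160 * n + (160 * n + 80 * n)                         ≡⟨ a₁ n ⟩
      200 * (2 * n)                                         ≤⟨ *-monoʳ-≤ 200 2n≤ ⟩
      200 * (12 * g + 8 * ni + 2 * x)                       ≡⟨ a₂ g ni x ⟩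
      2400 * g + 400 * x + 1600 * ni                        ≤⟨ +-monoʳ-≤ (2400 * g + 400 * x) (*-monoʳ-≤ 1600 covered) ⟩
      2400 * g + 400 * x + 1600 * (av + (hk + td))          ≡⟨ a₃ g av hk td x ⟩
      2400 * g + 400 * x + 1600 * av + (8 * (hk * 200) + 1600 * td)
        ≤⟨ +-monoʳ-≤ (2400 * g + 400 * x + 1600 * av) (+-mono-≤ (*-monoʳ-≤ 8 hk≤) td≤) ⟩
      2400 * g + 400 * x + 1600 * av + (8 * (12 * g + 8 * n) + (6400 * g + 96 * n))
        ≡⟨ a₄ g av n x ⟩
      1600 * av + 160 * n + (8896 * g + 400 * x)            ≤⟨ +-monoʳ-≤ (1600 * av + 160 * n) (+-monoˡ-≤ (400 * x) (*-monoˡ-≤ g 8896≤)) ⟩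
      1600 * av + 160 * n + (8960 * g + 400 * x)            ≡⟨ cong (1600 * av + 160 * n +_) (a₅ g x) ⟩
      1600 * av + 160 * n + 80 * (112 * g + 5 * x)          ≤⟨ +-monoʳ-≤ (1600 * av + 160 * n) (*-monoʳ-≤ 80 big) ⟩
      1600 * av + 160 * n + 80 * n                          ≡⟨ a₆ av n ⟩
      160 * (10 * av) + (160 * n + 80 * n)                  ∎

inj-fst : ∀ {S : Set} {T : S → Set} {xs : List (Σ S T)} → Unique (map proj₁ xs) → ∀ {p q} → p ∈ xs → q ∈ xs → proj₁ p ≡ proj₁ q → p ≡ q
inj-fst (h ∷ u) (here refl) (here refl) e = refl
inj-fst (h ∷ u) (here refl) (there m) e = ⊥-elim (All-lookup h (∈-map⁺ proj₁ m) e)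
inj-fst (h ∷ u) (there m) (here refl) e = ⊥-elim (All-lookup h (∈-map⁺ proj₁ m) (sym e))
inj-fst (h ∷ u) (there m) (there m') e = inj-fst u m m' e

module Contractions {n} (g m Δ C : ℕ) (𝔅 : Graph n → Set) where

  -- The state after i contractions of G₀ inside K; vs lists the freed vertices, and Z all vertices whose rows may have changed.
  record St (i : ℕ) : Set where
    field
      G₀ G : Graph n
      bad : 𝔅 G₀
      K : Adj n
      Q : QE g K
      inc : adj G ⊑ K
      sy : ∀ {u v} → adj G u v ≡ true → adj G v u ≡ true
      vs : List (Fin n)
      vs-len : length vs ≡ i
      vs! : Unique vs
      vs-iso : ∀ {v} → v ∈ vs → iso K v
      Z : List (Fin n)
      Z-len : length Z ≤ i * (2 + Δ)
      rows : ∀ {x} → x ∉ Z → ∀ y → adj G₀ x y ≡ adj G x y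
      hi : #d (adj G) + 2 * i ≤ 2 * m
      lo : 2 * m ≤ #d (adj G) + 2 * (Δ * i)
      Klo : 6 * n ≤ #d K + 2 * (Δ * i) + C

    ir : ∀ {v} → adj G v v ≢ true
    ir h = QE.irr Q (inc h)

  π : ∀ {i} → St i → Graph n × List (Fin n)
  π s = St.G s , St.vs s

  Choice : ∀ {i} → St i → Fin n → Set
  Choice s v = deg (St.K s) v ≤ Δ × (∃ λ u → adj (St.G s) v u ≡ true × (deg (adj (St.G s)) v ≤ 2 ⊎ deg (adj (St.G s)) u ≤ Δ))

  choice? : ∀ {i} (s : St i) v → Dec (Choice s v)
  choice? s v = (deg (St.K s) v ≤? Δ) ×-dec any? (λ u → (adj (St.G s) v u ≟ᵇ true) ×-dec ((deg (adj (St.G s)) v ≤? 2) ⊎-dec (deg (adj (St.G s)) u ≤? Δ)))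

  module _ {i} (s : St i) where
    open St s

    -- G and its host are contracted together. The host is not made edge-maximal again; `Klo`
    -- records that it loses at most Δ edges.
    contractAt : Σ (Fin n) (Choice s) → St (suc i)
    contractAt (v , dK , u , h , _) = record
      { G₀ = G₀ ; G = graphOf (contr (adj G) v u) ; bad = bad ; K = contr K v u ; Q = contrQE Q (inc h)
      ; inc = λ k → contr-mono {A = adj G} {K} (λ h → inc h) (gr⁻ (contr (adj G) v u) k)
      ; sy = λ k → gr⁺ (contr (adj G) v u) (contr-sym (adj G) sy (gr⁻ (contr (adj G) v u) k))
      ; vs = v ∷ vs ; vs-len = cong suc vs-len
      ; vs! = All-tabulate (λ { k refl → vs-iso k u (inc h) }) ∷ vs!
      ; vs-iso = λ { (here refl) → contr-iso K v u ; (there k) → CK.iso-keep (vs-iso k) }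
      ; Z = v ∷ u ∷ nbrs (adj G) v ++ Z
      ; Z-len = s≤s (s≤s (≤-trans (≤-reflexive (length-++ (nbrs (adj G) v))) (+-mono-≤ dG Z-len)))
      ; rows = λ nx y → trans (rows (λ k → nx (there (there (∈-++⁺ʳ (nbrs (adj G) v) k)))) y)
          (trans (CG.rows (λ k → nx (inZ k)) y) (sym (adj-graphOf (contr (adj G) v u) _ y)))
      ; hi = ≤-trans (≤-reflexive (trans (cong (_+ 2 * suc i) (#d-gr (contr (adj G) v u))) (e₁ (#d CG.H) i))) (≤-trans (+-monoˡ-≤ (2 * i) CG.#d-dec) hi)
      ; lo = ≤-trans lo (≤-trans (+-monoˡ-≤ (2 * (Δ * i)) (≤-trans CG.#d-inc (+-monoʳ-≤ (#d CG.H) (*-monoʳ-≤ 2 dG))))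
          (≤-reflexive (trans (e₂ (#d CG.H) Δ i) (cong (_+ 2 * (Δ * suc i)) (sym (#d-gr (contr (adj G) v u)))))))
      ; Klo = ≤-trans Klo (≤-trans (+-monoˡ-≤ C (+-monoˡ-≤ (2 * (Δ * i)) (≤-trans CK.#d-inc (+-monoʳ-≤ (#d CK.H) (*-monoʳ-≤ 2 dK)))))
          (≤-reflexive (cong (_+ C) (e₂ (#d CK.H) Δ i)))) }
      where
      module CG = ContrCount (adj G) sy ir h
      module CK = ContrCount K (λ {u} {v} → QE.symA Q {u} {v}) (λ {v} → QE.irr Q {v}) (inc h)
      dG : deg (adj G) v ≤ Δ
      dG = ≤-trans (nbrs-mono {A = adj G} {K} (λ h → inc h) v) dK
      inZ : ∀ {x} → x ∈ v ∷ u ∷ nbrs (adj G) v → x ∈ v ∷ u ∷ nbrs (adj G) v ++ Z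
      inZ (here e) = here e
      inZ (there (here e)) = there (here e)
      inZ (there (there k)) = there (there (∈-++⁺ˡ k))
      e₁ : ∀ D i → D + 2 * suc i ≡ D + 2 + 2 * i
      e₁ = solve-∀
      e₂ : ∀ D Δ i → D + 2 * Δ + 2 * (Δ * i) ≡ D + 2 * (Δ * suc i)
      e₂ = solve-∀

    next : List (St (suc i))
    next = map contractAt (collect (choice? s) (allFin n))

    next! : Unique (map π next)
    next! = subst Unique (map-∘ (collect (choice? s) (allFin n)))
      (Unique-map-on (π ∘ contractAt) (λ {p} {q} mp mq e → same p q mp mq e) (Unique-map⁻ fst!))
      where
      fst! : Unique (map proj₁ (collect (choice? s) (allFin n)))
      fst! = subst Unique (sym (collect-fst (choice? s) (allFin n))) (filter⁺ (choice? s) (allFin⁺ n))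
      head≡ : ∀ {x y : Fin n} {xs ys : List (Fin n)} → x ∷ xs ≡ y ∷ ys → x ≡ y
      head≡ refl = refl
      same : ∀ p q → p ∈ collect (choice? s) (allFin n) → q ∈ collect (choice? s) (allFin n) → π (contractAt p) ≡ π (contractAt q) → p ≡ q
      same p q mp mq e = inj-fst fst! mp mq (head≡ (cong proj₂ e))

    next-many : 199 ≤ Δ → n ≤ m → m ≤ 3 * n → 0 < n → 112 * g + 5 * (Δ * i) ≤ n → n ≤ 10 * length next
    next-many Δ≥ n≤m m≤3n n>0 big = subst (λ t → n ≤ 10 * t) (sym (trans (length-map contractAt (collect (choice? s) (allFin n))) (collect-length (choice? s) (allFin n))))
      (Avail.many g m Δ i Δ≥ G K Q inc sy (≤-trans (m≤m+n (#d (adj G)) (2 * i)) hi) lo n≤m m≤3n n>0 big)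

  open Decode {n} Δ

  cands : Graph n × List (Fin n) → List (Graph n × List (Fin n))
  cands (G , []) = []
  cands (G , v ∷ vs) = map (_, vs) (cand G v)

  cands-ok : ∀ {i} (s : St i) {t} → t ∈ next s → π s ∈ cands (π t)
  cands-ok s m with ∈-map⁻ (contractAt s) m
  ... | (v , dK , u , h , c) , _ , refl = ∈-map⁺ (_, St.vs s) (in-cand (St.G s) (St.sy s) (St.ir s) h
    (≤-trans (nbrs-mono {A = adj (St.G s)} {St.K s} (λ h → St.inc s h) v) dK) c)

  -- The summand 13 is 1 for the leaves and 2 · 6 for the two lists over darts, of which there are
  -- at most 2 m ≤ 6 n.
  cands-length : ∀ {i} (s : St i) → m ≤ 3 * n → length (cands (π s)) ≤ n * (c₀ + 13)
  cands-length {i} s m≤3n = go (St.vs s)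
    where
    G = St.G s
    go : ∀ vs → length (cands (G , vs)) ≤ n * (c₀ + 13)
    go [] = z≤n
    go (v ∷ vs) = ≤-trans (≤-reflexive (length-map (_, vs) (cand G v))) (≤-trans (cand-length G v)
      (≤-trans (+-monoʳ-≤ (n * (c₀ + 1)) (*-monoʳ-≤ 2 (≤-trans (≤-trans (m≤m+n (#d (adj G)) (2 * i)) (St.hi s)) (*-monoʳ-≤ 2 m≤3n)))) (≤-reflexive (e n c₀))))
      where
      e : ∀ n c → n * (c + 1) + 2 * (2 * (3 * n)) ≡ n * (c + 13)
      e = solve-∀

-- Attaching the freed vertices as a pendant path

-- The freed vertices are strung in the order of the list, so the path shows both the hanging point
-- and the order of the contractions.
addPath : ∀ {n} → Adj n → Fin n → List (Fin n) → Adj n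
addPath A x [] = A
addPath A x (v ∷ vs) = addPath (add A v x) v vs

module _ {n : ℕ} where
  add-up : ∀ (A : Adj n) {x y} → A ⊑ add A x y
  add-up A {x} {y} h = adjOf⁺ (add? A x y) (inj₁ h)

  add-sym : ∀ (A : Adj n) {x y} → (∀ {a b} → A a b ≡ true → A b a ≡ true) → ∀ {a b} → add A x y a b ≡ true → add A x y b a ≡ true
  add-sym A {x} {y} sy h with adjOf⁻ (add? A x y) h
  ... | inj₁ k = adjOf⁺ (add? A x y) (inj₁ (sy k))
  ... | inj₂ e = adjOf⁺ (add? A x y) (inj₂ (edge-sym e))

  addPath-up : ∀ (A : Adj n) x vs → A ⊑ addPath A x vs
  addPath-up A x [] h = h
  addPath-up A x (v ∷ vs) h = addPath-up (add A v x) v vs (add-up A h)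

  addPath-sym : ∀ (A : Adj n) x vs → (∀ {a b} → A a b ≡ true → A b a ≡ true) → ∀ {a b} → addPath A x vs a b ≡ true → addPath A x vs b a ≡ true
  addPath-sym A x [] sy = sy
  addPath-sym A x (v ∷ vs) sy = addPath-sym (add A v x) v vs (add-sym A sy)

  addPath-mono : ∀ {A A' : Adj n} x vs → A ⊑ A' → addPath A x vs ⊑ addPath A' x vs
  addPath-mono x [] s h = s h
  addPath-mono {A} {A'} x (v ∷ vs) s h = addPath-mono {add A v x} {add A' v x} v vs add-mono h
    where
    add-mono : add A v x ⊑ add A' v x
    add-mono k with adjOf⁻ (add? A v x) k
    ... | inj₁ q = adjOf⁺ (add? A' v x) (inj₁ (s q))
    ... | inj₂ q = adjOf⁺ (add? A' v x) (inj₂ q)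

  addPath-row : ∀ (A : Adj n) x vs {z w} → z ∉ x ∷ vs → addPath A x vs z w ≡ true → A z w ≡ true
  addPath-row A x [] nz h = h
  addPath-row A x (v ∷ vs) nz h with adjOf⁻ (add? A v x) (addPath-row (add A v x) v vs (nz ∘ there) h)
  ... | inj₁ k = k
  ... | inj₂ (inj₁ (e , _)) = ⊥-elim (nz (there (here e)))
  ... | inj₂ (inj₂ (e , _)) = ⊥-elim (nz (here e))

  addPath-edge : ∀ (A : Adj n) x vs {a b} → addPath A x vs a b ≡ true → A a b ≡ true ⊎ a ∈ vs ⊎ b ∈ vs
  addPath-edge A x [] h = inj₁ h
  addPath-edge A x (v ∷ vs) h with addPath-edge (add A v x) v vs h
  ... | inj₂ (inj₁ m) = inj₂ (inj₁ (there m))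
  ... | inj₂ (inj₂ m) = inj₂ (inj₂ (there m))
  ... | inj₁ k with adjOf⁻ (add? A v x) k
  ... | inj₁ q = inj₁ q
  ... | inj₂ (inj₁ (e , _)) = inj₂ (inj₁ (here e))
  ... | inj₂ (inj₂ (_ , e)) = inj₂ (inj₂ (here e))

  iso-add : ∀ (A : Adj n) {v x w} → w ≢ v → w ≢ x → iso A w → iso (add A v x) w
  iso-add A {v} {x} nv nx i y h with adjOf⁻ (add? A v x) h
  ... | inj₁ k = i y k
  ... | inj₂ (inj₁ (e , _)) = nv e
  ... | inj₂ (inj₂ (e , _)) = nx e

  leafExt : ∀ (A : Adj n) {v x} → (∀ {a b} → A a b ≡ true → A b a ≡ true) → v ≢ x → iso A v → Ext A (add A v x) v x
  leafExt A sy ne i = add-ext A ne (i _) (λ h → i _ (sy h))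

  iso-rest : ∀ (A : Adj n) {x v vs} → Unique (x ∷ v ∷ vs) → (∀ {w} → w ∈ v ∷ vs → iso A w) → ∀ {w} → w ∈ vs → iso (add A v x) w
  iso-rest A ((_ ∷ hx) ∷ hv ∷ _) i m = iso-add A (λ e → All-lookup hv m (sym e)) (λ e → All-lookup hx m (sym e)) (i (there m))

  tail! : ∀ {x v : Fin n} {vs} → Unique (x ∷ v ∷ vs) → Unique (v ∷ vs)
  tail! (_ ∷ u) = u

  head≢ : ∀ {x v : Fin n} {vs} → Unique (x ∷ v ∷ vs) → v ≢ x
  head≢ ((h ∷ _) ∷ _) e = h (sym e)

  addPath-QE : ∀ {g} {A : Adj n} x vs → QE g A → Unique (x ∷ vs) → (∀ {w} → w ∈ vs → iso A w) → QE g (addPath A x vs)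
  addPath-QE x [] Q u i = Q
  addPath-QE {A = A} x (v ∷ vs) Q u i = addPath-QE v vs (attach Q (i (here refl)) (leafExt A (QE.symA Q) (head≢ u) (i (here refl)))) (tail! u) (iso-rest A u i)

  addPath-#d : ∀ (A : Adj n) x vs → (∀ {a b} → A a b ≡ true → A b a ≡ true) → Unique (x ∷ vs) → (∀ {w} → w ∈ vs → iso A w) →
    #d (addPath A x vs) ≡ #d A + 2 * length vs
  addPath-#d A x [] sy u i = sym (+-identityʳ (#d A))
  addPath-#d A x (v ∷ vs) sy u i = trans (addPath-#d (add A v x) v vs (add-sym A sy) (tail! u) (iso-rest A u i))
    (trans (cong (_+ 2 * length vs) (#d-ext (leafExt A sy (head≢ u) (i (here refl))))) (e (#d A) (length vs)))
    where
    e : ∀ D l → 2 + D + 2 * l ≡ D + 2 * suc l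
    e = solve-∀

  addPath-PT : ∀ (A : Adj n) x v vs → Unique (x ∷ v ∷ vs) → (∀ {w} → w ∈ v ∷ vs → iso A w) → PT (addPath A x (v ∷ vs)) x v vs
  addPath-PT A x v [] u i = adjOf⁺ (add? A v x) (inj₂ (inj₁ (refl , refl))) , λ {z} h → o (adjOf⁻ (add? A v x) h)
    where
    o : ∀ {z} → A v z ≡ true ⊎ Edge v x v z → z ≡ x
    o (inj₁ k) = ⊥-elim (i (here refl) _ k)
    o (inj₂ (inj₁ (_ , e))) = e
    o (inj₂ (inj₂ (e , _))) = ⊥-elim (head≢ u e)
  addPath-PT A x v (y ∷ ys) u i = addPath-up (add (add A v x) y v) y ys (add-up (add A v x) (adjOf⁺ (add? A v x) (inj₂ (inj₁ (refl , refl))))) ,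
    addPath-up (add (add A v x) y v) y ys (adjOf⁺ (add? (add A v x) y v) (inj₂ (inj₂ (refl , refl)))) ,
    x≢y , (λ h → o (adjOf⁻ (add? (add A v x) y v) (addPath-row (add (add A v x) y v) y ys nv h))) ,
    addPath-PT (add A v x) v y ys (tail! u) (iso-rest A u i)
    where
    x≢y : x ≢ y
    x≢y e = ∉-head u (there (here refl)) e
    nv : v ∉ y ∷ ys
    nv m = ∉-head (tail! u) m refl
    o : ∀ {z} → add A v x v z ≡ true ⊎ Edge y v v z → z ≡ x ⊎ z ≡ y
    o (inj₂ (inj₁ (e , _))) = ⊥-elim (nv (here e))
    o (inj₂ (inj₂ (_ , e))) = inj₂ e
    o (inj₁ h) with adjOf⁻ (add? A v x) h
    ... | inj₁ k = ⊥-elim (i (here refl) _ k)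
    ... | inj₂ (inj₁ (_ , e)) = inj₁ e
    ... | inj₂ (inj₂ (e , _)) = ⊥-elim (head≢ u e)

filter-chain : ∀ {A : Set} {P Q R S : A → Set} (P? : ∀ x → Dec (P x)) (Q? : ∀ x → Dec (Q x)) (R? : ∀ x → Dec (R x)) (S? : ∀ x → Dec (S x)) →
  (∀ {x} → P x → Q x → R x → S x) → ∀ xs → length (filter R? (filter Q? (filter P? xs))) ≤ length (filter S? xs)
filter-chain P? Q? R? S? f [] = z≤n
filter-chain P? Q? R? S? f (x ∷ xs) with P? x
... | no _ = ≤-trans (filter-chain P? Q? R? S? f xs) (more (S? x))
  where
  more : Dec _ → length (filter S? xs) ≤ length (filter S? (x ∷ xs))
  more _ with S? x
  ... | yes _ = n≤1+n _
  ... | no _ = ≤-refl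
... | yes p with Q? x
... | no _ = ≤-trans (filter-chain P? Q? R? S? f xs) (more (S? x))
  where
  more : Dec _ → length (filter S? xs) ≤ length (filter S? (x ∷ xs))
  more _ with S? x
  ... | yes _ = n≤1+n _
  ... | no _ = ≤-refl
... | yes q with R? x
... | no _ = ≤-trans (filter-chain P? Q? R? S? f xs) (more (S? x))
  where
  more : Dec _ → length (filter S? xs) ≤ length (filter S? (x ∷ xs))
  more _ with S? x
  ... | yes _ = n≤1+n _
  ... | no _ = ≤-refl
... | yes r with S? x
... | yes _ = s≤s (filter-chain P? Q? R? S? f xs)
... | no ns = ⊥-elim (ns (f p q r))

-- Recording the added edges makes each round of refilling uniquely reversible. The price, the
-- number of possible records, is paid once at the end.
Code : ℕ → Set
Code n = Graph n × (List (Fin n) × List (Dart n))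

infix 4 _≟ᶜ_
_≟ᶜ_ : ∀ {n} → DecidableEquality (Code n)
_≟ᶜ_ = ×-≡-dec _≟ᵍ_ (×-≡-dec (List-≡-dec _≟_) (List-≡-dec _≟ᵈ_))

-- Attachment of the path and restoration of the number of edges

module Refill {n} (g m Δ C k : ℕ) (𝔅 : Graph n → Set) where
  open Contractions g m Δ C 𝔅

  t : ℕ
  t = Δ * k

  -- es records, latest first, the edges added in the rounds so far; a pair (v , v) stands for an idle round.
  record S₂ (j : ℕ) : Set where
    field
      G₀ G : Graph n
      bad : 𝔅 G₀
      K : Adj n
      Q : QE g K
      inc : adj G ⊑ K
      sy : ∀ {a b} → adj G a b ≡ true → adj G b a ≡ true
      u v : Fin n
      vs : List (Fin n)
      path! : Unique (u ∷ v ∷ vs)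
      path-len : suc (length vs) ≡ k
      pendant : PT K u v vs
      -- At the path K has no edges beyond those of G, so adding further edges of K keeps the path
      -- pendant.
      pathRows : ∀ {w y} → w ∈ v ∷ vs → K w y ≡ true → adj G w y ≡ true
      es : List (Dart n)
      es-len : length es ≡ j
      es-in : ∀ {e} → e ∈ es → isD (adj G) e ⊎ proj₁ e ≡ proj₂ e
      Z : List (Fin n)
      Z-len : length Z ≤ suc k + k * (2 + Δ) + 2 * j
      rows : ∀ {x} → x ∉ Z → ∀ y → adj G₀ x y ≡ adj G x y
      E : ℕ
      E-eq : #d (adj G) ≡ E + E
      E≤ : E ≤ m
      -- At most t = Δ k edges are missing at the beginning, and every round that is not idle
      -- supplies one; after t rounds none is missing.
      E≥ : m ≤ E + (t ∸ j)
      Klo : 6 * n ≤ #d K + (2 * t + C)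

    path : List (Fin n)
    path = u ∷ v ∷ vs

    pendantG : PT (adj G) u v vs
    pendantG = PT-row vs pathRows (λ _ h → inc h) pendant

  π₂ : ∀ {j} → S₂ j → Code n
  π₂ s = S₂.G s , S₂.path s , S₂.es s

  module Attach (s : St k) where
    open St s

    attachAt : ∀ u v' vs' → vs ≡ v' ∷ vs' → u ∉ vs → S₂ 0
    attachAt u v' vs' refl nu = record
      { G₀ = G₀ ; G = graphOf G' ; bad = bad ; K = addPath K u (v' ∷ vs') ; Q = addPath-QE u (v' ∷ vs') Q path! vs-iso
      ; inc = λ h → addPath-mono {A = adj G} {K} u (v' ∷ vs') inc (gr⁻ G' h)
      ; sy = λ h → gr⁺ G' (addPath-sym (adj G) u (v' ∷ vs') sy (gr⁻ G' h))
      ; u = u ; v = v' ; vs = vs' ; path! = path! ; path-len = vs-len ; pendant = addPath-PT K u v' vs' path! vs-iso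
      ; pathRows = λ {w} {y} m h → gr⁺ G' (onPath m h)
      ; es = [] ; es-len = refl ; es-in = λ ()
      ; Z = (u ∷ v' ∷ vs') ++ Z
      ; Z-len = ≤-trans (≤-reflexive (trans (length-++ (u ∷ v' ∷ vs')) (cong (λ l → suc l + length Z) vs-len)))
          (≤-trans (+-monoʳ-≤ (suc k) Z-len) (m≤m+n _ _))
      ; rows = λ {x} nx y → trans (rows (λ q → nx (∈-++⁺ʳ (u ∷ v' ∷ vs') q)) y)
          (trans (bool-ext (addPath-up (adj G) u (v' ∷ vs')) (addPath-row (adj G) u (v' ∷ vs') (λ q → nx (∈-++⁺ˡ q)))) (sym (adj-graphOf G' x y)))
      ; E = length (half G') ; E-eq = trans (#d-gr G') (#d-half G' (λ {a} {b} → addPath-sym (adj G) u (v' ∷ vs') sy {a} {b}) irG')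
      ; E≤ = *-cancelˡ-≤ 2 (≤-trans (≤-reflexive dbl) hi')
      ; E≥ = *-cancelˡ-≤ 2 (≤-trans lo (≤-trans (+-monoˡ-≤ (2 * t) (≤-trans (m≤m+n (#d (adj G)) (2 * k)) (≤-reflexive (sym size)))) (≤-reflexive (trans (cong (_+ 2 * t) (sym dbl)) (sym (*-distribˡ-+ 2 (length (half G')) t))))))
      ; Klo = ≤-trans Klo (≤-trans (≤-reflexive (+-assoc (#d K) (2 * t) C)) (+-monoˡ-≤ (2 * t + C) (#d-mono {A = K} {addPath K u (v' ∷ vs')} (addPath-up K u (v' ∷ vs'))))) }
      where
      G' : Adj n
      G' = addPath (adj G) u (v' ∷ vs')
      path! : Unique (u ∷ v' ∷ vs')
      path! = All-tabulate (λ { m refl → nu m }) ∷ vs!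
      isoG : ∀ {w} → w ∈ v' ∷ vs' → iso (adj G) w
      isoG m y h = vs-iso m y (inc h)
      size : #d G' ≡ #d (adj G) + 2 * k
      size = trans (addPath-#d (adj G) u (v' ∷ vs') sy path! isoG) (cong (λ l → #d (adj G) + 2 * l) vs-len)
      irG' : ∀ {w} → G' w w ≢ true
      irG' h = QE.irr (addPath-QE u (v' ∷ vs') Q path! vs-iso) (addPath-mono {A = adj G} {K} u (v' ∷ vs') inc h)
      dbl : 2 * length (half G') ≡ #d G'
      dbl = trans (cong (length (half G') +_) (+-identityʳ _)) (sym (#d-half G' (λ {a} {b} → addPath-sym (adj G) u (v' ∷ vs') sy {a} {b}) irG'))
      hi' : #d G' ≤ 2 * m
      hi' = ≤-trans (≤-reflexive size) hi
      onPath : ∀ {w y} → w ∈ v' ∷ vs' → addPath K u (v' ∷ vs') w y ≡ true → G' w y ≡ true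
      onPath {w} {y} m h = path-only K (adj G) u (v' ∷ vs') (λ k → ⊥-elim (vs-iso m y k)) h
        where
        path-only : ∀ (A A' : Adj n) x xs {a b} → (A a b ≡ true → A' a b ≡ true) → addPath A x xs a b ≡ true → addPath A' x xs a b ≡ true
        path-only A A' x [] f h = f h
        path-only A A' x (z ∷ zs) {a} {b} f h = path-only (add A z x) (add A' z x) z zs f' h
          where
          f' : add A z x a b ≡ true → add A' z x a b ≡ true
          f' q with adjOf⁻ (add? A z x) q
          ... | inj₁ r = adjOf⁺ (add? A' z x) (inj₁ (f r))
          ... | inj₂ r = adjOf⁺ (add? A' z x) (inj₂ r)

    free? : ∀ u → Dec (u ∉ vs)
    free? u = ¬? (u ∈? vs)

    attachments : ∀ ws → vs ≡ ws → List (S₂ 0)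
    attachments [] e = []
    attachments (v ∷ ws) e = map (λ p → attachAt (proj₁ p) v ws e (proj₂ p)) (collect free? (allFin n))

    next₂ : List (S₂ 0)
    next₂ = attachments vs refl

    next₂-many : 0 < k → 2 * k ≤ n → n ≤ 2 * length next₂
    next₂-many k>0 2k≤n = go vs refl
      where
      free-count : n ≤ length (filter free? (allFin n)) + k
      free-count = ≤-trans (≤-reflexive (sym (trans (length-split free? (allFin n)) (length-tabulate {n = n} id))))
        (+-monoʳ-≤ (length (filter free? (allFin n))) (≤-trans (⊆-length (filter⁺ (λ u → ¬? (free? u)) (allFin⁺ n)) taken) (≤-reflexive vs-len)))
        where
        taken : ∀ {x} → x ∈ filter (λ u → ¬? (free? u)) (allFin n) → x ∈ vs
        taken {x} m with x ∈? vs
        ... | yes p = p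
        ... | no p = ⊥-elim (proj₂ (∈-filter⁻ (λ u → ¬? (free? u)) {xs = allFin n} m) p)
      go : ∀ ws (e : vs ≡ ws) → n ≤ 2 * length (attachments ws e)
      go [] e = ⊥-elim (<-irrefl (trans (sym (cong length e)) vs-len) k>0)
      go (v ∷ ws) e = subst (λ l → n ≤ 2 * l) (sym (trans (length-map (λ p → attachAt (proj₁ p) v ws e (proj₂ p)) (collect free? (allFin n))) (collect-length free? (allFin n))))
        (+-cancelʳ-≤ (2 * k) _ _ (≤-trans (+-monoʳ-≤ n 2k≤n) (≤-trans (≤-reflexive (a n)) (≤-trans (*-monoʳ-≤ 2 free-count) (≤-reflexive (*-distribˡ-+ 2 (length (filter free? (allFin n))) k))))))
        where
        a : ∀ n → n + n ≡ 2 * n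
        a = solve-∀

  strip? : ∀ (ws : List (Fin n)) (H : Graph n) x y → Dec (adj H x y ≡ true × x ∉ ws × y ∉ ws)
  strip? ws H x y = (adj H x y ≟ᵇ true) ×-dec ¬? (x ∈? ws) ×-dec ¬? (y ∈? ws)

  -- The freed vertices were isolated before, so deleting all edges at them restores the graph.
  unattach : Code n → List (Graph n × List (Fin n))
  unattach (H , [] , _) = []
  unattach (H , _ ∷ ws , _) = (graphOf (adjOf (strip? ws H)) , ws) ∷ []

  unattach-length : ∀ c → length (unattach c) ≤ 1
  unattach-length (H , [] , _) = z≤n
  unattach-length (H , _ ∷ ws , _) = s≤s z≤n

  module _ (s : St k) where
    open St s
    open Attach s

    unattach-ok : ∀ {y} → y ∈ next₂ → π s ∈ unattach (π₂ y)
    unattach-ok = go vs refl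
      where
      strip-eq : ∀ {u} v ws (e : vs ≡ v ∷ ws) → graphOf (adjOf (strip? (v ∷ ws) (graphOf (addPath (adj G) u (v ∷ ws))))) ≡ G
      strip-eq {u} v ws refl = graph-ext to from
        where
        H = graphOf (addPath (adj G) u (v ∷ ws))
        to : adj (graphOf (adjOf (strip? (v ∷ ws) H))) ⊑ adj G
        to h with adjOf⁻ (strip? (v ∷ ws) H) (gr⁻ (adjOf (strip? (v ∷ ws) H)) h)
        ... | k , p , q with addPath-edge (adj G) u (v ∷ ws) (gr⁻ (addPath (adj G) u (v ∷ ws)) k)
        ... | inj₁ r = r
        ... | inj₂ (inj₁ m) = ⊥-elim (p m)
        ... | inj₂ (inj₂ m) = ⊥-elim (q m)
        from : adj G ⊑ adj (graphOf (adjOf (strip? (v ∷ ws) H)))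
        from h = gr⁺ (adjOf (strip? (v ∷ ws) H)) (adjOf⁺ (strip? (v ∷ ws) H) (gr⁺ (addPath (adj G) u (v ∷ ws)) (addPath-up (adj G) u (v ∷ ws) h) ,
          (λ m → vs-iso m _ (inc h)) , (λ m → vs-iso m _ (inc (sy h)))))
      go : ∀ ws (e : vs ≡ ws) {y} → y ∈ attachments ws e → π s ∈ unattach (π₂ y)
      go (v ∷ ws) refl m with ∈-map⁻ (λ p → attachAt (proj₁ p) v ws refl (proj₂ p)) m
      ... | (u , nu) , _ , refl = here (cong (_, v ∷ ws) (sym (strip-eq v ws refl)))

    next₂! : Unique (map π₂ next₂)
    next₂! = go vs refl
      where
      fst! : Unique (map proj₁ (collect free? (allFin n)))
      fst! = subst Unique (sym (collect-fst free? (allFin n))) (filter⁺ free? (allFin⁺ n))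
      head≡ : ∀ {x y : Fin n} {xs ys : List (Fin n)} → x ∷ xs ≡ y ∷ ys → x ≡ y
      head≡ refl = refl
      go : ∀ ws (e : vs ≡ ws) → Unique (map π₂ (attachments ws e))
      go [] e = []
      go (v ∷ ws) refl = subst Unique (map-∘ (collect free? (allFin n)))
        (Unique-map-on (λ p → π₂ (attachAt (proj₁ p) v ws refl (proj₂ p))) (λ {p} {q} mp mq e → inj-fst fst! mp mq (head≡ (cong (proj₁ ∘ proj₂) e))) (Unique-map⁻ fst!))

  module Round {j} (s : S₂ j) where
    open S₂ s

    New : Dart n → Set
    New d = K (proj₁ d) (proj₂ d) ≡ true × adj G (proj₁ d) (proj₂ d) ≢ true

    new? : ∀ d → Dec (New d)
    new? d = (K (proj₁ d) (proj₂ d) ≟ᵇ true) ×-dec ¬? (adj G (proj₁ d) (proj₂ d) ≟ᵇ true)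

    newExt : ∀ {d} → New d → Ext (adj G) (add (adj G) (proj₁ d) (proj₂ d)) (proj₁ d) (proj₂ d)
    newExt (h , nh) = add-ext (adj G) (QE.adj≢ Q h) nh (λ q → nh (sy q))

    addAt : E < m → Σ (Dart n) New → S₂ (suc j)
    addAt lt ((x , y) , h , nh) = record
      { G₀ = G₀ ; G = graphOf G' ; bad = bad ; K = K ; Q = Q ; inc = inc'
      ; sy = λ q → gr⁺ G' (add-sym (adj G) sy (gr⁻ G' q)) ; u = u ; v = v ; vs = vs ; path! = path! ; path-len = path-len
      ; pendant = pendant ; pathRows = λ m q → gr⁺ G' (add-up (adj G) (pathRows m q))
      ; es = (x , y) ∷ es ; es-len = cong suc es-len
      ; es-in = λ { (here refl) → inj₁ (gr⁺ G' (Ext.axy X)) ; (there m) → map₁ (λ q → gr⁺ G' (add-up (adj G) q)) (es-in m) }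
      ; Z = x ∷ y ∷ Z ; Z-len = ≤-trans (s≤s (s≤s Z-len)) (≤-reflexive (a (suc k + k * (2 + Δ)) j))
      ; rows = λ {z} nz w → trans (rows (λ q → nz (there (there q))) w) (trans (bool-ext (add-up (adj G)) (back nz)) (sym (adj-graphOf G' z w)))
      ; E = suc E ; E-eq = trans (#d-gr G') (trans (#d-ext X) (trans (cong (2 +_) E-eq) (cong suc (sym (+-suc E E)))))
      ; E≤ = lt ; E≥ = E≥' ; Klo = Klo }
      where
      G' : Adj n
      G' = add (adj G) x y
      X : Ext (adj G) G' x y
      X = newExt {x , y} (h , nh)
      inc' : adj (graphOf G') ⊑ K
      inc' q with Ext.dn X (gr⁻ G' q)
      ... | inj₁ r = inc r
      ... | inj₂ (inj₁ (refl , refl)) = h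
      ... | inj₂ (inj₂ (refl , refl)) = QE.symA Q h
      a : ∀ c j → suc (suc (c + 2 * j)) ≡ c + 2 * suc j
      a = solve-∀
      back : ∀ {z w} → z ∉ x ∷ y ∷ Z → G' z w ≡ true → adj G z w ≡ true
      back nz q with Ext.dn X q
      ... | inj₁ r = r
      ... | inj₂ (inj₁ (e , _)) = ⊥-elim (nz (here e))
      ... | inj₂ (inj₂ (e , _)) = ⊥-elim (nz (there (here e)))
      E≥' : m ≤ suc E + (t ∸ suc j)
      E≥' = subst (λ q → m ≤ suc E + q) (pred[m∸n]≡m∸[1+n] t j) (go (t ∸ j) E≥)
        where
        go : ∀ q → m ≤ E + q → m ≤ suc E + pred q
        go zero le = ⊥-elim (<-irrefl refl (<-≤-trans lt (≤-trans le (≤-reflexive (+-identityʳ E)))))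
        go (suc q) le = ≤-trans le (≤-reflexive (+-suc E q))

    -- A round with nothing to add still records one of n loops. Every round then gains a factor of
    -- order n, and the count does not depend on how many edges were missing.
    idleAt : m ≤ E → Fin n → S₂ (suc j)
    idleAt ge w = record
      { G₀ = G₀ ; G = G ; bad = bad ; K = K ; Q = Q ; inc = inc ; sy = sy ; u = u ; v = v ; vs = vs ; path! = path! ; path-len = path-len
      ; pendant = pendant ; pathRows = pathRows ; es = (w , w) ∷ es ; es-len = cong suc es-len
      ; es-in = λ { (here refl) → inj₂ refl ; (there q) → es-in q }
      ; Z = Z ; Z-len = ≤-trans Z-len (+-monoʳ-≤ (suc k + k * (2 + Δ)) (*-monoʳ-≤ 2 (n≤1+n j)))
      ; rows = rows ; E = E ; E-eq = E-eq ; E≤ = E≤ ; E≥ = ≤-trans ge (m≤m+n E _) ; Klo = Klo }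

    next₃ : List (S₂ (suc j))
    next₃ with E <? m
    ... | yes lt = map (addAt lt) (collect new? allD)
    ... | no ge = map (idleAt (≮⇒≥ ge)) (allFin n)

    new-count : #d K ≤ length (filter new? allD) + #d (adj G)
    new-count = ≤-trans (⊆-length {ys = filter new? allD ++ darts (adj G)} (darts! K) (λ {d} q → sub d (∈-darts⁻ K q)))
      (≤-reflexive (length-++ (filter new? allD)))
      where
      sub : ∀ d → K (proj₁ d) (proj₂ d) ≡ true → d ∈ filter new? allD ++ darts (adj G)
      sub d h with adj G (proj₁ d) (proj₂ d) ≟ᵇ true
      ... | yes q = ∈-++⁺ʳ (filter new? allD) (∈-darts⁺ (adj G) q)
      ... | no q = ∈-++⁺ˡ (∈-filter⁺ new? (∈-allD d) (h , q))

    -- By `dense`, G has at most 6 n - 2 n / c darts, while K has at least 6 n - (2 t + C). Of the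
    -- difference 2 n / c the hypothesis `small` gives up at most n / c.
    next₃-many : ∀ c → 0 < c → c * m + n ≤ 3 * (c * n) → c * (2 * t + C) ≤ n → n ≤ c * length next₃
    next₃-many c c>0 dense small with E <? m
    ... | no ge = ≤-trans (≤-trans (≤-reflexive (sym (+-identityʳ n))) (*-monoˡ-≤ n c>0)) (≤-reflexive (cong (c *_) (sym (trans (length-map (idleAt (≮⇒≥ ge)) (allFin n)) (length-tabulate {n = n} id)))))
    ... | yes lt = ≤-trans main (≤-reflexive (cong (c *_) (sym (trans (length-map (addAt lt) (collect new? allD)) (collect-length new? allD)))))
      where
      r = length (filter new? allD)
      D≤ : #d (adj G) ≤ 2 * m
      D≤ = ≤-trans (≤-reflexive E-eq) (≤-trans (+-mono-≤ E≤ E≤) (≤-reflexive (cong (m +_) (sym (+-identityʳ m)))))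
      open ≤-Reasoning
      e₁ : ∀ c n → n + n + c * (6 * n) ≡ c * (6 * n) + 2 * n
      e₁ = solve-∀
      e₂ : ∀ c r m x n → c * (r + 2 * m + x) + 2 * n ≡ c * r + 2 * (c * m + n) + c * x
      e₂ = solve-∀
      e₃ : ∀ c r n → c * r + 2 * (3 * (c * n)) + n ≡ c * r + (n + c * (6 * n))
      e₃ = solve-∀
      big : n + (n + c * (6 * n)) ≤ c * r + (n + c * (6 * n))
      big = begin
        n + (n + c * (6 * n))                  ≡⟨ +-assoc n n _ ⟨
        n + n + c * (6 * n)                    ≡⟨ e₁ c n ⟩
        c * (6 * n) + 2 * n                    ≤⟨ +-monoˡ-≤ (2 * n) (*-monoʳ-≤ c (≤-trans Klo (+-monoˡ-≤ (2 * t + C) (≤-trans new-count (+-monoʳ-≤ r D≤))))) ⟩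
        c * (r + 2 * m + (2 * t + C)) + 2 * n  ≡⟨ e₂ c r m (2 * t + C) n ⟩
        c * r + 2 * (c * m + n) + c * (2 * t + C) ≤⟨ +-mono-≤ (+-monoʳ-≤ (c * r) (*-monoʳ-≤ 2 dense)) small ⟩
        c * r + 2 * (3 * (c * n)) + n          ≡⟨ e₃ c r n ⟩
        c * r + (n + c * (6 * n))              ∎
      main : n ≤ c * r
      main = +-cancelʳ-≤ (n + c * (6 * n)) n (c * r) big

  unround : Code n → List (Code n)
  unround (H , P , []) = []
  unround (H , P , (x , y) ∷ es) = ((if does (x ≟ y) then H else graphOf (rem (adj H) x y)) , P , es) ∷ []

  unround-length : ∀ c → length (unround c) ≤ 1
  unround-length (H , P , []) = z≤n
  unround-length (H , P , _ ∷ _) = s≤s z≤n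

  module _ {j} (s : S₂ j) where
    open S₂ s
    open Round s

    unround-ok : ∀ {y} → y ∈ next₃ → π₂ s ∈ unround (π₂ y)
    unround-ok q with E <? m
    unround-ok q | no ge with ∈-map⁻ (idleAt (≮⇒≥ ge)) q
    ... | w , _ , refl = here (cong (λ b → (if b then G else graphOf (rem (adj G) w w)) , path , es) (sym (dec-true (w ≟ w) refl)))
    unround-ok q | yes lt with ∈-map⁻ (addAt lt) q
    ... | ((x , y) , h , nh) , _ , refl = here (trans (cong (_, path , es) (sym undo)) (cong (λ b → (if b then H else graphOf (rem (adj H) x y)) , path , es) (sym (dec-false (x ≟ y) (QE.adj≢ Q h)))))
      where
      H : Graph n
      H = graphOf (add (adj G) x y)
      X = newExt {x , y} (h , nh)
      undo : graphOf (rem (adj H) x y) ≡ G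
      undo = graph-ext to from
        where
        to : adj (graphOf (rem (adj H) x y)) ⊑ adj G
        to q with adjOf⁻ (rem? (adj H) x y) (gr⁻ (rem (adj H) x y) q)
        ... | r , ne with Ext.dn X (gr⁻ (add (adj G) x y) r)
        ... | inj₁ z = z
        ... | inj₂ e = ⊥-elim (ne e)
        from : adj G ⊑ adj (graphOf (rem (adj H) x y))
        from q = gr⁺ (rem (adj H) x y) (adjOf⁺ (rem? (adj H) x y) (gr⁺ (add (adj G) x y) (add-up (adj G) q) ,
          λ { (inj₁ (refl , refl)) → nh q ; (inj₂ (refl , refl)) → nh (sy q) }))

    next₃! : Unique (map π₂ next₃)
    next₃! with E <? m
    ... | no ge = subst Unique (map-∘ (allFin n)) (Unique-map⁺ (λ e → cong proj₁ (head≡ (cong (proj₂ ∘ proj₂) e))) (allFin⁺ n))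
      where
      head≡ : ∀ {x y : Dart n} {xs ys : List (Dart n)} → x ∷ xs ≡ y ∷ ys → x ≡ y
      head≡ refl = refl
    ... | yes lt = subst Unique (map-∘ (collect new? allD)) (Unique-map-on (π₂ ∘ addAt lt) (λ {p} {q} mp mq e → inj-fst fst! mp mq (head≡ (cong (proj₂ ∘ proj₂) e))) (Unique-map⁻ fst!))
      where
      fst! : Unique (map proj₁ (collect new? allD))
      fst! = subst Unique (sym (collect-fst new? allD)) (filter⁺ new? allD!)
      head≡ : ∀ {x y : Dart n} {xs ys : List (Dart n)} → x ∷ xs ≡ y ∷ ys → x ≡ y
      head≡ refl = refl

-- Counting the switchings

^-distribʳ-* : ∀ a c j → (a * c) ^ j ≡ a ^ j * c ^ j
^-distribʳ-* a c zero = refl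
^-distribʳ-* a c (suc j) = trans (cong (a * c *_) (^-distribʳ-* a c j)) (e a c (a ^ j) (c ^ j))
  where
  e : ∀ a c x y → a * c * (x * y) ≡ a * x * (c * y)
  e = solve-∀

fan₂ : ∀ {n} → Adj n → List (Fin n) → List (Dart n)
fan₂ A zs = concatMap (λ z → guard (deg A z ≤? 2) (map (z ,_) (nbrs A z))) zs

fan₂-length : ∀ {n} (A : Adj n) zs → length (fan₂ A zs) ≤ length zs * 2
fan₂-length A [] = z≤n
fan₂-length A (z ∷ zs) = ≤-trans (≤-reflexive (length-++ (guard (deg A z ≤? 2) (map (z ,_) (nbrs A z)))))
  (+-mono-≤ (guard-length (deg A z ≤? 2) (λ le → ≤-trans (≤-reflexive (length-map (z ,_) (nbrs A z))) le)) (fan₂-length A zs))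

∈-fan₂ : ∀ {n} (A : Adj n) {zs z w} → z ∈ zs → deg A z ≤ 2 → A z w ≡ true → (z , w) ∈ fan₂ A zs
∈-fan₂ A {zs} {z} m d h = ∈-concat⁺′ (∈-guard (deg A z ≤? 2) d (∈-map⁺ (z ,_) (∈-nbrs⁺ A h))) (∈-map⁺ (λ z → guard (deg A z ≤? 2) (map (z ,_) (nbrs A z))) m)

module Switching {n} (g m Δ C k d : ℕ) (𝔅 : Graph n → Set)
  (noPath : ∀ {G} → 𝔅 G → ∀ {u v vs} → PT (adj G) u v vs → Unique (v ∷ vs) → suc (length vs) ≡ k → ⊥)
  (Δ≥ : 199 ≤ Δ) (n≤m : n ≤ m) (m≤3n : m ≤ 3 * n) (n>0 : 0 < n) (k>0 : 0 < k) (d>0 : 0 < d)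
  (big : 112 * g + 5 * (Δ * k) ≤ n) (2k≤n : 2 * k ≤ n) (dense : d * m + n ≤ 3 * (d * n)) (small : d * (2 * (Δ * k) + C) ≤ n) where

  open Contractions g m Δ C 𝔅
  open Refill g m Δ C k 𝔅
  open Decode {n} Δ using (c₀)

  infix 4 _≟₁_
  _≟₁_ : DecidableEquality (Graph n × List (Fin n))
  _≟₁_ = ×-≡-dec _≟ᵍ_ (List-≡-dec _≟_)

  module M₁ = Mult _≟₁_
  module M₂ = Mult (_≟ᶜ_ {n})

  c₁ : ℕ
  c₁ = c₀ + 13

  module Chain (X₀ : List (St 0)) (X₀! : Unique (map π X₀)) where
    b : ℕ
    b = length X₀

    -- A contraction multiplies the number of states by at least n / 10 and their multiplicity by at
    -- most n c₁, so the ratio of the two loses only a constant factor.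
    contracted : ∀ i → i ≤ k → ∃ λ (X : List (St i)) → (∀ z → M₁.occ π X z ≤ (n * c₁) ^ i) × b * n ^ i ≤ 10 ^ i * length X
    contracted zero _ = X₀ , M₁.occ-unique π X₀! , ≤-reflexive (trans (*-identityʳ b) (sym (+-identityʳ b)))
    contracted (suc i) le with contracted i (<⇒≤ le)
    ... | X , occ , len = concatMap next X
      , MultStep.mult-step _≟₁_ _≟₁_ π π next cands X (λ {x} _ m → cands-ok x m) (λ {x} _ → next! x) (λ {x} {y} _ _ → cands-length y m≤3n) occ
      , (begin
          b * (n * n ^ i)                            ≡⟨ e₁ b n (n ^ i) ⟩
          (b * n ^ i) * n                            ≤⟨ *-monoˡ-≤ n len ⟩
          (10 ^ i * length X) * n                    ≡⟨ *-assoc (10 ^ i) (length X) n ⟩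
          10 ^ i * (length X * n)                    ≤⟨ *-monoʳ-≤ (10 ^ i) (concatMap-≥ next {10} {n} X (λ {x} _ → next-many x Δ≥ n≤m m≤3n n>0 big')) ⟩
          10 ^ i * (10 * length (concatMap next X))  ≡⟨ e₂ (10 ^ i) (length (concatMap next X)) ⟩
          (10 * 10 ^ i) * length (concatMap next X)  ∎)
      where
      open ≤-Reasoning
      e₁ : ∀ b n x → b * (n * x) ≡ (b * x) * n
      e₁ = solve-∀
      e₂ : ∀ t l → t * (10 * l) ≡ (10 * t) * l
      e₂ = solve-∀
      big' : 112 * g + 5 * (Δ * i) ≤ n
      big' = ≤-trans (+-monoʳ-≤ (112 * g) (*-monoʳ-≤ 5 (*-monoʳ-≤ Δ (<⇒≤ le)))) big

    X₁ : List (St k)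
    X₁ = proj₁ (contracted k ≤-refl)

    -- The hanging point is visible in the code and the attachment is undone uniquely: the number of
    -- states gains a factor n / 2 and the multiplicity none. This is the whole profit of the
    -- switching.
    attached : ∃ λ (X : List (S₂ 0)) → (∀ z → M₂.occ π₂ X z ≤ (n * c₁) ^ k) × length X₁ * n ≤ 2 * length X
    attached = concatMap nx X₁
      , (λ z → ≤-trans (MultStep.mult-step _≟₁_ _≟ᶜ_ π π₂ nx unattach X₁ (λ {x} _ m → unattach-ok x m) (λ {x} _ → next₂! x)
          (λ {x} {y} _ _ → unattach-length (π₂ y)) (proj₁ (proj₂ (contracted k ≤-refl))) z) (≤-reflexive (*-identityˡ _)))
      , concatMap-≥ nx {2} {n} X₁ (λ {x} _ → Attach.next₂-many x k>0 2k≤n)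
      where
      nx : St k → List (S₂ 0)
      nx s = Attach.next₂ s

    filled : ∀ j → ∃ λ (X : List (S₂ j)) → (∀ z → M₂.occ π₂ X z ≤ (n * c₁) ^ k) × length (proj₁ attached) * n ^ j ≤ d ^ j * length X
    filled zero = proj₁ attached , proj₁ (proj₂ attached) , ≤-reflexive (trans (*-identityʳ _) (sym (+-identityʳ _)))
    filled (suc j) with filled j
    ... | X , occ , len = concatMap nx X
      , (λ z → ≤-trans (MultStep.mult-step _≟ᶜ_ _≟ᶜ_ π₂ π₂ nx unround X (λ {x} _ m → unround-ok x m) (λ {x} _ → next₃! x)
          (λ {x} {y} _ _ → unround-length (π₂ y)) occ z) (≤-reflexive (*-identityˡ _)))
      , (begin
          x₂ * (n * n ^ j)                         ≡⟨ e₁ x₂ n (n ^ j) ⟩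
          (x₂ * n ^ j) * n                         ≤⟨ *-monoˡ-≤ n len ⟩
          (d ^ j * length X) * n                   ≡⟨ *-assoc (d ^ j) (length X) n ⟩
          d ^ j * (length X * n)                   ≤⟨ *-monoʳ-≤ (d ^ j) (concatMap-≥ nx {d} {n} X (λ {x} _ → Round.next₃-many x d d>0 dense small)) ⟩
          d ^ j * (d * length (concatMap nx X))    ≡⟨ e₂ (d ^ j) d (length (concatMap nx X)) ⟩
          (d * d ^ j) * length (concatMap nx X)    ∎)
      where
      open ≤-Reasoning
      x₂ = length (proj₁ attached)
      nx : S₂ j → List (S₂ (suc j))
      nx s = Round.next₃ s
      e₁ : ∀ b n x → b * (n * x) ≡ (b * x) * n
      e₁ = solve-∀
      e₂ : ∀ t d l → t * (d * l) ≡ (d * t) * l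
      e₂ = solve-∀

    X₃ : List (S₂ t)
    X₃ = proj₁ (filled t)

  member : (s : S₂ t) → InS g n m (S₂.G s)
  member s = ToEmb.simple G QG , edges , ToEmb.embedding G QG
    where
    open S₂ s
    QG : QE g (adj G)
    QG = subQE Q inc sy
    E≡m : E ≡ m
    E≡m = ≤-antisym E≤ (subst (m ≤_) (trans (cong (E +_) (n∸n≡0 t)) (+-identityʳ E)) E≥)
    halves : ∀ a c → a + a ≡ c + c → a ≡ c
    halves a c e = *-cancelˡ-≡ a c 2 (trans (cong (a +_) (+-identityʳ a)) (trans e (cong (c +_) (sym (+-identityʳ c)))))
    edges : numEdges G ≡ m
    edges = trans (sym (halves E (numEdges G) (trans (sym E-eq) (#d-edges G (ToEmb.simple G QG))))) E≡m

  zmax : ℕ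
  zmax = suc k + k * (2 + Δ) + 2 * t

  -- The pendant paths of the outcome all run through the rows changed by any one switching leading to it.
  paths-bound : ∀ {H} (s₀ : S₂ t) → S₂.G s₀ ≡ H → ∀ {Ps} → Unique Ps → (∀ {P} → P ∈ Ps → ∃ λ (s : S₂ t) → S₂.G s ≡ H × S₂.path s ≡ P) →
    length Ps ≤ zmax * 2 * k
  paths-bound s₀ refl {Ps} u from = ≤-trans (subst (length Ps ≤_) (trans (len-cart F (upTo k)) (cong (length F *_) (length-upTo k)))
      (rel-length Rel u ex (λ {P} {P'} {y} a b → inj {P} {P'} {y} a b)))
    (*-monoˡ-≤ k (≤-trans (fan₂-length (adj G) Z) (*-monoˡ-≤ 2 Z-len)))
    where
    open S₂ s₀ using (G; G₀; bad; Z; Z-len; rows)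
    F : List (Dart n)
    F = fan₂ (adj G) Z
    Rel : List (Fin n) → Dart n × ℕ → Set
    Rel P ((z , w) , i) = At P i w z
    ex : ∀ {P} → P ∈ Ps → ∃ λ y → y ∈ cartesianProduct F (upTo k) × Rel P y
    ex m with from m
    ... | s , eG , refl with anyL? (_∈? Z) (S₂.v s ∷ S₂.vs s)
    ... | yes q with find q
    ... | z , z∈ , zZ with PT-at (S₂.vs s) (subst (λ H → PT (adj H) (S₂.u s) (S₂.v s) (S₂.vs s)) eG (S₂.pendantG s)) z∈
    ... | i , w , lt , at , h , dz = ((z , w) , i) , ∈-cartesianProduct⁺ (∈-fan₂ (adj G) zZ dz h) (∈-upTo⁺ (subst (i <_) (S₂.path-len s) lt)) , at
    ex m | s , eG , refl | no q = ⊥-elim (noPath bad pt₀ (tail! (S₂.path! s)) (S₂.path-len s))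
      where
      off : ∀ {w} → w ∈ S₂.v s ∷ S₂.vs s → ∀ y → adj G₀ w y ≡ adj G w y
      off w∈ = rows (λ wZ → q (lose w∈ wZ))
      pt₀ : PT (adj G₀) (S₂.u s) (S₂.v s) (S₂.vs s)
      pt₀ = PT-row (S₂.vs s) (λ {w} {y} w∈ h → trans (off w∈ y) h) (λ {w} {y} w∈ h → trans (sym (off w∈ y)) h)
        (subst (λ H → PT (adj H) (S₂.u s) (S₂.v s) (S₂.vs s)) eG (S₂.pendantG s))
    inj : ∀ {P P' y} → P ∈ Ps → P' ∈ Ps → Rel P y → Rel P' y → P ≡ P'
    inj {y = (z , w) , i} m m' a a' with from m | from m'
    ... | s , eG , refl | s' , eG' , refl = PP-unique {A = adj G} (S₂.path s) (S₂.path s') (cong suc (trans (S₂.path-len s) (sym (S₂.path-len s'))))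
      (subst (λ H → PP (adj H) (S₂.path s)) eG (S₂.pendantG s)) (subst (λ H → PP (adj H) (S₂.path s')) eG' (S₂.pendantG s')) a a'

  module Final (allG : List (Graph n)) (complete : ∀ G → InS g n m G → G ∈ allG) (X : List (S₂ t))
    {μ : ℕ} (occ : ∀ z → M₂.occ π₂ X z ≤ μ) where
    module MG = Mult (_≟ᵍ_ {n})
    module MP = Mult (List-≡-dec (_≟_ {n}))
    module ME = Mult (List-≡-dec (_≟ᵈ_ {n}))

    -- With graph and path fixed, only the t recorded pairs vary. Each is a dart of the outcome, at
    -- most 6 n of them, or one of n loops, and each record has multiplicity at most μ.
    edges-bound : ∀ H P → length (filter (λ s → List-≡-dec _≟_ (S₂.path s) P) (filter (λ s → S₂.G s ≟ᵍ H) X)) ≤ (7 * n) ^ t * μ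
    edges-bound H P = ≤-trans (ME.fibre S₂.es Y (tuples t ground) es∈ occ') (*-monoˡ-≤ μ (≤-trans (≤-reflexive (tuples-length t ground)) (^-monoˡ-≤ t ground≤)))
      where
      Y = filter (λ s → List-≡-dec _≟_ (S₂.path s) P) (filter (λ s → S₂.G s ≟ᵍ H) X)
      ground : List (Dart n)
      ground = guard (#d (adj H) ≤? 6 * n) (darts (adj H)) ++ map (λ v → v , v) (allFin n)
      ground≤ : length ground ≤ 7 * n
      ground≤ = ≤-trans (≤-reflexive (trans (length-++ (guard (#d (adj H) ≤? 6 * n) (darts (adj H)))) (cong (length (guard (#d (adj H) ≤? 6 * n) (darts (adj H))) +_)
          (trans (length-map _ (allFin n)) (length-tabulate {n = n} id)))))
        (≤-trans (+-monoˡ-≤ n (guard-length (#d (adj H) ≤? 6 * n) id)) (≤-reflexive (e n)))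
        where
        e : ∀ n → 6 * n + n ≡ 7 * n
        e = solve-∀
      es∈ : ∀ {s} → s ∈ Y → S₂.es s ∈ tuples t ground
      es∈ {s} q with ∈-filter⁻ (λ s → List-≡-dec _≟_ (S₂.path s) P) {xs = filter (λ s → S₂.G s ≟ᵍ H) X} q
      ... | q' , _ with ∈-filter⁻ (λ s → S₂.G s ≟ᵍ H) {xs = X} q'
      ... | _ , refl = subst (λ l → S₂.es s ∈ tuples l ground) (S₂.es-len s) (∈-tuples (S₂.es s) (λ r → into (S₂.es-in s r)))
        where
        6n : #d (adj (S₂.G s)) ≤ 6 * n
        6n = ≤-trans (≤-reflexive (S₂.E-eq s)) (≤-trans (+-mono-≤ (≤-trans (S₂.E≤ s) m≤3n) (≤-trans (S₂.E≤ s) m≤3n)) (≤-reflexive (e n)))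
          where
          e : ∀ n → 3 * n + 3 * n ≡ 6 * n
          e = solve-∀
        into : ∀ {e} → isD (adj (S₂.G s)) e ⊎ proj₁ e ≡ proj₂ e → e ∈ ground
        into (inj₁ h) = ∈-++⁺ˡ (∈-guard (#d (adj (S₂.G s)) ≤? 6 * n) 6n (∈-darts⁺ (adj (S₂.G s)) h))
        into (inj₂ refl) = ∈-++⁺ʳ (guard (#d (adj (S₂.G s)) ≤? 6 * n) (darts (adj (S₂.G s)))) (∈-map⁺ (λ v → v , v) (∈-allFin _))
      occ' : ∀ z → ME.occ S₂.es Y z ≤ μ
      occ' z = ≤-trans (filter-chain (λ s → S₂.G s ≟ᵍ H) (λ s → List-≡-dec _≟_ (S₂.path s) P) (λ s → List-≡-dec _≟ᵈ_ (S₂.es s) z) (λ s → π₂ s ≟ᶜ (H , P , z))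
        (λ { refl refl refl → refl }) X) (occ (H , P , z))

    -- Any state `s₀` of the fibre supplies the set of changed rows needed by `paths-bound`; an
    -- empty fibre needs none.
    paths-fibre : ∀ H → length (filter (λ s → S₂.G s ≟ᵍ H) X) ≤ zmax * 2 * k * ((7 * n) ^ t * μ)
    paths-fibre H = go (filter (λ s → S₂.G s ≟ᵍ H) X) refl
      where
      go : ∀ Y → filter (λ s → S₂.G s ≟ᵍ H) X ≡ Y → length Y ≤ zmax * 2 * k * ((7 * n) ^ t * μ)
      go [] e = z≤n
      go Y@(s₀ ∷ Y') e = ≤-trans (MP.fibre S₂.path Y Ps (λ q → ∈-deduplicate⁺ (List-≡-dec _≟_) (∈-map⁺ S₂.path q))
          (λ P → subst (λ Y → length (filter (λ s → List-≡-dec _≟_ (S₂.path s) P) Y) ≤ (7 * n) ^ t * μ) e (edges-bound H P)))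
        (*-monoˡ-≤ ((7 * n) ^ t * μ) (paths-bound s₀ (inH (here refl)) (deduplicate-! (List-≡-dec _≟_) (map S₂.path Y)) from))
        where
        Ps = deduplicate (List-≡-dec _≟_) (map S₂.path Y)
        inH : ∀ {s} → s ∈ Y → S₂.G s ≡ H
        inH {s} q = proj₂ (∈-filter⁻ (λ s → S₂.G s ≟ᵍ H) {xs = X} (subst (s ∈_) (sym e) q))
        from : ∀ {P} → P ∈ Ps → ∃ λ s → S₂.G s ≡ H × S₂.path s ≡ P
        from q with ∈-map⁻ S₂.path (∈-deduplicate⁻ (List-≡-dec _≟_) (map S₂.path Y) q)
        ... | s , s∈ , e' = s , inH s∈ , sym e'

    total-bound : length X ≤ length allG * (zmax * 2 * k * ((7 * n) ^ t * μ))
    total-bound = MG.fibre S₂.G X allG (λ {s} _ → complete (S₂.G s) (member s)) paths-fibre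

  -- The factor 2 comes from the hanging point, `zmax * 2 * k` from the pendant paths of the
  -- outcome, `10 * c₁` from each contraction and `7 * d` from each round of refilling.
  loss : ℕ
  loss = 2 * (zmax * 2 * k) * ((10 * c₁) ^ k * (7 * d) ^ t)

  conclusion : (X₀ : List (St 0)) → Unique (map π X₀) → (allG : List (Graph n)) → (∀ G → InS g n m G → G ∈ allG) →
    length X₀ * n ≤ length allG * loss
  conclusion X₀ X₀! allG complete = *-cancelʳ-≤ (b * n) (S * loss) (n ^ k * n ^ t) {{nz}} (begin
      b * n * (n ^ k * n ^ t)                                   ≡⟨ e₁ b n (n ^ k) (n ^ t) ⟩
      b * n ^ k * n * n ^ t                                     ≤⟨ *-monoˡ-≤ (n ^ t) (*-monoˡ-≤ n (proj₂ (proj₂ (contracted k ≤-refl)))) ⟩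
      10 ^ k * length X₁ * n * n ^ t                            ≡⟨ cong (_* n ^ t) (*-assoc (10 ^ k) (length X₁) n) ⟩
      10 ^ k * (length X₁ * n) * n ^ t                          ≤⟨ *-monoˡ-≤ (n ^ t) (*-monoʳ-≤ (10 ^ k) (proj₂ (proj₂ attached))) ⟩
      10 ^ k * (2 * x₂) * n ^ t                                 ≡⟨ e₂ (10 ^ k) x₂ (n ^ t) ⟩
      10 ^ k * 2 * (x₂ * n ^ t)                                 ≤⟨ *-monoʳ-≤ (10 ^ k * 2) (proj₂ (proj₂ (filled t))) ⟩
      10 ^ k * 2 * (d ^ t * length X₃)                          ≤⟨ *-monoʳ-≤ (10 ^ k * 2) (*-monoʳ-≤ (d ^ t) (Final.total-bound allG complete X₃ (proj₁ (proj₂ (filled t))))) ⟩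
      10 ^ k * 2 * (d ^ t * (S * (T₀ * ((7 * n) ^ t * (n * c₁) ^ k))))
        ≡⟨ cong₂ (λ p q → 10 ^ k * 2 * (d ^ t * (S * (T₀ * (p * q))))) (^-distribʳ-* 7 n t) (^-distribʳ-* n c₁ k) ⟩
      10 ^ k * 2 * (d ^ t * (S * (T₀ * (7 ^ t * n ^ t * (n ^ k * c₁ ^ k)))))
        ≡⟨ e₃ (10 ^ k) (d ^ t) S T₀ (7 ^ t) (n ^ t) (n ^ k) (c₁ ^ k) ⟩
      S * (2 * T₀ * (10 ^ k * c₁ ^ k * (7 ^ t * d ^ t))) * (n ^ k * n ^ t)
        ≡⟨ cong₂ (λ p q → S * (2 * T₀ * (p * q)) * (n ^ k * n ^ t)) (sym (^-distribʳ-* 10 c₁ k)) (sym (^-distribʳ-* 7 d t)) ⟩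
      S * loss * (n ^ k * n ^ t)                                ∎)
    where
    open Chain X₀ X₀!
    open ≤-Reasoning
    S = length allG
    T₀ = zmax * 2 * k
    x₂ = length (proj₁ attached)
    nz : NonZero (n ^ k * n ^ t)
    nz = m*n≢0 (n ^ k) (n ^ t) {{m^n≢0 n k {{>-nonZero n>0}}}} {{m^n≢0 n t {{>-nonZero n>0}}}}
    e₁ : ∀ b n x y → b * n * (x * y) ≡ b * x * n * y
    e₁ = solve-∀
    e₂ : ∀ a x y → a * (2 * x) * y ≡ a * 2 * (x * y)
    e₂ = solve-∀
    e₃ : ∀ a d S T s x y c → a * 2 * (d * (S * (T * (s * x * (y * c))))) ≡ S * (2 * T * (a * c * (s * d))) * (y * x)
    e₃ = solve-∀

-- Growth estimates

x<2^x : ∀ x → x < 2 ^ x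
x<2^x zero = s≤s z≤n
x<2^x (suc x) = ≤-trans (+-mono-≤ (m^n>0 2 x) (x<2^x x)) (≤-reflexive (cong (2 ^ x +_) (sym (+-identityʳ (2 ^ x)))))

pow-log : ∀ n → 0 < n → 2 ^ ⌊log₂ n ⌋ ≤ n
pow-log n n>0 = go n n n>0 ≤-refl
  where
  halves : ∀ n → ⌊ n /2⌋ + ⌊ n /2⌋ ≤ n
  halves n = ≤-trans (+-monoʳ-≤ ⌊ n /2⌋ (⌊n/2⌋≤⌈n/2⌉ n)) (≤-reflexive (⌊n/2⌋+⌈n/2⌉≡n n))
  go : ∀ fuel n → 0 < n → n ≤ fuel → 2 ^ ⌊log₂ n ⌋ ≤ n
  go fuel 1 _ _ = ≤-reflexive (cong (2 ^_) (⌊log₂[2^n]⌋≡n 0))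
  go (suc fuel) n@(suc (suc n')) _ le = ≤-trans (≤-reflexive (cong (2 ^_) (sym log-suc))) (≤-trans (≤-reflexive (cong (2 ^ ℓ +_) (+-identityʳ (2 ^ ℓ))))
      (≤-trans (+-mono-≤ rec rec) (halves n)))
    where
    ℓ = ⌊log₂ ⌊ n /2⌋ ⌋
    rec : 2 ^ ℓ ≤ ⌊ n /2⌋
    rec = go fuel ⌊ n /2⌋ (s≤s z≤n) (≤-trans (≤-pred (⌊n/2⌋<n (suc n'))) (≤-pred le))
    log-suc : suc ℓ ≡ ⌊log₂ n ⌋
    log-suc = trans (cong suc (⌊log₂⌊n/2⌋⌋≡⌊log₂n⌋∸1 n)) (m+[n∸m]≡n {1} {⌊log₂ n ⌋} (subst (_≤ ⌊log₂ n ⌋) (⌊log₂[2^n]⌋≡n 1) (⌊log₂⌋-mono-≤ {2} {n} (s≤s (s≤s z≤n)))))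

-- As there are Δ rounds for each vertex of the path, Λ is the constant lost per vertex, and it is
-- below 2 ^ Λ. The summand 3 in Q pays for `c₂` and for two factors k, each of them at most 2 ^ k.
-- `K₀` makes k large enough for this and for the linear hypotheses of the switching.
module Numbers (g Δ C d r : ℕ) where
  c₁ Λ Q c₂ K₀ : ℕ
  c₁ = 2 ^ (Δ + Δ) * 2 ^ (Δ + Δ) + 13
  Λ = 10 * c₁ * (7 * d) ^ Δ
  Q = suc (suc (suc Λ))
  c₂ = r * (4 * (4 + 3 * Δ))
  K₀ = 2 + (112 * g + 5 * Δ) + d * (2 * Δ + C) + c₂

  module _ {n k : ℕ} (K₀≤k : K₀ ≤ k) (pow : 2 ^ (Q * k) ≤ n) where
    k>0 : 0 < k
    k>0 = ≤-trans (s≤s z≤n) K₀≤k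

    k≤2^k : k ≤ 2 ^ k
    k≤2^k = <⇒≤ (x<2^x k)

    k²≤n : k * k ≤ n
    k²≤n = ≤-trans (*-mono-≤ k≤2^k k≤2^k) (≤-trans (≤-reflexive (sym (^-distribˡ-+-* 2 k k)))
      (≤-trans (^-monoʳ-≤ 2 (+-monoʳ-≤ k (m≤m+n k (k + Λ * k)))) pow))

    scale : ∀ c → c ≤ k → c * k ≤ n
    scale c h = ≤-trans (*-monoˡ-≤ k h) k²≤n

    part : ∀ a x → a + x * k ≤ (a + x) * k
    part a x = ≤-trans (+-monoˡ-≤ (x * k) (≤-trans (≤-reflexive (sym (*-identityʳ a))) (*-monoʳ-≤ a k>0))) (≤-reflexive (sym (*-distribʳ-+ k a x)))

    big : 112 * g + 5 * (Δ * k) ≤ n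
    big = ≤-trans (≤-reflexive (cong (112 * g +_) (sym (*-assoc 5 Δ k)))) (≤-trans (part (112 * g) (5 * Δ)) (scale _
      (≤-trans (≤-trans (m≤n+m (112 * g + 5 * Δ) 2) (≤-trans (m≤m+n _ (d * (2 * Δ + C))) (m≤m+n _ c₂))) K₀≤k)))

    2k≤n : 2 * k ≤ n
    2k≤n = scale 2 (≤-trans (m≤m+n 2 _) (≤-trans (≤-trans (m≤m+n (2 + (112 * g + 5 * Δ)) (d * (2 * Δ + C))) (m≤m+n _ c₂)) K₀≤k))

    small : d * (2 * (Δ * k) + C) ≤ n
    small = ≤-trans (*-monoʳ-≤ d (≤-trans (≤-reflexive (e₁ Δ k C)) (≤-trans (part C (2 * Δ)) (≤-reflexive (cong (_* k) (+-comm C (2 * Δ)))))))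
      (≤-trans (≤-reflexive (sym (*-assoc d (2 * Δ + C) k))) (scale _ (≤-trans (≤-trans (m≤n+m (d * (2 * Δ + C)) (2 + (112 * g + 5 * Δ))) (m≤m+n _ c₂)) K₀≤k)))
      where
      e₁ : ∀ Δ k C → 2 * (Δ * k) + C ≡ C + 2 * Δ * k
      e₁ = solve-∀

    loss≤ : r * (2 * ((suc k + k * (2 + Δ) + 2 * (Δ * k)) * 2 * k) * ((10 * c₁) ^ k * (7 * d) ^ (Δ * k))) ≤ n
    loss≤ = begin
      r * (2 * ((suc k + k * (2 + Δ) + 2 * (Δ * k)) * 2 * k) * ((10 * c₁) ^ k * (7 * d) ^ (Δ * k)))
        ≤⟨ *-monoʳ-≤ r (*-monoˡ-≤ _ (*-monoʳ-≤ 2 (*-monoˡ-≤ k (*-monoˡ-≤ 2 z≤)))) ⟩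
      r * (2 * (k * (4 + 3 * Δ) * 2 * k) * ((10 * c₁) ^ k * (7 * d) ^ (Δ * k)))
        ≡⟨ cong (λ p → r * (2 * (k * (4 + 3 * Δ) * 2 * k) * ((10 * c₁) ^ k * p))) (sym (^-*-assoc (7 * d) Δ k)) ⟩
      r * (2 * (k * (4 + 3 * Δ) * 2 * k) * ((10 * c₁) ^ k * ((7 * d) ^ Δ) ^ k))
        ≡⟨ e₂ r k (4 + 3 * Δ) ((10 * c₁) ^ k) (((7 * d) ^ Δ) ^ k) ⟩
      c₂ * (k * (k * ((10 * c₁) ^ k * ((7 * d) ^ Δ) ^ k)))
        ≡⟨ cong (λ p → c₂ * (k * (k * p))) (sym (^-distribʳ-* (10 * c₁) ((7 * d) ^ Δ) k)) ⟩
      c₂ * (k * (k * Λ ^ k))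
        ≤⟨ *-mono-≤ (≤-trans (≤-trans (m≤n+m c₂ _) K₀≤k) k≤2^k) (*-mono-≤ k≤2^k (*-mono-≤ k≤2^k (≤-trans (^-monoˡ-≤ k (<⇒≤ (x<2^x Λ))) (≤-reflexive (^-*-assoc 2 Λ k))))) ⟩
      2 ^ k * (2 ^ k * (2 ^ k * 2 ^ (Λ * k)))
        ≡⟨ sym (trans (^-distribˡ-+-* 2 k _) (cong (2 ^ k *_) (trans (^-distribˡ-+-* 2 k _) (cong (2 ^ k *_) (^-distribˡ-+-* 2 k _))))) ⟩
      2 ^ (Q * k)
        ≤⟨ pow ⟩
      n ∎
      where
      open ≤-Reasoning
      z≤ : suc k + k * (2 + Δ) + 2 * (Δ * k) ≤ k * (4 + 3 * Δ)
      z≤ = ≤-trans (+-monoˡ-≤ (2 * (Δ * k)) (+-monoˡ-≤ (k * (2 + Δ)) (+-monoˡ-≤ k k>0))) (≤-reflexive (e k Δ))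
        where
        e : ∀ k Δ → k + k + k * (2 + Δ) + 2 * (Δ * k) ≡ k * (4 + 3 * Δ)
        e = solve-∀
      e₂ : ∀ r k z x y → r * (2 * (k * z * 2 * k) * (x * y)) ≡ r * (4 * z) * (k * (k * (x * y)))
      e₂ = solve-∀

-- Any bound of at least 199 on the degrees works; it is kept opaque because the constants below are exponential in it.
abstract
  Δ₀ : ℕ
  Δ₀ = 199

  Δ₀≥ : 199 ≤ Δ₀
  Δ₀≥ = ≤-refl

-- Choice of the parameters for given g, density and r

module Instance (g d r n m : ℕ) where
  deficit : ℕ
  deficit = 12 + 2060 * g

  open Numbers g Δ₀ deficit d r

  -- The factor 2 compensates the rounding in k = ⌊ℓ / Q⌋: ℓ < (k + 1) Q ≤ 2 k Q.
  q : ℕ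
  q = 2 * Q

  module _ {a b : ℕ} (d>0 : 0 < d) (d<a : d < a) (b<3d : b < 3 * d) (lo : a * n ≤ d * m) (hi : d * m ≤ b * n)
    (n≥3 : 3 ≤ n) (n≥ : 2 ^ (Q * K₀) ≤ n)
    (allG bad : List (Graph n)) (all⇔ : ∀ G → (G ∈ allG) ⇔ InS g n m G)
    (bad! : Unique bad) (bad⇔ : ∀ G → (G ∈ bad) ⇔ (InS g n m G × ¬ LargeFace g 1 q G)) where

    n>0 : 0 < n
    n>0 = ≤-trans (s≤s z≤n) n≥3

    n≤m : n ≤ m
    n≤m = *-cancelˡ-≤ d {{>-nonZero d>0}} (≤-trans (*-monoˡ-≤ n (<⇒≤ d<a)) lo)

    m≤3n : m ≤ 3 * n
    m≤3n = *-cancelˡ-≤ d {{>-nonZero d>0}} (≤-trans hi (≤-trans (*-monoˡ-≤ n (<⇒≤ b<3d)) (≤-reflexive (e d n))))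
      where
      e : ∀ d n → 3 * d * n ≡ d * (3 * n)
      e = solve-∀

    dense : d * m + n ≤ 3 * (d * n)
    dense = ≤-trans (+-monoˡ-≤ n hi) (≤-trans (≤-reflexive (+-comm (b * n) n)) (≤-trans (*-monoˡ-≤ n b<3d) (≤-reflexive (*-assoc 3 d n))))

    ℓ k : ℕ
    ℓ = ⌊log₂ n ⌋
    k = ℓ / Q

    kQ : k * Q ≤ ℓ
    kQ = ≤-trans (m≤n+m (k * Q) (ℓ % Q)) (≤-reflexive (sym (m≡m%n+[m/n]*n ℓ Q)))

    ℓ< : ℓ < suc k * Q
    ℓ< = ≤-trans (s≤s (≤-reflexive (m≡m%n+[m/n]*n ℓ Q))) (+-monoˡ-≤ (k * Q) (m%n<n ℓ Q))

    K₀≤k : K₀ ≤ k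
    K₀≤k = ≮⇒≥ (λ lt → <-irrefl refl (<-≤-trans ℓ< (≤-trans (*-monoˡ-≤ Q lt) (≤-trans (≤-reflexive (*-comm K₀ Q))
      (subst (_≤ ℓ) (⌊log₂[2^n]⌋≡n (Q * K₀)) (⌊log₂⌋-mono-≤ n≥))))))

    pow : 2 ^ (Q * k) ≤ n
    pow = ≤-trans (^-monoʳ-≤ 2 (≤-trans (≤-reflexive (*-comm Q k)) kQ)) (pow-log n n>0)

    𝔅 : Graph n → Set
    𝔅 G = ¬ LargeFace g 1 q G × IsSimple G × Embedding g G

    -- `LargeFace` asks for one embedding with a large face, and the embedding at hand has one, of
    -- size at least k.
    noPath : ∀ {G} → 𝔅 G → ∀ {u v vs} → PT (adj G) u v vs → Unique (v ∷ vs) → suc (length vs) ≡ k → ⊥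
    noPath {G} (nl , (sy , _) , e) {u} {v} {vs} pt u! len = nl (e , Embedding.face e v u ,
      ≤-trans (≤-reflexive (*-identityˡ ℓ)) (≤-trans (<⇒≤ ℓ<) (≤-trans (*-monoˡ-≤ Q (≤-trans (+-monoˡ-≤ k (k>0 K₀≤k pow)) (≤-reflexive (e₁ k))))
        (≤-trans (≤-reflexive (e₂ k Q)) (*-monoʳ-≤ q (subst (_≤ Embedding.faceSize e (Embedding.face e v u)) len
          (LargePath.large G e vs (λ {x} {y} h → trans (sy y x) h) pt u!)))))))
      where
      e₁ : ∀ k → k + k ≡ 2 * k
      e₁ = solve-∀
      e₂ : ∀ k Q → 2 * k * Q ≡ 2 * Q * k
      e₂ = solve-∀

    module Sw = Switching g m Δ₀ deficit k d 𝔅 noPath Δ₀≥ n≤m m≤3n n>0 (k>0 K₀≤k pow) d>0 (big K₀≤k pow) (2k≤n K₀≤k pow) dense (small K₀≤k pow)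
    open Contractions g m Δ₀ deficit 𝔅 using (St; π)

    start : (G : Graph n) → InS g n m G → 𝔅 G → St 0
    start G (simple , edges , e) bd = record
      { G₀ = G ; G = G ; bad = bd ; K = K ; Q = Q' ; inc = inc ; sy = QE.symA Q₀ ; vs = [] ; vs-len = refl ; vs! = [] ; vs-iso = λ () ; Z = [] ; Z-len = z≤n
      ; rows = λ _ _ → refl ; hi = ≤-reflexive (trans (+-identityʳ _) size)
      ; lo = ≤-trans (≤-reflexive (sym size)) (m≤m+n _ _)
      ; Klo = ≤-trans (SatBound.many-edges Q' sat n≥3) (≤-reflexive (e₁ (#d K) g Δ₀)) }
      where
      Q₀ : QE g (adj G)
      Q₀ = FromEmb.qe G simple e
      open Saturated (saturate Q₀) renaming (Q to Q')
      size : #d (adj G) ≡ 2 * m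
      size = trans (#d-edges G simple) (trans (cong₂ _+_ edges edges) (cong (m +_) (sym (+-identityʳ m))))
      e₁ : ∀ D g Δ → D + 12 + 2060 * g ≡ D + 2 * (Δ * 0) + (12 + 2060 * g)
      e₁ = solve-∀

    startAt : ∀ {G} → G ∈ bad → St 0
    startAt {G} m∈ = start G (proj₁ info) (proj₂ info , proj₁ (proj₁ info) , proj₂ (proj₂ (proj₁ info)))
      where
      info : InS g n m G × ¬ LargeFace g 1 q G
      info = Equivalence.to (bad⇔ G) m∈

    X₀ : List (St 0)
    X₀ = mapWith∈ bad startAt

    X₀-codes : map π X₀ ≡ map (λ G → G , []) bad
    X₀-codes = trans (map-mapWith∈ bad startAt π) (mapWith∈≗map (λ G → G , []) bad)

    few : r * length bad ≤ length allG
    few = *-cancelʳ-≤ (r * length bad) (length allG) n {{>-nonZero n>0}} (begin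
        r * length bad * n       ≡⟨ *-assoc r (length bad) n ⟩
        r * (length bad * n)     ≡⟨ cong (λ b → r * (b * n)) len ⟩
        r * (length X₀ * n)      ≤⟨ *-monoʳ-≤ r (Sw.conclusion X₀ X₀! allG (λ G → Equivalence.from (all⇔ G))) ⟩
        r * (length allG * Sw.loss) ≡⟨ e r (length allG) Sw.loss ⟩
        length allG * (r * Sw.loss) ≤⟨ *-monoʳ-≤ (length allG) (loss≤ K₀≤k pow) ⟩
        length allG * n          ∎)
      where
      open ≤-Reasoning
      e : ∀ r s l → r * (s * l) ≡ s * (r * l)
      e = solve-∀
      len : length bad ≡ length X₀
      len = trans (sym (length-map (λ G → G , []) bad)) (trans (cong length (sym X₀-codes)) (length-map π X₀))
      X₀! : Unique (map π X₀)
      X₀! = subst Unique (sym X₀-codes) (Unique-map⁺ (cong proj₁) bad!)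

theorem6p3 : (g : ℕ) (m : ℕ → ℕ) →
    (∃ λ a → ∃ λ b → ∃ λ d → 0 < d × d < a × b < 3 * d ×
    ∃ λ N₀ → ∀ n → N₀ ≤ n → a * n ≤ d * m n × d * m n ≤ b * n) →
    ∃ λ p → ∃ λ q → 0 < p × 0 < q ×
    (∀ (r : ℕ) → ∃ λ N → ∀ n → N ≤ n →
    ∀ (allG bad : List (Graph n)) →
    Unique allG → (∀ G → (G ∈ allG) ⇔ InS g n (m n) G) →
    Unique bad → (∀ G → (G ∈ bad) ⇔ (InS g n (m n) G × ¬ LargeFace g p q G)) →
    r * length bad ≤ length allG)
-- The constant has to be fixed before `r`. `Q` does not depend on `r`, so the value 0 stands in for
-- it here.
theorem6p3 g m (a , b , d , d>0 , d<a , b<3d , N₀ , hyp) = 1 , 2 * Numbers.Q g Δ₀ (12 + 2060 * g) d 0 , s≤s z≤n , s≤s z≤n , λ r →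
  let open Numbers g Δ₀ (12 + 2060 * g) d r in
  -- The 3 is the number of vertices needed for edge-maximal embeddings, and 2 ^ (Q * K₀) ensures K₀
  -- ≤ k.
  N₀ + (3 + 2 ^ (Q * K₀)) , λ n N≤n allG bad _ all⇔ bad! bad⇔ →
  let rest = ≤-trans (m≤n+m (3 + 2 ^ (Q * K₀)) N₀) N≤n
      lo , hi = hyp n (≤-trans (m≤m+n N₀ _) N≤n) in
  Instance.few g d r n (m n) d>0 d<a b<3d lo hi (≤-trans (m≤m+n 3 _) rest) (≤-trans (m≤n+m _ 3) rest) allG bad all⇔ bad! bad⇔
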